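{- For every integer $t\ge 3$, let $W^{(3)}_t$ be the $3$-uniform wheel on $t$ vertices $v_0,v_1,\dots,v_{t-1}$, whose edges are $\{v_0,v_i,v_{i+1}\}$ for $i=1,\dots,t-1$, with indices of the rim vertices taken cyclically so that $v_t:=v_1$. Then $\pi_{u}(W^{(3)}_t)=1/4$ if $t$ is even, and $\pi_{u}(W^{(3)}_t)=0$ if $t$ is odd.
   Context: A $3$-graph is a pair $H=(V,E)$ with $E\subseteq [V]^3$. $H$ is $F$-free if it contains no (not necessarily induced) copy of $F$. For $d\in[0,1]$, $\mu>0$, $H=(V,E)$ is $(d,\mu)$-dense if every $U\subseteq V$ satisfies $|[U]^3\cap E|\ge d\binom{|U|}{3}-\mu|V|^3$. The uniform Turán density is $\pi_{u}(F)=\sup\{d\in[0,1]:$ for every $\mu>0$ and $n_0\in\mathbb N$ there is an $F$-free $(d,\mu)$-dense $3$-graph $H$ with $|V(H)|\ge n_0\}$. -}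

module Defs where

open import Data.Nat using (ℕ; zero; suc; _≥_; _^_)
open import Data.Nat.Combinatorics using (_C_)
open import Data.Fin using (Fin; toℕ; _<?_)
open import Data.Fin.Subset using (Subset; ∣_∣; inside; outside)
open import Data.Vec using (lookup)
open import Data.Bool using (Bool; true; false; _∧_; if_then_else_)
open import Data.List using (List; map)
open import Data.Nat.ListAction using (sum)
open import Data.List using (allFin)
open import Data.Integer using (+_)
open import Data.Rational using (ℚ; _/_; _*_; _-_; _≤_; _<_)
open import Data.Product using (Σ; _×_; ∃)
open import Data.Empty using (⊥)
open import Function.Definitions using (Injective)
open import Relation.Binary.PropositionalEquality using (_≡_)
open import Relation.Nullary.Decidable using (⌊_⌋)

-- A 3-graph on vertex set Fin n.  Its edge set E ⊆ [Fin n]^3 is encoded by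
-- its (symmetric) indicator function on ordered triples: E a b c ≡ true iff
-- a, b, c are distinct and {a,b,c} ∈ E.
record 3Graph : Set where
  field
    n        : ℕ
    E        : Fin n → Fin n → Fin n → Bool
    sym₁₂    : ∀ a b c → E a b c ≡ E b a c
    sym₂₃    : ∀ a b c → E a b c ≡ E a c b
    loopless : ∀ a c → E a a c ≡ false
open 3Graph public

ℕ→ℚ : ℕ → ℚ
ℕ→ℚ m = (+ m) / 1

memb : ∀ {m} → Subset m → Fin m → Bool
memb U a with lookup U a
... | inside  = true
... | outside = false

edgesIn : (H : 3Graph) → Subset (n H) → ℕ
edgesIn H U =
  sum (map (λ a → sum (map (λ b → sum (map (λ c →
    if ⌊ a <? b ⌋ ∧ ⌊ b <? c ⌋ ∧ memb U a ∧ memb U b ∧ memb U c ∧ E H a b c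
    then 1 else 0) (allFin (n H)))) (allFin (n H)))) (allFin (n H)))

Dense : ℚ → ℚ → 3Graph → Set
Dense d μ H = ∀ (U : Subset (n H)) →
  (d * ℕ→ℚ (∣ U ∣ C 3)) - (μ * ℕ→ℚ (n H ^ 3)) ≤ ℕ→ℚ (edgesIn H U)

rimNext : ℕ → ℕ → ℕ
rimNext t i = if ⌊ suc i Data.Nat.<? t ⌋ then suc i else 1
  where import Data.Nat

ContainsWheel : ℕ → 3Graph → Set
ContainsWheel t H =
  Σ (Fin t → Fin (n H)) λ φ → Injective _≡_ _≡_ φ ×
    (∀ (z i j : Fin t) → toℕ z ≡ 0 → 1 Data.Nat.≤ toℕ i → toℕ j ≡ rimNext t (toℕ i) →
       E H (φ z) (φ i) (φ j) ≡ true)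
  where import Data.Nat

WheelFree : ℕ → 3Graph → Set
WheelFree t H = ContainsWheel t H → ⊥

Admissible : ℕ → ℚ → Set
Admissible t d = (ℕ→ℚ 0 ≤ d) × (d ≤ ℕ→ℚ 1) ×
  (∀ (μ : ℚ) → ℕ→ℚ 0 < μ → ∀ (n₀ : ℕ) →
     ∃ λ (H : 3Graph) → (n H ≥ n₀) × WheelFree t H × Dense d μ H)

IsUniformTuranDensity : ℕ → ℚ → Set
IsUniformTuranDensity t s =
  (∀ d → Admissible t d → d ≤ s) ×
  (∀ e → e < s → ∃ λ d → Admissible t d × e < d)

{-# OPTIONS --safe #-}
-- Lower bound for even t.  Orient the pairs of an n-set, n = 2^m, by a skew
-- matrix K with entries ±1 off the diagonal and K² = (1 - n) I, and take the
-- cyclically oriented triangles as edges.  Along the rim of a wheel the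
-- orientation towards the hub alternates, so the rim is even.  A triple with
-- signs x, y, z is an edge with indicator (1 + xy + yz + zx) / 4, and over a
-- vertex set with indicator f the quadratic terms sum to O(‖K f‖²) = O(n²).
--
-- Upper bound for odd t.  A link with positive density contains large complete
-- bipartite graphs, hence the even rim.
--
-- Upper bound for even t.  The same argument inside common neighbourhoods shows
-- that every link has few triangles.  A link with few triangles has boundedly
-- many almost edge-free containers U a p, and the neighbourhood of b in the link
-- of a lies almost inside U a (κ a b).  A partition that is regular for the
-- relations "c ∈ U a p" and "κ a b = p", followed by Ramsey's theorem, yields
-- cells whose triples all look alike, and regularity bounds the density of such
-- a triple by the mean square of D = density of U a (κ a b) in a third cell.
-- Let A be the largest value that D attains with non-negligible weight.  If
-- A ≤ 1/2, the mean square is about A² at most.  Otherwise a container U a p of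
-- density A also fills a proportion A of the cell of b; as it is almost edge-free,
-- the neighbourhoods of its members lie in its complement, and the mean square
-- drops to A (1 - A)² + (1 - A) A² ≤ 1/4.
module Submission where

open import Defs hiding (n; E; sym₁₂; sym₂₃; loopless)
open import Algebra.Bundles using (CommutativeRing)
open import Algebra.Structures using (IsCommutativeRing)
import Algebra.Properties.Semiring.Sum
import Algebra.Solver.Ring
import Algebra.Solver.Ring.AlmostCommutativeRing as ACR
open import Data.Bool using (Bool; true; false; _∧_; _∨_; not; if_then_else_)
import Data.Bool.Properties as Bool
open import Data.Empty using (⊥; ⊥-elim)
open import Data.Fin using (Fin; zero; suc)
import Data.Fin as Fin
open import Data.Fin.Patterns
import Data.Fin.Properties as Fin
open import Data.Fin.Subset as Subset using (Subset; ∣_∣)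
open import Data.Fin.Subset.Properties using (∣⊤∣≡n)
import Data.Integer as ℤ
import Data.Integer.Properties as ℤ
open import Data.List as List using (List; []; _∷_; length)
open import Data.List.Membership.Propositional using (_∈_)
open import Data.List.Membership.Propositional.Properties using (∈-allFin)
open import Data.List.Properties using (length-map; length-tabulate; map-∘; map-tabulate)
open import Data.List.Relation.Binary.Sublist.Propositional using (_⊆_; []; _∷_; _∷ʳ_; ⊆-refl; ⊆-trans; minimum)
open import Data.List.Relation.Binary.Sublist.Propositional.Properties using (map⁺; All-resp-⊆)
open import Data.List.Relation.Unary.All as All using (All; []; _∷_)
open import Data.List.Relation.Unary.AllPairs using (AllPairs; []; _∷_)
open import Data.List.Relation.Unary.Any using (here; there)
open import Data.Maybe using (Maybe; just; nothing)
open import Data.Nat using (ℕ; zero; suc)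
import Data.Nat as ℕ
open import Data.Nat.Combinatorics using (nCk+nC[k+1]≡[n+1]C[k+1]; nC1≡n) renaming (_C_ to _choose_)
open import Data.Nat.Divisibility using (_∣_; divides; ∣m+n∣m⇒∣n; ∣1⇒≡1)
open import Data.Nat.ListAction using (sum)
import Data.Nat.Properties as ℕ
open import Data.Product using (∃; _×_; _,_; proj₁; proj₂)
open import Data.Rational using (ℚ; 0ℚ; 1ℚ; ½; _≤_; _<_; _≤?_; _<?_)
import Data.Rational as ℚ
open import Data.Rational.Properties as ℚ
  using (≤-refl; ≤-reflexive; ≤-trans; ≤-total; <⇒≤; <-irrefl; <-≤-trans; ≤-<-trans; <-trans; ≰⇒>; ≮⇒≥; module ≤-Reasoning)
open import Data.Sum using (_⊎_; inj₁; inj₂)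
open import Data.Unit using (⊤; tt)
open import Data.Vec as Vec using (Vec; []; _∷_; lookup; tabulate)
open import Data.Vec.Properties using (lookup∘tabulate; lookup-replicate; length-toList)
open import Function using (_∘_; id; case_of_)
open import Function.Definitions using (Injective)
open import Relation.Binary.Definitions using (tri<; tri≈; tri>)
open import Relation.Binary.PropositionalEquality
open import Relation.Nullary using (¬_; Dec; yes; no)
open import Relation.Nullary.Decidable using (isYes; dec⇒maybe; _×-dec_)

-- Opaque copies of the field operations keep the unifier from unfolding
-- them to integer arithmetic.
infixl 6 _+_ _-_
infixl 7 _*_
infix  8 -_

-- The delicate point is that a large container also fills the cell of b. The level A only says that
-- for many pairs a, b the container of the class of b has density A in the third cell; nothing ties
-- this container to the cell of b itself. Therefore many third cells are tried at once, between a
-- fixed first and a fixed last cell of a homogeneous sequence. For each of them, a random pair from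
-- the two fixed cells yields a large class with probability at least `h`, so two of them share a
-- large class, and one of these two can take over the role of the cell of b. Homogeneity then
-- provides such a class for every triple of the sequence.
--
-- The outcome is a sequence of cells all of whose triples have density well below d, whereas the
-- hypothesis speaks of vertex sets. Averages over cells are fractional vertex weights. The cubic
-- form that compares edges with d vanishes on repeated vertices, so its lower bound on vertex sets
-- extends to all weights between 0 and 1.

opaque
  _+_ _*_ : ℚ → ℚ → ℚ
  _+_ = ℚ._+_
  _*_ = ℚ._*_

  -_ : ℚ → ℚ
  -_ = ℚ.-_

  fromℕ : ℕ → ℚ
  fromℕ = ℕ→ℚ

_-_ : ℚ → ℚ → ℚ
x - y = x + - y

opaque
  unfolding _+_

  +-*-isCommutativeRing : IsCommutativeRing _≡_ _+_ _*_ -_ 0ℚ 1ℚ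
  +-*-isCommutativeRing = ℚ.+-*-isCommutativeRing

  +-mono-≤ : ∀ {x y u v} → x ≤ y → u ≤ v → x + u ≤ y + v
  +-mono-≤ = ℚ.+-mono-≤

  *-mono-≤ˡ : ∀ {x y} z → 0ℚ ≤ z → x ≤ y → z * x ≤ z * y
  *-mono-≤ˡ z z≥0 = ℚ.*-monoˡ-≤-nonNeg z {{ℚ.nonNegative z≥0}}

  +-mono-<ˡ : ∀ {x y z} → x < y → x + z < y + z
  +-mono-<ˡ {z = z} = ℚ.+-monoˡ-< z

  *-pos : ∀ {x y} → 0ℚ < x → 0ℚ < y → 0ℚ < x * y
  *-pos {x} {y} x>0 y>0 = ℚ.positive⁻¹ (x ℚ.* y) {{ℚ.pos*pos⇒pos x {{ℚ.positive x>0}} y {{ℚ.positive y>0}}}}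

  *-cancel-≤ : ∀ {x y} z → 0ℚ < z → z * x ≤ z * y → x ≤ y
  *-cancel-≤ z z>0 = ℚ.*-cancelˡ-≤-pos z {{ℚ.positive z>0}}

  *-inverse : ∀ x → 0ℚ < x → ∃ λ y → x * y ≡ 1ℚ
  *-inverse x x>0 = (ℚ.1/ x) {{ℚ.>-nonZero x>0}} , ℚ.*-inverseʳ x {{ℚ.>-nonZero x>0}}

  archimedean : ∀ x → 0ℚ < x → ∃ λ k → 1ℚ ≤ fromℕ (suc k) * x
  archimedean x@(ℚ.mkℚ ℤ.+[1+ p ] d _) _ = d , ℚ.toℚᵘ-cancel-≤ (ℚᵘ.≤-respʳ-≃ (ℚᵘ.≃-sym (ℚᵘ.≃-trans (ℚ.toℚᵘ-homo-* (ℕ→ℚ (suc d)) x)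
    (ℚᵘ.*-congʳ {ℚ.toℚᵘ x} (ℚ.toℚᵘ-fromℚᵘ (ℚᵘ.mkℚᵘ (ℤ.+ suc d) 0)))))
    (ℚᵘ.*≤* (ℤ.≤-trans (ℤ.≤-reflexive (trans (ℤ.*-identityˡ _) (cong (λ z → ℤ.+ suc z) (ℕ.+-identityʳ d)))) (ℤ.≤-trans (ℤ.+≤+ (ℕ.m≤m*n (suc d) (suc p))) (ℤ.≤-reflexive (sym (ℤ.*-identityʳ _)))))))
    where
    import Data.Rational.Unnormalised as ℚᵘ
    import Data.Rational.Unnormalised.Properties as ℚᵘ
  archimedean (ℚ.mkℚ (ℤ.+ 0) d _) (ℚ.*<* (ℤ.+<+ ()))
  archimedean (ℚ.mkℚ ℤ.-[1+ p ] d _) (ℚ.*<* ())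

  fromℕ-0 : fromℕ 0 ≡ 0ℚ
  fromℕ-0 = refl

  fromℕ-1 : fromℕ 1 ≡ 1ℚ
  fromℕ-1 = refl

  fromℕ-+ : ∀ a b → fromℕ (a ℕ.+ b) ≡ fromℕ a + fromℕ b
  fromℕ-+ a b = ℚ.toℚᵘ-injective (begin
    ℚ.toℚᵘ (ℕ→ℚ (a ℕ.+ b))                 ≈⟨ h (a ℕ.+ b) ⟩
    mkℚᵘ (ℤ.+ (a ℕ.+ b)) 0                  ≈⟨ *≡* (cong (ℤ._* ℤ.+ 1) (sym (cong₂ ℤ._+_ (ℤ.*-identityʳ (ℤ.+ a)) (ℤ.*-identityʳ (ℤ.+ b))))) ⟩
    mkℚᵘ (ℤ.+ a) 0 ℚᵘ.+ mkℚᵘ (ℤ.+ b) 0       ≈⟨ ℚᵘ.+-cong (h a) (h b) ⟨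
    ℚ.toℚᵘ (ℕ→ℚ a) ℚᵘ.+ ℚ.toℚᵘ (ℕ→ℚ b)      ≈⟨ ℚ.toℚᵘ-homo-+ (ℕ→ℚ a) (ℕ→ℚ b) ⟨
    ℚ.toℚᵘ (ℕ→ℚ a ℚ.+ ℕ→ℚ b)                ∎)
    where
    open import Data.Rational.Unnormalised using (mkℚᵘ; *≡*)
    import Data.Rational.Unnormalised as ℚᵘ
    import Data.Rational.Unnormalised.Properties as ℚᵘ
    open ℚᵘ.≃-Reasoning
    h : ∀ m → ℚ.toℚᵘ (ℕ→ℚ m) ℚᵘ.≃ mkℚᵘ (ℤ.+ m) 0
    h m = ℚ.toℚᵘ-fromℚᵘ (mkℚᵘ (ℤ.+ m) 0)

ℚ-ring : CommutativeRing _ _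
ℚ-ring = record { isCommutativeRing = +-*-isCommutativeRing }

open CommutativeRing ℚ-ring public
  using (+-assoc; +-comm; +-identityˡ; +-identityʳ; *-assoc; *-comm; *-identityˡ; *-identityʳ; zeroˡ; zeroʳ; distribˡ; distribʳ)
  renaming (-‿inverseʳ to +-inverseʳ)

-- Finite sums and the ring solver

private
  module Sum = Algebra.Properties.Semiring.Sum (CommutativeRing.semiring ℚ-ring)

opaque
  ∑ : ∀ {n} → (Fin n → ℚ) → ℚ
  ∑ = Sum.sum

  ∑-zero : (f : Fin 0 → ℚ) → ∑ f ≡ 0ℚ
  ∑-zero f = refl

  ∑-suc : ∀ {n} (f : Fin (suc n) → ℚ) → ∑ f ≡ f zero + ∑ (λ i → f (suc i))
  ∑-suc f = refl

  ∑-+ : ∀ {n} (f g : Fin n → ℚ) → ∑ (λ i → f i + g i) ≡ ∑ f + ∑ g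
  ∑-+ = Sum.∑-distrib-+

  ∑-swap : ∀ {m n} (f : Fin m → Fin n → ℚ) → ∑ (λ i → ∑ (λ j → f i j)) ≡ ∑ (λ j → ∑ (λ i → f i j))
  ∑-swap = Sum.∑-comm

  ∑-*ˡ : ∀ {n} (c : ℚ) (f : Fin n → ℚ) → c * ∑ f ≡ ∑ (λ i → c * f i)
  ∑-*ˡ = Sum.*-distribˡ-sum

  ∑-*ʳ : ∀ {n} (c : ℚ) (f : Fin n → ℚ) → ∑ f * c ≡ ∑ (λ i → f i * c)
  ∑-*ʳ = Sum.*-distribʳ-sum

private
  almostRing = ACR.fromCommutativeRing ℚ-ring

  opaque
    unfolding _+_

    +-homo : ∀ x y → x ℚ.+ y ≡ x + y
    +-homo _ _ = refl

    *-homo : ∀ x y → x ℚ.* y ≡ x * y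
    *-homo _ _ = refl

    neg-homo : ∀ x → ℚ.- x ≡ - x
    neg-homo _ = refl

  coefficients : ℚ.+-*-rawRing ACR.-Raw-AlmostCommutative⟶ almostRing
  coefficients = record
    { ⟦_⟧ = id ; +-homo = +-homo ; *-homo = *-homo ; -‿homo = neg-homo ; 0-homo = refl ; 1-homo = refl }

module Solver = Algebra.Solver.Ring ℚ.+-*-rawRing almostRing coefficients (λ x y → dec⇒maybe (x ℚ.≟ y))
open Solver using (solve; con; _:=_; _:+_; _:*_; _:-_; :-_)

-- Inequalities, indicators and natural numbers as rationals

private variable
  n m : ℕ

-- Most inequalities below are proved by exhibiting the nonnegative difference `d` of the two sides;
-- what remains is a ring identity.
by-diff : ∀ {x y} d → 0ℚ ≤ d → x + d ≡ y → x ≤ y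
by-diff {x} {y} d d≥0 eq = begin
  x       ≡⟨ +-identityʳ x ⟨
  x + 0ℚ  ≤⟨ +-mono-≤ (≤-refl {x}) d≥0 ⟩
  x + d   ≡⟨ eq ⟩
  y       ∎
  where open ≤-Reasoning

diff : ∀ {x y} → x ≤ y → 0ℚ ≤ y - x
diff {x} {y} x≤y = begin
  0ℚ     ≡⟨ +-inverseʳ x ⟨
  x - x  ≤⟨ +-mono-≤ x≤y (≤-refl { - x}) ⟩
  y - x  ∎
  where open ≤-Reasoning

*-nonneg : ∀ {x y} → 0ℚ ≤ x → 0ℚ ≤ y → 0ℚ ≤ x * y
*-nonneg {x} {y} x≥0 y≥0 = begin
  0ℚ      ≡⟨ zeroʳ x ⟨
  x * 0ℚ  ≤⟨ *-mono-≤ˡ x x≥0 y≥0 ⟩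
  x * y   ∎
  where open ≤-Reasoning

+-nonneg : ∀ {x y} → 0ℚ ≤ x → 0ℚ ≤ y → 0ℚ ≤ x + y
+-nonneg {x} {y} x≥0 y≥0 = subst (_≤ x + y) (+-identityˡ 0ℚ) (+-mono-≤ x≥0 y≥0)

*-mono-≤ʳ : ∀ {x y} z → 0ℚ ≤ z → x ≤ y → x * z ≤ y * z
*-mono-≤ʳ {x} {y} z z≥0 x≤y = subst₂ _≤_ (*-comm z x) (*-comm z y) (*-mono-≤ˡ z z≥0 x≤y)

*-mono-≤ : ∀ {x y u v} → 0ℚ ≤ x → 0ℚ ≤ v → x ≤ y → u ≤ v → x * u ≤ y * v
*-mono-≤ {x} {y} {u} {v} x≥0 v≥0 x≤y u≤v =
  ≤-trans (*-mono-≤ˡ x x≥0 u≤v) (*-mono-≤ʳ v v≥0 x≤y)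

square-nonneg : ∀ x → 0ℚ ≤ x * x
square-nonneg x with ≤-total 0ℚ x
... | inj₁ x≥0 = *-nonneg x≥0 x≥0
... | inj₂ x≤0 = subst (0ℚ ≤_) (solve 1 (λ x → (con 0ℚ :- x) :* (con 0ℚ :- x) := x :* x) refl x)
                  (*-nonneg (diff x≤0) (diff x≤0))

0≤1 : 0ℚ ≤ 1ℚ
0≤1 = ℚ.nonNegative⁻¹ 1ℚ

𝟙 : Bool → ℚ
𝟙 true  = 1ℚ
𝟙 false = 0ℚ

𝟙-nonneg : ∀ b → 0ℚ ≤ 𝟙 b
𝟙-nonneg true  = 0≤1
𝟙-nonneg false = ≤-refl

𝟙≤1 : ∀ b → 𝟙 b ≤ 1ℚ
𝟙≤1 true  = ≤-refl
𝟙≤1 false = 0≤1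

𝟙-∧ : ∀ a b → 𝟙 (a ∧ b) ≡ 𝟙 a * 𝟙 b
𝟙-∧ true  b = sym (*-identityˡ (𝟙 b))
𝟙-∧ false b = sym (zeroˡ (𝟙 b))

𝟙-idem : ∀ a → 𝟙 a * 𝟙 a ≡ 𝟙 a
𝟙-idem true  = *-identityˡ 1ℚ
𝟙-idem false = zeroˡ 0ℚ

𝟙-not : ∀ a → 𝟙 (not a) ≡ 1ℚ - 𝟙 a
𝟙-not true  = sym (+-inverseʳ 1ℚ)
𝟙-not false = solve 0 (con 1ℚ := con 1ℚ :- con 0ℚ) refl

opaque
  unfolding ∑

  ∑-cong : {f g : Fin n → ℚ} → (∀ i → f i ≡ g i) → ∑ f ≡ ∑ g
  ∑-cong {zero}  eq = refl
  ∑-cong {suc n} eq = cong₂ _+_ (eq zero) (∑-cong (eq ∘ suc))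

  ∑-mono : {f g : Fin n → ℚ} → (∀ i → f i ≤ g i) → ∑ f ≤ ∑ g
  ∑-mono {zero}  le = ≤-refl
  ∑-mono {suc n} le = +-mono-≤ (le zero) (∑-mono (le ∘ suc))

  ∑-0 : ∀ n → ∑ {n} (λ _ → 0ℚ) ≡ 0ℚ
  ∑-0 zero    = refl
  ∑-0 (suc n) = trans (+-identityˡ _) (∑-0 n)

  ∑-nonneg : {f : Fin n → ℚ} → (∀ i → 0ℚ ≤ f i) → 0ℚ ≤ ∑ f
  ∑-nonneg {n} le = ≤-trans (≤-reflexive (sym (∑-0 n))) (∑-mono le)

  ∑-- : (f g : Fin n → ℚ) → ∑ (λ i → f i - g i) ≡ ∑ f - ∑ g
  ∑-- {zero}  f g = sym (+-inverseʳ 0ℚ)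
  ∑-- {suc n} f g = trans (cong ((f zero - g zero) +_) (∑-- (f ∘ suc) (g ∘ suc)))
    (solve 4 (λ a b c d → a :- b :+ (c :- d) := a :+ c :- (b :+ d)) refl (f zero) (g zero) (∑ (f ∘ suc)) (∑ (g ∘ suc)))

fromℕ-suc : ∀ a → fromℕ (suc a) ≡ 1ℚ + fromℕ a
fromℕ-suc a = trans (fromℕ-+ 1 a) (cong (_+ fromℕ a) fromℕ-1)

fromℕ-* : ∀ a b → fromℕ (a ℕ.* b) ≡ fromℕ a * fromℕ b
fromℕ-* zero    b = trans fromℕ-0 (sym (trans (cong (_* fromℕ b) fromℕ-0) (zeroˡ (fromℕ b))))
fromℕ-* (suc a) b = begin
  fromℕ (b ℕ.+ a ℕ.* b)           ≡⟨ fromℕ-+ b (a ℕ.* b) ⟩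
  fromℕ b + fromℕ (a ℕ.* b)       ≡⟨ cong (fromℕ b +_) (fromℕ-* a b) ⟩
  fromℕ b + fromℕ a * fromℕ b     ≡⟨ solve 2 (λ a b → b :+ a :* b := (con 1ℚ :+ a) :* b) refl (fromℕ a) (fromℕ b) ⟩
  (1ℚ + fromℕ a) * fromℕ b        ≡⟨ cong (_* fromℕ b) (fromℕ-suc a) ⟨
  fromℕ (suc a) * fromℕ b         ∎
  where open ≡-Reasoning

fromℕ-nonneg : ∀ a → 0ℚ ≤ fromℕ a
fromℕ-nonneg zero    = ≤-reflexive (sym fromℕ-0)
fromℕ-nonneg (suc a) = subst (0ℚ ≤_) (sym (fromℕ-suc a)) (+-nonneg 0≤1 (fromℕ-nonneg a))

fromℕ-mono : ∀ {a b} → a ℕ.≤ b → fromℕ a ≤ fromℕ b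
fromℕ-mono {a} {b} a≤b = by-diff (fromℕ (b ℕ.∸ a)) (fromℕ-nonneg _)
  (trans (sym (fromℕ-+ a (b ℕ.∸ a))) (cong fromℕ (ℕ.m+[n∸m]≡n a≤b)))

fromℕ-pos : ∀ a → 0ℚ < fromℕ (suc a)
fromℕ-pos a = <-≤-trans (ℚ.positive⁻¹ 1ℚ) (subst (_≤ fromℕ (suc a)) fromℕ-1 (fromℕ-mono {1} {suc a} (ℕ.s≤s ℕ.z≤n)))

opaque
  unfolding ∑

  ∑-const : ∀ n c → ∑ {n} (λ _ → c) ≡ fromℕ n * c
  ∑-const zero    c = sym (trans (cong (_* c) fromℕ-0) (zeroˡ c))
  ∑-const (suc n) c = trans (cong (c +_) (∑-const n c))
    (trans (solve 2 (λ c n → c :+ n :* c := (con 1ℚ :+ n) :* c) refl c (fromℕ n)) (cong (_* c) (sym (fromℕ-suc n))))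

∑-≤-const : ∀ {f : Fin n → ℚ} c → (∀ i → f i ≤ c) → ∑ f ≤ fromℕ n * c
∑-≤-const {n} c le = ≤-trans (∑-mono le) (≤-reflexive (∑-const n c))

opaque
  unfolding ∑

  ∑-∃-< : (f g : Fin n → ℚ) → ∑ f < ∑ g → ∃ λ i → f i < g i
  ∑-∃-< {zero}  f g lt = ⊥-elim (<-irrefl refl lt)
  ∑-∃-< {suc n} f g lt with f zero <? g zero
  ... | yes p = zero , p
  ... | no ¬p with ∑-∃-< (f ∘ suc) (g ∘ suc)
                     (≰⇒> λ le → <-irrefl refl (<-≤-trans lt (+-mono-≤ (≮⇒≥ ¬p) le)))
  ...   | i , p = suc i , p

infix 4 _==_
_==_ : Fin n → Fin n → Bool
i == j = isYes (i Fin.≟ j)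

==-refl : (i : Fin n) → (i == i) ≡ true
==-refl i with i Fin.≟ i
... | yes _ = refl
... | no ¬p = ⊥-elim (¬p refl)

==-≡ : {i j : Fin n} → (i == j) ≡ true → i ≡ j
==-≡ {i = i} {j} eq with i Fin.≟ j
... | yes p = p

==-≢ : {i j : Fin n} → i ≢ j → (i == j) ≡ false
==-≢ {i = i} {j} ne with i Fin.≟ j
... | yes p = ⊥-elim (ne p)
... | no _ = refl

==-sym : (i j : Fin n) → (i == j) ≡ (j == i)
==-sym i j with i Fin.≟ j
... | yes p = sym (trans (cong (_== i) (sym p)) (==-refl i))
... | no ¬p = sym (==-≢ (¬p ∘ sym))

==-suc : (i j : Fin n) → (suc i == suc j) ≡ (i == j)
==-suc i j with i Fin.≟ j
... | yes _ = refl
... | no _  = refl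

opaque
  unfolding ∑

  ∑-δ : (j : Fin n) (f : Fin n → ℚ) → ∑ (λ i → 𝟙 (j == i) * f i) ≡ f j
  ∑-δ {suc n} zero f = begin
    1ℚ * f zero + ∑ (λ i → 0ℚ * f (suc i))  ≡⟨ cong₂ _+_ (*-identityˡ _) (trans (∑-cong (λ i → zeroˡ (f (suc i)))) (∑-0 n)) ⟩
    f zero + 0ℚ                            ≡⟨ +-identityʳ _ ⟩
    f zero                                 ∎
    where open ≡-Reasoning
  ∑-δ {suc n} (suc j) f = begin
    0ℚ * f zero + ∑ (λ i → 𝟙 (suc j == suc i) * f (suc i))  ≡⟨ cong₂ _+_ (zeroˡ _) (∑-cong λ i → cong (λ b → 𝟙 b * f (suc i)) (==-suc j i)) ⟩
    0ℚ + ∑ (λ i → 𝟙 (j == i) * f (suc i))                  ≡⟨ +-identityˡ _ ⟩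
    ∑ (λ i → 𝟙 (j == i) * f (suc i))                        ≡⟨ ∑-δ j (f ∘ suc) ⟩
    f (suc j)                                              ∎
    where open ≡-Reasoning

+-left : ∀ {x y z} → x ≡ y → x + z ≡ y + z
+-left refl = refl

+-right : ∀ {x y z} → y ≡ z → x + y ≡ x + z
+-right refl = refl

*-left : ∀ {x y z} → x ≡ y → x * z ≡ y * z
*-left refl = refl

*-right : ∀ {x y z} → y ≡ z → x * y ≡ x * z
*-right refl = refl

-- Weighted averages and regular pairs

opaque
  𝔼 : (Fin n → ℚ) → (Fin n → ℚ) → ℚ
  𝔼 w f = ∑ λ a → w a * f a

record Prob (w : Fin n → ℚ) : Set where
  field
    nonneg : ∀ a → 0ℚ ≤ w a
    total  : ∑ w ≡ 1ℚ
open Prob public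

opaque
  unfolding 𝔼

  𝔼-def : (w f : Fin n → ℚ) → 𝔼 w f ≡ ∑ λ a → w a * f a
  𝔼-def w f = refl

  𝔼-cong : (w : Fin n → ℚ) {f g : Fin n → ℚ} → (∀ a → f a ≡ g a) → 𝔼 w f ≡ 𝔼 w g
  𝔼-cong w eq = ∑-cong λ a → cong (w a *_) (eq a)

  𝔼-+ : (w f g : Fin n → ℚ) → 𝔼 w (λ a → f a + g a) ≡ 𝔼 w f + 𝔼 w g
  𝔼-+ w f g = trans (∑-cong λ a → distribˡ (w a) (f a) (g a)) (∑-+ (λ a → w a * f a) (λ a → w a * g a))

  𝔼-*ˡ : (w : Fin n → ℚ) (c : ℚ) (f : Fin n → ℚ) → 𝔼 w (λ a → c * f a) ≡ c * 𝔼 w f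
  𝔼-*ˡ w c f = trans (∑-cong λ a → solve 3 (λ w c f → w :* (c :* f) := c :* (w :* f)) refl (w a) c (f a))
    (sym (∑-*ˡ c (λ a → w a * f a)))

  𝔼-- : (w f g : Fin n → ℚ) → 𝔼 w (λ a → f a - g a) ≡ 𝔼 w f - 𝔼 w g
  𝔼-- w f g = trans (∑-cong λ a → solve 3 (λ w f g → w :* (f :- g) := w :* f :- w :* g) refl (w a) (f a) (g a))
    (∑-- (λ a → w a * f a) (λ a → w a * g a))

  𝔼-swap : (u : Fin n → ℚ) (v : Fin m → ℚ) (f : Fin n → Fin m → ℚ) →
           𝔼 u (λ a → 𝔼 v (f a)) ≡ 𝔼 v (λ b → 𝔼 u (λ a → f a b))
  𝔼-swap u v f = begin
    ∑ (λ a → u a * ∑ (λ b → v b * f a b))    ≡⟨ ∑-cong (λ a → ∑-*ˡ (u a) (λ b → v b * f a b)) ⟩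
    ∑ (λ a → ∑ (λ b → u a * (v b * f a b)))  ≡⟨ ∑-swap (λ a b → u a * (v b * f a b)) ⟩
    ∑ (λ b → ∑ (λ a → u a * (v b * f a b)))  ≡⟨ ∑-cong (λ b → trans
       (∑-cong λ a → solve 3 (λ u v f → u :* (v :* f) := v :* (u :* f)) refl (u a) (v b) (f a b))
       (sym (∑-*ˡ (v b) (λ a → u a * f a b)))) ⟩
    ∑ (λ b → v b * ∑ (λ a → u a * f a b))    ∎
    where open ≡-Reasoning

  𝔼-∑ : (w : Fin n → ℚ) (f : Fin m → Fin n → ℚ) →
        𝔼 w (λ a → ∑ (λ p → f p a)) ≡ ∑ (λ p → 𝔼 w (f p))
  𝔼-∑ w f = trans (∑-cong λ a → ∑-*ˡ (w a) (λ p → f p a)) (∑-swap λ a p → w a * f p a)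

module _ {w : Fin n → ℚ} (P : Prob w) where
  opaque
    unfolding 𝔼

    𝔼-mono : {f g : Fin n → ℚ} → (∀ a → f a ≤ g a) → 𝔼 w f ≤ 𝔼 w g
    𝔼-mono le = ∑-mono λ a → *-mono-≤ˡ (w a) (nonneg P a) (le a)

    𝔼-const : ∀ c → 𝔼 w (λ _ → c) ≡ c
    𝔼-const c = trans (sym (∑-*ʳ c w)) (trans (cong (_* c) (total P)) (*-identityˡ c))

    𝔼-nonneg : {f : Fin n → ℚ} → (∀ a → 0ℚ ≤ f a) → 0ℚ ≤ 𝔼 w f
    𝔼-nonneg le = ∑-nonneg λ a → *-nonneg (nonneg P a) (le a)

    𝔼-≤ : ∀ {f : Fin n → ℚ} c → (∀ a → f a ≤ c) → 𝔼 w f ≤ c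
    𝔼-≤ c le = ≤-trans (𝔼-mono le) (≤-reflexive (𝔼-const c))

density : (u : Fin n → ℚ) (w : Fin m → ℚ) → (Fin n → Fin m → Bool) → ℚ
density u w f = 𝔼 u λ a → 𝔼 w λ c → 𝟙 (f a c)

onRectangle : (u : Fin n → ℚ) (w : Fin m → ℚ) → (Fin n → Fin m → ℚ) → (Fin n → Bool) → (Fin m → Bool) → ℚ
onRectangle u w g s t = 𝔼 u λ a → 𝔼 w λ c → 𝟙 (s a) * 𝟙 (t c) * g a c

-- Regularity in the cut norm: the error `δ` is measured against the whole pair of cells. Hence `s`
-- and `t` may be arbitrarily small, and the rectangles may depend on a further vertex over which
-- one then averages.
record Regular (δ : ℚ) (u : Fin n → ℚ) (w : Fin m → ℚ) (f : Fin n → Fin m → Bool) : Set where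
  field
    upper : ∀ s t → onRectangle u w (λ a c → 𝟙 (f a c)) s t ≤ onRectangle u w (λ _ _ → density u w f) s t + δ
    lower : ∀ s t → onRectangle u w (λ _ _ → density u w f) s t ≤ onRectangle u w (λ a c → 𝟙 (f a c)) s t + δ
open Regular public

module _ {u : Fin n → ℚ} {w : Fin m → ℚ} (Pu : Prob u) (Pw : Prob w) where

  𝔼𝔼-mono : {f g : Fin n → Fin m → ℚ} → (∀ a c → f a c ≤ g a c) →
            (𝔼 u λ a → 𝔼 w (f a)) ≤ (𝔼 u λ a → 𝔼 w (g a))
  𝔼𝔼-mono le = 𝔼-mono Pu λ a → 𝔼-mono Pw (le a)

  density-nonneg : ∀ f → 0ℚ ≤ density u w f
  density-nonneg f = 𝔼-nonneg Pu λ a → 𝔼-nonneg Pw λ c → 𝟙-nonneg (f a c)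

  density-≤1 : ∀ f → density u w f ≤ 1ℚ
  density-≤1 f = 𝔼-≤ Pu 1ℚ λ a → 𝔼-≤ Pw 1ℚ λ c → 𝟙≤1 (f a c)

  density-not : ∀ f → density u w (λ a c → not (f a c)) ≡ 1ℚ - density u w f
  density-not f = begin
    𝔼 u (λ a → 𝔼 w (λ c → 𝟙 (not (f a c))))        ≡⟨ 𝔼-cong u (λ a → 𝔼-cong w λ c → 𝟙-not (f a c)) ⟩
    𝔼 u (λ a → 𝔼 w (λ c → 1ℚ - 𝟙 (f a c)))         ≡⟨ 𝔼-cong u (λ a → trans (𝔼-- w (λ _ → 1ℚ) _) (+-left (𝔼-const Pw 1ℚ))) ⟩
    𝔼 u (λ a → 1ℚ - 𝔼 w (λ c → 𝟙 (f a c)))         ≡⟨ trans (𝔼-- u (λ _ → 1ℚ) _) (+-left (𝔼-const Pu 1ℚ)) ⟩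
    1ℚ - density u w f                              ∎
    where open ≡-Reasoning

  𝔼𝔼-- : (f g : Fin n → Fin m → ℚ) →
         (𝔼 u λ a → 𝔼 w λ c → f a c - g a c) ≡ (𝔼 u λ a → 𝔼 w (f a)) - (𝔼 u λ a → 𝔼 w (g a))
  𝔼𝔼-- f g = trans (𝔼-cong u λ a → 𝔼-- w (f a) (g a)) (𝔼-- u _ _)

  onRectangle-complement : ∀ g s t → onRectangle u w (λ a c → 1ℚ - g a c) s t ≡
                      onRectangle u w (λ _ _ → 1ℚ) s t - onRectangle u w g s t
  onRectangle-complement g s t = trans
    (𝔼-cong u λ a → 𝔼-cong w λ c → solve 2 (λ p g → p :* (con 1ℚ :- g) := p :* con 1ℚ :- p :* g) refl (𝟙 (s a) * 𝟙 (t c)) (g a c))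
    (𝔼𝔼-- (λ a c → 𝟙 (s a) * 𝟙 (t c) * 1ℚ) (λ a c → 𝟙 (s a) * 𝟙 (t c) * g a c))

  -- Complementing exchanges the two bounds. It is applied where c is confined to the complement of
  -- a container.
  Regular-not : ∀ {δ f} → Regular δ u w f → Regular δ u w (λ a c → not (f a c))
  Regular-not {δ} {f} R = record
    { upper = λ s t → subst₂ (λ x y → x ≤ y + δ) (sym (lhs s t)) (sym (rhs s t)) (flip (lower R s t))
    ; lower = λ s t → subst₂ (λ x y → x ≤ y + δ) (sym (rhs s t)) (sym (lhs s t)) (flip (upper R s t)) }
    where
    flip : ∀ {a b c} → a ≤ b + δ → c - b ≤ c - a + δ
    flip {a} {b} {c} le = by-diff (b + δ - a) (diff le)
      (solve 4 (λ a b c d → (c :- b) :+ (b :+ d :- a) := c :- a :+ d) refl a b c δ)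
    lhs : ∀ s t → onRectangle u w (λ a c → 𝟙 (not (f a c))) s t ≡ onRectangle u w (λ _ _ → 1ℚ) s t - onRectangle u w (λ a c → 𝟙 (f a c)) s t
    lhs s t = trans (𝔼-cong u λ a → 𝔼-cong w λ c → cong (𝟙 (s a) * 𝟙 (t c) *_) (𝟙-not (f a c)))
                    (onRectangle-complement (λ a c → 𝟙 (f a c)) s t)
    rhs : ∀ s t → onRectangle u w (λ _ _ → density u w (λ a c → not (f a c))) s t ≡ onRectangle u w (λ _ _ → 1ℚ) s t - onRectangle u w (λ _ _ → density u w f) s t
    rhs s t = trans (𝔼-cong u λ a → 𝔼-cong w λ c → cong (𝟙 (s a) * 𝟙 (t c) *_) (density-not f))
                    (onRectangle-complement (λ _ _ → density u w f) s t)

-- Regularity of O p decouples the constraint at a, then that of O′ q the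
-- constraint at b.
module _ {u : Fin n → ℚ} {v : Fin n → ℚ} {w : Fin n → ℚ} (Pu : Prob u) (Pv : Prob v) (Pw : Prob w)
         {δ : ℚ} (δ≥0 : 0ℚ ≤ δ) where

  decouple₁ : ∀ {f g : Fin n → Fin n → Bool} (π : Fin n → Fin n → Bool) → Regular δ u w f → Regular δ v w g →
    (𝔼 u λ a → 𝔼 v λ b → 𝔼 w λ c → 𝟙 (π a b) * (𝟙 (f a c) * 𝟙 (g b c)))
      ≤ (𝔼 u λ a → 𝔼 v λ b → 𝟙 (π a b) * (density u w f * density v w g)) + (δ + δ)
  decouple₁ {f} {g} π Rf Rg = begin
    (𝔼 u λ a → 𝔼 v λ b → 𝔼 w λ c → 𝟙 (π a b) * (𝟙 (f a c) * 𝟙 (g b c)))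
      ≡⟨ 𝔼-swap u v _ ⟩
    (𝔼 v λ b → 𝔼 u λ a → 𝔼 w λ c → 𝟙 (π a b) * (𝟙 (f a c) * 𝟙 (g b c)))
      ≡⟨ 𝔼-cong v (λ b → 𝔼-cong u λ a → 𝔼-cong w λ c →
           solve 3 (λ p f g → p :* (f :* g) := p :* g :* f) refl (𝟙 (π a b)) (𝟙 (f a c)) (𝟙 (g b c))) ⟩
    -- For a fixed b, the conditions on a and on c form a rectangle.
    (𝔼 v λ b → onRectangle u w (λ a c → 𝟙 (f a c)) (λ a → π a b) (g b))
      ≤⟨ 𝔼-mono Pv (λ b → upper Rf (λ a → π a b) (g b)) ⟩
    (𝔼 v λ b → onRectangle u w (λ _ _ → F) (λ a → π a b) (g b) + δ)
      ≡⟨ trans (𝔼-+ v _ _) (cong₂ _+_ (𝔼-swap v u _) (𝔼-const Pv δ)) ⟩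
    (𝔼 u λ a → 𝔼 v λ b → 𝔼 w λ c → 𝟙 (π a b) * 𝟙 (g b c) * F) + δ
      ≡⟨ cong (_+ δ) (𝔼-cong u λ a → trans (𝔼-cong v λ b → trans (𝔼-cong w λ c →
            solve 3 (λ p g F → p :* g :* F := F :* (p :* con 1ℚ :* g)) refl (𝟙 (π a b)) (𝟙 (g b c)) F)
            (𝔼-*ˡ w F _)) (𝔼-*ˡ v F _)) ⟩
    -- Now c is free of a, and for a fixed a the condition `π a b` selects a set of vertices b.
    (𝔼 u λ a → F * onRectangle v w (λ b c → 𝟙 (g b c)) (π a) (λ _ → true)) + δ
      ≤⟨ +-mono-≤ (𝔼-mono Pu λ a → *-mono-≤ˡ F F≥0 (upper Rg (π a) (λ _ → true))) ≤-refl ⟩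
    (𝔼 u λ a → F * (onRectangle v w (λ _ _ → G) (π a) (λ _ → true) + δ)) + δ
      ≤⟨ +-mono-≤ (𝔼-mono Pu λ a → shrink a) ≤-refl ⟩
    (𝔼 u λ a → (𝔼 v λ b → 𝟙 (π a b) * (F * G)) + δ) + δ
      ≡⟨ cong (_+ δ) (trans (𝔼-+ u _ _) (+-right (𝔼-const Pu δ))) ⟩
    (𝔼 u λ a → 𝔼 v λ b → 𝟙 (π a b) * (F * G)) + δ + δ
      ≡⟨ +-assoc _ δ δ ⟩
    (𝔼 u λ a → 𝔼 v λ b → 𝟙 (π a b) * (F * G)) + (δ + δ) ∎
    where
    open ≤-Reasoning
    F = density u w f
    G = density v w g
    F≥0 = density-nonneg Pu Pw f
    F≤1 = density-≤1 Pu Pw f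
    shrink : ∀ a → F * (onRectangle v w (λ _ _ → G) (π a) (λ _ → true) + δ) ≤ (𝔼 v λ b → 𝟙 (π a b) * (F * G)) + δ
    shrink a = begin
      F * (onRectangle v w (λ _ _ → G) (π a) (λ _ → true) + δ)
        ≡⟨ distribˡ F _ δ ⟩
      F * onRectangle v w (λ _ _ → G) (π a) (λ _ → true) + F * δ
        ≤⟨ +-mono-≤ ≤-refl (≤-trans (*-mono-≤ʳ δ δ≥0 F≤1) (≤-reflexive (*-identityˡ δ))) ⟩
      F * onRectangle v w (λ _ _ → G) (π a) (λ _ → true) + δ
        ≡⟨ cong (_+ δ) (trans (sym (𝔼-*ˡ v F _)) (𝔼-cong v λ b → trans (cong (F *_) (𝔼-const Pw _))
             (solve 3 (λ p F G → F :* (p :* con 1ℚ :* G) := p :* (F :* G)) refl (𝟙 (π a b)) F G))) ⟩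
      (𝔼 v λ b → 𝟙 (π a b) * (F * G)) + δ ∎

  -- The relation imposed on c depends on the pair a, b, but only through finitely many indices.
  -- Each pair of values p, q is decoupled separately, and the errors add up unweighted over all I ·
  -- J pairs; this is why `δ` is chosen only after the number of classes.
  decouple : ∀ {I J} (O : Fin I → Fin n → Fin n → Bool) (O′ : Fin J → Fin n → Fin n → Bool)
    (o : Fin n → Fin n → Fin I) (o′ : Fin n → Fin n → Fin J) →
    (∀ p → Regular δ u w (O p)) → (∀ q → Regular δ v w (O′ q)) →
    (𝔼 u λ a → 𝔼 v λ b → 𝔼 w λ c → 𝟙 (O (o a b) a c) * 𝟙 (O′ (o′ b a) b c))
      ≤ (𝔼 u λ a → 𝔼 v λ b → density u w (O (o a b)) * density v w (O′ (o′ b a)))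
        + fromℕ I * (fromℕ J * (δ + δ))
  decouple {I} {J} O O′ o o′ RO RO′ = begin
    (𝔼 u λ a → 𝔼 v λ b → 𝔼 w λ c → 𝟙 (O (o a b) a c) * 𝟙 (O′ (o′ b a) b c))
      ≡⟨ 𝔼-cong u (λ a → 𝔼-cong v λ b → split a b λ p q → 𝔼 w λ c → 𝟙 (O p a c) * 𝟙 (O′ q b c)) ⟩
    (𝔼 u λ a → 𝔼 v λ b → ∑ λ p → ∑ λ q → 𝟙 (π p q a b) * 𝔼 w λ c → 𝟙 (O p a c) * 𝟙 (O′ q b c))
      ≡⟨ pull (λ p q a b → 𝟙 (π p q a b) * 𝔼 w λ c → 𝟙 (O p a c) * 𝟙 (O′ q b c)) ⟩
    (∑ λ p → ∑ λ q → 𝔼 u λ a → 𝔼 v λ b → 𝟙 (π p q a b) * 𝔼 w λ c → 𝟙 (O p a c) * 𝟙 (O′ q b c))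
      ≡⟨ ∑-cong (λ p → ∑-cong λ q → 𝔼-cong u λ a → 𝔼-cong v λ b → sym (𝔼-*ˡ w _ _)) ⟩
    (∑ λ p → ∑ λ q → 𝔼 u λ a → 𝔼 v λ b → 𝔼 w λ c → 𝟙 (π p q a b) * (𝟙 (O p a c) * 𝟙 (O′ q b c)))
      ≤⟨ ∑-mono (λ p → ∑-mono λ q → decouple₁ (π p q) (RO p) (RO′ q)) ⟩
    (∑ λ p → ∑ λ q → (𝔼 u λ a → 𝔼 v λ b → 𝟙 (π p q a b) * (density u w (O p) * density v w (O′ q))) + (δ + δ))
      ≡⟨ trans (∑-cong λ p → trans (∑-+ (λ q → _) (λ q → δ + δ)) (+-right (∑-const J (δ + δ))))
               (trans (∑-+ (λ p → _) (λ p → fromℕ J * (δ + δ))) (+-right (∑-const I _))) ⟩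
    (∑ λ p → ∑ λ q → 𝔼 u λ a → 𝔼 v λ b → 𝟙 (π p q a b) * (density u w (O p) * density v w (O′ q))) + err
      ≡⟨ cong (_+ err) (sym (pull λ p q a b → 𝟙 (π p q a b) * (density u w (O p) * density v w (O′ q)))) ⟩
    (𝔼 u λ a → 𝔼 v λ b → ∑ λ p → ∑ λ q → 𝟙 (π p q a b) * (density u w (O p) * density v w (O′ q))) + err
      ≡⟨ cong (_+ err) (𝔼-cong u λ a → 𝔼-cong v λ b → sym (split a b λ p q → density u w (O p) * density v w (O′ q))) ⟩
    (𝔼 u λ a → 𝔼 v λ b → density u w (O (o a b)) * density v w (O′ (o′ b a))) + err ∎
    where
    open ≤-Reasoning
    err = fromℕ I * (fromℕ J * (δ + δ))
    π : Fin I → Fin J → Fin n → Fin n → Bool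
    π p q a b = (o a b == p) ∧ (o′ b a == q)
    split : ∀ a b (h : Fin I → Fin J → ℚ) → h (o a b) (o′ b a) ≡ ∑ λ p → ∑ λ q → 𝟙 (π p q a b) * h p q
    split a b h = sym (trans
      (∑-cong λ p → trans
        (∑-cong λ q → trans (cong (_* h p q) (𝟙-∧ (o a b == p) (o′ b a == q))) (*-assoc _ _ _))
        (trans (sym (∑-*ˡ (𝟙 (o a b == p)) (λ q → 𝟙 (o′ b a == q) * h p q))) (cong (𝟙 (o a b == p) *_) (∑-δ (o′ b a) (h p)))))
      (∑-δ (o a b) (λ p → h p (o′ b a))))
    pull : (F : Fin I → Fin J → Fin n → Fin n → ℚ) →
           (𝔼 u λ a → 𝔼 v λ b → ∑ λ p → ∑ λ q → F p q a b) ≡ (∑ λ p → ∑ λ q → 𝔼 u λ a → 𝔼 v λ b → F p q a b)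
    pull F = trans (𝔼-cong u λ a → trans (𝔼-∑ v _) (∑-cong λ p → 𝔼-∑ v _))
                   (trans (𝔼-∑ u _) (∑-cong λ p → 𝔼-∑ u _))

-- The density of a triple of cells

¼ : ℚ
¼ = ℤ.+ 1 ℚ./ 4

3ℚ : ℚ
3ℚ = ℤ.+ 3 ℚ./ 1

square-mono : ∀ {x y} → 0ℚ ≤ x → x ≤ y → x * x ≤ y * y
square-mono x≥0 x≤y = *-mono-≤ x≥0 (≤-trans x≥0 x≤y) x≤y x≤y

-- Separates the density seen from a from the density seen from b, so that each mean square can be
-- bounded by its own cover.
product≤mean-square : ∀ x y → x * y ≤ ½ * (x * x) + ½ * (y * y)
product≤mean-square x y = by-diff (½ * ((x - y) * (x - y))) (*-nonneg (ℚ.nonNegative⁻¹ ½) (square-nonneg (x - y)))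
  (solve 2 (λ x y → x :* y :+ con ½ :* ((x :- y) :* (x :- y)) := con ½ :* (x :* x) :+ con ½ :* (y :* y)) refl x y)

private
  slack : ∀ {A η} → A ≤ 1ℚ → η ≤ 1ℚ → A + A + η ≤ 3ℚ
  slack {A} {η} A≤1 η≤1 = by-diff (1ℚ - A + (1ℚ - A) + (1ℚ - η)) (+-nonneg (+-nonneg (diff A≤1) (diff A≤1)) (diff η≤1))
    (solve 2 (λ A η → A :+ A :+ η :+ (con 1ℚ :- A :+ (con 1ℚ :- A) :+ (con 1ℚ :- η)) := con 3ℚ) refl A η)

small-square : ∀ {A η} → 0ℚ ≤ A → 0ℚ ≤ η → η ≤ 1ℚ → A ≤ ½ → (A + η) * (A + η) ≤ ¼ + 3ℚ * η
small-square {A} {η} A≥0 η≥0 η≤1 A≤½ = by-diff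
  ((½ - A) * (½ + A) + η * (3ℚ - (A + A + η)))
  (+-nonneg (*-nonneg (diff A≤½) (+-nonneg (ℚ.nonNegative⁻¹ ½) A≥0))
            (*-nonneg η≥0 (diff (slack (≤-trans A≤½ (ℚ.≤ᵇ⇒≤ _)) η≤1))))
  (solve 2 (λ A η → (A :+ η) :* (A :+ η) :+ ((con ½ :- A) :* (con ½ :+ A) :+ η :* (con 3ℚ :- (A :+ A :+ η)))
     := con ¼ :+ con 3ℚ :* η) refl A η)

-- A (1 - A)² + (1 - A) A² = A (1 - A) ≤ 1/4, and for A ≥ 1/2 the left side only
-- decreases when weight is moved to the first summand.
mixture : ∀ {A η P} → ½ ≤ A → A ≤ 1ℚ → 0ℚ ≤ η → η ≤ 1ℚ → A ≤ P → P ≤ 1ℚ →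
  P * ((1ℚ - A) * (1ℚ - A)) + (1ℚ - P) * ((A + η) * (A + η)) ≤ ¼ + 3ℚ * η
mixture {A} {η} {P} A≥½ A≤1 η≥0 η≤1 A≤P P≤1 = by-diff
  ((A - ½) * (A - ½) + (P - A) * (A - ½ + (A - ½)) + η * (1ℚ * 3ℚ - (1ℚ - P) * (A + A + η)))
  (+-nonneg (+-nonneg (square-nonneg (A - ½)) (*-nonneg (diff A≤P) (+-nonneg (diff A≥½) (diff A≥½))))
            (*-nonneg η≥0 (diff (*-mono-≤ (diff P≤1) (ℚ.≤ᵇ⇒≤ _) 1-P≤1 (slack A≤1 η≤1)))))
  (solve 3 (λ A η P → P :* ((con 1ℚ :- A) :* (con 1ℚ :- A)) :+ (con 1ℚ :- P) :* ((A :+ η) :* (A :+ η))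
      :+ ((A :- con ½) :* (A :- con ½) :+ (P :- A) :* (A :- con ½ :+ (A :- con ½))
          :+ η :* (con 1ℚ :* con 3ℚ :- (con 1ℚ :- P) :* (A :+ A :+ η))) := con ¼ :+ con 3ℚ :* η) refl A η P)
  where
  1-P≤1 : 1ℚ - P ≤ 1ℚ
  1-P≤1 = by-diff P (≤-trans (≤-trans (ℚ.≤ᵇ⇒≤ _) A≥½) A≤P) (solve 1 (λ P → con 1ℚ :- P :+ P := con 1ℚ) refl P)

-- κ a b is the class of b in the link of a; U a m contains, up to few edges,
-- the link neighbourhoods of all vertices of class m.
module Link {n M : ℕ} (E : Fin n → Fin n → Fin n → Bool) (κ : Fin n → Fin n → Fin M) (U : Fin n → Fin M → Fin n → Bool) where

  Weight : Set
  Weight = Fin n → ℚ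

  D : Fin M → Weight → Weight → ℚ
  D p u w = density u w (λ a c → U a p c)

  tripleDensity : Weight → Weight → Weight → ℚ
  tripleDensity u v w = 𝔼 u λ a → 𝔼 v λ b → 𝔼 w λ c → 𝟙 (E a b c)

  escape : Weight → Weight → Weight → ℚ
  escape u v w = 𝔼 u λ a → 𝔼 v λ b → 𝔼 w λ c → 𝟙 (E a b c ∧ not (U a (κ a b) c))

  inside : Fin M → Weight → Weight → Weight → ℚ
  inside p u v w = 𝔼 u λ a → 𝔼 v λ b → 𝔼 w λ c → 𝟙 (E a b c ∧ (U a p b ∧ U a p c))

  tail : ℚ → Weight → Weight → Weight → ℚ
  tail x u v w = 𝔼 u λ a → 𝔼 v λ b → 𝟙 (isYes (x ≤? D (κ a b) u w))

  -- What the choice of a and b imposes on c from the side of a: apart from a weight `ε` of edges, c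
  -- lies in the set that relation `O (o a b)` assigns to a. The bound M + 1 leaves room for the M
  -- containers and the complement of one of them.
  record Cover (δ q ε : ℚ) (u v w : Weight) : Set where
    field
      I        : ℕ
      I≤       : I ℕ.≤ suc M
      O        : Fin I → Fin n → Fin n → Bool
      o        : Fin n → Fin n → Fin I
      regular  : ∀ p → Regular δ u w (O p)
      squares  : (𝔼 u λ a → 𝔼 v λ b → density u w (O (o a b)) * density u w (O (o a b))) ≤ q
      uncovered : (𝔼 u λ a → 𝔼 v λ b → 𝔼 w λ c → 𝟙 (E a b c ∧ not (O (o a b) a c))) ≤ ε

  module _ {u v w : Weight} (Pu : Prob u) (Pv : Prob v) (Pw : Prob w)
           {δ η ε A : ℚ} (η≥0 : 0ℚ ≤ η) (η≤1 : η ≤ 1ℚ) (A≥0 : 0ℚ ≤ A)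
           (R : ∀ p → Regular δ u w (λ a c → U a p c)) (small-tail : tail (A + η) u v w ≤ ε) where

    private
      sq : ∀ f → density u w f ≤ 1ℚ → density u w f * density u w f ≤ 1ℚ
      sq f le = ≤-trans (square-mono (density-nonneg Pu Pw f) le) (≤-reflexive (*-identityˡ 1ℚ))

      t : Fin n → Fin n → ℚ
      t a b = 𝟙 (isYes (A + η ≤? D (κ a b) u w))

      -- Outside the tail the density is below `A + η`; a pair in the tail is charged the trivial
      -- bound 1.
      by-tail : ∀ a b → D (κ a b) u w * D (κ a b) u w ≤ (A + η) * (A + η) + t a b
      by-tail a b with A + η ≤? D (κ a b) u w
      ... | yes _ = ≤-trans (sq (λ a′ c → U a′ (κ a b) c) (density-≤1 Pu Pw (λ a′ c → U a′ (κ a b) c))) (≤-trans (≤-reflexive (sym (+-identityˡ 1ℚ)))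
                      (+-mono-≤ (square-nonneg (A + η)) ≤-refl))
      ... | no ¬p = ≤-trans (square-mono (density-nonneg Pu Pw (λ a′ c → U a′ (κ a b) c)) (<⇒≤ (≰⇒> ¬p))) (≤-reflexive (sym (+-identityʳ _)))

    cover-small : A ≤ ½ → Cover δ (¼ + 3ℚ * η + ε) (escape u v w) u v w
    cover-small A≤½ = record
      { I = M ; I≤ = ℕ.n≤1+n M ; O = λ p a c → U a p c ; o = κ ; regular = R
      ; squares = begin
          (𝔼 u λ a → 𝔼 v λ b → D (κ a b) u w * D (κ a b) u w)
            ≤⟨ 𝔼𝔼-mono Pu Pv by-tail ⟩
          (𝔼 u λ a → 𝔼 v λ b → (A + η) * (A + η) + t a b)
            ≡⟨ trans (𝔼-cong u λ a → trans (𝔼-+ v _ _) (+-left (𝔼-const Pv _)))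
                     (trans (𝔼-+ u _ _) (+-left (𝔼-const Pu _))) ⟩
          (A + η) * (A + η) + tail (A + η) u v w
            ≤⟨ +-mono-≤ (small-square A≥0 η≥0 η≤1 A≤½) small-tail ⟩
          ¼ + 3ℚ * η + ε ∎
      ; uncovered = ≤-refl }
      where open ≤-Reasoning

    -- A vertex b of the large container is covered by the complement of that container instead of
    -- by the container of its own class; the edges violating this lie inside the large container
    -- and cost `θ`. The two lower bounds on `D p` serve different purposes: the one in the third
    -- cell makes the complement small, the one in the cell of b makes this case frequent.
    cover-large : ∀ {θ} p → ½ ≤ A → A ≤ 1ℚ → A ≤ D p u w → A ≤ D p u v → inside p u v w ≤ θ →
                  Cover δ (¼ + 3ℚ * η + ε) (escape u v w + θ) u v w
    cover-large {θ} p A≥½ A≤1 A≤Dw A≤Dv NI = record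
      { I = suc M ; I≤ = ℕ.≤-refl ; O = O ; o = o ; regular = reg
      ; squares = begin
          (𝔼 u λ a → 𝔼 v λ b → density u w (O (o a b)) * density u w (O (o a b)))
            ≤⟨ 𝔼𝔼-mono Pu Pv pointwise ⟩
          (𝔼 u λ a → 𝔼 v λ b → 𝟙 (U a p b) * (X - Y) + Y + t a b)
            ≡⟨ trans (𝔼-cong u λ a → trans (𝔼-+ v _ _) (+-left (trans (𝔼-+ v _ _) (cong₂ _+_
                        (trans (𝔼-cong v λ b → *-comm _ _) (𝔼-*ˡ v (X - Y) _)) (𝔼-const Pv Y)))))
                 (trans (𝔼-+ u _ _) (+-left (trans (𝔼-+ u _ _) (cong₂ _+_ (𝔼-*ˡ u (X - Y) _) (𝔼-const Pu Y))))) ⟩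
          (X - Y) * D p u v + Y + tail (A + η) u v w
            ≡⟨ +-left (solve 3 (λ X Y P → (X :- Y) :* P :+ Y := P :* X :+ (con 1ℚ :- P) :* Y) refl X Y (D p u v)) ⟩
          D p u v * X + (1ℚ - D p u v) * Y + tail (A + η) u v w
            ≤⟨ +-mono-≤ (mixture A≥½ A≤1 η≥0 η≤1 A≤Dv (density-≤1 Pu Pv (λ a c → U a p c))) small-tail ⟩
          ¼ + 3ℚ * η + ε ∎
      ; uncovered = begin
          (𝔼 u λ a → 𝔼 v λ b → 𝔼 w λ c → 𝟙 (E a b c ∧ not (O (o a b) a c)))
            ≤⟨ 𝔼-mono Pu (λ a → 𝔼𝔼-mono Pv Pw λ b c → escapes a b c) ⟩
          (𝔼 u λ a → 𝔼 v λ b → 𝔼 w λ c → 𝟙 (E a b c ∧ not (U a (κ a b) c)) + 𝟙 (E a b c ∧ (U a p b ∧ U a p c)))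
            ≡⟨ trans (𝔼-cong u λ a → trans (𝔼-cong v λ b → 𝔼-+ w _ _) (𝔼-+ v _ _)) (𝔼-+ u _ _) ⟩
          escape u v w + inside p u v w
            ≤⟨ +-mono-≤ ≤-refl NI ⟩
          escape u v w + θ ∎ }
      where
      open ≤-Reasoning
      X = (1ℚ - A) * (1ℚ - A)
      Y = (A + η) * (A + η)
      O : Fin (suc M) → Fin n → Fin n → Bool
      O zero    a c = not (U a p c)
      O (suc q) a c = U a q c
      o : Fin n → Fin n → Fin (suc M)
      o a b = if U a p b then zero else suc (κ a b)
      reg : ∀ q → Regular δ u w (O q)
      reg zero    = Regular-not Pu Pw (R p)
      reg (suc q) = R q
      pointwise : ∀ a b → density u w (O (o a b)) * density u w (O (o a b)) ≤ 𝟙 (U a p b) * (X - Y) + Y + t a b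
      pointwise a b with U a p b
      ... | true  = begin
        density u w (O zero) * density u w (O zero)
          ≤⟨ square-mono (density-nonneg Pu Pw (O zero)) (≤-trans (≤-reflexive (density-not Pu Pw (λ a c → U a p c)))
               (+-mono-≤ ≤-refl (neg-antimono A≤Dw))) ⟩
        X                                ≡⟨ solve 2 (λ X Y → X := con 1ℚ :* (X :- Y) :+ Y :+ con 0ℚ) refl X Y ⟩
        1ℚ * (X - Y) + Y + 0ℚ            ≤⟨ +-mono-≤ ≤-refl (𝟙-nonneg (isYes (A + η ≤? D (κ a b) u w))) ⟩
        1ℚ * (X - Y) + Y + t a b ∎
        where
        neg-antimono : ∀ {x y} → x ≤ y → - y ≤ - x
        neg-antimono {x} {y} x≤y = by-diff (y - x) (diff x≤y) (solve 2 (λ x y → :- y :+ (y :- x) := :- x) refl x y)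
      ... | false = ≤-trans (by-tail a b) (≤-reflexive (+-left (solve 2 (λ X Y → Y := con 0ℚ :* (X :- Y) :+ Y) refl X Y)))
      escapes : ∀ a b c → 𝟙 (E a b c ∧ not (O (o a b) a c)) ≤ 𝟙 (E a b c ∧ not (U a (κ a b) c)) + 𝟙 (E a b c ∧ (U a p b ∧ U a p c))
      escapes a b c with E a b c | U a p b
      ... | false | _     = ≤-reflexive (sym (+-identityˡ 0ℚ))
      ... | true  | false = ≤-reflexive (sym (+-identityʳ _))
      ... | true  | true with U a p c
      ...   | true  = ≤-trans (≤-reflexive (sym (+-identityˡ 1ℚ))) (+-mono-≤ (𝟙-nonneg (not (U a (κ a b) c))) ≤-refl)
      ...   | false = ≤-trans (≤-reflexive (sym (+-identityˡ 0ℚ))) (+-mono-≤ (𝟙-nonneg (not (U a (κ a b) c))) ≤-refl)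

  -- Every edge is covered both from a and from b, and decoupling turns the two conditions on c into
  -- a product of densities. A cover from one side only would bound the density by a mean of
  -- densities rather than of their squares.
  density-bound : (∀ a b c → E a b c ≡ E b a c) → ∀ {u v w} → Prob u → Prob v → Prob w → ∀ {δ q ε₁ ε₂} → 0ℚ ≤ δ →
    Cover δ q ε₁ u v w → Cover δ q ε₂ v u w →
    tripleDensity u v w ≤ q + fromℕ (suc M) * (fromℕ (suc M) * (δ + δ)) + (ε₁ + ε₂)
  density-bound E-sym {u} {v} {w} Pu Pv Pw {δ} {q} {ε₁} {ε₂} δ≥0 C C′ = begin
    tripleDensity u v w
      ≤⟨ 𝔼-mono Pu (λ a → 𝔼𝔼-mono Pv Pw λ b c → pointwise (E a b c) (C.O (C.o a b) a c) (C′.O (C′.o b a) b c)) ⟩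
    (𝔼 u λ a → 𝔼 v λ b → 𝔼 w λ c → 𝟙 (C.O (C.o a b) a c) * 𝟙 (C′.O (C′.o b a) b c)
       + (𝟙 (E a b c ∧ not (C.O (C.o a b) a c)) + 𝟙 (E a b c ∧ not (C′.O (C′.o b a) b c))))
      ≡⟨ trans (split _ _) (+-right (split _ _)) ⟩
    (𝔼 u λ a → 𝔼 v λ b → 𝔼 w λ c → 𝟙 (C.O (C.o a b) a c) * 𝟙 (C′.O (C′.o b a) b c))
       + ((𝔼 u λ a → 𝔼 v λ b → 𝔼 w λ c → 𝟙 (E a b c ∧ not (C.O (C.o a b) a c)))
          + (𝔼 u λ a → 𝔼 v λ b → 𝔼 w λ c → 𝟙 (E a b c ∧ not (C′.O (C′.o b a) b c))))
      ≤⟨ +-mono-≤ (decouple Pu Pv Pw δ≥0 C.O C′.O C.o C′.o C.regular C′.regular)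
                  (+-mono-≤ C.uncovered (≤-trans (≤-reflexive swapped) C′.uncovered)) ⟩
    (𝔼 u λ a → 𝔼 v λ b → d a b * d′ a b) + fromℕ C.I * (fromℕ C′.I * (δ + δ)) + (ε₁ + ε₂)
      ≤⟨ +-mono-≤ (+-mono-≤ squares errors) ≤-refl ⟩
    q + fromℕ (suc M) * (fromℕ (suc M) * (δ + δ)) + (ε₁ + ε₂) ∎
    where
    open ≤-Reasoning
    module C = Cover C
    module C′ = Cover C′
    d d′ : Fin n → Fin n → ℚ
    d a b = density u w (C.O (C.o a b))
    d′ a b = density v w (C′.O (C′.o b a))
    pointwise : ∀ e x y → 𝟙 e ≤ 𝟙 x * 𝟙 y + (𝟙 (e ∧ not x) + 𝟙 (e ∧ not y))
    pointwise false x y = +-nonneg (*-nonneg (𝟙-nonneg x) (𝟙-nonneg y)) (+-nonneg ≤-refl ≤-refl)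
    pointwise true true true = ≤-reflexive (solve 0 (con 1ℚ := con 1ℚ :* con 1ℚ :+ (con 0ℚ :+ con 0ℚ)) refl)
    pointwise true true false = ≤-reflexive (solve 0 (con 1ℚ := con 1ℚ :* con 0ℚ :+ (con 0ℚ :+ con 1ℚ)) refl)
    pointwise true false y = by-diff (𝟙 (not y)) (𝟙-nonneg (not y))
      (solve 2 (λ y y′ → con 1ℚ :+ y′ := con 0ℚ :* y :+ (con 1ℚ :+ y′)) refl (𝟙 y) (𝟙 (not y)))
    split : ∀ (f g : Fin n → Fin n → Fin n → ℚ) → (𝔼 u λ a → 𝔼 v λ b → 𝔼 w λ c → f a b c + g a b c) ≡
                    (𝔼 u λ a → 𝔼 v λ b → 𝔼 w λ c → f a b c) + (𝔼 u λ a → 𝔼 v λ b → 𝔼 w λ c → g a b c)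
    split f g = trans (𝔼-cong u λ a → trans (𝔼-cong v λ b → 𝔼-+ w _ _) (𝔼-+ v _ _)) (𝔼-+ u _ _)
    swapped : (𝔼 u λ a → 𝔼 v λ b → 𝔼 w λ c → 𝟙 (E a b c ∧ not (C′.O (C′.o b a) b c))) ≡
              (𝔼 v λ b → 𝔼 u λ a → 𝔼 w λ c → 𝟙 (E b a c ∧ not (C′.O (C′.o b a) b c)))
    swapped = trans (𝔼-swap u v _) (𝔼-cong v λ b → 𝔼-cong u λ a → 𝔼-cong w λ c →
      cong (λ e → 𝟙 (e ∧ not (C′.O (C′.o b a) b c))) (E-sym a b c))
    squares : (𝔼 u λ a → 𝔼 v λ b → d a b * d′ a b) ≤ q
    squares = begin
      (𝔼 u λ a → 𝔼 v λ b → d a b * d′ a b)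
        ≤⟨ 𝔼𝔼-mono Pu Pv (λ a b → product≤mean-square (d a b) (d′ a b)) ⟩
      (𝔼 u λ a → 𝔼 v λ b → ½ * (d a b * d a b) + ½ * (d′ a b * d′ a b))
        ≡⟨ trans (𝔼-cong u λ a → trans (𝔼-+ v _ _) (cong₂ _+_ (𝔼-*ˡ v ½ _) (𝔼-*ˡ v ½ _)))
                 (trans (𝔼-+ u _ _) (cong₂ _+_ (𝔼-*ˡ u ½ _) (𝔼-*ˡ u ½ _))) ⟩
      ½ * (𝔼 u λ a → 𝔼 v λ b → d a b * d a b) + ½ * (𝔼 u λ a → 𝔼 v λ b → d′ a b * d′ a b)
        ≤⟨ +-mono-≤ (*-mono-≤ˡ ½ (ℚ.nonNegative⁻¹ ½) C.squares)
                    (*-mono-≤ˡ ½ (ℚ.nonNegative⁻¹ ½) (≤-trans (≤-reflexive (𝔼-swap u v _)) C′.squares)) ⟩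
      ½ * q + ½ * q
        ≡⟨ solve 1 (λ q → con ½ :* q :+ con ½ :* q := q) refl q ⟩
      q ∎
    δδ≥0 : 0ℚ ≤ δ + δ
    δδ≥0 = +-nonneg δ≥0 δ≥0
    errors : fromℕ C.I * (fromℕ C′.I * (δ + δ)) ≤ fromℕ (suc M) * (fromℕ (suc M) * (δ + δ))
    errors = *-mono-≤ (fromℕ-nonneg C.I) (*-nonneg (fromℕ-nonneg (suc M)) δδ≥0) (fromℕ-mono C.I≤)
               (*-mono-≤ʳ (δ + δ) δδ≥0 (fromℕ-mono C′.I≤))

-- Bonferroni's inequality, levels and common classes

pairSum : ∀ {q} → (Fin q → Fin q → ℚ) → ℚ
pairSum {zero}  F = 0ℚ
pairSum {suc q} F = ∑ (λ t → F zero (suc t)) + pairSum (λ t t′ → F (suc t) (suc t′))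

pairSum-nonneg : ∀ {q} {F : Fin q → Fin q → ℚ} → (∀ t t′ → 0ℚ ≤ F t t′) → 0ℚ ≤ pairSum F
pairSum-nonneg {zero}  F≥0 = ≤-refl
pairSum-nonneg {suc q} F≥0 = +-nonneg (∑-nonneg λ t → F≥0 zero (suc t)) (pairSum-nonneg λ t t′ → F≥0 (suc t) (suc t′))

pairSum-≤ : ∀ {q} {F : Fin q → Fin q → ℚ} {τ} → 0ℚ ≤ τ → (∀ t t′ → t Fin.< t′ → F t t′ ≤ τ) →
            pairSum F ≤ fromℕ q * fromℕ q * τ
pairSum-≤ {zero}  τ≥0 F≤τ = *-nonneg (*-nonneg (fromℕ-nonneg 0) (fromℕ-nonneg 0)) τ≥0
pairSum-≤ {suc q} {F} {τ} τ≥0 F≤τ = begin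
  pairSum F                          ≤⟨ +-mono-≤ (∑-≤-const τ λ t → F≤τ zero (suc t) (ℕ.s≤s ℕ.z≤n))
                                                 (pairSum-≤ τ≥0 λ t t′ t<t′ → F≤τ (suc t) (suc t′) (ℕ.s≤s t<t′)) ⟩
  Q * τ + Q * Q * τ                  ≤⟨ by-diff (Q * τ + τ) (+-nonneg (*-nonneg (fromℕ-nonneg q) τ≥0) τ≥0)
                                          (solve 2 (λ Q τ → Q :* τ :+ Q :* Q :* τ :+ (Q :* τ :+ τ) := (con 1ℚ :+ Q) :* (con 1ℚ :+ Q) :* τ) refl Q τ) ⟩
  (1ℚ + Q) * (1ℚ + Q) * τ            ≡⟨ cong (λ x → x * x * τ) (sym (fromℕ-suc q)) ⟩
  fromℕ (suc q) * fromℕ (suc q) * τ  ∎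
  where open ≤-Reasoning
        Q = fromℕ q

𝔼-pairSum : (w : Fin n → ℚ) → ∀ {q} (F : Fin q → Fin q → Fin n → ℚ) →
            𝔼 w (λ a → pairSum (λ t t′ → F t t′ a)) ≡ pairSum (λ t t′ → 𝔼 w (F t t′))
𝔼-pairSum w {zero}  F = trans (𝔼-cong w λ a → sym (zeroˡ 0ℚ)) (trans (𝔼-*ˡ w 0ℚ _) (zeroˡ _))
𝔼-pairSum w {suc q} F = trans (𝔼-+ w _ _) (cong₂ _+_ (𝔼-∑ w _) (𝔼-pairSum w λ t t′ → F (suc t) (suc t′)))

-- For k true events this is k ≤ 1 + k (k - 1) / 2: the pairs that contain the first true event
-- already pay for all the others.
bonferroni : ∀ {q} (s : Fin q → Bool) → ∑ (λ t → 𝟙 (s t)) ≤ 1ℚ + pairSum (λ t t′ → 𝟙 (s t ∧ s t′))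
bonferroni {zero}  s = ≤-trans (≤-reflexive (∑-zero _)) (≤-trans 0≤1 (≤-reflexive (sym (+-identityʳ 1ℚ))))
bonferroni {suc q} s = ≤-trans (≤-reflexive (∑-suc _)) (step (s zero))
  where
  open ≤-Reasoning
  X = ∑ (λ t → 𝟙 (s (suc t)))
  P = pairSum (λ t t′ → 𝟙 (s (suc t) ∧ s (suc t′)))
  step : ∀ b → 𝟙 b + X ≤ 1ℚ + (∑ (λ t → 𝟙 (b ∧ s (suc t))) + P)
  step true = by-diff P (pairSum-nonneg λ t t′ → 𝟙-nonneg (s (suc t) ∧ s (suc t′))) (+-assoc 1ℚ X P)
  step false = begin
    0ℚ + X                                          ≡⟨ +-identityˡ X ⟩
    X                                               ≤⟨ bonferroni (s ∘ suc) ⟩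
    1ℚ + P                                          ≡⟨ +-right (trans (sym (+-identityˡ P)) (+-left (sym (∑-0 q)))) ⟩
    1ℚ + (∑ {q} (λ _ → 0ℚ) + P)                     ∎

last-true : ∀ {P : ℕ → Set} → (∀ l → Dec (P l)) → P 0 → ∀ g → ¬ P (suc g) → ∃ λ l → l ℕ.≤ g × P l × ¬ P (suc l)
last-true P? p0 zero    ¬p = 0 , ℕ.z≤n , p0 , ¬p
last-true P? p0 (suc g) ¬p with P? (suc g)
... | yes p = suc g , ℕ.≤-refl , p , ¬p
... | no ¬p′ with last-true P? p0 g ¬p′
...   | l , l≤g , pl , ¬psl = l , ℕ.m≤n⇒m≤1+n l≤g , pl , ¬psl

module Levels {n M : ℕ} (E : Fin n → Fin n → Fin n → Bool) (κ : Fin n → Fin n → Fin M) (U : Fin n → Fin M → Fin n → Bool) where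
  open Link E κ U

  module _ {η ε : ℚ} (g : ℕ) (η>0 : 0ℚ < η) (gη≡1 : fromℕ g * η ≡ 1ℚ) (ε≤1 : ε ≤ 1ℚ) (ε>0 : 0ℚ < ε) where

    -- Multiples of `η` replace the exact value of A, so that there are only g + 1 levels and a
    -- level can be part of a colour. A last level exists because the tail at 0 has weight 1 and the
    -- tail beyond 1 is empty.
    level : ∀ {u v w} → Prob u → Prob v → Prob w →
            ∃ λ l → l ℕ.≤ g × ε ≤ tail (fromℕ l * η) u v w × ¬ (ε ≤ tail (fromℕ (suc l) * η) u v w)
    level {u} {v} {w} Pu Pv Pw = last-true (λ l → ε ≤? tail (fromℕ l * η) u v w) always g never
      where
      always : ε ≤ tail (fromℕ 0 * η) u v w
      always = ≤-trans ε≤1 (≤-reflexive (sym (trans (𝔼-cong u λ a → trans (𝔼-cong v λ b → one a b) (𝔼-const Pv 1ℚ)) (𝔼-const Pu 1ℚ))))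
        where
        one : ∀ a b → 𝟙 (isYes (fromℕ 0 * η ≤? D (κ a b) u w)) ≡ 1ℚ
        one a b with fromℕ 0 * η ≤? D (κ a b) u w
        ... | yes _ = refl
        ... | no ¬p = ⊥-elim (¬p (≤-trans (≤-reflexive (trans (*-left fromℕ-0) (zeroˡ η))) (density-nonneg Pu Pw λ a′ c → U a′ (κ a b) c)))
      1<g+1η : 1ℚ < fromℕ (suc g) * η
      1<g+1η = <-≤-trans (≤-<-trans (≤-reflexive (sym (+-identityˡ 1ℚ))) (+-mono-<ˡ η>0))
        (≤-reflexive (sym (trans (*-left (fromℕ-suc g)) (trans (solve 2 (λ G η → (con 1ℚ :+ G) :* η := η :+ G :* η) refl (fromℕ g) η) (+-right gη≡1)))))
      never : ¬ (ε ≤ tail (fromℕ (suc g) * η) u v w)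
      never le = <-irrefl refl (<-≤-trans ε>0 (≤-trans le (≤-reflexive (trans (𝔼-cong u λ a → trans (𝔼-cong v λ b → none a b) (𝔼-const Pv 0ℚ)) (𝔼-const Pu 0ℚ)))))
        where
        none : ∀ a b → 𝟙 (isYes (fromℕ (suc g) * η ≤? D (κ a b) u w)) ≡ 0ℚ
        none a b with fromℕ (suc g) * η ≤? D (κ a b) u w
        ... | yes p = ⊥-elim (<-irrefl refl (<-≤-trans 1<g+1η (≤-trans p (density-≤1 Pu Pw λ a′ c → U a′ (κ a b) c))))
        ... | no _ = refl

  -- The counterpart of `inside` in which the fixed class is replaced by the class of a random b,
  -- varying with a. Sparse containers make this quantity small, whereas a cover needs `inside p` to
  -- be small for a single p.
  spread : Weight → Weight → Weight → Weight → ℚ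
  spread u v w w′ = 𝔼 u λ a → 𝔼 v λ b → 𝔼 w λ c → 𝔼 w′ λ d → 𝟙 (E a c d ∧ (U a (κ a b) c ∧ U a (κ a b) d))

  module _ {u v : Weight} (Pu : Prob u) (Pv : Prob v) {δ : ℚ}
           (R : ∀ p → Regular δ u v (λ a b → κ a b == p)) where

    β : Fin M → ℚ
    β p = density u v (λ a b → κ a b == p)

    β-nonneg : ∀ p → 0ℚ ≤ β p
    β-nonneg p = density-nonneg Pu Pv λ a b → κ a b == p

    by-class : (f : Fin M → Fin n → ℚ) → (𝔼 u λ a → 𝔼 v λ b → f (κ a b) a) ≡
               ∑ λ p → 𝔼 u λ a → (𝔼 v λ b → 𝟙 (κ a b == p)) * f p a
    by-class f = trans (𝔼-cong u λ a → trans (𝔼-cong v λ b → sym (∑-δ (κ a b) (λ p → f p a))) (trans (𝔼-∑ v _) (∑-cong λ p →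
      trans (𝔼-cong v λ b → *-comm _ _) (trans (𝔼-*ˡ v (f p a) _) (*-comm _ _))))) (𝔼-∑ u _)

    class-average : (f : Fin M → ℚ) → (𝔼 u λ a → 𝔼 v λ b → f (κ a b)) ≡ ∑ λ p → β p * f p
    class-average f = trans (by-class λ p _ → f p) (∑-cong λ p →
      trans (𝔼-cong u λ a → *-comm _ (f p)) (trans (𝔼-*ˡ u (f p) _) (*-comm (f p) (β p))))

    -- Passes from the plain average over a to the average weighted by the share of class p at a.
    -- Something is lost only at vertices a whose share is below the mean `β p`; regularity of the
    -- class relation on the set of vertices with share at most `β p` bounds the loss by `δ`.
    class-weight : ∀ p (N : Fin n → ℚ) → (∀ a → 0ℚ ≤ N a) → (∀ a → N a ≤ 1ℚ) →
      β p * 𝔼 u N ≤ (𝔼 u λ a → (𝔼 v λ b → 𝟙 (κ a b == p)) * N a) + δ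
    class-weight p N N≥0 N≤1 = begin
      β p * 𝔼 u N
        ≡⟨ 𝔼-*ˡ u (β p) N ⟨
      (𝔼 u λ a → β p * N a)
        ≤⟨ 𝔼-mono Pu pointwise ⟩
      (𝔼 u λ a → βₐ a * N a + 𝟙 (s a) * (β p - βₐ a))
        ≡⟨ trans (𝔼-+ u _ _) (+-right (trans (𝔼-cong u λ a → solve 3 (λ s B b → s :* (B :- b) := s :* B :- s :* b) refl (𝟙 (s a)) (β p) (βₐ a)) (𝔼-- u _ _))) ⟩
      (𝔼 u λ a → βₐ a * N a) + ((𝔼 u λ a → 𝟙 (s a) * β p) - (𝔼 u λ a → 𝟙 (s a) * βₐ a))
        ≤⟨ +-mono-≤ ≤-refl (by-diff _ (diff low) (solve 3 (λ x y d → x :- y :+ (y :+ d :- x) := d) refl _ _ δ)) ⟩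
      (𝔼 u λ a → βₐ a * N a) + δ ∎
      where
      open ≤-Reasoning
      βₐ : Fin n → ℚ
      βₐ a = 𝔼 v λ b → 𝟙 (κ a b == p)
      s : Fin n → Bool
      s a = isYes (βₐ a ≤? β p)
      pointwise : ∀ a → β p * N a ≤ βₐ a * N a + 𝟙 (s a) * (β p - βₐ a)
      pointwise a with βₐ a ≤? β p
      ... | yes le = by-diff ((β p - βₐ a) * (1ℚ - N a)) (*-nonneg (diff le) (diff (N≤1 a)))
        (solve 3 (λ B b N → B :* N :+ (B :- b) :* (con 1ℚ :- N) := b :* N :+ con 1ℚ :* (B :- b)) refl (β p) (βₐ a) (N a))
      ... | no ¬le = ≤-trans (*-mono-≤ʳ (N a) (N≥0 a) (<⇒≤ (≰⇒> ¬le))) (≤-reflexive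
        (solve 3 (λ B b N → b :* N := b :* N :+ con 0ℚ :* (B :- b)) refl (β p) (βₐ a) (N a)))
      low : (𝔼 u λ a → 𝟙 (s a) * β p) ≤ (𝔼 u λ a → 𝟙 (s a) * βₐ a) + δ
      low = subst₂ (λ x y → x ≤ y + δ)
        (𝔼-cong u λ a → trans (𝔼-cong v λ b → *-left (*-identityʳ _)) (𝔼-const Pv _))
        (𝔼-cong u λ a → trans (𝔼-cong v λ b → *-left (*-identityʳ _)) (𝔼-*ˡ v (𝟙 (s a)) _))
        (lower (R p) s (λ _ → true))

    -- Bonferroni: if no two targets shared a large class, the q events of
    -- probability at least ε would be almost disjoint.
    common-class : ∀ {q} (w : Fin q → Weight) → (∀ t → Prob (w t)) → ∀ {A ε ζ θ τ} → 0ℚ < θ → 0ℚ ≤ τ →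
      (∀ t → ε ≤ tail A u v (w t)) →
      (∀ t t′ → t Fin.< t′ → spread u v (w t) (w t′) ≤ ζ) →
      ζ + fromℕ M * δ ≤ θ * τ →
      1ℚ + fromℕ q * fromℕ q * τ < fromℕ q * ε →
      (∀ t t′ → t Fin.< t′ → ∀ p → A ≤ D p u (w t) → A ≤ D p u (w t′) → ¬ (inside p u (w t) (w t′) ≤ θ)) → ⊥
    common-class {q} w Pw {A} {ε} {ζ} {θ} {τ} θ>0 τ≥0 large near small count none = <-irrefl refl (<-≤-trans count (begin
      fromℕ q * ε
        ≡⟨ ∑-const q ε ⟨
      ∑ (λ _ → ε)
        ≤⟨ ∑-mono large ⟩
      ∑ (λ t → tail A u v (w t))
        ≡⟨ trans (sym (𝔼-∑ u _)) (𝔼-cong u λ a → sym (𝔼-∑ v _)) ⟩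
      (𝔼 u λ a → 𝔼 v λ b → ∑ λ t → 𝟙 (S (κ a b) t))
        ≤⟨ 𝔼𝔼-mono Pu Pv (λ a b → bonferroni (S (κ a b))) ⟩
      (𝔼 u λ a → 𝔼 v λ b → 1ℚ + pairSum λ t t′ → 𝟙 (S (κ a b) t ∧ S (κ a b) t′))
        ≡⟨ trans (𝔼-cong u λ a → trans (𝔼-+ v _ _) (cong₂ _+_ (𝔼-const Pv 1ℚ) (𝔼-pairSum v {q} _)))
             (trans (𝔼-+ u _ _) (cong₂ _+_ (𝔼-const Pu 1ℚ) (𝔼-pairSum u {q} _))) ⟩
      1ℚ + pairSum (λ t t′ → 𝔼 u λ a → 𝔼 v λ b → 𝟙 (S (κ a b) t ∧ S (κ a b) t′))
        ≤⟨ +-mono-≤ ≤-refl (pairSum-≤ τ≥0 pair) ⟩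
      1ℚ + fromℕ q * fromℕ q * τ ∎))
      where
      open ≤-Reasoning
      S : Fin M → Fin q → Bool
      S p t = isYes (A ≤? D p u (w t))
      -- Markov's inequality: by `none`, each class that is large for both targets has inside weight
      -- above `θ`, while the classes weighted by their frequency have total inside weight at most
      -- `ζ` plus the regularity error.
      pair : ∀ t t′ → t Fin.< t′ → (𝔼 u λ a → 𝔼 v λ b → 𝟙 (S (κ a b) t ∧ S (κ a b) t′)) ≤ τ
      pair t t′ t<t′ = *-cancel-≤ θ θ>0 (begin
        θ * (𝔼 u λ a → 𝔼 v λ b → 𝟙 (S (κ a b) t ∧ S (κ a b) t′))
          ≡⟨ trans (*-right (class-average λ p → 𝟙 (S p t ∧ S p t′))) (trans (∑-*ˡ θ _) (∑-cong λ p →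
               solve 3 (λ θ β s → θ :* (β :* s) := β :* (θ :* s)) refl θ (β p) (𝟙 (S p t ∧ S p t′)))) ⟩
        (∑ λ p → β p * (θ * 𝟙 (S p t ∧ S p t′)))
          ≤⟨ ∑-mono (λ p → *-mono-≤ˡ (β p) (β-nonneg p) (bad p)) ⟩
        (∑ λ p → β p * 𝔼 u (N p))
          ≤⟨ ∑-mono (λ p → class-weight p (N p) (N-nonneg p) (N-≤1 p)) ⟩
        (∑ λ p → (𝔼 u λ a → (𝔼 v λ b → 𝟙 (κ a b == p)) * N p a) + δ)
          ≡⟨ trans (∑-+ (λ p → _) (λ _ → δ)) (cong₂ _+_ (sym (by-class N)) (∑-const M δ)) ⟩
        spread u v (w t) (w t′) + fromℕ M * δ
          ≤⟨ +-mono-≤ (near t t′ t<t′) ≤-refl ⟩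
        ζ + fromℕ M * δ
          ≤⟨ small ⟩
        θ * τ ∎)
        where
        N : Fin M → Fin n → ℚ
        N p a = 𝔼 (w t) λ c → 𝔼 (w t′) λ d → 𝟙 (E a c d ∧ (U a p c ∧ U a p d))
        N-nonneg : ∀ p a → 0ℚ ≤ N p a
        N-nonneg p a = density-nonneg (Pw t) (Pw t′) λ c d → E a c d ∧ (U a p c ∧ U a p d)
        N-≤1 : ∀ p a → N p a ≤ 1ℚ
        N-≤1 p a = density-≤1 (Pw t) (Pw t′) λ c d → E a c d ∧ (U a p c ∧ U a p d)
        bad : ∀ p → θ * 𝟙 (S p t ∧ S p t′) ≤ 𝔼 u (N p)
        bad p with A ≤? D p u (w t) | A ≤? D p u (w t′)
        ... | yes x | yes y = ≤-trans (≤-reflexive (*-identityʳ θ)) (<⇒≤ (≰⇒> (none t t′ t<t′ p x y)))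
        ... | yes _ | no _ = ≤-trans (≤-reflexive (zeroʳ θ)) (𝔼-nonneg Pu (N-nonneg p))
        ... | no _  | _    = ≤-trans (≤-reflexive (zeroʳ θ)) (𝔼-nonneg Pu (N-nonneg p))

-- Increasing tuples and Ramsey's theorem

-- The order is that of positions in the list. The entries are later sampled independently, so the
-- same vertex or cell may occur more than once.
Increasing : ∀ {A : Set} r → (Vec A r → Set) → List A → Set
Increasing zero    P xs       = P []
Increasing (suc r) P []       = ⊤
Increasing (suc r) P (x ∷ xs) = Increasing r (P ∘ (x ∷_)) xs × Increasing (suc r) P xs

Increasing-⊆ : ∀ {A : Set} r {P : Vec A r → Set} {xs ys} → xs ⊆ ys → Increasing r P ys → Increasing r P xs
Increasing-⊆ zero    s i = i
Increasing-⊆ (suc r) [] i = tt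
Increasing-⊆ (suc r) (y ∷ʳ s) (_ , i) = Increasing-⊆ (suc r) s i
Increasing-⊆ (suc r) (refl ∷ s) (i , j) = Increasing-⊆ r s i , Increasing-⊆ (suc r) s j

Increasing-∈ : ∀ {A : Set} {r} {P : Vec A r → Set} {xs} → Increasing r P xs → (v : Vec A r) → Vec.toList v ⊆ xs → P v
Increasing-∈ i [] s = i
Increasing-∈ (_ , i) (x ∷ v) (_ ∷ʳ s) = Increasing-∈ i (x ∷ v) s
Increasing-∈ (i , _) (x ∷ v) (refl ∷ s) = Increasing-∈ i v s

private
  positive : ∀ {k} (ps : List (Fin (suc k))) → All (zero {k} Fin.<_) ps → AllPairs Fin._<_ ps →
             ∃ λ qs → ps ≡ List.map suc qs × AllPairs Fin._<_ qs
  positive []           []      []       = [] , refl , []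
  positive (suc p ∷ ps) (_ ∷ z) (h ∷ hs) with positive ps z hs
  ... | qs , refl , hs′ = p ∷ qs , refl , unsuc qs h ∷ hs′
    where
    unsuc : ∀ {k} {p : Fin k} (qs : List (Fin k)) → All (suc p Fin.<_) (List.map suc qs) → All (p Fin.<_) qs
    unsuc [] [] = []
    unsuc (q ∷ qs) (ℕ.s≤s l ∷ ls) = l ∷ unsuc qs ls

lookup-⊆ : ∀ {A : Set} (xs : List A) (ps : List (Fin (length xs))) → AllPairs Fin._<_ ps → List.map (List.lookup xs) ps ⊆ xs
lookup-⊆ xs       []          _        = minimum xs
lookup-⊆ {A} (x ∷ xs) (p ∷ ps) (h ∷ hs) = first p h
  where
  shift : ∀ ps → All (zero {length xs} Fin.<_) ps → AllPairs Fin._<_ ps → List.map (List.lookup (x ∷ xs)) ps ⊆ xs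
  shift ps z hs with positive ps z hs
  ... | qs , refl , hs′ = subst (_⊆ xs) (map-∘ qs) (lookup-⊆ xs qs hs′)
  first : ∀ p → All (p Fin.<_) ps → List.map (List.lookup (x ∷ xs)) (p ∷ ps) ⊆ x ∷ xs
  first zero    h = refl ∷ shift ps h hs
  first (suc p) h = x ∷ʳ shift (suc p ∷ ps) (ℕ.s≤s ℕ.z≤n ∷ All.map (ℕ.≤-trans (ℕ.s≤s ℕ.z≤n)) h) (h ∷ hs)

splitting : ∀ {A : Set} {P : A → Set} → (∀ x → Dec (P x)) → ∀ a b (xs : List A) → a ℕ.+ b ℕ.≤ length xs →
  (∃ λ ys → ys ⊆ xs × a ℕ.≤ length ys × All P ys) ⊎ (∃ λ ys → ys ⊆ xs × b ℕ.≤ length ys × All (¬_ ∘ P) ys)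
splitting P? zero    b       xs       l = inj₁ ([] , minimum xs , ℕ.z≤n , [])
splitting P? (suc a) zero    xs       l = inj₂ ([] , minimum xs , ℕ.z≤n , [])
splitting P? (suc a) (suc b) (x ∷ xs) (ℕ.s≤s l) with P? x
... | yes p with splitting P? a (suc b) xs l
...   | inj₁ (ys , s , k , h) = inj₁ (x ∷ ys , refl ∷ s , ℕ.s≤s k , p ∷ h)
...   | inj₂ (ys , s , k , h) = inj₂ (ys , x ∷ʳ s , k , h)
splitting P? (suc a) (suc b) (x ∷ xs) (ℕ.s≤s l) | no ¬p with splitting P? (suc a) b xs (subst (ℕ._≤ length xs) (ℕ.+-suc a b) l)
...   | inj₁ (ys , s , k , h) = inj₁ (ys , x ∷ʳ s , k , h)
...   | inj₂ (ys , s , k , h) = inj₂ (x ∷ ys , refl ∷ s , ℕ.s≤s k , ¬p ∷ h)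

pigeonhole : ∀ c m → ∃ λ k → ∀ {A : Set} (f : A → Fin c) (xs : List A) → k ℕ.≤ length xs →
  ∃ λ ys → ∃ λ col → ys ⊆ xs × m ℕ.≤ length ys × All (λ y → f y ≡ col) ys
pigeonhole c m = 1 ℕ.+ c ℕ.* m , λ f xs l → go f (List.allFin c) xs (subst (λ z → 1 ℕ.+ z ℕ.* m ℕ.≤ length xs) (sym (length-tabulate {n = c} id)) l)
                                             (All.tabulate λ {x} _ → ∈-allFin (f x))
  where
  go : ∀ {A : Set} (f : A → Fin c) cols xs → 1 ℕ.+ length cols ℕ.* m ℕ.≤ length xs → All (λ x → f x ∈ cols) xs →
       ∃ λ ys → ∃ λ col → ys ⊆ xs × m ℕ.≤ length ys × All (λ y → f y ≡ col) ys
  go f []           (x ∷ xs) l (() ∷ _)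
  go f (col ∷ cols) xs       l h with splitting (λ x → f x Fin.≟ col) m (1 ℕ.+ length cols ℕ.* m) xs
                                        (subst (ℕ._≤ length xs) (sym (ℕ.+-suc m (length cols ℕ.* m))) l)
  ... | inj₁ (ys , s , k , e) = ys , col , s , k , e
  ... | inj₂ (ys , s , k , e) with go f cols ys k (remove ys e (All-resp-⊆ s h))
    where
    remove : ∀ ys → All (λ x → f x ≢ col) ys → All (λ x → f x ∈ col ∷ cols) ys → All (λ x → f x ∈ cols) ys
    remove [] [] [] = []
    remove (y ∷ ys) (ne ∷ es) (here eq ∷ hs) = ⊥-elim (ne eq)
    remove (y ∷ ys) (ne ∷ es) (there i ∷ hs) = i ∷ remove ys es hs
  ...   | zs , col′ , s′ , k′ , e′ = zs , col′ , ⊆-trans s′ s , k′ , e′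

Monochromatic : ∀ {A : Set} {c} r → (Vec A r → Fin c) → Fin c → List A → Set
Monochromatic r γ col = Increasing r (λ v → γ v ≡ col)

Ramsey : ℕ → ℕ → ℕ → ℕ → Set₁
Ramsey c r m k = ∀ {A : Set} (γ : Vec A r → Fin c) (xs : List A) → k ℕ.≤ length xs →
  ∃ λ ys → ∃ λ col → ys ⊆ xs × m ℕ.≤ length ys × Monochromatic r γ col ys

-- The intermediate object of the Erdős-Rado argument: the colour of an increasing tuple is
-- determined by its first entry and is recorded beside that entry.
EndHomogeneous : ∀ {A : Set} {c} r → (Vec A (suc r) → Fin c) → List (A × Fin c) → Set
EndHomogeneous r γ []               = ⊤
EndHomogeneous r γ ((x , col) ∷ zs) = Monochromatic r (γ ∘ (x ∷_)) col (List.map proj₁ zs) × EndHomogeneous r γ zs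

opaque
  -- Induction on r. Fixing a first entry colours r-tuples of the remaining ones, and passing to a
  -- monochromatic sublist before choosing the next entry produces an end-homogeneous list; the
  -- pigeonhole principle for the recorded colours finishes.
  ramsey : ∀ c r m → ∃ (Ramsey c r m)
  ramsey c zero    m = m , λ γ xs l → xs , γ [] , ⊆-refl , l , refl
  ramsey c (suc r) m = proj₁ (end (proj₁ (pigeonhole c m))) , λ γ xs l → finish γ xs (proj₂ (end (proj₁ (pigeonhole c m))) γ xs l)
    where
    end : ∀ L → ∃ λ k → ∀ {A : Set} (γ : Vec A (suc r) → Fin c) (xs : List A) → k ℕ.≤ length xs →
          ∃ λ zs → List.map proj₁ zs ⊆ xs × L ℕ.≤ length zs × EndHomogeneous r γ zs
    end zero    = 0 , λ γ xs l → [] , minimum xs , ℕ.z≤n , tt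
    end (suc L) with end L
    ... | k , endL with ramsey c r k
    ...   | k′ , ramseyk = suc k′ , extend
      where
      extend : ∀ {A : Set} (γ : Vec A (suc r) → Fin c) (xs : List A) → suc k′ ℕ.≤ length xs →
               ∃ λ zs → List.map proj₁ zs ⊆ xs × suc L ℕ.≤ length zs × EndHomogeneous r γ zs
      extend γ (x ∷ xs) (ℕ.s≤s l) with ramseyk (γ ∘ (x ∷_)) xs l
      ... | ys , col , s , kl , mono with endL γ ys kl
      ...   | zs , s′ , L≤ , eh = (x , col) ∷ zs , refl ∷ ⊆-trans s′ s , ℕ.s≤s L≤ , Increasing-⊆ r s′ mono , eh

    sub : ∀ {A : Set} {γ : Vec A (suc r) → Fin c} {zs′ zs} → zs′ ⊆ zs → EndHomogeneous r γ zs → EndHomogeneous r γ zs′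
    sub [] e = tt
    sub (_ ∷ʳ s) (_ , e) = sub s e
    sub (refl ∷ s) (h , e) = Increasing-⊆ r (map⁺ proj₁ s) h , sub s e

    mono : ∀ {A : Set} {γ : Vec A (suc r) → Fin c} {col} zs → All (λ z → proj₂ z ≡ col) zs → EndHomogeneous r γ zs →
           Monochromatic (suc r) γ col (List.map proj₁ zs)
    mono [] _ _ = tt
    mono ((x , col) ∷ zs) (refl ∷ cs) (h , e) = h , mono zs cs e

    finish : ∀ {A : Set} (γ : Vec A (suc r) → Fin c) (xs : List A) →
             (∃ λ zs → List.map proj₁ zs ⊆ xs × proj₁ (pigeonhole c m) ℕ.≤ length zs × EndHomogeneous r γ zs) →
             ∃ λ ys → ∃ λ col → ys ⊆ xs × m ℕ.≤ length ys × Monochromatic (suc r) γ col ys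
    finish γ xs (zs , s , l , e) with proj₂ (pigeonhole c m) proj₂ zs l
    ... | zs′ , col , s′ , l′ , cs = List.map proj₁ zs′ , col , ⊆-trans (map⁺ proj₁ s′) s ,
      subst (m ℕ.≤_) (sym (length-map proj₁ zs′)) l′ , mono zs′ cs (sub s′ e)

-- Expectations over independent samples

𝔼-∃-< : ∀ {w : Fin n → ℚ} → Prob w → ∀ {f : Fin n → ℚ} {c} → 𝔼 w f < c → ∃ λ a → f a < c
𝔼-∃-< {w = w} Pw {f} {c} lt with ∑-∃-< (λ a → w a * f a) (λ a → w a * c)
    (subst₂ _<_ (𝔼-def w f) (trans (sym (𝔼-const Pw c)) (𝔼-def w (λ _ → c))) lt)
... | a , lt′ = a , ≰⇒> λ c≤f → <-irrefl refl (<-≤-trans lt′ (*-mono-≤ˡ (w a) (nonneg Pw a) c≤f))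

𝔼ᵛ : (Fin n → ℚ) → ∀ r → (Vec (Fin n) r → ℚ) → ℚ
𝔼ᵛ w zero    F = F []
𝔼ᵛ w (suc r) F = 𝔼 w λ x → 𝔼ᵛ w r (F ∘ (x ∷_))

increasingSum : ∀ r → (Vec (Fin n) r → ℚ) → List (Fin n) → ℚ
increasingSum zero    F xs       = F []
increasingSum (suc r) F []       = 0ℚ
increasingSum (suc r) F (x ∷ xs) = increasingSum r (F ∘ (x ∷_)) xs + increasingSum (suc r) F xs

increasingSum-nonneg : ∀ r {F : Vec (Fin n) r → ℚ} → (∀ v → 0ℚ ≤ F v) → ∀ xs → 0ℚ ≤ increasingSum r F xs
increasingSum-nonneg zero    F≥0 xs       = F≥0 []
increasingSum-nonneg (suc r) F≥0 []       = ≤-refl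
increasingSum-nonneg (suc r) F≥0 (x ∷ xs) =
  +-nonneg (increasingSum-nonneg r (F≥0 ∘ (x ∷_)) xs) (increasingSum-nonneg (suc r) F≥0 xs)

increasing-< : ∀ r {F : Vec (Fin n) r → ℚ} {c} → (∀ v → 0ℚ ≤ F v) → ∀ xs → increasingSum r F xs < c →
               Increasing r (λ v → F v < c) xs
increasing-< zero    F≥0 xs       lt = lt
increasing-< (suc r) F≥0 []       lt = tt
increasing-< (suc r) {F} F≥0 (x ∷ xs) lt =
  increasing-< r (F≥0 ∘ (x ∷_)) xs (≤-<-trans (by-diff _ (increasingSum-nonneg (suc r) F≥0 xs) refl) lt) ,
  increasing-< (suc r) F≥0 xs (≤-<-trans (by-diff _ (increasingSum-nonneg r (F≥0 ∘ (x ∷_)) xs) (+-comm _ _)) lt)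

module _ {w : Fin n → ℚ} (Pw : Prob w) where

  𝔼ᵛ-∃-< : ∀ r {F : Vec (Fin n) r → ℚ} {c} → 𝔼ᵛ w r F < c → ∃ λ v → F v < c
  𝔼ᵛ-∃-< zero    lt = [] , lt
  𝔼ᵛ-∃-< (suc r) lt with 𝔼-∃-< Pw lt
  ... | x , lt′ with 𝔼ᵛ-∃-< r lt′
  ...   | v , lt″ = x ∷ v , lt″

  𝔼ᵛ-const : ∀ r c → 𝔼ᵛ w r (λ _ → c) ≡ c
  𝔼ᵛ-const zero    c = refl
  𝔼ᵛ-const (suc r) c = trans (𝔼-cong w λ _ → 𝔼ᵛ-const r c) (𝔼-const Pw c)

  𝔼ᵛ-+ : ∀ r (F G : Vec (Fin n) r → ℚ) → 𝔼ᵛ w r (λ v → F v + G v) ≡ 𝔼ᵛ w r F + 𝔼ᵛ w r G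
  𝔼ᵛ-+ zero    F G = refl
  𝔼ᵛ-+ (suc r) F G = trans (𝔼-cong w λ x → 𝔼ᵛ-+ r (F ∘ (x ∷_)) (G ∘ (x ∷_))) (𝔼-+ w _ _)

  𝔼ᵛ-nonneg : ∀ r {F : Vec (Fin n) r → ℚ} → (∀ v → 0ℚ ≤ F v) → 0ℚ ≤ 𝔼ᵛ w r F
  𝔼ᵛ-nonneg zero    F≥0 = F≥0 []
  𝔼ᵛ-nonneg (suc r) F≥0 = 𝔼-nonneg Pw λ x → 𝔼ᵛ-nonneg r (F≥0 ∘ (x ∷_))

  -- K positions have at most 2 ^ K increasing selections. This crude count is the same for every r,
  -- so both branches of the recursion contribute the same factor and it doubles with each new
  -- entry.
  expected-increasingSum : ∀ K r {F : Vec (Fin n) r → ℚ} → (∀ v → 0ℚ ≤ F v) →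
    𝔼ᵛ w K (λ v → increasingSum r F (Vec.toList v)) ≤ fromℕ (2 ℕ.^ K) * 𝔼ᵛ w r F
  expected-increasingSum K zero {F} F≥0 = ≤-trans (≤-reflexive (trans (𝔼ᵛ-const K (F [])) (sym (*-identityˡ (F [])))))
    (*-mono-≤ʳ (F []) (F≥0 []) (≤-trans (≤-reflexive (sym fromℕ-1)) (fromℕ-mono (ℕ.m^n>0 2 K))))
  expected-increasingSum zero (suc r) {F} F≥0 = *-nonneg (fromℕ-nonneg 1) (𝔼ᵛ-nonneg (suc r) F≥0)
  expected-increasingSum (suc K) (suc r) {F} F≥0 = begin
    𝔼ᵛ w (suc K) (λ v → increasingSum (suc r) F (Vec.toList v))
      ≡⟨ trans (𝔼-cong w λ x → 𝔼ᵛ-+ K _ _) (trans (𝔼-+ w _ _) (+-right (𝔼-const Pw _))) ⟩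
    (𝔼 w λ x → 𝔼ᵛ w K (λ v → increasingSum r (F ∘ (x ∷_)) (Vec.toList v))) + 𝔼ᵛ w K (λ v → increasingSum (suc r) F (Vec.toList v))
      ≤⟨ +-mono-≤ (𝔼-mono Pw λ x → expected-increasingSum K r (F≥0 ∘ (x ∷_))) (expected-increasingSum K (suc r) F≥0) ⟩
    (𝔼 w λ x → fromℕ (2 ℕ.^ K) * 𝔼ᵛ w r (F ∘ (x ∷_))) + fromℕ (2 ℕ.^ K) * 𝔼ᵛ w (suc r) F
      ≡⟨ +-left (𝔼-*ˡ w (fromℕ (2 ℕ.^ K)) _) ⟩
    fromℕ (2 ℕ.^ K) * 𝔼ᵛ w (suc r) F + fromℕ (2 ℕ.^ K) * 𝔼ᵛ w (suc r) F
      ≡⟨ distribʳ _ (fromℕ (2 ℕ.^ K)) (fromℕ (2 ℕ.^ K)) ⟨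
    (fromℕ (2 ℕ.^ K) + fromℕ (2 ℕ.^ K)) * 𝔼ᵛ w (suc r) F
      ≡⟨ *-left (trans (sym (fromℕ-+ (2 ℕ.^ K) (2 ℕ.^ K))) (cong (λ z → fromℕ (2 ℕ.^ K ℕ.+ z)) (sym (ℕ.+-identityʳ _)))) ⟩
    fromℕ (2 ℕ.^ suc K) * 𝔼ᵛ w (suc r) F ∎
    where open ≤-Reasoning

  -- First moment method: all terms are nonnegative, so a list whose sum is below `c` has every
  -- single term below `c`.
  good-list : ∀ K r {F : Vec (Fin n) r → ℚ} {c} → (∀ v → 0ℚ ≤ F v) → fromℕ (2 ℕ.^ K) * 𝔼ᵛ w r F < c →
              ∃ λ xs → length xs ≡ K × Increasing r (λ v → F v < c) xs
  good-list K r F≥0 lt with 𝔼ᵛ-∃-< K (≤-<-trans (expected-increasingSum K r F≥0) lt)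
  ... | v , lt′ = Vec.toList v , length-toList v , increasing-< r F≥0 (Vec.toList v) lt′

-- Containers in graphs with few triangles

∑-member : ∀ {M} (f : Fin M → ℚ) → (∀ i → 0ℚ ≤ f i) → ∀ j → f j ≤ ∑ f
∑-member f f≥0 j = ≤-trans (≤-reflexive (sym (∑-δ j f))) (∑-mono λ i →
  ≤-trans (*-mono-≤ʳ (f i) (f≥0 i) (𝟙≤1 (j == i))) (≤-reflexive (*-identityˡ (f i))))

∑-by-class : ∀ {M} (κ : Fin n → Fin M) (f : Fin M → Fin n → ℚ) →
             ∑ (λ b → f (κ b) b) ≡ ∑ λ m → ∑ λ b → 𝟙 (κ b == m) * f m b
∑-by-class κ f = trans (∑-cong λ b → sym (∑-δ (κ b) (λ m → f m b))) (∑-swap λ b m → 𝟙 (κ b == m) * f m b)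

enc : ∀ {M} → Fin M → Bool → Fin (M ℕ.* 2)
enc m s = Fin.combine m (if s then suc zero else zero)

bit : Fin 2 → Bool
bit zero    = false
bit (suc _) = true

dec-class : ∀ {M} → Fin (M ℕ.* 2) → Fin M × Bool
dec-class {M} x = proj₁ (Fin.remQuot {M} 2 x) , bit (proj₂ (Fin.remQuot {M} 2 x))

dec-enc : ∀ {M} (m : Fin M) s → dec-class (enc m s) ≡ (m , s)
dec-enc m true  = cong (λ z → proj₁ z , bit (proj₂ z)) (Fin.remQuot-combine {k = 2} m (suc zero))
dec-enc m false = cong (λ z → proj₁ z , bit (proj₂ z)) (Fin.remQuot-combine {k = 2} m zero)

-- The principle: if b is adjacent to q, every common neighbour of b and q closes a triangle at q.
-- So, up to `ζ` adjacencies in total, the neighbourhoods of all neighbours of q avoid the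
-- neighbourhood of q, which may therefore be removed from their containers.
module Containers {n : ℕ} (L : Fin n → Fin n → Bool) {ε ζ : ℚ} (ε>0 : 0ℚ < ε) (ζ≥0 : 0ℚ ≤ ζ) (n>0 : 0ℚ < fromℕ n)
  (L-sym : ∀ b c → L b c ≡ L c b)
  (triangles : ∀ q → ∑ (λ b → ∑ λ c → 𝟙 (L q b ∧ (L b c ∧ L q c))) ≤ ζ) where

  private
    N = fromℕ n
    ε≥0 = <⇒≤ ε>0
    N≥0 = fromℕ-nonneg n

  Ψ Λ : ∀ {M} → (Fin n → Fin M) → (Fin M → Fin n → Bool) → ℚ
  Ψ κ C = ∑ λ b → ∑ λ c → 𝟙 (C (κ b) c)
  Λ κ C = ∑ λ b → ∑ λ c → 𝟙 (L b c ∧ not (C (κ b) c))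

  -- Each vertex b has a class κ b whose container C (κ b) is meant to contain
  -- the neighbourhood of b.
  module State {M : ℕ} (κ : Fin n → Fin M) (C : Fin M → Fin n → Bool) where

    deg : Fin M → Fin n → ℚ
    deg m c = ∑ λ d → 𝟙 (C m d ∧ L c d)

    heavy : Fin M → Fin n → Bool
    heavy m c = C m c ∧ isYes (ε * N ≤? deg m c)

    size : Fin M → ℚ
    size m = ∑ λ b → 𝟙 (κ b == m)

    hit : Fin M → Fin n → ℚ
    hit m q = ∑ λ b → 𝟙 (κ b == m) * 𝟙 (L q b)

    -- Heaviness of q makes a container lose at least `ε * N` vertices, and the second condition
    -- makes this happen for a proportion `ε` of the class. Both are needed for a definite drop of
    -- the potential `Ψ`.
    Splits : Fin M → Fin n → Set
    Splits m q = heavy m q ≡ true × ε * size m ≤ hit m q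

    splits? : ∀ m → Dec (∃ (Splits m))
    splits? m = Fin.any? λ q → (heavy m q Bool.≟ true) ×-dec (ε * size m ≤? hit m q)

    splitter : Fin M → Maybe (Fin n)
    splitter m with splits? m
    ... | yes (q , _) = just q
    ... | no _        = nothing

    active : Fin M → Bool
    active m = isYes (splits? m)

    adj : Maybe (Fin n) → Fin n → Bool
    adj (just q) b = L q b
    adj nothing  b = false

    -- Neighbours of the splitter form a class of their own, with a reduced container; the others
    -- keep theirs. In a class without a splitter the second half stays empty.
    κ′ : Fin n → Fin (M ℕ.* 2)
    κ′ b = enc (κ b) (adj (splitter (κ b)) b)

    C″ : Fin M × Bool → Fin n → Bool
    C″ (m , s) c = C m c ∧ not (s ∧ adj (splitter m) c)

    C′ : Fin (M ℕ.* 2) → Fin n → Bool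
    C′ x = C″ (dec-class x)

    C′κ′ : ∀ b c → C′ (κ′ b) c ≡ C″ (κ b , adj (splitter (κ b)) b) c
    C′κ′ b c = cong (λ z → C″ z c) (dec-enc (κ b) (adj (splitter (κ b)) b))

    activity : ℚ
    activity = ∑ λ b → 𝟙 (active (κ b))

    size≥0 : ∀ m → 0ℚ ≤ size m
    size≥0 m = ∑-nonneg λ b → 𝟙-nonneg (κ b == m)

    degree : Maybe (Fin n) → Fin M → ℚ
    degree (just q) m = deg m q
    degree nothing  m = 0ℚ

    drop : Ψ κ C ≡ Ψ κ′ C′ + ∑ (λ b → 𝟙 (adj (splitter (κ b)) b) * degree (splitter (κ b)) (κ b))
    drop = sym (trans (sym (∑-+ (λ b → ∑ λ c → 𝟙 (C′ (κ′ b) c)) _)) (∑-cong row))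
      where
      point : ∀ s x y → 𝟙 (x ∧ not (s ∧ y)) + 𝟙 s * 𝟙 (x ∧ y) ≡ 𝟙 x
      point true  true  true  = solve 0 (con 0ℚ :+ con 1ℚ :* con 1ℚ := con 1ℚ) refl
      point true  true  false = solve 0 (con 1ℚ :+ con 1ℚ :* con 0ℚ := con 1ℚ) refl
      point true  false y     = solve 0 (con 0ℚ :+ con 1ℚ :* con 0ℚ := con 0ℚ) refl
      point false true  y     = solve 1 (λ y → con 1ℚ :+ con 0ℚ :* y := con 1ℚ) refl (𝟙 y)
      point false false y     = solve 0 (con 0ℚ :+ con 0ℚ :* con 0ℚ := con 0ℚ) refl
      nothing-deg : ∀ m → degree nothing m ≡ ∑ λ c → 𝟙 (C m c ∧ false)
      nothing-deg m = sym (trans (∑-cong λ c → cong 𝟙 (Bool.∧-zeroʳ (C m c))) (∑-0 n))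
      degree-adj : ∀ q m → degree q m ≡ ∑ λ c → 𝟙 (C m c ∧ adj q c)
      degree-adj (just q) m = refl
      degree-adj nothing  m = nothing-deg m
      row : ∀ b → ∑ (λ c → 𝟙 (C′ (κ′ b) c)) + 𝟙 (adj (splitter (κ b)) b) * degree (splitter (κ b)) (κ b) ≡ ∑ λ c → 𝟙 (C (κ b) c)
      row b = trans (cong₂ _+_ (∑-cong λ c → cong 𝟙 (C′κ′ b c))
                (trans (*-right (degree-adj (splitter (κ b)) (κ b))) (∑-*ˡ _ _)))
              (trans (sym (∑-+ _ _)) (∑-cong λ c → point (adj (splitter (κ b)) b) (C (κ b) c) (adj (splitter (κ b)) c)))

    ∧-true : ∀ {x y} → x ∧ y ≡ true → x ≡ true × y ≡ true
    ∧-true {true} {true} _ = refl , refl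

    isYes-true : ∀ {P : Set} (d : Dec P) → isYes d ≡ true → P
    isYes-true (yes p) _ = p

    degree-large : ∀ m b → 𝟙 (adj (splitter m) b) * (ε * N) ≤ 𝟙 (adj (splitter m) b) * degree (splitter m) m
    degree-large m b with splits? m
    ... | yes (q , h , _) = *-mono-≤ˡ (𝟙 (L q b)) (𝟙-nonneg (L q b)) (isYes-true (ε * N ≤? deg m q) (proj₂ (∧-true h)))
    ... | no _ = ≤-reflexive (trans (zeroˡ _) (sym (zeroˡ _)))

    hits : ∀ m → ε * ∑ (λ b → 𝟙 (κ b == m) * 𝟙 (active m)) ≤ ∑ λ b → 𝟙 (κ b == m) * 𝟙 (adj (splitter m) b)
    hits m with splits? m
    ... | yes (q , _ , h) = ≤-trans (≤-reflexive (*-right (∑-cong λ b → *-identityʳ _))) h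
    ... | no _ = ≤-reflexive (trans (*-right (trans (∑-cong λ b → zeroʳ _) (∑-0 n))) (trans (zeroʳ ε)
                   (sym (trans (∑-cong λ b → zeroʳ _) (∑-0 n)))))

    potential-drop : Ψ κ′ C′ + ε * activity * (ε * N) ≤ Ψ κ C
    potential-drop = ≤-trans (+-mono-≤ ≤-refl (begin
      ε * activity * (ε * N)
        ≤⟨ *-mono-≤ʳ (ε * N) (*-nonneg ε≥0 N≥0) (begin
             ε * activity
               ≡⟨ trans (*-right (∑-by-class κ (λ m _ → 𝟙 (active m)))) (∑-*ˡ ε _) ⟩
             ∑ (λ m → ε * ∑ (λ b → 𝟙 (κ b == m) * 𝟙 (active m)))
               ≤⟨ ∑-mono hits ⟩
             ∑ (λ m → ∑ λ b → 𝟙 (κ b == m) * 𝟙 (adj (splitter m) b))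
               ≡⟨ ∑-by-class κ (λ m b → 𝟙 (adj (splitter m) b)) ⟨
             ∑ (λ b → 𝟙 (adj (splitter (κ b)) b)) ∎) ⟩
      ∑ (λ b → 𝟙 (adj (splitter (κ b)) b)) * (ε * N)
        ≡⟨ ∑-*ʳ (ε * N) _ ⟩
      ∑ (λ b → 𝟙 (adj (splitter (κ b)) b) * (ε * N))
        ≤⟨ ∑-mono (λ b → degree-large (κ b) b) ⟩
      ∑ (λ b → 𝟙 (adj (splitter (κ b)) b) * degree (splitter (κ b)) (κ b)) ∎)) (≤-reflexive (sym drop))
      where open ≤-Reasoning

    -- An adjacency of b and c is newly lost only if both are adjacent to the splitter of the class
    -- of b. It then belongs to a triangle at that splitter, and there is at most one splitter per
    -- class.
    loss : Λ κ′ C′ ≤ Λ κ C + fromℕ M * ζ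
    loss = begin
      Λ κ′ C′
        ≤⟨ ∑-mono (λ b → ∑-mono λ c → ≤-trans (≤-reflexive (cong (λ z → 𝟙 (L b c ∧ not z)) (C′κ′ b c)))
             (point (L b c) (C (κ b) c) (adj (splitter (κ b)) b) (adj (splitter (κ b)) c))) ⟩
      ∑ (λ b → ∑ λ c → 𝟙 (L b c ∧ not (C (κ b) c)) + 𝟙 (adj (splitter (κ b)) b ∧ (L b c ∧ adj (splitter (κ b)) c)))
        ≡⟨ trans (∑-cong λ b → ∑-+ _ _) (∑-+ _ _) ⟩
      Λ κ C + ∑ (λ b → ∑ λ c → 𝟙 (adj (splitter (κ b)) b ∧ (L b c ∧ adj (splitter (κ b)) c)))
        ≤⟨ +-mono-≤ ≤-refl (∑-mono λ b → ∑-member (λ m → ∑ λ c → 𝟙 (adj (splitter m) b ∧ (L b c ∧ adj (splitter m) c)))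
             (λ m → ∑-nonneg λ c → 𝟙-nonneg (adj (splitter m) b ∧ (L b c ∧ adj (splitter m) c))) (κ b)) ⟩
      Λ κ C + ∑ (λ b → ∑ λ m → ∑ λ c → 𝟙 (adj (splitter m) b ∧ (L b c ∧ adj (splitter m) c)))
        ≡⟨ +-right (∑-swap _) ⟩
      Λ κ C + ∑ (λ m → ∑ λ b → ∑ λ c → 𝟙 (adj (splitter m) b ∧ (L b c ∧ adj (splitter m) c)))
        ≤⟨ +-mono-≤ ≤-refl (∑-≤-const ζ λ m → few (splitter m)) ⟩
      Λ κ C + fromℕ M * ζ ∎
      where
      open ≤-Reasoning
      point : ∀ l x s y → 𝟙 (l ∧ not (x ∧ not (s ∧ y))) ≤ 𝟙 (l ∧ not x) + 𝟙 (s ∧ (l ∧ y))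
      point false x s y = +-nonneg ≤-refl (𝟙-nonneg (s ∧ false))
      point true false s y = by-diff (𝟙 (s ∧ y)) (𝟙-nonneg (s ∧ y)) refl
      point true true false y = ≤-reflexive (sym (+-identityˡ 0ℚ))
      point true true true true = ≤-reflexive (sym (+-identityˡ 1ℚ))
      point true true true false = ≤-reflexive (sym (+-identityˡ 0ℚ))
      few : ∀ q → ∑ (λ b → ∑ λ c → 𝟙 (adj q b ∧ (L b c ∧ adj q c))) ≤ ζ
      few (just q) = triangles q
      few nothing  = ≤-trans (≤-reflexive (trans (∑-cong λ b → ∑-0 n) (∑-0 n))) ζ≥0

    light : Fin M → Fin n → Bool
    light m c = C m c ∧ not (isYes (ε * N ≤? deg m c))

    -- A light vertex has fewer than `ε * N` neighbours in the whole container, hence also among the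
    -- light vertices.
    light-sparse : ∀ m → ∑ (λ c → ∑ λ d → 𝟙 (light m c ∧ (light m d ∧ L c d))) ≤ N * (ε * N)
    light-sparse m = ∑-≤-const (ε * N) row
      where
      open ≤-Reasoning
      drop-test : ∀ x t l → 𝟙 ((x ∧ t) ∧ l) ≤ 𝟙 (x ∧ l)
      drop-test true  true  l = ≤-refl
      drop-test true  false l = 𝟙-nonneg l
      drop-test false t     l = ≤-refl
      row : ∀ c → ∑ (λ d → 𝟙 (light m c ∧ (light m d ∧ L c d))) ≤ ε * N
      row c with C m c | ε * N ≤? deg m c
      ... | false | _ = ≤-trans (≤-reflexive (∑-0 n)) (*-nonneg ε≥0 N≥0)
      ... | true | yes _ = ≤-trans (≤-reflexive (∑-0 n)) (*-nonneg ε≥0 N≥0)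
      ... | true | no ¬h = ≤-trans (∑-mono λ d → drop-test (C m d) (not (isYes (ε * N ≤? deg m d))) (L c d)) (<⇒≤ (≰⇒> ¬h))

    -- Dropping the heavy vertices is cheap once few vertices lie in active classes: in an inactive
    -- class every heavy vertex is adjacent to less than a proportion `ε` of the class, and the
    -- active classes together have at most `ε * N` members.
    light-loss : activity ≤ ε * N → ∑ (λ b → ∑ λ c → 𝟙 (L b c ∧ not (light (κ b) c))) ≤ Λ κ C + (N * (ε * N) + N * (ε * N))
    light-loss small = begin
      ∑ (λ b → ∑ λ c → 𝟙 (L b c ∧ not (light (κ b) c)))
        ≤⟨ ∑-mono (λ b → ∑-mono λ c → point (L b c) (C (κ b) c) (isYes (ε * N ≤? deg (κ b) c))) ⟩
      ∑ (λ b → ∑ λ c → 𝟙 (L b c ∧ not (C (κ b) c)) + 𝟙 (heavy (κ b) c) * 𝟙 (L b c))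
        ≡⟨ trans (∑-cong λ b → ∑-+ _ _) (∑-+ _ _) ⟩
      Λ κ C + ∑ (λ b → ∑ λ c → 𝟙 (heavy (κ b) c) * 𝟙 (L b c))
        ≤⟨ +-mono-≤ ≤-refl heavy-loss ⟩
      Λ κ C + (N * (ε * N) + N * (ε * N)) ∎
      where
      open ≤-Reasoning
      point : ∀ l x h → 𝟙 (l ∧ not (x ∧ not h)) ≤ 𝟙 (l ∧ not x) + 𝟙 (x ∧ h) * 𝟙 l
      point false x h = +-nonneg ≤-refl (*-nonneg (𝟙-nonneg (x ∧ h)) ≤-refl)
      point true false h = ≤-reflexive (solve 0 (con 1ℚ := con 1ℚ :+ con 0ℚ :* con 1ℚ) refl)
      point true true true = ≤-reflexive (solve 0 (con 1ℚ := con 0ℚ :+ con 1ℚ :* con 1ℚ) refl)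
      point true true false = ≤-reflexive (solve 0 (con 0ℚ := con 0ℚ :+ con 0ℚ :* con 1ℚ) refl)
      class : ∀ m → ∑ (λ b → 𝟙 (κ b == m) * ∑ λ c → 𝟙 (heavy m c) * 𝟙 (L b c)) ≤
                    ∑ (λ b → 𝟙 (κ b == m) * (𝟙 (active m) * N)) + N * (ε * size m)
      class m with splits? m
      ... | yes _ = ≤-trans (∑-mono λ b → *-mono-≤ˡ (𝟙 (κ b == m)) (𝟙-nonneg (κ b == m))
              (≤-trans (∑-≤-const 1ℚ λ c → ≤-trans (*-mono-≤ (𝟙-nonneg (heavy m c)) 0≤1 (𝟙≤1 (heavy m c)) (𝟙≤1 (L b c))) (≤-reflexive (*-identityˡ 1ℚ)))
                       (≤-reflexive (*-comm N 1ℚ))))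
              (by-diff (N * (ε * size m)) (*-nonneg N≥0 (*-nonneg ε≥0 (size≥0 m))) refl)
      ... | no ¬s = begin
        ∑ (λ b → 𝟙 (κ b == m) * ∑ λ c → 𝟙 (heavy m c) * 𝟙 (L b c))
          ≡⟨ trans (∑-cong λ b → ∑-*ˡ _ _) (∑-swap _) ⟩
        ∑ (λ c → ∑ λ b → 𝟙 (κ b == m) * (𝟙 (heavy m c) * 𝟙 (L b c)))
          ≤⟨ ∑-≤-const (ε * size m) (λ c → column c (heavy m c) refl) ⟩
        N * (ε * size m)
          ≤⟨ by-diff _ (∑-nonneg λ b → *-nonneg (𝟙-nonneg (κ b == m)) (*-nonneg ≤-refl N≥0)) (+-comm _ _) ⟩
        ∑ (λ b → 𝟙 (κ b == m) * (0ℚ * N)) + N * (ε * size m) ∎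
        where
        column : ∀ c h → heavy m c ≡ h → ∑ (λ b → 𝟙 (κ b == m) * (𝟙 h * 𝟙 (L b c))) ≤ ε * size m
        column c true eq = ≤-trans (≤-reflexive (∑-cong λ b → *-right (trans (*-identityˡ _) (cong 𝟙 (L-sym b c)))))
                             (<⇒≤ (≰⇒> λ h → ¬s (c , eq , h)))
        column c false eq = ≤-trans (≤-reflexive (trans (∑-cong λ b → trans (*-right (zeroˡ _)) (zeroʳ _)) (∑-0 n)))
                              (*-nonneg ε≥0 (size≥0 m))
      sizes : ∑ size ≡ N
      sizes = trans (sym (trans (∑-by-class κ (λ _ _ → 1ℚ)) (∑-cong λ m → ∑-cong λ b → *-identityʳ _)))
                    (trans (∑-const n 1ℚ) (*-identityʳ N))
      heavy-loss : ∑ (λ b → ∑ λ c → 𝟙 (heavy (κ b) c) * 𝟙 (L b c)) ≤ N * (ε * N) + N * (ε * N)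
      heavy-loss = begin
        ∑ (λ b → ∑ λ c → 𝟙 (heavy (κ b) c) * 𝟙 (L b c))
          ≡⟨ ∑-by-class κ (λ m b → ∑ λ c → 𝟙 (heavy m c) * 𝟙 (L b c)) ⟩
        ∑ (λ m → ∑ (λ b → 𝟙 (κ b == m) * ∑ λ c → 𝟙 (heavy m c) * 𝟙 (L b c)))
          ≤⟨ ∑-mono class ⟩
        ∑ (λ m → ∑ (λ b → 𝟙 (κ b == m) * (𝟙 (active m) * N)) + N * (ε * size m))
          ≡⟨ trans (∑-+ _ _) (cong₂ _+_ (sym (∑-by-class κ λ m _ → 𝟙 (active m) * N))
               (trans (sym (∑-*ˡ N _)) (*-right (trans (sym (∑-*ˡ ε _)) (*-right sizes))))) ⟩
        ∑ (λ b → 𝟙 (active (κ b)) * N) + N * (ε * N)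
          ≡⟨ +-left (sym (∑-*ʳ N _)) ⟩
        activity * N + N * (ε * N)
          ≤⟨ +-mono-≤ (≤-trans (*-mono-≤ʳ N N≥0 small) (≤-reflexive (*-comm _ N))) ≤-refl ⟩
        N * (ε * N) + N * (ε * N) ∎

  record Family (M : ℕ) (bound : ℚ) : Set where
    field
      κ      : Fin n → Fin M
      U      : Fin M → Fin n → Bool
      sparse : ∀ m → ∑ (λ c → ∑ λ d → 𝟙 (U m c ∧ (U m d ∧ L c d))) ≤ N * (ε * N)
      covers : ∑ (λ b → ∑ λ c → 𝟙 (L b c ∧ not (U (κ b) c))) ≤ bound

  private
    2εN² = N * (ε * N) + N * (ε * N)
    τ = ε * (ε * N) * (ε * N)

  -- The number of classes doubles in each round, and a round loses at most `ζ` per class. The power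
  -- `4 ^ R` is a generous bound for the resulting geometric sum that fits the recursion.
  Outcome : ℕ → ∀ {M} → (Fin n → Fin M) → (Fin M → Fin n → Bool) → Set
  Outcome R {M} κ C = ∃ λ M′ → M′ ℕ.≤ M ℕ.* 2 ℕ.^ R × Family M′ (Λ κ C + fromℕ (M ℕ.* 4 ℕ.^ R) * ζ + 2εN²)

  stop : ∀ R {M} (κ : Fin n → Fin M) (C : Fin M → Fin n → Bool) → State.activity κ C ≤ ε * N → Outcome R κ C
  stop R {M} κ C inactive = M , ℕ.≤-trans (ℕ.≤-reflexive (sym (ℕ.*-identityʳ M))) (ℕ.*-monoʳ-≤ M (ℕ.m^n>0 2 R)) , record
    { κ = κ ; U = State.light κ C ; sparse = State.light-sparse κ C
    ; covers = ≤-trans (State.light-loss κ C inactive) (+-mono-≤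
        (by-diff (fromℕ (M ℕ.* 4 ℕ.^ R) * ζ) (*-nonneg (fromℕ-nonneg _) ζ≥0) refl) ≤-refl) }

  decrease : ∀ {M} (κ : Fin n → Fin M) (C : Fin M → Fin n → Bool) → ¬ (State.activity κ C ≤ ε * N) →
             Ψ (State.κ′ κ C) (State.C′ κ C) + τ ≤ Ψ κ C
  decrease κ C active = ≤-trans (+-mono-≤ ≤-refl (*-mono-≤ʳ (ε * N) (*-nonneg ε≥0 N≥0) (*-mono-≤ˡ ε ε≥0 (<⇒≤ (≰⇒> active)))))
                                (State.potential-drop κ C)

  exhausted : ∀ {M} (κ : Fin n → Fin M) (C : Fin M → Fin n → Bool) → ¬ (State.activity κ C ≤ ε * N) → ¬ (Ψ κ C ≤ fromℕ 0 * τ)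
  exhausted κ C active le = <-irrefl refl (<-≤-trans (*-pos (*-pos ε>0 (*-pos ε>0 n>0)) (*-pos ε>0 n>0)) (begin
    τ            ≤⟨ by-diff Ψ′ (∑-nonneg λ b → ∑-nonneg λ c → 𝟙-nonneg (State.C′ κ C (State.κ′ κ C b) c)) (+-comm τ Ψ′) ⟩
    Ψ′ + τ       ≤⟨ decrease κ C active ⟩
    Ψ κ C        ≤⟨ le ⟩
    fromℕ 0 * τ  ≡⟨ trans (*-left fromℕ-0) (zeroˡ τ) ⟩
    0ℚ           ∎))
    where open ≤-Reasoning
          Ψ′ = Ψ (State.κ′ κ C) (State.C′ κ C)

  potential-left : ∀ R {M} (κ : Fin n → Fin M) (C : Fin M → Fin n → Bool) → ¬ (State.activity κ C ≤ ε * N) →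
                   Ψ κ C ≤ fromℕ (suc R) * τ → Ψ (State.κ′ κ C) (State.C′ κ C) ≤ fromℕ R * τ
  potential-left R κ C active le = cancel (begin
    Ψ (State.κ′ κ C) (State.C′ κ C) + τ  ≤⟨ decrease κ C active ⟩
    Ψ κ C                                ≤⟨ le ⟩
    fromℕ (suc R) * τ                    ≡⟨ trans (*-left (fromℕ-suc R)) (solve 2 (λ R t → (con 1ℚ :+ R) :* t := R :* t :+ t) refl (fromℕ R) τ) ⟩
    fromℕ R * τ + τ                      ∎)
    where
    open ≤-Reasoning
    cancel : ∀ {x y z} → x + z ≤ y + z → x ≤ y
    cancel {x} {y} {z} le = by-diff (y + z - (x + z)) (diff le) (solve 3 (λ x y z → x :+ (y :+ z :- (x :+ z)) := y) refl x y z)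

  counting : ∀ R M → M ℕ.+ M ℕ.* 2 ℕ.* 4 ℕ.^ R ℕ.≤ M ℕ.* 4 ℕ.^ suc R
  counting R M = begin
    M ℕ.+ M ℕ.* 2 ℕ.* P        ≡⟨ cong₂ ℕ._+_ (ℕ.*-identityʳ M) (sym (ℕ.*-assoc M 2 P)) ⟨
    M ℕ.* 1 ℕ.+ M ℕ.* (2 ℕ.* P) ≡⟨ ℕ.*-distribˡ-+ M 1 (2 ℕ.* P) ⟨
    M ℕ.* (1 ℕ.+ 2 ℕ.* P)      ≤⟨ ℕ.*-monoʳ-≤ M (ℕ.+-monoˡ-≤ (2 ℕ.* P) (ℕ.≤-trans (ℕ.m^n>0 4 R) (ℕ.m≤n*m P 2))) ⟩
    M ℕ.* (2 ℕ.* P ℕ.+ 2 ℕ.* P) ≡⟨ cong (M ℕ.*_) (ℕ.*-distribʳ-+ P 2 2) ⟨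
    M ℕ.* (4 ℕ.* P)            ∎
    where open ℕ.≤-Reasoning
          P = 4 ℕ.^ R

  carry : ∀ R {M} (κ : Fin n → Fin M) (C : Fin M → Fin n → Bool) → Outcome R (State.κ′ κ C) (State.C′ κ C) → Outcome (suc R) κ C
  carry R {M} κ C (M′ , M′≤ , F) = M′ , ℕ.≤-trans M′≤ (ℕ.≤-reflexive (ℕ.*-assoc M 2 (2 ℕ.^ R))) , record
    { κ = Family.κ F ; U = Family.U F ; sparse = Family.sparse F
    ; covers = ≤-trans (Family.covers F) (+-mono-≤ (begin
        Λ (State.κ′ κ C) (State.C′ κ C) + fromℕ Q * ζ  ≤⟨ +-mono-≤ (State.loss κ C) ≤-refl ⟩
        Λ κ C + fromℕ M * ζ + fromℕ Q * ζ              ≡⟨ solve 4 (λ a x y z → a :+ x :* z :+ y :* z := a :+ (x :+ y) :* z) refl (Λ κ C) (fromℕ M) (fromℕ Q) ζ ⟩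
        Λ κ C + (fromℕ M + fromℕ Q) * ζ                ≡⟨ +-right (*-left (fromℕ-+ M Q)) ⟨
        Λ κ C + fromℕ (M ℕ.+ Q) * ζ                    ≤⟨ +-mono-≤ ≤-refl (*-mono-≤ʳ ζ ζ≥0 (fromℕ-mono (counting R M))) ⟩
        Λ κ C + fromℕ (M ℕ.* 4 ℕ.^ suc R) * ζ          ∎) ≤-refl) }
    where open ≤-Reasoning
          Q = M ℕ.* 2 ℕ.* 4 ℕ.^ R

  iterate : ∀ R {M} (κ : Fin n → Fin M) (C : Fin M → Fin n → Bool) → Ψ κ C ≤ fromℕ R * τ → Outcome R κ C
  iterate R κ C Ψ≤ = by-activity R Ψ≤ (State.activity κ C ≤? ε * N)
    where
    by-activity : ∀ R → Ψ κ C ≤ fromℕ R * τ → Dec (State.activity κ C ≤ ε * N) → Outcome R κ C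
    by-activity R       Ψ≤ (yes inactive) = stop R κ C inactive
    by-activity zero    Ψ≤ (no active)    = ⊥-elim (exhausted κ C active Ψ≤)
    by-activity (suc R) Ψ≤ (no active)    =
      carry R κ C (iterate R (State.κ′ κ C) (State.C′ κ C) (potential-left R κ C active Ψ≤))

  -- The potential starts at N² and drops by at least ε³ N² in each round, so R ≥ 1 / ε³ rounds
  -- suffice, whatever N is.
  containers : ∀ R → 1ℚ ≤ fromℕ R * (ε * (ε * ε)) → Family (2 ℕ.^ R) (fromℕ (4 ℕ.^ R) * ζ + 2εN²)
  containers R large = finish (iterate R {1} (λ _ → zero) (λ _ _ → true) initial)
    where
    open ≤-Reasoning
    initial : Ψ {1} (λ _ → zero) (λ _ _ → true) ≤ fromℕ R * τ
    initial = begin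
      ∑ (λ (b : Fin n) → ∑ {n} (λ c → 1ℚ))   ≡⟨ trans (∑-cong λ b → ∑-const n 1ℚ) (∑-const n (N * 1ℚ)) ⟩
      N * (N * 1ℚ)                           ≡⟨ solve 1 (λ N → N :* (N :* con 1ℚ) := N :* N :* con 1ℚ) refl N ⟩
      N * N * 1ℚ                             ≤⟨ *-mono-≤ˡ (N * N) (square-nonneg N) large ⟩
      N * N * (fromℕ R * (ε * (ε * ε)))      ≡⟨ solve 3 (λ N R e → N :* N :* (R :* (e :* (e :* e))) := R :* (e :* (e :* N) :* (e :* N))) refl N (fromℕ R) ε ⟩
      fromℕ R * τ                            ∎
    finish : Outcome R {1} (λ _ → zero) (λ _ _ → true) → Family (2 ℕ.^ R) (fromℕ (4 ℕ.^ R) * ζ + 2εN²)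
    finish (M′ , M′≤ , F) = record
      { κ = λ b → Fin.inject≤ (F.κ b) M′≤2^R
      ; U = extend
      ; sparse = extend-sparse
      ; covers = ≤-trans (≤-reflexive (∑-cong λ b → ∑-cong λ c → cong (λ z → 𝟙 (L b c ∧ not z)) (extend-inject (F.κ b) c)))
          (≤-trans F.covers (≤-reflexive (+-left (trans (cong₂ _+_ Λ≡0 (cong (λ z → fromℕ z * ζ) (ℕ.*-identityˡ (4 ℕ.^ R)))) (+-identityˡ _))))) }
      where
      module F = Family F
      M′≤2^R : M′ ℕ.≤ 2 ℕ.^ R
      M′≤2^R = ℕ.≤-trans M′≤ (ℕ.≤-reflexive (ℕ.*-identityˡ (2 ℕ.^ R)))
      -- Padding with empty containers gives exactly `2 ^ R` classes, the same number for the links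
      -- of all vertices.
      extend : Fin (2 ℕ.^ R) → Fin n → Bool
      extend m with Fin.toℕ m ℕ.<? M′
      ... | yes lt = F.U (Fin.fromℕ< lt)
      ... | no _   = λ _ → false
      extend-inject : ∀ m c → extend (Fin.inject≤ m M′≤2^R) c ≡ F.U m c
      extend-inject m c with Fin.toℕ (Fin.inject≤ m M′≤2^R) ℕ.<? M′
      ... | yes lt = cong (λ m → F.U m c) (Fin.toℕ-injective (trans (Fin.toℕ-fromℕ< lt) (Fin.toℕ-inject≤ m M′≤2^R)))
      ... | no ¬lt = ⊥-elim (¬lt (subst (ℕ._< M′) (sym (Fin.toℕ-inject≤ m M′≤2^R)) (Fin.toℕ<n m)))
      extend-sparse : ∀ m → ∑ (λ c → ∑ λ d → 𝟙 (extend m c ∧ (extend m d ∧ L c d))) ≤ N * (ε * N)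
      extend-sparse m with Fin.toℕ m ℕ.<? M′
      ... | yes lt = F.sparse (Fin.fromℕ< lt)
      ... | no _   = ≤-trans (≤-reflexive (trans (∑-cong λ b → ∑-0 n) (∑-0 n))) (*-nonneg N≥0 (*-nonneg ε≥0 N≥0))
      Λ≡0 : Λ {1} (λ _ → zero) (λ _ _ → true) ≡ 0ℚ
      Λ≡0 = trans (∑-cong λ b → trans (∑-cong λ c → cong 𝟙 (Bool.∧-zeroʳ (L b c))) (∑-0 n)) (∑-0 n)

-- Regular partitions

module Cells {n N : ℕ} (χ : Fin n → Fin N) where

  size : Fin n → ℚ
  size a = ∑ λ b → 𝟙 (χ a == χ b)

  size-≥1 : ∀ a → 1ℚ ≤ size a
  size-≥1 a = ≤-trans (≤-reflexive (cong 𝟙 (sym (==-refl (χ a))))) (∑-member (λ b → 𝟙 (χ a == χ b)) (λ b → 𝟙-nonneg (χ a == χ b)) a)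

  size-pos : ∀ a → 0ℚ < size a
  size-pos a = <-≤-trans (ℚ.positive⁻¹ 1ℚ) (size-≥1 a)

  opaque
    1/size : Fin n → ℚ
    1/size a = proj₁ (*-inverse (size a) (size-pos a))

    size*1/size : ∀ a → size a * 1/size a ≡ 1ℚ
    size*1/size a = proj₂ (*-inverse (size a) (size-pos a))

  1/size-pos : ∀ a → 0ℚ ≤ 1/size a
  1/size-pos a = *-cancel-≤ (size a) (size-pos a) (≤-trans (≤-reflexive (zeroʳ (size a))) (≤-trans 0≤1 (≤-reflexive (sym (size*1/size a)))))

  size-cong : ∀ {a b} → χ a ≡ χ b → size a ≡ size b
  size-cong eq = ∑-cong λ c → cong (λ z → 𝟙 (z == χ c)) eq

  1/size-cong : ∀ {a b} → χ a ≡ χ b → 1/size a ≡ 1/size b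
  1/size-cong {a} {b} eq = begin
    1/size a                        ≡⟨ *-identityˡ _ ⟨
    1ℚ * 1/size a                   ≡⟨ *-left (sym (size*1/size b)) ⟩
    size b * 1/size b * 1/size a    ≡⟨ solve 3 (λ s x y → s :* x :* y := s :* y :* x) refl (size b) (1/size b) (1/size a) ⟩
    size b * 1/size a * 1/size b    ≡⟨ *-left (trans (*-left (sym (size-cong eq))) (size*1/size a)) ⟩
    1ℚ * 1/size b                   ≡⟨ *-identityˡ _ ⟩
    1/size b                        ∎
    where open ≡-Reasoning

  -- The uniform distribution on the cell of a. Cells are represented by their vertices, so an empty
  -- cell never has to be normalised.
  K : Fin n → Fin n → ℚ
  K a b = 𝟙 (χ a == χ b) * 1/size a

  K-prob : ∀ a → Prob (K a)
  K-prob a = record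
    { nonneg = λ b → *-nonneg (𝟙-nonneg (χ a == χ b)) (1/size-pos a)
    ; total  = trans (sym (∑-*ʳ (1/size a) _)) (size*1/size a) }

  K-cong : ∀ {a b} → χ a ≡ χ b → ∀ c → K a c ≡ K b c
  K-cong eq c = cong₂ _*_ (cong (λ z → 𝟙 (z == χ c)) eq) (1/size-cong eq)

  K-sym : ∀ a b → K a b ≡ K b a
  K-sym a b with χ a Fin.≟ χ b
  ... | yes eq = trans (*-left (cong 𝟙 (sym (trans (cong (_== χ a) (sym eq)) (==-refl (χ a)))))) (*-right (1/size-cong eq))
  ... | no ne = trans (zeroˡ _) (sym (trans (*-left (cong 𝟙 (==-≢ (ne ∘ sym)))) (zeroˡ _)))

  𝔼-on-cell : ∀ a {f g : Fin n → ℚ} → (∀ b → χ a ≡ χ b → f b ≡ g b) → 𝔼 (K a) f ≡ 𝔼 (K a) g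
  𝔼-on-cell a {f} {g} eq = trans (𝔼-def (K a) f) (trans (∑-cong on) (sym (𝔼-def (K a) g)))
    where
    on : ∀ b → K a b * f b ≡ K a b * g b
    on b with χ a Fin.≟ χ b
    ... | yes e = *-right (eq b e)
    ... | no _  = trans (*-left (zeroˡ (1/size a))) (trans (zeroˡ (f b)) (sym (trans (*-left (zeroˡ (1/size a))) (zeroˡ (g b)))))

  𝔼-K-cong : ∀ {a b} → χ a ≡ χ b → ∀ f → 𝔼 (K a) f ≡ 𝔼 (K b) f
  𝔼-K-cong {a} {b} eq f = trans (𝔼-def (K a) f) (trans (∑-cong λ c → *-left (K-cong eq c)) (sym (𝔼-def (K b) f)))

  𝔼-K-fix : ∀ a (g : Fin n → ℚ) → (∀ b → χ a ≡ χ b → g b ≡ g a) → 𝔼 (K a) g ≡ g a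
  𝔼-K-fix a g eq = trans (𝔼-on-cell a eq) (𝔼-const (K-prob a) (g a))

  K-adjoint : (g h : Fin n → ℚ) → ∑ (λ a → 𝔼 (K a) g * h a) ≡ ∑ λ a → g a * 𝔼 (K a) h
  K-adjoint g h = begin
    ∑ (λ a → 𝔼 (K a) g * h a)            ≡⟨ ∑-cong (λ a → trans (*-left (𝔼-def (K a) g)) (∑-*ʳ (h a) _)) ⟩
    ∑ (λ a → ∑ λ b → K a b * g b * h a)  ≡⟨ ∑-swap _ ⟩
    ∑ (λ b → ∑ λ a → K a b * g b * h a)  ≡⟨ ∑-cong (λ b → trans (∑-cong λ a → trans (*-left (*-left (K-sym a b)))
                                              (solve 3 (λ k g h → k :* g :* h := g :* (k :* h)) refl (K b a) (g b) (h a))) (sym (∑-*ˡ (g b) _))) ⟩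
    ∑ (λ b → g b * ∑ λ a → K b a * h a)  ≡⟨ ∑-cong (λ b → *-right (sym (𝔼-def (K b) h))) ⟩
    ∑ (λ b → g b * 𝔼 (K b) h)            ∎
    where open ≡-Reasoning

  -- Conditional expectation with respect to pairs of cells. By the lemmas that follow it is the
  -- orthogonal projection onto the functions that are constant on pairs of cells.
  P : (Fin n → Fin n → ℚ) → Fin n → Fin n → ℚ
  P g a c = 𝔼 (K a) λ a′ → 𝔼 (K c) λ c′ → g a′ c′

  P-adjoint : ∀ g h → ∑ (λ a → ∑ λ c → P g a c * h a c) ≡ ∑ λ a → ∑ λ c → g a c * P h a c
  P-adjoint g h = begin
    ∑ (λ a → ∑ λ c → P g a c * h a c)
      ≡⟨ ∑-swap _ ⟩
    ∑ (λ c → ∑ λ a → P g a c * h a c)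
      ≡⟨ ∑-cong (λ c → K-adjoint (λ a → 𝔼 (K c) (g a)) (λ a → h a c)) ⟩
    ∑ (λ c → ∑ λ a → 𝔼 (K c) (g a) * 𝔼 (K a) λ a′ → h a′ c)
      ≡⟨ ∑-swap _ ⟩
    ∑ (λ a → ∑ λ c → 𝔼 (K c) (g a) * 𝔼 (K a) λ a′ → h a′ c)
      ≡⟨ ∑-cong (λ a → K-adjoint (g a) (λ c → 𝔼 (K a) λ a′ → h a′ c)) ⟩
    ∑ (λ a → ∑ λ c → g a c * 𝔼 (K c) λ c′ → 𝔼 (K a) λ a′ → h a′ c′)
      ≡⟨ ∑-cong (λ a → ∑-cong λ c → *-right (𝔼-swap (K c) (K a) _)) ⟩
    ∑ (λ a → ∑ λ c → g a c * P h a c) ∎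
    where open ≡-Reasoning

  Measurable : (Fin n → Fin n → ℚ) → Set
  Measurable h = ∀ {a a′ c c′} → χ a ≡ χ a′ → χ c ≡ χ c′ → h a c ≡ h a′ c′

  P-fix : ∀ {h} → Measurable h → ∀ a c → P h a c ≡ h a c
  P-fix {h} mh a c = trans (𝔼-K-fix a _ λ b e → 𝔼-on-cell c λ d _ → mh (sym e) refl)
                           (𝔼-K-fix c (h a) λ d e → mh refl (sym e))

  P-measurable : ∀ g → Measurable (P g)
  P-measurable g {a} {a′} {c} {c′} ea ec = trans (𝔼-K-cong ea _) (𝔼-cong (K a′) λ b → 𝔼-K-cong ec (g b))

  P-sum : ∀ g → ∑ (λ a → ∑ (P g a)) ≡ ∑ λ a → ∑ (g a)
  P-sum g = trans (∑-cong λ a → ∑-cong λ c → sym (*-identityʳ (P g a c)))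
    (trans (P-adjoint g (λ _ _ → 1ℚ)) (∑-cong λ a → ∑-cong λ c → trans (*-right (P-fix {λ _ _ → 1ℚ} (λ _ _ → refl) a c)) (*-identityʳ (g a c))))

⟨_,_⟩ : (Fin n → Fin n → ℚ) → (Fin n → Fin n → ℚ) → ℚ
⟨ g , h ⟩ = ∑ λ a → ∑ λ c → g a c * h a c

⟨⟩-comm : (g h : Fin n → Fin n → ℚ) → ⟨ g , h ⟩ ≡ ⟨ h , g ⟩
⟨⟩-comm g h = ∑-cong λ a → ∑-cong λ c → *-comm (g a c) (h a c)

⟨⟩-cong : {g g′ h h′ : Fin n → Fin n → ℚ} → (∀ a c → g a c ≡ g′ a c) → (∀ a c → h a c ≡ h′ a c) → ⟨ g , h ⟩ ≡ ⟨ g′ , h′ ⟩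
⟨⟩-cong eg eh = ∑-cong λ a → ∑-cong λ c → cong₂ _*_ (eg a c) (eh a c)

⟨⟩--ˡ : (g g′ h : Fin n → Fin n → ℚ) → ⟨ (λ a c → g a c - g′ a c) , h ⟩ ≡ ⟨ g , h ⟩ - ⟨ g′ , h ⟩
⟨⟩--ˡ g g′ h = trans (∑-cong λ a → trans (∑-cong λ c → solve 3 (λ x y z → (x :- y) :* z := x :* z :- y :* z) refl (g a c) (g′ a c) (h a c))
  (∑-- _ _)) (∑-- _ _)

module _ {n N N′ : ℕ} (χ : Fin n → Fin N) (χ′ : Fin n → Fin N′) (refines : ∀ {a b} → χ′ a ≡ χ′ b → χ a ≡ χ b) where
  private
    module X = Cells χ
    module Y = Cells χ′

  -- The difference of the two sides is the squared norm of `Y.P f - X.P f - t * g`, by Pythagoras.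
  -- Leaving `t` free takes the place of the Cauchy-Schwarz inequality and avoids dividing by the
  -- norm of `g`.
  energy-increment : ∀ f {g} → Y.Measurable g → ∀ t →
    t * ⟨ (λ a c → f a c - X.P f a c) , g ⟩ + t * ⟨ (λ a c → f a c - X.P f a c) , g ⟩ - t * t * ⟨ g , g ⟩ + ⟨ f , X.P f ⟩ ≤ ⟨ f , Y.P f ⟩
  energy-increment f {g} mg t = by-diff (⟨ e , e ⟩)
    (∑-nonneg λ a → ∑-nonneg λ c → square-nonneg (e a c)) (begin
      t * F + t * F - t * t * ⟨ g , g ⟩ + ⟨ f , X.P f ⟩ + ⟨ e , e ⟩
        ≡⟨ +-right expand ⟩
      t * F + t * F - t * t * ⟨ g , g ⟩ + ⟨ f , X.P f ⟩ + (⟨ h , h ⟩ - (t * ⟨ h , g ⟩ + t * ⟨ h , g ⟩) + t * t * ⟨ g , g ⟩)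
        ≡⟨ cong₂ (λ u v → t * F + t * F - t * t * ⟨ g , g ⟩ + ⟨ f , X.P f ⟩ + (u - (t * v + t * v) + t * t * ⟨ g , g ⟩)) pythagoras same ⟩
      t * F + t * F - t * t * ⟨ g , g ⟩ + ⟨ f , X.P f ⟩ + (⟨ f , Y.P f ⟩ - ⟨ f , X.P f ⟩ - (t * F + t * F) + t * t * ⟨ g , g ⟩)
        ≡⟨ solve 5 (λ t F G p q → t :* F :+ t :* F :- t :* t :* G :+ p :+ (q :- p :- (t :* F :+ t :* F) :+ t :* t :* G) := q)
             refl t F (⟨ g , g ⟩) (⟨ f , X.P f ⟩) (⟨ f , Y.P f ⟩) ⟩
      ⟨ f , Y.P f ⟩ ∎)
    where
    open ≡-Reasoning
    F = ⟨ (λ a c → f a c - X.P f a c) , g ⟩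
    h e : Fin n → Fin n → ℚ
    h a c = Y.P f a c - X.P f a c
    e a c = h a c - t * g a c
    expand : ⟨ e , e ⟩ ≡ ⟨ h , h ⟩ - (t * ⟨ h , g ⟩ + t * ⟨ h , g ⟩) + t * t * ⟨ g , g ⟩
    expand = begin
      ⟨ e , e ⟩
        ≡⟨ ∑-cong (λ a → trans (∑-cong λ c → solve 3 (λ h t g → (h :- t :* g) :* (h :- t :* g) := h :* h :- (t :+ t) :* (h :* g) :+ t :* t :* (g :* g)) refl (h a c) t (g a c))
             (trans (∑-+ _ _) (cong₂ _+_ (trans (∑-- _ _) (cong (λ z → ∑ (λ c → h a c * h a c) - z) (sym (∑-*ˡ (t + t) _)))) (sym (∑-*ˡ (t * t) _))))) ⟩
      ∑ (λ a → ∑ (λ c → h a c * h a c) - (t + t) * ∑ (λ c → h a c * g a c) + t * t * ∑ (λ c → g a c * g a c))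
        ≡⟨ trans (∑-+ _ _) (cong₂ _+_ (trans (∑-- _ _) (cong (λ z → ⟨ h , h ⟩ - z) (sym (∑-*ˡ (t + t) _)))) (sym (∑-*ˡ (t * t) _))) ⟩
      ⟨ h , h ⟩ - (t + t) * ⟨ h , g ⟩ + t * t * ⟨ g , g ⟩
        ≡⟨ +-left (cong (λ z → ⟨ h , h ⟩ - z) (distribʳ ⟨ h , g ⟩ t t)) ⟩
      ⟨ h , h ⟩ - (t * ⟨ h , g ⟩ + t * ⟨ h , g ⟩) + t * t * ⟨ g , g ⟩ ∎
    same : ⟨ h , g ⟩ ≡ F
    same = begin
      ⟨ h , g ⟩                        ≡⟨ ⟨⟩--ˡ (Y.P f) (X.P f) g ⟩
      ⟨ Y.P f , g ⟩ - ⟨ X.P f , g ⟩    ≡⟨ +-left (trans (Y.P-adjoint f g) (⟨⟩-cong (λ _ _ → refl) (Y.P-fix {g} mg))) ⟩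
      ⟨ f , g ⟩ - ⟨ X.P f , g ⟩        ≡⟨ ⟨⟩--ˡ f (X.P f) g ⟨
      F                                ∎
    coarse : Y.Measurable (X.P f)
    coarse ea ec = X.P-measurable f (refines ea) (refines ec)
    YY : ⟨ Y.P f , Y.P f ⟩ ≡ ⟨ f , Y.P f ⟩
    YY = trans (Y.P-adjoint f (Y.P f)) (⟨⟩-cong (λ _ _ → refl) (Y.P-fix {Y.P f} (Y.P-measurable f)))
    YX : ⟨ Y.P f , X.P f ⟩ ≡ ⟨ f , X.P f ⟩
    YX = trans (Y.P-adjoint f (X.P f)) (⟨⟩-cong (λ _ _ → refl) (Y.P-fix {X.P f} coarse))
    XX : ⟨ X.P f , X.P f ⟩ ≡ ⟨ f , X.P f ⟩
    XX = trans (X.P-adjoint f (X.P f)) (⟨⟩-cong (λ _ _ → refl) (X.P-fix {X.P f} (X.P-measurable f)))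
    pythagoras : ⟨ h , h ⟩ ≡ ⟨ f , Y.P f ⟩ - ⟨ f , X.P f ⟩
    pythagoras = begin
      ⟨ h , h ⟩
        ≡⟨ ⟨⟩--ˡ (Y.P f) (X.P f) h ⟩
      ⟨ Y.P f , h ⟩ - ⟨ X.P f , h ⟩
        ≡⟨ cong₂ _-_ (trans (⟨⟩-comm (Y.P f) h) (⟨⟩--ˡ (Y.P f) (X.P f) (Y.P f))) (trans (⟨⟩-comm (X.P f) h) (⟨⟩--ˡ (Y.P f) (X.P f) (X.P f))) ⟩
      ⟨ Y.P f , Y.P f ⟩ - ⟨ X.P f , Y.P f ⟩ - (⟨ Y.P f , X.P f ⟩ - ⟨ X.P f , X.P f ⟩)
        ≡⟨ cong₂ _-_ (cong₂ _-_ YY (trans (⟨⟩-comm (X.P f) (Y.P f)) YX)) (cong₂ _-_ YX XX) ⟩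
      ⟨ f , Y.P f ⟩ - ⟨ f , X.P f ⟩ - (⟨ f , X.P f ⟩ - ⟨ f , X.P f ⟩)
        ≡⟨ solve 2 (λ q p → q :- p :- (p :- p) := q :- p) refl (⟨ f , Y.P f ⟩) (⟨ f , X.P f ⟩) ⟩
      ⟨ f , Y.P f ⟩ - ⟨ f , X.P f ⟩ ∎

-- Regularity of a pair speaks of all vertex subsets and is decided here only under double negation.
-- Finitely many such decisions combine, and this suffices because the partition serves to derive a
-- contradiction.
¬¬-∀ : ∀ {N} {P : Fin N → Set} → (∀ i → ¬ ¬ P i) → ¬ ¬ (∀ i → P i)
¬¬-∀ {zero}  h k = k λ ()
¬¬-∀ {suc N} h k = h zero λ p₀ → ¬¬-∀ (h ∘ suc) λ p → k λ { zero → p₀ ; (suc i) → p i }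

-- Each cell is paired with N cells as a row and with N cells as a column, so it is cut by at most N
-- sets `s` and N sets `t`.
refinedCount : ℕ → ℕ
refinedCount N = N ℕ.* (2 ℕ.^ N ℕ.* 2 ℕ.^ N)

refinedCount-≥ : ∀ N → N ℕ.≤ refinedCount N
refinedCount-≥ N = ℕ.≤-trans (ℕ.≤-reflexive (sym (ℕ.*-identityʳ N)))
  (ℕ.*-monoʳ-≤ N (ℕ.*-mono-≤ (ℕ.m^n>0 2 N) (ℕ.m^n>0 2 N)))

cellBound : ℕ → ℕ → ℕ
cellBound zero    N = N
cellBound (suc R) N = cellBound R (refinedCount N)

cellBound-≥ : ∀ R N → N ℕ.≤ cellBound R N
cellBound-≥ zero    N = ℕ.≤-refl
cellBound-≥ (suc R) N = ℕ.≤-trans (refinedCount-≥ N) (cellBound-≥ R (refinedCount N))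

toBit : Bool → Fin 2
toBit true  = suc zero
toBit false = zero

toBit-injective : ∀ {x y} → toBit x ≡ toBit y → x ≡ y
toBit-injective {true}  {true}  _ = refl
toBit-injective {false} {false} _ = refl

module Regularity {n I : ℕ} (f : Fin I → Fin n → Fin n → Bool) {δ ε : ℚ} (δ>0 : 0ℚ < δ) (ε>0 : 0ℚ < ε) (n>0 : 0ℚ < fromℕ n) where

  F : Fin I → Fin n → Fin n → ℚ
  F r a c = 𝟙 (f r a c)

  module _ {N : ℕ} (χ : Fin n → Fin N) where
    open Cells χ

    deviation : Fin I → Fin n → Fin n → (Fin n → Bool) → (Fin n → Bool) → ℚ
    deviation r x y s t = onRectangle (K x) (K y) (F r) s t - onRectangle (K x) (K y) (λ _ _ → density (K x) (K y) (f r)) s t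

    RegularPair : Fin N → Fin N → Set
    RegularPair i j = ∀ x y r → χ x ≡ i → χ y ≡ j → Regular δ (K x) (K y) (f r)

    -- The sign `σ` unifies the two ways of violating regularity; only its square matters for the
    -- norm of the test function.
    record Witness (i j : Fin N) : Set where
      field
        x y   : Fin n
        r     : Fin I
        s t   : Fin n → Bool
        σ     : ℚ
        x∈i   : χ x ≡ i
        y∈j   : χ y ≡ j
        sign  : σ * σ ≡ 1ℚ
        large : δ ≤ σ * deviation r x y s t

    dichotomy : ∀ i j → ¬ ¬ (RegularPair i j ⊎ Witness i j)
    dichotomy i j k = k (inj₁ λ x y r x∈i y∈j → record
      { upper = λ s t → up x y r x∈i y∈j s t (deviation r x y s t ≤? δ)
      ; lower = λ s t → low x y r x∈i y∈j s t (- deviation r x y s t ≤? δ) })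
      where
      up : ∀ x y r → χ x ≡ i → χ y ≡ j → ∀ s t → Dec (deviation r x y s t ≤ δ) →
           onRectangle (K x) (K y) (F r) s t ≤ onRectangle (K x) (K y) (λ _ _ → density (K x) (K y) (f r)) s t + δ
      up x y r x∈i y∈j s t (yes le) = by-diff _ (diff le) (solve 3 (λ u v d → u :+ (d :- (u :- v)) := v :+ d) refl _ _ δ)
      up x y r x∈i y∈j s t (no ¬le) = ⊥-elim (k (inj₂ record
        { x = x ; y = y ; r = r ; s = s ; t = t ; σ = 1ℚ ; x∈i = x∈i ; y∈j = y∈j ; sign = *-identityˡ 1ℚ
        ; large = ≤-trans (<⇒≤ (≰⇒> ¬le)) (≤-reflexive (sym (*-identityˡ _))) }))
      low : ∀ x y r → χ x ≡ i → χ y ≡ j → ∀ s t → Dec (- deviation r x y s t ≤ δ) →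
            onRectangle (K x) (K y) (λ _ _ → density (K x) (K y) (f r)) s t ≤ onRectangle (K x) (K y) (F r) s t + δ
      low x y r x∈i y∈j s t (yes le) = by-diff _ (diff le) (solve 3 (λ u v d → v :+ (d :- (:- (u :- v))) := u :+ d) refl _ _ δ)
      low x y r x∈i y∈j s t (no ¬le) = ⊥-elim (k (inj₂ record
        { x = x ; y = y ; r = r ; s = s ; t = t ; σ = - 1ℚ ; x∈i = x∈i ; y∈j = y∈j
        ; sign = solve 0 (:- con 1ℚ :* :- con 1ℚ := con 1ℚ) refl
        ; large = ≤-trans (<⇒≤ (≰⇒> ¬le)) (≤-reflexive (solve 1 (λ d → :- d := :- con 1ℚ :* d) refl _)) }))

    Verdicts : Set
    Verdicts = ∀ i j → RegularPair i j ⊎ Witness i j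

    verdicts : ¬ ¬ Verdicts
    verdicts = ¬¬-∀ λ i → ¬¬-∀ λ j → dichotomy i j

    rejected : ∀ {i j} → RegularPair i j ⊎ Witness i j → Bool
    rejected (inj₁ _) = false
    rejected (inj₂ _) = true

    accepted : ∀ {i j} (v : RegularPair i j ⊎ Witness i j) → rejected v ≡ false → RegularPair i j
    accepted (inj₁ reg) _ = reg

    irregular : Verdicts → Fin N → Fin N → Bool
    irregular w i j = rejected (w i j)

    energy : ℚ
    energy = ∑ λ r → ⟨ F r , P (F r) ⟩

    energy-≤ : energy ≤ fromℕ I * (fromℕ n * fromℕ n)
    energy-≤ = ∑-≤-const _ λ r → ∑-≤-const (fromℕ n) λ a → ≤-trans
      (∑-≤-const 1ℚ λ c → ≤-trans (*-mono-≤ (𝟙-nonneg (f r a c)) 0≤1 (𝟙≤1 (f r a c)) (density-≤1 (K-prob a) (K-prob c) (f r))) (≤-reflexive (*-identityˡ 1ℚ)))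
      (≤-reflexive (*-identityʳ _))

    module Refine (w : Verdicts) where

      module _ {i j : Fin N} where
        sᵂ tᵂ : RegularPair i j ⊎ Witness i j → Fin n → Bool
        sᵂ (inj₁ _) a = false
        sᵂ (inj₂ W) a = Witness.s W a
        tᵂ (inj₁ _) c = false
        tᵂ (inj₂ W) c = Witness.t W c

        -- The test function for the energy increment: the signed indicator of the witness
        -- rectangle, placed at the single relation that it violates. Since a pair of cells
        -- contributes for one relation only, the norm does not grow with the number of relations.
        gᵂ : RegularPair i j ⊎ Witness i j → Bool → Bool → Fin I → ℚ
        gᵂ (inj₁ _) u v r = 0ℚ
        gᵂ (inj₂ W) u v r = 𝟙 (Witness.r W == r) * (Witness.σ W * (𝟙 u * 𝟙 v))

        gᵂ-square : ∀ d u v → ∑ (λ r → gᵂ d u v r * gᵂ d u v r) ≤ 1ℚ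
        gᵂ-square (inj₁ _) u v = ≤-trans (≤-reflexive (trans (∑-cong λ r → zeroˡ 0ℚ) (∑-0 I))) 0≤1
        gᵂ-square (inj₂ W) u v = begin
          ∑ (λ r → gᵂ (inj₂ W) u v r * gᵂ (inj₂ W) u v r)
            ≡⟨ ∑-cong (λ r → trans (solve 4 (λ e σ u v → (e :* (σ :* (u :* v))) :* (e :* (σ :* (u :* v))) := e :* e :* (σ :* σ :* (u :* u :* (v :* v)))) refl
                 (𝟙 (Witness.r W == r)) (Witness.σ W) (𝟙 u) (𝟙 v))
                 (cong₂ _*_ (𝟙-idem (Witness.r W == r)) (cong₂ _*_ (Witness.sign W) (cong₂ _*_ (𝟙-idem u) (𝟙-idem v))))) ⟩
          ∑ (λ r → 𝟙 (Witness.r W == r) * (1ℚ * (𝟙 u * 𝟙 v)))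
            ≡⟨ ∑-δ (Witness.r W) (λ _ → 1ℚ * (𝟙 u * 𝟙 v)) ⟩
          1ℚ * (𝟙 u * 𝟙 v)
            ≤⟨ *-mono-≤ˡ 1ℚ 0≤1 (*-mono-≤ (𝟙-nonneg u) 0≤1 (𝟙≤1 u) (𝟙≤1 v)) ⟩
          1ℚ * (1ℚ * 1ℚ)
            ≡⟨ trans (*-identityˡ _) (*-identityˡ 1ℚ) ⟩
          1ℚ ∎
          where open ≤-Reasoning

      sBit tBit : Fin N → Fin N → Fin n → Bool
      sBit i j = sᵂ (w i j)
      tBit i j = tᵂ (w i j)

      sCode tCode : Fin n → Fin (2 ℕ.^ N)
      sCode a = Fin.funToFin λ j → toBit (sBit (χ a) j a)
      tCode a = Fin.funToFin λ i → toBit (tBit i (χ a) a)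

      χ′ : Fin n → Fin (refinedCount N)
      χ′ a = Fin.combine (χ a) (Fin.combine (sCode a) (tCode a))

      bits : ∀ {g h : Fin N → Bool} → Fin.funToFin (toBit ∘ g) ≡ Fin.funToFin (toBit ∘ h) → ∀ i → g i ≡ h i
      bits {g} {h} eq i = toBit-injective (trans (sym (Fin.finToFun-funToFin (toBit ∘ g) i))
        (trans (cong (λ z → Fin.finToFun z i) eq) (Fin.finToFun-funToFin (toBit ∘ h) i)))

      refines : ∀ {a b} → χ′ a ≡ χ′ b → χ a ≡ χ b
      refines {a} {b} eq = Fin.combine-injectiveˡ (χ a) _ (χ b) _ eq

      codes : ∀ {a b} → χ′ a ≡ χ′ b → sCode a ≡ sCode b × tCode a ≡ tCode b
      codes {a} {b} eq = Fin.combine-injective (sCode a) (tCode a) (sCode b) (tCode b)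
        (Fin.combine-injectiveʳ (χ a) (Fin.combine (sCode a) (tCode a)) (χ b) (Fin.combine (sCode b) (tCode b)) eq)

      s-agree : ∀ {a b} → χ′ a ≡ χ′ b → ∀ j → sBit (χ a) j a ≡ sBit (χ b) j b
      s-agree {a} {b} eq = bits {λ j → sBit (χ a) j a} {λ j → sBit (χ b) j b} (proj₁ (codes {a} {b} eq))

      t-agree : ∀ {a b} → χ′ a ≡ χ′ b → ∀ i → tBit i (χ a) a ≡ tBit i (χ b) b
      t-agree {a} {b} eq = bits {λ i → tBit i (χ a) a} {λ i → tBit i (χ b) b} (proj₂ (codes {a} {b} eq))

      g : Fin I → Fin n → Fin n → ℚ
      g r a c = gᵂ (w (χ a) (χ c)) (sBit (χ a) (χ c) a) (tBit (χ a) (χ c) c) r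

      g-measurable : ∀ r → Cells.Measurable χ′ (g r)
      g-measurable r {a} {a′} {c} {c′} ea ec = trans
        (cong₂ (λ u v → gᵂ (w (χ a) (χ c)) u v r) (s-agree {a} {a′} ea (χ c)) (t-agree {c} {c′} ec (χ a)))
        (cong₂ (λ i j → gᵂ (w i j) (sBit (χ a′) j a′) (tBit i (χ c′) c′) r) (refines ea) (refines ec))

      G : Fin n → Fin n → ℚ
      G a c = ∑ λ r → (F r a c - P (F r) a c) * g r a c

      -- Averaging `G` over an irregular pair of cells returns the signed deviation of its witness,
      -- because `P (F r)` is constant there; on the other pairs `G` vanishes.
      correlated : ∀ a c → δ * 𝟙 (irregular w (χ a) (χ c)) ≤ P G a c
      correlated a c = by-verdict (w (χ a) (χ c)) refl
        where
        by-verdict : ∀ v → w (χ a) (χ c) ≡ v → δ * 𝟙 (irregular w (χ a) (χ c)) ≤ P G a c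
        by-verdict (inj₁ R) eq = ≤-reflexive (trans (*-right (cong 𝟙 regular)) (trans (zeroʳ δ) (sym (trans
            (𝔼-on-cell a λ a′ ea → 𝔼-on-cell c λ c′ ec → vanish a′ c′ ea ec)
            (trans (𝔼-cong (K a) λ _ → 𝔼-const (K-prob c) 0ℚ) (𝔼-const (K-prob a) 0ℚ))))))
          where
          regular : irregular w (χ a) (χ c) ≡ false
          regular = cong rejected eq
          vanish : ∀ a′ c′ → χ a ≡ χ a′ → χ c ≡ χ c′ → G a′ c′ ≡ 0ℚ
          vanish a′ c′ ea ec = trans (∑-cong λ r → trans (*-right (trans
              (cong₂ (λ i j → gᵂ (w i j) (sᵂ (w i j) a′) (tᵂ (w i j) c′) r) (sym ea) (sym ec))
              (cong (λ v → gᵂ v (sᵂ v a′) (tᵂ v c′) r) eq))) (zeroʳ _)) (∑-0 I)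
        by-verdict (inj₂ W) eq = begin
          δ * 𝟙 (irregular w (χ a) (χ c))
            ≤⟨ ≤-trans (*-mono-≤ˡ δ (<⇒≤ δ>0) (𝟙≤1 (irregular w (χ a) (χ c)))) (≤-reflexive (*-identityʳ δ)) ⟩
          δ
            ≤⟨ W.large ⟩
          W.σ * deviation W.r W.x W.y W.s W.t
            ≡⟨ *-right (sym (𝔼𝔼-- (K-prob W.x) (K-prob W.y) _ _)) ⟩
          W.σ * (𝔼 (K W.x) λ a′ → 𝔼 (K W.y) λ c′ → q a′ c′)
            ≡⟨ trans (sym (𝔼-*ˡ (K W.x) W.σ _)) (𝔼-cong (K W.x) λ a′ → sym (𝔼-*ˡ (K W.y) W.σ _)) ⟩
          (𝔼 (K W.x) λ a′ → 𝔼 (K W.y) λ c′ → W.σ * q a′ c′)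
            ≡⟨ trans (𝔼-K-cong W.x∈i _) (𝔼-cong (K a) λ a′ → 𝔼-K-cong W.y∈j _) ⟩
          (𝔼 (K a) λ a′ → 𝔼 (K c) λ c′ → W.σ * q a′ c′)
            ≡⟨ 𝔼-on-cell a (λ a′ ea → 𝔼-on-cell c λ c′ ec → sym (value a′ c′ ea ec)) ⟩
          P G a c ∎
          where
          open ≤-Reasoning
          module W = Witness W
          q : Fin n → Fin n → ℚ
          q a′ c′ = 𝟙 (W.s a′) * 𝟙 (W.t c′) * F W.r a′ c′ - 𝟙 (W.s a′) * 𝟙 (W.t c′) * density (K W.x) (K W.y) (f W.r)
          value : ∀ a′ c′ → χ a ≡ χ a′ → χ c ≡ χ c′ → G a′ c′ ≡ W.σ * q a′ c′
          value a′ c′ ea ec = trans (∑-cong λ r → trans (*-right (trans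
              (cong₂ (λ i j → gᵂ (w i j) (sᵂ (w i j) a′) (tᵂ (w i j) c′) r) (sym ea) (sym ec))
              (cong (λ v → gᵂ v (sᵂ v a′) (tᵂ v c′) r) eq)))
              (solve 3 (λ d e z → d :* (e :* z) := e :* (d :* z)) refl (F r a′ c′ - P (F r) a′ c′) (𝟙 (W.r == r)) (W.σ * (𝟙 (W.s a′) * 𝟙 (W.t c′)))))
            (trans (∑-δ W.r (λ r → (F r a′ c′ - P (F r) a′ c′) * (W.σ * (𝟙 (W.s a′) * 𝟙 (W.t c′)))))
              (trans (*-left (cong (λ z → F W.r a′ c′ - z) (P-measurable (F W.r) (trans (sym ea) (sym W.x∈i)) (trans (sym ec) (sym W.y∈j)))))
                (solve 5 (λ F D σ s t → (F :- D) :* (σ :* (s :* t)) := σ :* (s :* t :* F :- s :* t :* D)) refl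
                  (F W.r a′ c′) (density (K W.x) (K W.y) (f W.r)) W.σ (𝟙 (W.s a′)) (𝟙 (W.t c′)))))

      irregularity : ℚ
      irregularity = ∑ λ a → ∑ λ c → 𝟙 (irregular w (χ a) (χ c))

      correlation : δ * irregularity ≤ ∑ λ r → ⟨ (λ a c → F r a c - P (F r) a c) , g r ⟩
      correlation = begin
        δ * irregularity
          ≡⟨ trans (∑-*ˡ δ _) (∑-cong λ a → ∑-*ˡ δ _) ⟩
        ∑ (λ a → ∑ λ c → δ * 𝟙 (irregular w (χ a) (χ c)))
          ≤⟨ ∑-mono (λ a → ∑-mono λ c → correlated a c) ⟩
        ∑ (λ a → ∑ λ c → P G a c)
          ≡⟨ P-sum G ⟩
        ∑ (λ a → ∑ λ c → G a c)
          ≡⟨ trans (∑-cong λ a → ∑-swap _) (∑-swap _) ⟩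
        ∑ (λ r → ⟨ (λ a c → F r a c - P (F r) a c) , g r ⟩) ∎
        where open ≤-Reasoning

      g-norm : ∑ (λ r → ⟨ g r , g r ⟩) ≤ fromℕ n * fromℕ n
      g-norm = begin
        ∑ (λ r → ⟨ g r , g r ⟩)
          ≡⟨ trans (∑-swap _) (∑-cong λ a → ∑-swap _) ⟩
        ∑ (λ a → ∑ λ c → ∑ λ r → g r a c * g r a c)
          ≤⟨ ∑-≤-const (fromℕ n) (λ a → ≤-trans (∑-≤-const 1ℚ λ c → gᵂ-square (w (χ a) (χ c)) (sBit (χ a) (χ c) a) (tBit (χ a) (χ c) c))
               (≤-reflexive (*-identityʳ (fromℕ n)))) ⟩
        fromℕ n * fromℕ n ∎
        where open ≤-Reasoning

  -- With t = δ ε, the correlation contributes at least 2 t · δ ε n² and the norm of the test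
  -- function costs at most t² n², which leaves a gain of (δ ε)² n².
  increment : ∀ {N} (χ : Fin n → Fin N) (w : Verdicts χ) → let open Refine χ w in
              ε * (fromℕ n * fromℕ n) ≤ irregularity →
              energy χ + δ * ε * (δ * ε) * (fromℕ n * fromℕ n) ≤ energy χ′
  increment {N} χ w irr = begin
    energy χ + t * t * N²
      ≤⟨ by-diff (t * (∑ c - t * N²) + t * (∑ c - t * N²) + t * t * (N² - ∑ k))
           (+-nonneg (+-nonneg (*-nonneg t≥0 (diff corr)) (*-nonneg t≥0 (diff corr))) (*-nonneg (*-nonneg t≥0 t≥0) (diff g-norm)))
           (solve 5 (λ e t N c k → e :+ t :* t :* N :+ (t :* (c :- t :* N) :+ t :* (c :- t :* N) :+ t :* t :* (N :- k)) := (t :+ t) :* c :- t :* t :* k :+ e)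
              refl (energy χ) t N² (∑ c) (∑ k)) ⟩
    (t + t) * ∑ c - t * t * ∑ k + energy χ
      ≡⟨ sym (trans (∑-+ _ _) (+-left (trans (∑-- _ _) (cong₂ _-_ (sym (∑-*ˡ (t + t) c)) (sym (∑-*ˡ (t * t) k)))))) ⟩
    ∑ (λ r → (t + t) * c r - t * t * k r + ⟨ F r , Cells.P χ (F r) ⟩)
      ≤⟨ ∑-mono (λ r → ≤-trans (≤-reflexive (+-left (cong (λ z → z - t * t * k r) (distribʳ (c r) t t))))
           (energy-increment χ χ′ (λ {a} {b} → refines {a} {b}) (F r) {g r} (λ {a} {a′} {c} {c′} → g-measurable r {a} {a′} {c} {c′}) t)) ⟩
    energy χ′ ∎
    where
    open Refine χ w
    open ≤-Reasoning
    t = δ * ε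
    t≥0 : 0ℚ ≤ t
    t≥0 = *-nonneg (<⇒≤ δ>0) (<⇒≤ ε>0)
    N² = fromℕ n * fromℕ n
    c k : Fin I → ℚ
    c r = ⟨ (λ a c → F r a c - Cells.P χ (F r) a c) , g r ⟩
    k r = ⟨ g r , g r ⟩
    corr : t * N² ≤ ∑ c
    corr = ≤-trans (≤-trans (≤-reflexive (*-assoc δ ε N²)) (*-mono-≤ˡ δ (<⇒≤ δ>0) irr)) correlation

  record RegularPartition (bound : ℕ) : Set where
    field
      N      : ℕ
      N≤     : N ℕ.≤ bound
      χ      : Fin n → Fin N
      irr    : Fin N → Fin N → Bool
      few    : ∑ (λ a → ∑ λ c → 𝟙 (irr (χ a) (χ c))) ≤ ε * (fromℕ n * fromℕ n)
      regular : ∀ x y r → irr (χ x) (χ y) ≡ false → Regular δ (Cells.K χ x) (Cells.K χ y) (f r)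

  private
    τ = δ * ε * (δ * ε) * (fromℕ n * fromℕ n)
    τ>0 : 0ℚ < τ
    τ>0 = *-pos (*-pos (*-pos δ>0 ε>0) (*-pos δ>0 ε>0)) (*-pos n>0 n>0)

  regularise : ∀ R {N} (χ : Fin n → Fin N) → fromℕ I * (fromℕ n * fromℕ n) ≤ energy χ + fromℕ R * τ →
               ¬ ¬ RegularPartition (cellBound R N)
  regularise R {N} χ le k = verdicts χ λ w → by-irregularity R le k w (Refine.irregularity χ w ≤? ε * (fromℕ n * fromℕ n))
    where
    by-irregularity : ∀ R → fromℕ I * (fromℕ n * fromℕ n) ≤ energy χ + fromℕ R * τ → ¬ RegularPartition (cellBound R N) →
                      ∀ w → Dec (Refine.irregularity χ w ≤ ε * (fromℕ n * fromℕ n)) → ⊥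
    by-irregularity R le k w (yes few) = k record
      { N = N ; N≤ = cellBound-≥ R N ; χ = χ ; irr = irregular χ w ; few = few
      ; regular = λ x y r ok → accepted χ (w (χ x) (χ y)) ok x y r refl refl }
    by-irregularity zero le k w (no many) = <-irrefl refl (<-≤-trans
      (≤-<-trans (≤-trans (≤-trans le (≤-reflexive (trans (+-right (trans (*-left fromℕ-0) (zeroˡ τ))) (trans (+-identityʳ _) (sym (+-identityˡ _))))))
                          ≤-refl)
                 (+-mono-<ˡ τ>0))
      (≤-trans (≤-reflexive (+-comm τ (energy χ))) (≤-trans (increment χ w (<⇒≤ (≰⇒> many))) (energy-≤ (Refine.χ′ χ w)))))
    by-irregularity (suc R) le k w (no many) = regularise R (Refine.χ′ χ w)
      (≤-trans le (≤-trans (≤-reflexive (trans (+-right (trans (*-left (fromℕ-suc R)) (solve 2 (λ R t → (con 1ℚ :+ R) :* t := t :+ R :* t) refl (fromℕ R) τ))) (sym (+-assoc _ τ _))))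
                           (+-mono-≤ (increment χ w (<⇒≤ (≰⇒> many))) ≤-refl))) k

  -- The total energy of the I relations never exceeds I n², so the number of rounds, and with it
  -- the number of cells, is bounded independently of n.
  regular-partition : ∀ R → fromℕ I ≤ fromℕ R * (δ * ε * (δ * ε)) → ¬ ¬ RegularPartition (cellBound R 1)
  regular-partition R enough = regularise R (λ _ → zero) (≤-trans
    (≤-trans (*-mono-≤ʳ (fromℕ n * fromℕ n) (square-nonneg (fromℕ n)) enough) (≤-reflexive (*-assoc _ _ _)))
    (by-diff (energy {1} (λ _ → zero)) (∑-nonneg λ r → ∑-nonneg λ a → ∑-nonneg λ c →
        *-nonneg (𝟙-nonneg (f r a c)) (density-nonneg (Cells.K-prob {N = 1} (λ _ → zero) a) (Cells.K-prob {N = 1} (λ _ → zero) c) (f r))) (+-comm _ _)))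

-- Counting edges by ordered triples

∑∑∑ : (Fin n → Fin n → Fin n → ℚ) → ℚ
∑∑∑ S = ∑ λ a → ∑ λ b → ∑ λ c → S a b c

infix 4 _≺_
_≺_ : Fin n → Fin n → Bool
a ≺ b = isYes (a Fin.<? b)

6ℚ : ℚ
6ℚ = fromℕ 6

private
  6≡ : 6ℚ ≡ 1ℚ + (1ℚ + (1ℚ + (1ℚ + (1ℚ + 1ℚ))))
  6≡ = trans (fromℕ-suc 5) (+-right (trans (fromℕ-suc 4) (+-right (trans (fromℕ-suc 3)
        (+-right (trans (fromℕ-suc 2) (+-right (trans (fromℕ-suc 1) (+-right fromℕ-1)))))))))

-- Each of the six orders of a triple of distinct vertices contributes the same amount.
module OrderedSum {n} (S : Fin n → Fin n → Fin n → ℚ)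
  (S-sym₁₂ : ∀ a b c → S a b c ≡ S b a c) (S-sym₂₃ : ∀ a b c → S a b c ≡ S a c b) (S-diag : ∀ a c → S a a c ≡ 0ℚ) where

  Inc : Fin n → Fin n → Fin n → ℚ
  Inc a b c = 𝟙 (a ≺ b) * 𝟙 (b ≺ c) * S a b c

  private
    ≺-flip : ∀ {a b : Fin n} → a ≢ b → 𝟙 (b ≺ a) ≡ 1ℚ - 𝟙 (a ≺ b)
    ≺-flip {a} {b} ne with a Fin.<? b | b Fin.<? a
    ... | yes p | yes q = ⊥-elim (ℕ.<-asym p q)
    ... | yes _ | no _  = sym (+-inverseʳ 1ℚ)
    ... | no _  | yes _ = solve 0 (con 1ℚ := con 1ℚ :- con 0ℚ) refl
    ... | no p  | no q  = ⊥-elim (ne (Fin.toℕ-injective (ℕ.≤-antisym (ℕ.≮⇒≥ q) (ℕ.≮⇒≥ p))))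

    -- Transitivity as a polynomial identity: it fails precisely for the two cyclic patterns of the
    -- three comparisons. In `spread-out` the six ordered terms add up to `S a b c` plus twice the
    -- difference of the two sides times `S a b c`.
    ≺-transitive : ∀ (a b c : Fin n) → a ≢ b → b ≢ c →
      𝟙 (a ≺ b) * 𝟙 (b ≺ c) + 𝟙 (a ≺ c) ≡ 𝟙 (b ≺ c) * 𝟙 (a ≺ c) + 𝟙 (a ≺ b) * 𝟙 (a ≺ c)
    ≺-transitive a b c ab bc with a Fin.<? b | b Fin.<? c | a Fin.<? c
    ... | yes _ | yes _ | yes _ = solve 0 (con 1ℚ :* con 1ℚ :+ con 1ℚ := con 1ℚ :* con 1ℚ :+ con 1ℚ :* con 1ℚ) refl
    ... | yes p | yes q | no r  = ⊥-elim (r (ℕ.<-trans p q))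
    ... | yes _ | no _  | yes _ = solve 0 (con 1ℚ :* con 0ℚ :+ con 1ℚ := con 0ℚ :* con 1ℚ :+ con 1ℚ :* con 1ℚ) refl
    ... | yes _ | no _  | no _  = solve 0 (con 1ℚ :* con 0ℚ :+ con 0ℚ := con 0ℚ :* con 0ℚ :+ con 1ℚ :* con 0ℚ) refl
    ... | no _  | yes _ | yes _ = solve 0 (con 0ℚ :* con 1ℚ :+ con 1ℚ := con 1ℚ :* con 1ℚ :+ con 0ℚ :* con 1ℚ) refl
    ... | no _  | yes _ | no _  = solve 0 (con 0ℚ :* con 1ℚ :+ con 0ℚ := con 1ℚ :* con 0ℚ :+ con 0ℚ :* con 0ℚ) refl
    ... | no p  | no q  | yes r = ⊥-elim (ℕ.<-irrefl refl (ℕ.<-≤-trans r (ℕ.≤-trans (ℕ.≮⇒≥ q) (ℕ.≮⇒≥ p))))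
    ... | no _  | no _  | no _  = solve 0 (con 0ℚ :* con 0ℚ :+ con 0ℚ := con 0ℚ :* con 0ℚ :+ con 0ℚ :* con 0ℚ) refl

    zero-out : ∀ a b c → S a b c ≡ 0ℚ → S a b c ≡ Inc a b c + (Inc a c b + (Inc b a c + (Inc b c a + (Inc c a b + Inc c b a))))
    zero-out a b c e = trans e (sym (trans (cong₂ _+_ (kill (a ≺ b) (b ≺ c) e) (cong₂ _+_ (kill (a ≺ c) (c ≺ b) (trans (sym (S-sym₂₃ a b c)) e))
      (cong₂ _+_ (kill (b ≺ a) (a ≺ c) (trans (sym (S-sym₁₂ a b c)) e))
        (cong₂ _+_ (kill (b ≺ c) (c ≺ a) (trans (S-sym₂₃ b c a) (trans (S-sym₁₂ b a c) e)))
          (cong₂ _+_ (kill (c ≺ a) (a ≺ b) (trans (S-sym₁₂ c a b) (trans (S-sym₂₃ a c b) e)))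
            (kill (c ≺ b) (b ≺ a) (trans (S-sym₁₂ c b a) (trans (S-sym₂₃ b c a) (trans (S-sym₁₂ b a c) e)))))))))
      (solve 0 (con 0ℚ :+ (con 0ℚ :+ (con 0ℚ :+ (con 0ℚ :+ (con 0ℚ :+ con 0ℚ)))) := con 0ℚ) refl)))
      where
      kill : ∀ p q {u} → u ≡ 0ℚ → 𝟙 p * 𝟙 q * u ≡ 0ℚ
      kill p q refl = zeroʳ _

    spread-out : ∀ a b c → S a b c ≡ Inc a b c + (Inc a c b + (Inc b a c + (Inc b c a + (Inc c a b + Inc c b a))))
    spread-out a b c with a Fin.≟ b | b Fin.≟ c | a Fin.≟ c
    ... | no ab | no bc | no ac = sym (begin
      Inc a b c + (Inc a c b + (Inc b a c + (Inc b c a + (Inc c a b + Inc c b a))))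
        ≡⟨ cong₂ _+_ refl (cong₂ _+_ (term (a ≺ c) (c ≺ b) (≺-flip bc) (sym (S-sym₂₃ a b c)))
             (cong₂ _+_ (term′ (b ≺ a) (a ≺ c) (≺-flip ab) (sym (S-sym₁₂ a b c)))
               (cong₂ _+_ (term (b ≺ c) (c ≺ a) (≺-flip ac) (trans (S-sym₂₃ b c a) (S-sym₁₂ b a c)))
                 (cong₂ _+_ (term′ (c ≺ a) (a ≺ b) (≺-flip ac) (trans (S-sym₁₂ c a b) (S-sym₂₃ a c b)))
                   (cong₂ _*_ (cong₂ _*_ (≺-flip bc) (≺-flip ab)) (trans (S-sym₁₂ c b a) (trans (S-sym₂₃ b c a) (S-sym₁₂ b a c)))))))) ⟩
      x * y * s + (z * (1ℚ - y) * s + ((1ℚ - x) * z * s + (y * (1ℚ - z) * s + ((1ℚ - z) * x * s + (1ℚ - y) * (1ℚ - x) * s))))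
        ≡⟨ solve 4 (λ x y z s → x :* y :* s :+ (z :* (con 1ℚ :- y) :* s :+ ((con 1ℚ :- x) :* z :* s :+ (y :* (con 1ℚ :- z) :* s :+ ((con 1ℚ :- z) :* x :* s :+ (con 1ℚ :- y) :* (con 1ℚ :- x) :* s))))
              := s :+ (con 1ℚ :+ con 1ℚ) :* ((x :* y :+ z) :- (y :* z :+ x :* z)) :* s) refl x y z s ⟩
      s + (1ℚ + 1ℚ) * ((x * y + z) - (y * z + x * z)) * s
        ≡⟨ +-right (*-left (*-right (cong (_- (y * z + x * z)) (≺-transitive a b c ab bc)))) ⟩
      s + (1ℚ + 1ℚ) * ((y * z + x * z) - (y * z + x * z)) * s
        ≡⟨ solve 2 (λ u s → s :+ (con 1ℚ :+ con 1ℚ) :* (u :- u) :* s := s) refl (y * z + x * z) s ⟩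
      s ∎)
      where
      open ≡-Reasoning
      x = 𝟙 (a ≺ b)
      y = 𝟙 (b ≺ c)
      z = 𝟙 (a ≺ c)
      s = S a b c
      term : ∀ p q {r u} → 𝟙 q ≡ r → u ≡ s → 𝟙 p * 𝟙 q * u ≡ 𝟙 p * r * s
      term p q refl refl = refl
      term′ : ∀ p q {r u} → 𝟙 p ≡ r → u ≡ s → 𝟙 p * 𝟙 q * u ≡ r * 𝟙 q * s
      term′ p q refl refl = refl
    ... | yes refl | _ | _ = zero-out a a c (S-diag a c)
    ... | no _ | yes refl | _ = zero-out a b b (trans (S-sym₁₂ a b b) (trans (S-sym₂₃ b a b) (S-diag b a)))
    ... | no _ | no _ | yes refl = zero-out a b a (trans (S-sym₂₃ a b a) (S-diag a b))

    inner : (F : Fin n → Fin n → Fin n → ℚ) → ∑∑∑ (λ a b c → F a c b) ≡ ∑∑∑ F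
    inner F = ∑-cong λ a → ∑-swap _

    outer : (F : Fin n → Fin n → Fin n → ℚ) → ∑∑∑ (λ a b c → F b a c) ≡ ∑∑∑ F
    outer F = ∑-swap _

    ∑∑∑-+ : (F G : Fin n → Fin n → Fin n → ℚ) → ∑∑∑ (λ a b c → F a b c + G a b c) ≡ ∑∑∑ F + ∑∑∑ G
    ∑∑∑-+ F G = trans (∑-cong λ a → trans (∑-cong λ b → ∑-+ _ _) (∑-+ _ _)) (∑-+ _ _)

  ordered-sum : ∑∑∑ S ≡ 6ℚ * ∑∑∑ Inc
  ordered-sum = begin
    ∑∑∑ S
      ≡⟨ ∑-cong (λ a → ∑-cong λ b → ∑-cong λ c → spread-out a b c) ⟩
    ∑∑∑ (λ a b c → Inc a b c + (Inc a c b + (Inc b a c + (Inc b c a + (Inc c a b + Inc c b a)))))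
      ≡⟨ trans (∑∑∑-+ _ _) (+-right (trans (∑∑∑-+ _ _) (+-right (trans (∑∑∑-+ _ _) (+-right (trans (∑∑∑-+ _ _) (+-right (∑∑∑-+ _ _)))))))) ⟩
    A + (∑∑∑ (λ a b c → Inc a c b) + (∑∑∑ (λ a b c → Inc b a c) + (∑∑∑ (λ a b c → Inc b c a) + (∑∑∑ (λ a b c → Inc c a b) + ∑∑∑ (λ a b c → Inc c b a)))))
      ≡⟨ +-right (cong₂ _+_ (inner Inc) (cong₂ _+_ (outer Inc) (cong₂ _+_ (trans (outer (λ a b c → Inc a c b)) (inner Inc))
           (cong₂ _+_ (trans (inner (λ a b c → Inc b a c)) (outer Inc))
             (trans (inner (λ a b c → Inc b c a)) (trans (outer (λ a b c → Inc a c b)) (inner Inc))))))) ⟩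
    A + (A + (A + (A + (A + A))))
      ≡⟨ solve 1 (λ A → A :+ (A :+ (A :+ (A :+ (A :+ A)))) := (con 1ℚ :+ (con 1ℚ :+ (con 1ℚ :+ (con 1ℚ :+ (con 1ℚ :+ con 1ℚ))))) :* A) refl A ⟩
    (1ℚ + (1ℚ + (1ℚ + (1ℚ + (1ℚ + 1ℚ))))) * A
      ≡⟨ *-left (sym 6≡) ⟩
    6ℚ * A ∎
    where open ≡-Reasoning
          A = ∑∑∑ Inc

memb-lookup : ∀ {m} (U : Subset m) a → memb U a ≡ lookup U a
memb-lookup U a with lookup U a
... | true  = refl
... | false = refl

fromℕ-sum : ∀ (f : Fin n → ℕ) → fromℕ (sum (List.map f (List.allFin n))) ≡ ∑ λ a → fromℕ (f a)
fromℕ-sum {n} f = trans (cong (fromℕ ∘ sum) (map-tabulate id f)) (go n f)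
  where
  go : ∀ m (g : Fin m → ℕ) → fromℕ (sum (List.tabulate g)) ≡ ∑ λ a → fromℕ (g a)
  go zero    g = trans fromℕ-0 (sym (∑-zero _))
  go (suc m) g = trans (fromℕ-+ (g zero) _) (trans (+-right (go m (g ∘ suc))) (sym (∑-suc _)))

fromℕ-if : ∀ b → fromℕ (if b then 1 else 0) ≡ 𝟙 b
fromℕ-if true  = fromℕ-1
fromℕ-if false = fromℕ-0

card : ∀ (U : Subset n) → fromℕ ∣ U ∣ ≡ ∑ λ a → 𝟙 (lookup U a)
card [] = trans fromℕ-0 (sym (∑-zero _))
card (true ∷ U)  = trans (fromℕ-suc ∣ U ∣) (trans (+-right (card U)) (sym (∑-suc _)))
card (false ∷ U) = trans (card U) (trans (sym (+-identityˡ _)) (sym (∑-suc _)))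

module _ (H : 3Graph) where
  open 3Graph H using (E; sym₁₂; sym₂₃; loopless) renaming (n to N)

  edges-ordered : ∀ (U : Subset N) → 6ℚ * fromℕ (edgesIn H U) ≡
    ∑∑∑ λ a b c → 𝟙 (lookup U a) * (𝟙 (lookup U b) * 𝟙 (lookup U c)) * 𝟙 (E a b c)
  edges-ordered U = trans (*-right unfold) (sym ordered-sum)
    where
    u : Fin N → ℚ
    u a = 𝟙 (lookup U a)
    open OrderedSum (λ a b c → u a * (u b * u c) * 𝟙 (E a b c))
      (λ a b c → cong₂ _*_ (solve 3 (λ x y z → x :* (y :* z) := y :* (x :* z)) refl (u a) (u b) (u c)) (cong 𝟙 (sym₁₂ a b c)))
      (λ a b c → cong₂ _*_ (*-right (*-comm (u b) (u c))) (cong 𝟙 (sym₂₃ a b c)))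
      (λ a c → trans (*-right (cong 𝟙 (loopless a c))) (zeroʳ _))
    point : ∀ x y p q r e → 𝟙 (x ∧ y ∧ p ∧ q ∧ r ∧ e) ≡ 𝟙 x * 𝟙 y * (𝟙 p * (𝟙 q * 𝟙 r) * 𝟙 e)
    point x y p q r e = trans (trans (𝟙-∧ x _) (*-right (trans (𝟙-∧ y _) (*-right (trans (𝟙-∧ p _) (*-right (trans (𝟙-∧ q _) (*-right (𝟙-∧ r e)))))))))
      (solve 6 (λ x y p q r e → x :* (y :* (p :* (q :* (r :* e)))) := x :* y :* (p :* (q :* r) :* e)) refl (𝟙 x) (𝟙 y) (𝟙 p) (𝟙 q) (𝟙 r) (𝟙 e))
    unfold : fromℕ (edgesIn H U) ≡ ∑∑∑ Inc
    unfold = trans (fromℕ-sum _) (∑-cong λ a → trans (fromℕ-sum _) (∑-cong λ b → trans (fromℕ-sum _) (∑-cong λ c →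
      trans (fromℕ-if _) (trans (point (a ≺ b) (b ≺ c) (memb U a) (memb U b) (memb U c) (E a b c))
        (cong (λ z → 𝟙 (a ≺ b) * 𝟙 (b ≺ c) * (z * 𝟙 (E a b c)))
          (cong₂ _*_ (cong 𝟙 (memb-lookup U a)) (cong₂ _*_ (cong 𝟙 (memb-lookup U b)) (cong 𝟙 (memb-lookup U c)))))))))

binomial₂ : ∀ u → (1ℚ + 1ℚ) * fromℕ (u choose 2) ≡ fromℕ u * (fromℕ u - 1ℚ)
binomial₂ zero = trans (*-right fromℕ-0) (trans (zeroʳ _) (sym (trans (*-left fromℕ-0) (zeroˡ _))))
binomial₂ (suc u) = begin
  (1ℚ + 1ℚ) * fromℕ (suc u choose 2)                      ≡⟨ *-right (trans (cong fromℕ (sym (nCk+nC[k+1]≡[n+1]C[k+1] u 1))) (fromℕ-+ (u choose 1) (u choose 2))) ⟩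
  (1ℚ + 1ℚ) * (fromℕ (u choose 1) + fromℕ (u choose 2))        ≡⟨ *-right (+-left (cong fromℕ (nC1≡n u))) ⟩
  (1ℚ + 1ℚ) * (fromℕ u + fromℕ (u choose 2))              ≡⟨ distribˡ _ _ _ ⟩
  (1ℚ + 1ℚ) * fromℕ u + (1ℚ + 1ℚ) * fromℕ (u choose 2)    ≡⟨ +-right (binomial₂ u) ⟩
  (1ℚ + 1ℚ) * fromℕ u + fromℕ u * (fromℕ u - 1ℚ)     ≡⟨ solve 1 (λ u → (con 1ℚ :+ con 1ℚ) :* u :+ u :* (u :- con 1ℚ) := (con 1ℚ :+ u) :* (con 1ℚ :+ u :- con 1ℚ)) refl (fromℕ u) ⟩
  (1ℚ + fromℕ u) * (1ℚ + fromℕ u - 1ℚ)               ≡⟨ cong (λ z → z * (z - 1ℚ)) (sym (fromℕ-suc u)) ⟩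
  fromℕ (suc u) * (fromℕ (suc u) - 1ℚ)               ∎
  where open ≡-Reasoning

binomial₃ : ∀ u → 6ℚ * fromℕ (u choose 3) ≡ fromℕ u * (fromℕ u - 1ℚ) * (fromℕ u - (1ℚ + 1ℚ))
binomial₃ zero = trans (*-right fromℕ-0) (trans (zeroʳ _) (sym (trans (*-left (trans (*-left fromℕ-0) (zeroˡ _))) (zeroˡ _))))
binomial₃ (suc u) = begin
  6ℚ * fromℕ (suc u choose 3)                        ≡⟨ *-right (trans (cong fromℕ (sym (nCk+nC[k+1]≡[n+1]C[k+1] u 2))) (fromℕ-+ (u choose 2) (u choose 3))) ⟩
  6ℚ * (fromℕ (u choose 2) + fromℕ (u choose 3))          ≡⟨ distribˡ _ _ _ ⟩
  6ℚ * fromℕ (u choose 2) + 6ℚ * fromℕ (u choose 3)       ≡⟨ cong₂ _+_ (trans (*-left 6≡)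
    (trans (solve 1 (λ x → (con 1ℚ :+ (con 1ℚ :+ (con 1ℚ :+ (con 1ℚ :+ (con 1ℚ :+ con 1ℚ))))) :* x := (con 1ℚ :+ (con 1ℚ :+ con 1ℚ)) :* ((con 1ℚ :+ con 1ℚ) :* x)) refl (fromℕ (u choose 2)))
      (*-right (binomial₂ u)))) (binomial₃ u) ⟩
  (1ℚ + (1ℚ + 1ℚ)) * (fromℕ u * (fromℕ u - 1ℚ)) + fromℕ u * (fromℕ u - 1ℚ) * (fromℕ u - (1ℚ + 1ℚ))
    ≡⟨ solve 1 (λ u → (con 1ℚ :+ (con 1ℚ :+ con 1ℚ)) :* (u :* (u :- con 1ℚ)) :+ u :* (u :- con 1ℚ) :* (u :- (con 1ℚ :+ con 1ℚ))
         := (con 1ℚ :+ u) :* (con 1ℚ :+ u :- con 1ℚ) :* (con 1ℚ :+ u :- (con 1ℚ :+ con 1ℚ))) refl (fromℕ u) ⟩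
  (1ℚ + fromℕ u) * (1ℚ + fromℕ u - 1ℚ) * (1ℚ + fromℕ u - (1ℚ + 1ℚ))
    ≡⟨ cong (λ z → z * (z - 1ℚ) * (z - (1ℚ + 1ℚ))) (sym (fromℕ-suc u)) ⟩
  fromℕ (suc u) * (fromℕ (suc u) - 1ℚ) * (fromℕ (suc u) - (1ℚ + 1ℚ)) ∎
  where open ≡-Reasoning

-- Fractional vertex weights

opaque
  unfolding _+_ fromℕ

  dense-edges : ∀ {d μ H} → Dense d μ H → ∀ U → d * fromℕ (∣ U ∣ choose 3) - μ * fromℕ (3Graph.n H ℕ.^ 3) ≤ fromℕ (edgesIn H U)
  dense-edges dense = dense

  edges-dense : ∀ {d μ H} → (∀ U → d * fromℕ (∣ U ∣ choose 3) - μ * fromℕ (3Graph.n H ℕ.^ 3) ≤ fromℕ (edgesIn H U)) → Dense d μ H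
  edges-dense dense = dense

cubic : (Fin n → Fin n → Fin n → ℚ) → (Fin n → ℚ) → ℚ
cubic G x = ∑ λ a → x a * ∑ λ b → x b * ∑ λ c → x c * G a b c

cubic-def : (G : Fin n → Fin n → Fin n → ℚ) (x : Fin n → ℚ) → cubic G x ≡ ∑∑∑ λ a b c → x a * (x b * (x c * G a b c))
cubic-def G x = ∑-cong λ a → trans (*-right (∑-cong λ b → ∑-*ˡ (x b) _)) (trans (∑-*ˡ (x a) _) (∑-cong λ b → ∑-*ˡ (x a) _))

-- A cubic form without repeated variables is affine in each variable, so its
-- minimum over the cube is attained at a vertex.
module Rounding {n} (G : Fin n → Fin n → Fin n → ℚ)
  (G₁₂ : ∀ a c → G a a c ≡ 0ℚ) (G₂₃ : ∀ a b → G a b b ≡ 0ℚ) (G₁₃ : ∀ a b → G a b a ≡ 0ℚ)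
  {m : ℚ} (vertices : ∀ (f : Fin n → Bool) → m ≤ cubic G (𝟙 ∘ f)) where

  update : (Fin n → ℚ) → Fin n → ℚ → Fin n → ℚ
  update x v y a = if a == v then y else x a

  affine : ∀ x v → cubic G x ≡ (1ℚ - x v) * cubic G (update x v 0ℚ) + x v * cubic G (update x v 1ℚ)
  affine x v = begin
    cubic G x
      ≡⟨ cubic-def G x ⟩
    ∑∑∑ (λ a b c → x a * (x b * (x c * G a b c)))
      ≡⟨ ∑-cong (λ a → ∑-cong λ b → ∑-cong λ c → point a b c) ⟩
    ∑∑∑ (λ a b c → (1ℚ - x v) * term 0ℚ a b c + x v * term 1ℚ a b c)
      ≡⟨ trans (∑-cong λ a → trans (∑-cong λ b → ∑-+ _ _) (∑-+ _ _)) (∑-+ _ _) ⟩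
    ∑∑∑ (λ a b c → (1ℚ - x v) * term 0ℚ a b c) + ∑∑∑ (λ a b c → x v * term 1ℚ a b c)
      ≡⟨ cong₂ _+_ (pull (1ℚ - x v) 0ℚ) (pull (x v) 1ℚ) ⟩
    (1ℚ - x v) * cubic G (update x v 0ℚ) + x v * cubic G (update x v 1ℚ) ∎
    where
    open ≡-Reasoning
    term : ℚ → Fin n → Fin n → Fin n → ℚ
    term y a b c = update x v y a * (update x v y b * (update x v y c * G a b c))
    pull : ∀ k y → ∑∑∑ (λ a b c → k * term y a b c) ≡ k * cubic G (update x v y)
    pull k y = trans (∑-cong λ a → trans (∑-cong λ b → sym (∑-*ˡ k _)) (sym (∑-*ˡ k _)))
      (trans (sym (∑-*ˡ k _)) (*-right (sym (cubic-def G (update x v y)))))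
    vanish : ∀ {g} → g ≡ 0ℚ → ∀ p q r p₀ q₀ r₀ p₁ q₁ r₁ k → p * (q * (r * g)) ≡ (1ℚ - k) * (p₀ * (q₀ * (r₀ * g))) + k * (p₁ * (q₁ * (r₁ * g)))
    vanish refl p q r p₀ q₀ r₀ p₁ q₁ r₁ k = trans (zero³ p q r) (sym (trans (cong₂ _+_ (trans (*-right (zero³ p₀ q₀ r₀)) (zeroʳ _)) (trans (*-right (zero³ p₁ q₁ r₁)) (zeroʳ _))) (+-identityˡ 0ℚ)))
      where
      zero³ : ∀ p q r → p * (q * (r * 0ℚ)) ≡ 0ℚ
      zero³ p q r = solve 3 (λ p q r → p :* (q :* (r :* con 0ℚ)) := con 0ℚ) refl p q r
    point : ∀ a b c → x a * (x b * (x c * G a b c)) ≡ (1ℚ - x v) * term 0ℚ a b c + x v * term 1ℚ a b c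
    point a b c with a Fin.≟ v | b Fin.≟ v | c Fin.≟ v
    ... | yes refl | yes refl | yes refl = vanish (G₁₂ a c) _ _ _ _ _ _ _ _ _ _
    ... | yes refl | yes refl | no _     = vanish (G₁₂ a c) _ _ _ _ _ _ _ _ _ _
    ... | yes refl | no _     | yes refl = vanish (G₁₃ a b) _ _ _ _ _ _ _ _ _ _
    ... | no _     | yes refl | yes refl = vanish (G₂₃ a b) _ _ _ _ _ _ _ _ _ _
    ... | yes refl | no _     | no _     = solve 4 (λ v b c g → v :* (b :* (c :* g)) := (con 1ℚ :- v) :* (con 0ℚ :* (b :* (c :* g))) :+ v :* (con 1ℚ :* (b :* (c :* g)))) refl (x v) (x b) (x c) (G a b c)
    ... | no _     | yes refl | no _     = solve 4 (λ a v c g → a :* (v :* (c :* g)) := (con 1ℚ :- v) :* (a :* (con 0ℚ :* (c :* g))) :+ v :* (a :* (con 1ℚ :* (c :* g)))) refl (x a) (x v) (x c) (G a b c)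
    ... | no _     | no _     | yes refl = solve 4 (λ a b v g → a :* (b :* (v :* g)) := (con 1ℚ :- v) :* (a :* (b :* (con 0ℚ :* g))) :+ v :* (a :* (b :* (con 1ℚ :* g)))) refl (x a) (x b) (x v) (G a b c)
    ... | no _     | no _     | no _     = solve 5 (λ a b c v g → a :* (b :* (c :* g)) := (con 1ℚ :- v) :* (a :* (b :* (c :* g))) :+ v :* (a :* (b :* (c :* g)))) refl (x a) (x b) (x c) (x v) (G a b c)

  IsBit : ℚ → Set
  IsBit y = ∃ λ b → y ≡ 𝟙 b

  -- The coordinates from position k on are already 0 or 1, and coordinate k - 1 is rounded next. By
  -- `affine` the value at x is a convex combination of the values at the two roundings, so a lower
  -- bound for both is one for x.
  round : ∀ k x → (∀ v → 0ℚ ≤ x v) → (∀ v → x v ≤ 1ℚ) → (∀ v → k ℕ.≤ Fin.toℕ v → IsBit (x v)) → m ≤ cubic G x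
  round zero x x≥0 x≤1 bits = ≤-trans (vertices (λ v → proj₁ (bits v ℕ.z≤n))) (≤-reflexive
    (trans (cubic-def G _) (trans (∑-cong λ a → ∑-cong λ b → ∑-cong λ c → cong₂ _*_ (sym (proj₂ (bits a ℕ.z≤n)))
      (cong₂ _*_ (sym (proj₂ (bits b ℕ.z≤n))) (*-left (sym (proj₂ (bits c ℕ.z≤n)))))) (sym (cubic-def G x)))))
  round (suc k) x x≥0 x≤1 bits with k ℕ.<? n
  ... | no k≮n = round k x x≥0 x≤1 λ v k≤v → ⊥-elim (k≮n (ℕ.≤-<-trans k≤v (Fin.toℕ<n v)))
  ... | yes k<n = begin
    m                                      ≡⟨ solve 2 (λ t m → m := (con 1ℚ :- t) :* m :+ t :* m) refl t m ⟩
    (1ℚ - t) * m + t * m                   ≤⟨ +-mono-≤ (*-mono-≤ˡ _ (diff (x≤1 v)) (fixed false)) (*-mono-≤ˡ t (x≥0 v) (fixed true)) ⟩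
    (1ℚ - t) * cubic G (update x v 0ℚ) + t * cubic G (update x v 1ℚ)  ≡⟨ affine x v ⟨
    cubic G x                              ∎
    where
    open ≤-Reasoning
    v = Fin.fromℕ< k<n
    t = x v
    fixed : ∀ b → m ≤ cubic G (update x v (𝟙 b))
    fixed b = round k (update x v (𝟙 b)) low high is-bit
      where
      low : ∀ a → 0ℚ ≤ update x v (𝟙 b) a
      low a with a Fin.≟ v
      ... | yes _ = 𝟙-nonneg b
      ... | no _  = x≥0 a
      high : ∀ a → update x v (𝟙 b) a ≤ 1ℚ
      high a with a Fin.≟ v
      ... | yes _ = 𝟙≤1 b
      ... | no _  = x≤1 a
      is-bit : ∀ a → k ℕ.≤ Fin.toℕ a → IsBit (update x v (𝟙 b) a)
      is-bit a k≤a with a Fin.≟ v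
      ... | yes _ = b , refl
      ... | no a≢v = bits a (ℕ.≤∧≢⇒< k≤a λ e → a≢v (Fin.toℕ-injective (trans (sym e) (sym (Fin.toℕ-fromℕ< k<n)))))

  rounding : ∀ x → (∀ v → 0ℚ ≤ x v) → (∀ v → x v ≤ 1ℚ) → m ≤ cubic G x
  rounding x x≥0 x≤1 = round n x x≥0 x≤1 λ v n≤v → ⊥-elim (ℕ.<⇒≱ (Fin.toℕ<n v) n≤v)

δ[_,_] : Fin n → Fin n → ℚ
δ[ a , b ] = 𝟙 (a == b)

distinct : Fin n → Fin n → Fin n → ℚ
distinct a b c = (1ℚ - δ[ a , b ]) * ((1ℚ - δ[ b , c ]) * (1ℚ - δ[ a , c ]))

module WeightedDensity {d μ : ℚ} (d≥0 : 0ℚ ≤ d) (μ≥0 : 0ℚ ≤ μ) (H : 3Graph) (dense : Dense d μ H) where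
  open 3Graph H renaming (n to size)
  N = fromℕ size

  -- Subtracting `d` on triples of distinct vertices only makes `G` vanish as soon as two arguments
  -- agree, which is what the rounding argument requires.
  G : Fin size → Fin size → Fin size → ℚ
  G a b c = 𝟙 (E a b c) - d * distinct a b c

  private
    δ-refl : (a : Fin size) → δ[ a , a ] ≡ 1ℚ
    δ-refl a = cong 𝟙 (==-refl a)

    no-edge : ∀ {a b c} → E a b c ≡ false → distinct a b c ≡ 0ℚ → G a b c ≡ 0ℚ
    no-edge e z = trans (cong₂ (λ p q → 𝟙 p - d * q) e z) (solve 1 (λ d → con 0ℚ :- d :* con 0ℚ := con 0ℚ) refl d)

    G₁₂ : ∀ a c → G a a c ≡ 0ℚ
    G₁₂ a c = no-edge (loopless a c) (trans (*-left (trans (cong (λ z → 1ℚ - z) (δ-refl a)) (+-inverseʳ 1ℚ))) (zeroˡ _))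
    G₂₃ : ∀ a b → G a b b ≡ 0ℚ
    G₂₃ a b = no-edge (trans (sym₁₂ a b b) (trans (sym₂₃ b a b) (loopless b a)))
      (trans (*-right (trans (*-left (trans (cong (λ z → 1ℚ - z) (δ-refl b)) (+-inverseʳ 1ℚ))) (zeroˡ _))) (zeroʳ _))
    G₁₃ : ∀ a b → G a b a ≡ 0ℚ
    G₁₃ a b = no-edge (trans (sym₂₃ a b a) (loopless a b))
      (trans (*-right (trans (*-right (trans (cong (λ z → 1ℚ - z) (δ-refl a)) (+-inverseʳ 1ℚ))) (zeroʳ _))) (zeroʳ _))

  distinct-sum : (f : Fin size → Bool) → let x = 𝟙 ∘ f ; u = ∑ x in
    ∑∑∑ (λ a b c → x a * (x b * x c) * distinct a b c) ≡ u * (u - 1ℚ) * (u - (1ℚ + 1ℚ))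
  distinct-sum f = begin
    ∑∑∑ (λ a b c → x a * (x b * x c) * distinct a b c)
      ≡⟨ ∑-cong (λ a → ∑-cong λ b → inner a b) ⟩
    ∑ (λ a → ∑ λ b → (u - (1ℚ + 1ℚ)) * (x a * x b) - (u - (1ℚ + 1ℚ)) * (δ[ a , b ] * (x a * x b)))
      ≡⟨ ∑-cong (λ a → trans (∑-- _ _) (cong₂ _-_ (trans (sym (∑-*ˡ _ _)) (*-right (sym (∑-*ˡ (x a) x))))
           (trans (sym (∑-*ˡ _ _)) (*-right (trans (∑-δ a (λ b → x a * x b)) (𝟙-idem (f a))))))) ⟩
    ∑ (λ a → (u - (1ℚ + 1ℚ)) * (x a * u) - (u - (1ℚ + 1ℚ)) * x a)
      ≡⟨ trans (∑-- _ _) (cong₂ _-_ (trans (sym (∑-*ˡ _ _)) (*-right (sym (∑-*ʳ u x)))) (sym (∑-*ˡ _ _))) ⟩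
    (u - (1ℚ + 1ℚ)) * (u * u) - (u - (1ℚ + 1ℚ)) * u
      ≡⟨ solve 1 (λ u → (u :- (con 1ℚ :+ con 1ℚ)) :* (u :* u) :- (u :- (con 1ℚ :+ con 1ℚ)) :* u := u :* (u :- con 1ℚ) :* (u :- (con 1ℚ :+ con 1ℚ))) refl u ⟩
    u * (u - 1ℚ) * (u - (1ℚ + 1ℚ)) ∎
    where
    open ≡-Reasoning
    x : Fin size → ℚ
    x = 𝟙 ∘ f
    u = ∑ x
    inner : ∀ a b → ∑ (λ c → x a * (x b * x c) * distinct a b c) ≡ (u - (1ℚ + 1ℚ)) * (x a * x b) - (u - (1ℚ + 1ℚ)) * (δ[ a , b ] * (x a * x b))
    inner a b with a Fin.≟ b
    ... | yes refl = trans (∑-cong λ c → trans (*-right (trans (*-left (+-inverseʳ 1ℚ)) (zeroˡ _))) (zeroʳ _))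
      (trans (∑-0 size) (solve 2 (λ k p → con 0ℚ := k :* p :- k :* (con 1ℚ :* p)) refl (u - (1ℚ + 1ℚ)) (x a * x a)))
    ... | no a≢b = begin
      ∑ (λ c → x a * (x b * x c) * ((1ℚ - 0ℚ) * ((1ℚ - δ[ b , c ]) * (1ℚ - δ[ a , c ]))))
        ≡⟨ ∑-cong (λ c → trans (solve 5 (λ a b c p q → a :* (b :* c) :* ((con 1ℚ :- con 0ℚ) :* ((con 1ℚ :- p) :* (con 1ℚ :- q))) := a :* b :* (c :- p :* c :- q :* c) :+ a :* b :* c :* (p :* q)) refl (x a) (x b) (x c) δ[ b , c ] δ[ a , c ])
             (trans (+-right (trans (*-right (exclusive c)) (zeroʳ _))) (+-identityʳ _))) ⟩
      ∑ (λ c → x a * x b * (x c - δ[ b , c ] * x c - δ[ a , c ] * x c))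
        ≡⟨ trans (sym (∑-*ˡ _ _)) (*-right (trans (∑-- _ _) (cong₂ _-_ (trans (∑-- _ _) (cong (λ z → u - z) (∑-δ b x))) (∑-δ a x)))) ⟩
      x a * x b * (u - x b - x a)
        ≡⟨ solve 3 (λ a b u → a :* b :* (u :- b :- a) := u :* (a :* b) :- a :* (b :* b) :- (a :* a) :* b) refl (x a) (x b) u ⟩
      u * (x a * x b) - x a * (x b * x b) - x a * x a * x b
        ≡⟨ cong₂ (λ p q → u * (x a * x b) - x a * p - q * x b) (𝟙-idem (f b)) (𝟙-idem (f a)) ⟩
      u * (x a * x b) - x a * x b - x a * x b
        ≡⟨ solve 2 (λ u p → u :* p :- p :- p := (u :- (con 1ℚ :+ con 1ℚ)) :* p :- (u :- (con 1ℚ :+ con 1ℚ)) :* (con 0ℚ :* p)) refl u (x a * x b) ⟩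
      (u - (1ℚ + 1ℚ)) * (x a * x b) - (u - (1ℚ + 1ℚ)) * (0ℚ * (x a * x b)) ∎
      where
      exclusive : ∀ c → δ[ b , c ] * δ[ a , c ] ≡ 0ℚ
      exclusive c with b Fin.≟ c | a Fin.≟ c
      ... | yes refl | yes refl = ⊥-elim (a≢b refl)
      ... | yes _ | no _  = zeroʳ 1ℚ
      ... | no _  | yes _ = zeroˡ 1ℚ
      ... | no _  | no _  = zeroˡ 0ℚ

  dense-vertices : ∀ (f : Fin size → Bool) → - (6ℚ * (μ * (N * (N * N)))) ≤ cubic G (𝟙 ∘ f)
  dense-vertices f = begin
    - (6ℚ * (μ * (N * (N * N))))
      ≤⟨ by-diff (6ℚ * (e - (d * b - μ * (N * (N * N))))) (*-nonneg (fromℕ-nonneg 6) (diff bound))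
           (solve 5 (λ s μN e d b → :- (s :* μN) :+ s :* (e :- (d :* b :- μN)) := s :* e :- d :* (s :* b)) refl 6ℚ (μ * (N * (N * N))) e d b) ⟩
    6ℚ * e - d * (6ℚ * b)
      ≡⟨ cong₂ (λ p q → p - d * q) edges pairs ⟩
    ∑∑∑ (λ a b c → x a * (x b * x c) * 𝟙 (E a b c)) - d * ∑∑∑ (λ a b c → x a * (x b * x c) * distinct a b c)
      ≡⟨ cong (λ z → ∑∑∑ (λ a b c → x a * (x b * x c) * 𝟙 (E a b c)) - z) (trans (∑-*ˡ d _) (∑-cong λ a → trans (∑-*ˡ d _) (∑-cong λ b → ∑-*ˡ d _))) ⟩
    ∑∑∑ (λ a b c → x a * (x b * x c) * 𝟙 (E a b c)) - ∑∑∑ (λ a b c → d * (x a * (x b * x c) * distinct a b c))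
      ≡⟨ sym (trans (∑-cong λ a → trans (∑-cong λ b → ∑-- _ _) (∑-- _ _)) (∑-- _ _)) ⟩
    ∑∑∑ (λ a b c → x a * (x b * x c) * 𝟙 (E a b c) - d * (x a * (x b * x c) * distinct a b c))
      ≡⟨ ∑-cong (λ a → ∑-cong λ b → ∑-cong λ c → solve 6 (λ a b c e d q → a :* (b :* c) :* e :- d :* (a :* (b :* c) :* q) := a :* (b :* (c :* (e :- d :* q)))) refl (x a) (x b) (x c) (𝟙 (E a b c)) d (distinct a b c)) ⟩
    ∑∑∑ (λ a b c → x a * (x b * (x c * G a b c)))
      ≡⟨ cubic-def G x ⟨
    cubic G x ∎
    where
    open ≤-Reasoning
    x : Fin size → ℚ
    x = 𝟙 ∘ f
    U = tabulate f
    e = fromℕ (edgesIn H U)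
    b = fromℕ (∣ U ∣ choose 3)
    bound : d * b - μ * (N * (N * N)) ≤ e
    bound = ≤-trans (≤-reflexive (cong (λ z → d * b - μ * z) (sym (trans (fromℕ-* size _) (*-right (trans (fromℕ-* size _) (*-right (cong fromℕ (ℕ.*-identityʳ size)))))))))
                    (dense-edges {H = H} dense U)
    edges : 6ℚ * e ≡ ∑∑∑ (λ a b c → x a * (x b * x c) * 𝟙 (E a b c))
    edges = trans (edges-ordered H U) (∑-cong λ a → ∑-cong λ b → ∑-cong λ c → *-left
      (cong₂ _*_ (cong 𝟙 (lookup∘tabulate f a)) (cong₂ _*_ (cong 𝟙 (lookup∘tabulate f b)) (cong 𝟙 (lookup∘tabulate f c)))))
    cardU : fromℕ ∣ U ∣ ≡ ∑ x
    cardU = trans (card U) (∑-cong λ a → cong 𝟙 (lookup∘tabulate f a))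
    pairs : 6ℚ * b ≡ ∑∑∑ (λ a b c → x a * (x b * x c) * distinct a b c)
    pairs = trans (binomial₃ ∣ U ∣) (trans (cong (λ u → u * (u - 1ℚ) * (u - (1ℚ + 1ℚ))) cardU) (sym (distinct-sum f)))

  fractional : ∀ x → (∀ v → 0ℚ ≤ x v) → (∀ v → x v ≤ 1ℚ) → - (6ℚ * (μ * (N * (N * N)))) ≤ cubic G x
  fractional = Rounding.rounding G G₁₂ G₂₃ G₁₃ dense-vertices

triple : (Fin n → Fin n → Fin n → Bool) → (u v w : Fin n → ℚ) → ℚ
triple E u v w = 𝔼 u λ a → 𝔼 v λ b → 𝔼 w λ c → 𝟙 (E a b c)

module Weighted {d μ : ℚ} (d≥0 : 0ℚ ≤ d) (d≤1 : d ≤ 1ℚ) (μ≥0 : 0ℚ ≤ μ) (H : 3Graph) (dense : Dense d μ H) where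
  open 3Graph H renaming (n to size)
  open WeightedDensity d≥0 μ≥0 H dense

  distinct-bound : ∀ (a b c : Fin size) → 1ℚ - δ[ a , b ] - δ[ b , c ] - δ[ a , c ] ≤ distinct a b c
  distinct-bound a b c = by-diff
    (p * (q + r - q * r) + q * r) (+-nonneg (*-nonneg p≥0 (≤-trans (*-nonneg q≥0 (diff r≤1)) (by-diff r r≥0 (solve 2 (λ q r → q :* (con 1ℚ :- r) :+ r := q :+ r :- q :* r) refl q r)))) (*-nonneg q≥0 r≥0))
    (solve 3 (λ p q r → con 1ℚ :- p :- q :- r :+ (p :* (q :+ r :- q :* r) :+ q :* r) := (con 1ℚ :- p) :* ((con 1ℚ :- q) :* (con 1ℚ :- r))) refl p q r)
    where
    p = δ[ a , b ]
    q = δ[ b , c ]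
    r = δ[ a , c ]
    p≥0 = 𝟙-nonneg (a == b)
    q≥0 = 𝟙-nonneg (b == c)
    r≥0 = 𝟙-nonneg (a == c)
    r≤1 = 𝟙≤1 (a == c)

  𝔼-δ : (v : Fin size → ℚ) (a : Fin size) → 𝔼 v (λ b → δ[ a , b ]) ≡ v a
  𝔼-δ v a = trans (𝔼-def v _) (trans (∑-cong λ b → *-comm _ _) (∑-δ a v))

  module _ {q : ℕ} (w : Fin q → Fin size → ℚ) (Pw : ∀ i → Prob (w i)) {s : ℚ} (w≤s : ∀ i a → w i a ≤ s) where

    -- Replacing `distinct` by 1 costs at most the probability that two of the three random vertices
    -- coincide, and each of the three coincidences has probability at most `s`.
    mixed : ∀ i j k → (𝔼 (w i) λ a → 𝔼 (w j) λ b → 𝔼 (w k) λ c → G a b c) ≤ triple E (w i) (w j) (w k) - d + (s + s + s)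
    mixed i j k = begin
      (𝔼 (w i) λ a → 𝔼 (w j) λ b → 𝔼 (w k) λ c → G a b c)
        ≤⟨ 𝔼-mono (Pw i) (λ a → 𝔼𝔼-mono (Pw j) (Pw k) λ b c → point a b c) ⟩
      (𝔼 (w i) λ a → 𝔼 (w j) λ b → 𝔼 (w k) λ c → 𝟙 (E a b c) - d + (δ[ a , b ] + δ[ b , c ] + δ[ a , c ]))
        ≡⟨ 𝔼-cong (w i) (λ a → 𝔼-cong (w j) λ b → trans (𝔼-+ (w k) _ _) (cong₂ _+_ (trans (𝔼-- (w k) _ _) (cong (λ z → 𝔼 (w k) (λ c → 𝟙 (E a b c)) - z) (𝔼-const (Pw k) d)))
             (trans (𝔼-+ (w k) _ _) (cong₂ _+_ (trans (𝔼-+ (w k) _ _) (cong₂ _+_ (𝔼-const (Pw k) _) (𝔼-δ (w k) b))) (𝔼-δ (w k) a))))) ⟩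
      (𝔼 (w i) λ a → 𝔼 (w j) λ b → 𝔼 (w k) (λ c → 𝟙 (E a b c)) - d + (δ[ a , b ] + w k b + w k a))
        ≤⟨ 𝔼𝔼-mono (Pw i) (Pw j) (λ a b → +-mono-≤ ≤-refl (+-mono-≤ (+-mono-≤ ≤-refl (w≤s k b)) (w≤s k a))) ⟩
      (𝔼 (w i) λ a → 𝔼 (w j) λ b → 𝔼 (w k) (λ c → 𝟙 (E a b c)) - d + (δ[ a , b ] + s + s))
        ≡⟨ 𝔼-cong (w i) (λ a → trans (𝔼-+ (w j) _ _) (cong₂ _+_ (trans (𝔼-- (w j) _ _) (cong (λ z → 𝔼 (w j) (λ b → 𝔼 (w k) λ c → 𝟙 (E a b c)) - z) (𝔼-const (Pw j) d)))
             (trans (𝔼-+ (w j) _ _) (cong₂ _+_ (trans (𝔼-+ (w j) _ _) (cong₂ _+_ (𝔼-δ (w j) a) (𝔼-const (Pw j) s))) (𝔼-const (Pw j) s))))) ⟩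
      (𝔼 (w i) λ a → (𝔼 (w j) λ b → 𝔼 (w k) (λ c → 𝟙 (E a b c))) - d + (w j a + s + s))
        ≤⟨ 𝔼-mono (Pw i) (λ a → +-mono-≤ ≤-refl (+-mono-≤ (+-mono-≤ (w≤s j a) ≤-refl) ≤-refl)) ⟩
      (𝔼 (w i) λ a → (𝔼 (w j) λ b → 𝔼 (w k) (λ c → 𝟙 (E a b c))) - d + (s + s + s))
        ≡⟨ trans (𝔼-+ (w i) _ _) (cong₂ _+_ (trans (𝔼-- (w i) _ _) (cong (λ z → triple E (w i) (w j) (w k) - z) (𝔼-const (Pw i) d))) (𝔼-const (Pw i) _)) ⟩
      triple E (w i) (w j) (w k) - d + (s + s + s) ∎
      where
      open ≤-Reasoning
      point : ∀ a b c → G a b c ≤ 𝟙 (E a b c) - d + (δ[ a , b ] + δ[ b , c ] + δ[ a , c ])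
      point a b c = by-diff (d * (D - (1ℚ - p - q′ - r)) + (1ℚ - d) * (p + q′ + r))
        (+-nonneg (*-nonneg d≥0 (diff (distinct-bound a b c))) (*-nonneg (diff d≤1) (+-nonneg (+-nonneg (𝟙-nonneg (a == b)) (𝟙-nonneg (b == c))) (𝟙-nonneg (a == c)))))
        (solve 6 (λ e d D p q r → e :- d :* D :+ (d :* (D :- (con 1ℚ :- p :- q :- r)) :+ (con 1ℚ :- d) :* (p :+ q :+ r)) := e :- d :+ (p :+ q :+ r)) refl (𝟙 (E a b c)) d D p q′ r)
        where
        D = distinct a b c
        p = δ[ a , b ]
        q′ = δ[ b , c ]
        r = δ[ a , c ]

    x : ℚ → Fin size → ℚ
    x k a = k * ∑ λ i → w i a

    linear : ∀ k h → ∑ (λ a → x k a * h a) ≡ k * ∑ λ i → 𝔼 (w i) h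
    linear k h = begin
      ∑ (λ a → k * ∑ (λ i → w i a) * h a)      ≡⟨ ∑-cong (λ a → trans (*-assoc k _ (h a)) (*-right (∑-*ʳ (h a) _))) ⟩
      ∑ (λ a → k * ∑ (λ i → w i a * h a))      ≡⟨ sym (∑-*ˡ k _) ⟩
      k * ∑ (λ a → ∑ (λ i → w i a * h a))      ≡⟨ *-right (trans (∑-swap _) (∑-cong λ i → sym (𝔼-def (w i) h))) ⟩
      k * ∑ (λ i → 𝔼 (w i) h)                  ∎
      where open ≡-Reasoning

    expand : ∀ k → cubic G (x k) ≡ k * (k * (k * ∑∑∑ λ i j l → 𝔼 (w i) λ a → 𝔼 (w j) λ b → 𝔼 (w l) λ c → G a b c))
    expand k = begin
      cubic G (x k)
        ≡⟨ trans (linear k _) (*-right (∑-cong λ i → trans (𝔼-cong (w i) λ a → linear k _) (𝔼-*ˡ (w i) k _))) ⟩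
      k * ∑ (λ i → k * 𝔼 (w i) λ a → ∑ λ j → 𝔼 (w j) λ b → ∑ λ c → x k c * G a b c)
        ≡⟨ *-right (trans (sym (∑-*ˡ k _)) (*-right (∑-cong λ i → trans (𝔼-∑ (w i) _) (∑-cong λ j →
             trans (𝔼-cong (w i) λ a → trans (𝔼-cong (w j) λ b → trans (linear k _) refl) (𝔼-*ˡ (w j) k _)) (𝔼-*ˡ (w i) k _))))) ⟩
      k * (k * ∑ (λ i → ∑ λ j → k * 𝔼 (w i) λ a → 𝔼 (w j) λ b → ∑ λ l → 𝔼 (w l) (G a b)))
        ≡⟨ *-right (*-right (trans (∑-cong λ i → sym (∑-*ˡ k _)) (trans (sym (∑-*ˡ k _)) (*-right (∑-cong λ i → ∑-cong λ j →
             trans (𝔼-cong (w i) λ a → 𝔼-∑ (w j) _) (𝔼-∑ (w i) _)))))) ⟩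
      k * (k * (k * ∑∑∑ λ i j l → 𝔼 (w i) λ a → 𝔼 (w j) λ b → 𝔼 (w l) λ c → G a b c)) ∎
      where open ≡-Reasoning

    triple-≤1 : ∀ i j k → triple E (w i) (w j) (w k) ≤ 1ℚ
    triple-≤1 i j k = 𝔼-≤ (Pw i) 1ℚ λ a → density-≤1 (Pw j) (Pw k) (E a)

    triple₁₂ : ∀ i j k → triple E (w i) (w j) (w k) ≡ triple E (w j) (w i) (w k)
    triple₁₂ i j k = trans (𝔼-swap (w i) (w j) _) (𝔼-cong (w j) λ b → 𝔼-cong (w i) λ a → 𝔼-cong (w k) λ c → cong 𝟙 (sym₁₂ a b c))

    triple₂₃ : ∀ i j k → triple E (w i) (w j) (w k) ≡ triple E (w i) (w k) (w j)
    triple₂₃ i j k = 𝔼-cong (w i) λ a → trans (𝔼-swap (w j) (w k) _) (𝔼-cong (w k) λ c → 𝔼-cong (w j) λ b → cong 𝟙 (sym₂₃ a b c))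

    module _ {β : ℚ} (β≥0 : 0ℚ ≤ β) (sparse : ∀ {i j k} → i Fin.< j → j Fin.< k → triple E (w i) (w j) (w k) ≤ β) where

      sorted : ∀ i j k → i ≢ j → j ≢ k → i ≢ k → triple E (w i) (w j) (w k) ≤ β
      sorted i j k ij jk ik with Fin.<-cmp i j | Fin.<-cmp j k | Fin.<-cmp i k
      ... | tri≈ _ e _ | _ | _ = ⊥-elim (ij e)
      ... | _ | tri≈ _ e _ | _ = ⊥-elim (jk e)
      ... | _ | _ | tri≈ _ e _ = ⊥-elim (ik e)
      ... | tri< p _ _ | tri< q _ _ | _          = sparse p q
      ... | tri< p _ _ | tri> _ _ q | tri< r _ _ = ≤-trans (≤-reflexive (triple₂₃ i j k)) (sparse r q)
      ... | tri< p _ _ | tri> _ _ q | tri> _ _ r = ≤-trans (≤-reflexive (trans (triple₂₃ i j k) (triple₁₂ i k j))) (sparse r p)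
      ... | tri> _ _ p | tri< q _ _ | tri< r _ _ = ≤-trans (≤-reflexive (triple₁₂ i j k)) (sparse p r)
      ... | tri> _ _ p | tri< q _ _ | tri> _ _ r = ≤-trans (≤-reflexive (trans (triple₁₂ i j k) (triple₂₃ j i k))) (sparse q r)
      ... | tri> _ _ p | tri> _ _ q | _          = ≤-trans (≤-reflexive (trans (triple₂₃ i j k) (trans (triple₁₂ i k j) (triple₂₃ k i j)))) (sparse q p)

      -- Triples with a repeated index get the trivial bound 1. They number at most 3 q² among q³,
      -- so they contribute only the terms `k₀ + k₀ + k₀` in the end.
      all-triples : ∀ i j k → triple E (w i) (w j) (w k) ≤ β + (δ[ i , j ] + δ[ j , k ] + δ[ i , k ])
      all-triples i j k with i Fin.≟ j | j Fin.≟ k | i Fin.≟ k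
      ... | no ij | no jk | no ik = ≤-trans (sorted i j k ij jk ik) (≤-reflexive (solve 1 (λ β → β := β :+ (con 0ℚ :+ con 0ℚ :+ con 0ℚ)) refl β))
      ... | yes _ | y | z = one (isYes y) (isYes z) (solve 3 (λ β y z → con 1ℚ :+ (β :+ (y :+ z)) := β :+ (con 1ℚ :+ y :+ z)) refl β _ _)
        where
        one : ∀ y z {t} → 1ℚ + (β + (𝟙 y + 𝟙 z)) ≡ t → triple E (w i) (w j) (w k) ≤ t
        one y z eq = ≤-trans (triple-≤1 i j k) (by-diff _ (+-nonneg β≥0 (+-nonneg (𝟙-nonneg y) (𝟙-nonneg z))) eq)
      ... | no _ | yes _ | z = ≤-trans (triple-≤1 i j k) (by-diff (β + 𝟙 (isYes z)) (+-nonneg β≥0 (𝟙-nonneg (isYes z)))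
        (solve 2 (λ β z → con 1ℚ :+ (β :+ z) := β :+ (con 0ℚ :+ con 1ℚ :+ z)) refl β (𝟙 (isYes z))))
      ... | no _ | no _ | yes _ = ≤-trans (triple-≤1 i j k) (by-diff β β≥0
        (solve 1 (λ β → con 1ℚ :+ β := β :+ (con 0ℚ :+ con 0ℚ :+ con 1ℚ)) refl β))

      private
        Q = fromℕ q
        Q≥0 = fromℕ-nonneg q
        r = β - d + (s + s + s)

      total-bound : ∑∑∑ (λ i j k → 𝔼 (w i) λ a → 𝔼 (w j) λ b → 𝔼 (w k) λ c → G a b c) ≤
                    Q * (Q * (Q * r)) + (Q * Q + Q * Q + Q * Q)
      total-bound = begin
        ∑∑∑ (λ i j k → 𝔼 (w i) λ a → 𝔼 (w j) λ b → 𝔼 (w k) λ c → G a b c)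
          ≤⟨ ∑-mono (λ i → ∑-mono λ j → ∑-mono λ k → ≤-trans (mixed i j k) (≤-trans (+-mono-≤ (+-mono-≤ (all-triples i j k) ≤-refl) ≤-refl)
               (≤-reflexive (solve 6 (λ β d s x y z → β :+ (x :+ y :+ z) :- d :+ (s :+ s :+ s) := β :- d :+ (s :+ s :+ s) :+ (x :* con 1ℚ :+ y :* con 1ℚ :+ z :* con 1ℚ)) refl β d s δ[ i , j ] δ[ j , k ] δ[ i , k ])))) ⟩
        ∑∑∑ (λ i j k → r + (δ[ i , j ] * 1ℚ + δ[ j , k ] * 1ℚ + δ[ i , k ] * 1ℚ))
          ≡⟨ ∑-cong (λ i → ∑-cong λ j → trans (∑-+ _ _) (cong₂ _+_ (∑-const q r)
               (trans (∑-+ _ _) (cong₂ _+_ (trans (∑-+ _ _) (cong₂ _+_ (∑-const q _) (∑-δ j (λ _ → 1ℚ)))) (∑-δ i (λ _ → 1ℚ)))))) ⟩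
        ∑ (λ i → ∑ λ j → Q * r + (Q * (δ[ i , j ] * 1ℚ) + 1ℚ + 1ℚ))
          ≡⟨ ∑-cong (λ i → trans (∑-+ _ _) (cong₂ _+_ (∑-const q _) (trans (∑-+ _ _) (cong₂ _+_ (trans (∑-+ _ _) (cong₂ _+_
               (trans (sym (∑-*ˡ Q _)) (*-right (∑-δ i (λ _ → 1ℚ)))) (∑-const q 1ℚ))) (∑-const q 1ℚ))))) ⟩
        ∑ {q} (λ i → Q * (Q * r) + (Q * 1ℚ + Q * 1ℚ + Q * 1ℚ))
          ≡⟨ trans (∑-const q _) (solve 2 (λ Q r → Q :* (Q :* (Q :* r) :+ (Q :* con 1ℚ :+ Q :* con 1ℚ :+ Q :* con 1ℚ)) := Q :* (Q :* (Q :* r)) :+ (Q :* Q :+ Q :* Q :+ Q :* Q)) refl Q r) ⟩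
        Q * (Q * (Q * r)) + (Q * Q + Q * Q + Q * Q) ∎
        where
        open ≤-Reasoning

      -- Apply the density condition to the weights k₀ z Σ w i ≤ 1, where k₀ = 1/q and z = 1/s.
      weighted-density : ∀ {k₀ z P} → Q * k₀ ≡ 1ℚ → 0ℚ ≤ k₀ → s * z ≡ 1ℚ → 0ℚ < z → N ≤ z * P →
                         d ≤ β + (s + s + s) + (k₀ + k₀ + k₀) + 6ℚ * (μ * (P * (P * P)))
      weighted-density {k₀} {z} {P} Qk₀ k₀≥0 sz z>0 N≤ = cancel (*-cancel-≤ (z * (z * z)) (*-pos z>0 (*-pos z>0 z>0)) (begin
        z * (z * z) * 0ℚ
          ≡⟨ solve 2 (λ z m → z :* (z :* z) :* con 0ℚ := :- m :+ m) refl z (6ℚ * (μ * (N * (N * N)))) ⟩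
        - (6ℚ * (μ * (N * (N * N)))) + 6ℚ * (μ * (N * (N * N)))
          ≤⟨ +-mono-≤ (fractional (x (k₀ * z)) x≥0 x≤1) (*-mono-≤ˡ 6ℚ (fromℕ-nonneg 6) (*-mono-≤ˡ μ μ≥0 N³)) ⟩
        cubic G (x (k₀ * z)) + 6ℚ * (μ * (z * P * (z * P * (z * P))))
          ≡⟨ +-left (expand (k₀ * z)) ⟩
        k * (k * (k * ∑∑∑ (λ i j l → 𝔼 (w i) λ a → 𝔼 (w j) λ b → 𝔼 (w l) λ c → G a b c))) + 6ℚ * (μ * (z * P * (z * P * (z * P))))
          ≤⟨ +-mono-≤ (*-mono-≤ˡ k k≥0 (*-mono-≤ˡ k k≥0 (*-mono-≤ˡ k k≥0 total-bound))) ≤-refl ⟩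
        k * (k * (k * (Q * (Q * (Q * r)) + (Q * Q + Q * Q + Q * Q)))) + 6ℚ * (μ * (z * P * (z * P * (z * P))))
          ≡⟨ solve 7 (λ k₀ z Q r S μ P → (k₀ :* z) :* ((k₀ :* z) :* ((k₀ :* z) :* (Q :* (Q :* (Q :* r)) :+ (Q :* Q :+ Q :* Q :+ Q :* Q)))) :+ S :* (μ :* (z :* P :* (z :* P :* (z :* P))))
               := z :* (z :* z) :* ((Q :* k₀) :* (Q :* k₀) :* (Q :* k₀) :* r :+ (Q :* k₀) :* (Q :* k₀) :* (k₀ :+ k₀ :+ k₀) :+ S :* (μ :* (P :* (P :* P))))) refl k₀ z Q r 6ℚ μ P ⟩
        z * (z * z) * (Q * k₀ * (Q * k₀) * (Q * k₀) * r + Q * k₀ * (Q * k₀) * (k₀ + k₀ + k₀) + 6ℚ * (μ * (P * (P * P))))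
          ≡⟨ *-right (cong (λ e → e * e * e * r + e * e * (k₀ + k₀ + k₀) + 6ℚ * (μ * (P * (P * P)))) Qk₀) ⟩
        z * (z * z) * (1ℚ * 1ℚ * 1ℚ * r + 1ℚ * 1ℚ * (k₀ + k₀ + k₀) + 6ℚ * (μ * (P * (P * P)))) ∎))
        where
        open ≤-Reasoning
        k = k₀ * z
        z≥0 = <⇒≤ z>0
        k≥0 : 0ℚ ≤ k
        k≥0 = *-nonneg k₀≥0 z≥0
        N≥0 : 0ℚ ≤ N
        N≥0 = fromℕ-nonneg size
        zP≥0 : 0ℚ ≤ z * P
        zP≥0 = ≤-trans N≥0 N≤
        N³ : N * (N * N) ≤ z * P * (z * P * (z * P))
        N³ = *-mono-≤ N≥0 (*-nonneg zP≥0 zP≥0) N≤ (*-mono-≤ N≥0 zP≥0 N≤ N≤)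
        x≥0 : ∀ v → 0ℚ ≤ x k v
        x≥0 v = *-nonneg k≥0 (∑-nonneg λ i → nonneg (Pw i) v)
        -- The q cells may coincide, so up to q weights of size at most `s` can meet in one vertex;
        -- the factor 1 / (q s) compensates for this.
        x≤1 : ∀ v → x k v ≤ 1ℚ
        x≤1 v = ≤-trans (*-mono-≤ˡ k k≥0 (∑-≤-const s λ i → w≤s i v)) (≤-reflexive
          (trans (solve 4 (λ k z Q s → k :* z :* (Q :* s) := Q :* k :* (s :* z)) refl k₀ z Q s) (trans (cong₂ _*_ Qk₀ sz) (*-identityˡ 1ℚ))))
        cancel : 0ℚ ≤ 1ℚ * 1ℚ * 1ℚ * r + 1ℚ * 1ℚ * (k₀ + k₀ + k₀) + 6ℚ * (μ * (P * (P * P))) →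
                 d ≤ β + (s + s + s) + (k₀ + k₀ + k₀) + 6ℚ * (μ * (P * (P * P)))
        cancel le = by-diff _ le (solve 5 (λ β d s k m → d :+ (con 1ℚ :* con 1ℚ :* con 1ℚ :* (β :- d :+ (s :+ s :+ s)) :+ con 1ℚ :* con 1ℚ :* (k :+ k :+ k) :+ m)
          := β :+ (s :+ s :+ s) :+ (k :+ k :+ k) :+ m) refl β d s k₀ (6ℚ * (μ * (P * (P * P)))))

-- Uniform sampling of cells

𝔼ᵛ-𝔼-swap : (w : Fin n → ℚ) (u : Fin m → ℚ) → ∀ r (F : Fin m → Vec (Fin n) r → ℚ) →
             𝔼ᵛ w r (λ v → 𝔼 u λ a → F a v) ≡ 𝔼 u λ a → 𝔼ᵛ w r (F a)
𝔼ᵛ-𝔼-swap w u zero    F = refl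
𝔼ᵛ-𝔼-swap w u (suc r) F = trans (𝔼-cong w λ x → 𝔼ᵛ-𝔼-swap w u r λ a → F a ∘ (x ∷_)) (𝔼-swap w u _)

𝔼ᵛ-∑ : (w : Fin n → ℚ) → ∀ r (F : Fin m → Vec (Fin n) r → ℚ) → 𝔼ᵛ w r (λ v → ∑ λ i → F i v) ≡ ∑ λ i → 𝔼ᵛ w r (F i)
𝔼ᵛ-∑ w zero    F = refl
𝔼ᵛ-∑ w (suc r) F = trans (𝔼-cong w λ x → 𝔼ᵛ-∑ w r λ i → F i ∘ (x ∷_)) (𝔼-∑ w _)

module Uniform {n : ℕ} (n>0 : 0ℚ < fromℕ n) where
  opaque
    1/n : ℚ
    1/n = proj₁ (*-inverse (fromℕ n) n>0)

    n*1/n : fromℕ n * 1/n ≡ 1ℚ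
    n*1/n = proj₂ (*-inverse (fromℕ n) n>0)

  1/n≥0 : 0ℚ ≤ 1/n
  1/n≥0 = *-cancel-≤ (fromℕ n) n>0 (≤-trans (≤-reflexive (zeroʳ _)) (≤-trans 0≤1 (≤-reflexive (sym n*1/n))))

  unif : Fin n → ℚ
  unif _ = 1/n

  unif-prob : Prob unif
  unif-prob = record { nonneg = λ _ → 1/n≥0 ; total = trans (∑-const n 1/n) n*1/n }

  𝔼-unif : (f : Fin n → ℚ) → 𝔼 unif f ≡ 1/n * ∑ f
  𝔼-unif f = trans (𝔼-def unif f) (sym (∑-*ˡ 1/n f))

  𝔼-unif-≤ : ∀ (f : Fin n → ℚ) {c} → ∑ f ≤ fromℕ n * c → 𝔼 unif f ≤ c
  𝔼-unif-≤ f {c} le = ≤-trans (≤-reflexive (𝔼-unif f)) (≤-trans (*-mono-≤ˡ 1/n 1/n≥0 le)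
    (≤-reflexive (trans (sym (*-assoc 1/n _ c)) (trans (*-left (trans (*-comm 1/n _) n*1/n)) (*-identityˡ c)))))

  𝔼𝔼-unif-≤ : ∀ (f : Fin n → Fin n → ℚ) {c} → ∑ (λ a → ∑ (f a)) ≤ fromℕ n * (c * fromℕ n) → (𝔼 unif λ a → 𝔼 unif (f a)) ≤ c
  𝔼𝔼-unif-≤ f {c} le = 𝔼-unif-≤ _ (≤-trans (≤-reflexive (trans (∑-cong λ a → 𝔼-unif (f a)) (sym (∑-*ˡ 1/n _))))
    (≤-trans (*-mono-≤ˡ 1/n 1/n≥0 le) (≤-reflexive (trans (solve 3 (λ i n c → i :* (n :* (c :* n)) := (n :* i) :* (n :* c)) refl 1/n (fromℕ n) c)
      (trans (*-left n*1/n) (*-identityˡ _))))))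

  module _ {N : ℕ} (χ : Fin n → Fin N) where
    open Cells χ

    𝔼-unif-K : (f : Fin n → ℚ) → 𝔼 unif (λ x → 𝔼 (K x) f) ≡ 𝔼 unif f
    𝔼-unif-K f = begin
      𝔼 unif (λ x → 𝔼 (K x) f)              ≡⟨ 𝔼-unif _ ⟩
      1/n * ∑ (λ x → 𝔼 (K x) f)             ≡⟨ *-right (∑-cong λ x → sym (*-identityʳ _)) ⟩
      1/n * ∑ (λ x → 𝔼 (K x) f * 1ℚ)        ≡⟨ *-right (K-adjoint f (λ _ → 1ℚ)) ⟩
      1/n * ∑ (λ x → f x * 𝔼 (K x) (λ _ → 1ℚ)) ≡⟨ *-right (∑-cong λ x → trans (*-right (𝔼-const (K-prob x) 1ℚ)) (*-identityʳ _)) ⟩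
      1/n * ∑ f                             ≡⟨ 𝔼-unif f ⟨
      𝔼 unif f                              ∎
      where open ≡-Reasoning

    lift : ∀ r → (Vec (Fin n) r → ℚ) → Vec (Fin n) r → ℚ
    lift zero    h []       = h []
    lift (suc r) h (x ∷ xs) = 𝔼 (K x) λ a → lift r (h ∘ (a ∷_)) xs

    𝔼ᵛ-lift : ∀ r h → 𝔼ᵛ unif r (lift r h) ≡ 𝔼ᵛ unif r h
    𝔼ᵛ-lift zero    h = refl
    𝔼ᵛ-lift (suc r) h = trans (𝔼-cong unif λ x → 𝔼ᵛ-𝔼-swap unif (K x) r _)
      (trans (𝔼-unif-K _) (𝔼-cong unif λ a → 𝔼ᵛ-lift r (h ∘ (a ∷_))))

    lift-mono : ∀ r {h h′} → (∀ v → h v ≤ h′ v) → ∀ v → lift r h v ≤ lift r h′ v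
    lift-mono zero    le []       = le []
    lift-mono (suc r) le (x ∷ xs) = 𝔼-mono (K-prob x) λ a → lift-mono r (le ∘ (a ∷_)) xs

    lift-nonneg : ∀ r {h} → (∀ v → 0ℚ ≤ h v) → ∀ v → 0ℚ ≤ lift r h v
    lift-nonneg zero    h≥0 []       = h≥0 []
    lift-nonneg (suc r) h≥0 (x ∷ xs) = 𝔼-nonneg (K-prob x) λ a → lift-nonneg r (h≥0 ∘ (a ∷_)) xs

    -- A random vertex of the cell of a uniform vertex is again uniform, so losses averaged over
    -- cells have the same expectation as the losses themselves. The first moment method then
    -- applies to the sum of all L losses at once.
    avoid : ∀ K r {L} (loss : Fin L → Vec (Fin n) r → ℚ) → (∀ i v → 0ℚ ≤ loss i v) →
            ∀ {b} → (∀ i → 𝔼ᵛ unif r (loss i) ≤ b) → fromℕ (2 ℕ.^ K) * (fromℕ L * b) < 1ℚ →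
            ∃ λ xs → length xs ≡ K × Increasing r (λ v → ∀ i → lift r (loss i) v < 1ℚ) xs
    avoid K r {L} loss loss≥0 {b} small rare = let xs , len , inc = good-list unif-prob K r {F} (λ v → lift-nonneg r (λ v → ∑-nonneg λ i → loss≥0 i v) v) expectation
                                               in xs , len , Increasing-map r (λ {v} lt i → ≤-<-trans (lift-mono r (λ v → ∑-member (λ i → loss i v) (λ i → loss≥0 i v) i) v) lt) xs inc
      where
      F : Vec (Fin n) r → ℚ
      F = lift r λ v → ∑ λ i → loss i v
      expectation : fromℕ (2 ℕ.^ K) * 𝔼ᵛ unif r F < 1ℚ
      expectation = ≤-<-trans (*-mono-≤ˡ _ (fromℕ-nonneg _) (≤-trans (≤-reflexive (trans (𝔼ᵛ-lift r _) (𝔼ᵛ-∑ unif r loss))) (∑-≤-const b small))) rare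
      Increasing-map : ∀ {A : Set} r {P Q : Vec A r → Set} → (∀ {v} → P v → Q v) → ∀ xs → Increasing r P xs → Increasing r Q xs
      Increasing-map zero    f xs p = f p
      Increasing-map (suc r) f [] p = _
      Increasing-map (suc r) f (x ∷ xs) (p , q) = Increasing-map r f xs p , Increasing-map (suc r) f xs q

    module _ (ρ : ℚ) (ρ≥0 : 0ℚ ≤ ρ) where

      tiny : Fin n → Bool
      tiny v = isYes (size v <? ρ * fromℕ n)

      few-tiny : 𝔼 unif (𝟙 ∘ tiny) ≤ fromℕ N * ρ
      few-tiny = 𝔼-unif-≤ _ (begin
        ∑ (𝟙 ∘ tiny)                                       ≡⟨ ∑-by-class χ (λ _ v → 𝟙 (tiny v)) ⟩
        ∑ (λ j → ∑ λ v → 𝟙 (χ v == j) * 𝟙 (tiny v))        ≤⟨ ∑-≤-const (ρ * fromℕ n) cell ⟩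
        fromℕ N * (ρ * fromℕ n)                            ≡⟨ solve 3 (λ N ρ n → N :* (ρ :* n) := n :* (N :* ρ)) refl (fromℕ N) ρ (fromℕ n) ⟩
        fromℕ n * (fromℕ N * ρ)                            ∎)
        where
        open ≤-Reasoning
        cell : ∀ j → ∑ (λ v → 𝟙 (χ v == j) * 𝟙 (tiny v)) ≤ ρ * fromℕ n
        cell j with Fin.any? (λ v → (χ v Fin.≟ j) ×-dec (size v <? ρ * fromℕ n))
        ... | yes (v₀ , refl , lt) = ≤-trans (∑-mono λ v → ≤-trans (*-mono-≤ˡ _ (𝟙-nonneg (χ v == χ v₀)) (𝟙≤1 (tiny v)))
                (≤-reflexive (trans (*-identityʳ _) (cong 𝟙 (==-sym (χ v) (χ v₀)))))) (<⇒≤ lt)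
        ... | no none = ≤-trans (≤-reflexive (trans (∑-cong zero-term) (∑-0 n))) (*-nonneg ρ≥0 (fromℕ-nonneg n))
          where
          zero-term : ∀ v → 𝟙 (χ v == j) * 𝟙 (tiny v) ≡ 0ℚ
          zero-term v with χ v Fin.≟ j | size v <? ρ * fromℕ n
          ... | yes p | yes q = ⊥-elim (none (v , p , q))
          ... | yes _ | no _ = zeroʳ 1ℚ
          ... | no _ | _ = zeroˡ _

      K-≤ : ∀ {s} → 0ℚ ≤ s → s * (ρ * fromℕ n) ≡ 1ℚ → ∀ v → tiny v ≡ false → ∀ a → K v a ≤ s
      K-≤ {s} s≥0 eq v big a = ≤-trans (*-mono-≤ʳ _ (1/size-pos v) (𝟙≤1 (χ v == χ a))) (≤-trans (≤-reflexive (*-identityˡ _))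
        (*-cancel-≤ (size v) (size-pos v) (≤-trans (≤-reflexive (trans (size*1/size v) (sym eq)))
          (≤-trans (*-mono-≤ˡ s s≥0 (not-tiny big)) (≤-reflexive (*-comm s (size v)))))))
        where
        not-tiny : tiny v ≡ false → ρ * fromℕ n ≤ size v
        not-tiny big with size v <? ρ * fromℕ n
        ... | no ¬lt = ≮⇒≥ ¬lt

-- Losses on quadruples of cells

reciprocal : ∀ k → ∃ λ η → fromℕ (suc k) * η ≡ 1ℚ × 0ℚ < η
reciprocal k = let η , eq = *-inverse (fromℕ (suc k)) (fromℕ-pos k) in
  η , eq , ≰⇒> λ η≤0 → <-irrefl refl (<-≤-trans (ℚ.positive⁻¹ 1ℚ)
    (≤-trans (≤-reflexive (sym eq)) (≤-trans (*-mono-≤ˡ _ (fromℕ-nonneg (suc k)) η≤0) (≤-reflexive (zeroʳ _)))))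

small-reciprocal : ∀ h → 0ℚ < h → ∃ λ k → ∃ λ η → fromℕ (suc k) * η ≡ 1ℚ × 0ℚ < η × η ≤ h
small-reciprocal h h>0 = let k , 1≤kh = archimedean h h>0 ; η , eq , η>0 = reciprocal k in
  k , η , eq , η>0 , *-cancel-≤ (fromℕ (suc k)) (fromℕ-pos k) (≤-trans (≤-reflexive eq) 1≤kh)

fraction : ∀ C h → 0ℚ < h → ∃ λ b → 0ℚ < b × fromℕ C * b ≤ h
fraction C h h>0 = let η , eq , η>0 = reciprocal C in
  h * η , *-pos h>0 η>0 , ≤-trans (*-mono-≤ʳ (h * η) (<⇒≤ (*-pos h>0 η>0)) (fromℕ-mono (ℕ.n≤1+n C)))
    (≤-reflexive (trans (solve 3 (λ c h e → c :* (h :* e) := h :* (c :* e)) refl (fromℕ (suc C)) h η) (trans (*-right eq) (*-identityʳ h))))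

nth : ∀ {A : Set} → A → List A → ℕ → A
nth d xs t with t ℕ.<? length xs
... | yes lt = List.lookup xs (Fin.fromℕ< lt)
... | no _   = d

nth-lookup : ∀ {A : Set} (d : A) xs {t} (lt : t ℕ.< length xs) → nth d xs t ≡ List.lookup xs (Fin.fromℕ< lt)
nth-lookup d xs {t} lt with t ℕ.<? length xs
... | yes lt′ = cong (List.lookup xs) (Fin.fromℕ<-cong _ _ refl lt′ lt)
... | no ¬lt = ⊥-elim (¬lt lt)

Increasing₃ : ∀ {A : Set} {P : Vec A 3 → Set} {d xs} → Increasing 3 P xs → ∀ {i j k} → i ℕ.< j → j ℕ.< k → k ℕ.< length xs →
              P (nth d xs i ∷ nth d xs j ∷ nth d xs k ∷ [])
Increasing₃ {P = P} {d} {xs} inc {i} {j} {k} ij jk kl =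
  subst P (cong₂ _∷_ (sym (nth-lookup d xs il)) (cong₂ _∷_ (sym (nth-lookup d xs jl)) (cong (_∷ []) (sym (nth-lookup d xs kl)))))
    (Increasing-∈ inc _ (lookup-⊆ xs (Fin.fromℕ< il ∷ Fin.fromℕ< jl ∷ Fin.fromℕ< kl ∷ [])
      ((<F il jl ij ∷ <F il kl (ℕ.<-trans ij jk) ∷ []) ∷ (<F jl kl jk ∷ []) ∷ [] ∷ [])))
  where
  jl = ℕ.<-trans jk kl
  il = ℕ.<-trans ij jl
  <F : ∀ {s t} (p : s ℕ.< length xs) (q : t ℕ.< length xs) → s ℕ.< t → Fin.fromℕ< p Fin.< Fin.fromℕ< q
  <F p q lt = subst₂ ℕ._<_ (sym (Fin.toℕ-fromℕ< p)) (sym (Fin.toℕ-fromℕ< q)) lt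

Increasing₄ : ∀ {A : Set} {P : Vec A 4 → Set} {d xs} → Increasing 4 P xs → ∀ {i j k l} → i ℕ.< j → j ℕ.< k → k ℕ.< l → l ℕ.< length xs →
              P (nth d xs i ∷ nth d xs j ∷ nth d xs k ∷ nth d xs l ∷ [])
Increasing₄ {P = P} {d} {xs} inc {i} {j} {k} {l} ij jk kl ll =
  subst P (cong₂ _∷_ (sym (nth-lookup d xs il)) (cong₂ _∷_ (sym (nth-lookup d xs jl)) (cong₂ _∷_ (sym (nth-lookup d xs kl′)) (cong (_∷ []) (sym (nth-lookup d xs ll))))))
    (Increasing-∈ inc _ (lookup-⊆ xs (Fin.fromℕ< il ∷ Fin.fromℕ< jl ∷ Fin.fromℕ< kl′ ∷ Fin.fromℕ< ll ∷ [])
      ((<F il jl ij ∷ <F il kl′ (ℕ.<-trans ij jk) ∷ <F il ll (ℕ.<-trans ij (ℕ.<-trans jk kl)) ∷ []) ∷ (<F jl kl′ jk ∷ <F jl ll (ℕ.<-trans jk kl) ∷ []) ∷ (<F kl′ ll kl ∷ []) ∷ [] ∷ [])))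
  where
  kl′ = ℕ.<-trans kl ll
  jl = ℕ.<-trans jk kl′
  il = ℕ.<-trans ij jl
  <F : ∀ {s t} (p : s ℕ.< length xs) (q : t ℕ.< length xs) → s ℕ.< t → Fin.fromℕ< p Fin.< Fin.fromℕ< q
  <F p q lt = subst₂ ℕ._<_ (sym (Fin.toℕ-fromℕ< p)) (sym (Fin.toℕ-fromℕ< q)) lt

-- The losses that the cells of a quadruple x₁ < x₂ < x₃ < x₄ should avoid.
module Losses {n M N : ℕ} (E : Fin n → Fin n → Fin n → Bool) (κ : Fin n → Fin n → Fin M) (U : Fin n → Fin M → Fin n → Bool)
  (χ : Fin n → Fin N) (irr : Fin N → Fin N → Bool) (A ρ : ℚ) (A≥0 : 0ℚ ≤ A) (n>0 : 0ℚ < fromℕ n) (ρ≥0 : 0ℚ ≤ ρ) where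
  open Link E κ U
  open Levels E κ U
  open Cells χ
  open Uniform n>0

  escaping : Fin n → Fin n → Fin n → ℚ
  escaping a b c = 𝟙 (E a b c ∧ not (U a (κ a b) c))

  spreading : Fin n → Fin n → Fin n → Fin n → ℚ
  spreading a b c d = 𝟙 (E a c d ∧ (U a (κ a b) c ∧ U a (κ a b) d))

  -- Losses 0 to 3 are what covers and `common-class` need, once seen from each of the two outer
  -- cells; losses 4 to 7 are irregular pairs, and loss 8 is a small first cell. The factor `A`
  -- turns the common threshold 1 into the bound `ζ` = 1 / A. The indicators are constant on cells,
  -- so a cell average below 1 is 0.
  loss : Fin 9 → Vec (Fin n) 4 → ℚ
  loss 0F (a ∷ b ∷ c ∷ d ∷ []) = A * escaping a c b
  loss 1F (a ∷ b ∷ c ∷ d ∷ []) = A * escaping c a b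
  loss 2F (a ∷ b ∷ c ∷ d ∷ []) = A * spreading a d b c
  loss 3F (a ∷ b ∷ c ∷ d ∷ []) = A * spreading d a b c
  loss 4F (a ∷ b ∷ c ∷ d ∷ []) = 𝟙 (irr (χ a) (χ b))
  loss 5F (a ∷ b ∷ c ∷ d ∷ []) = 𝟙 (irr (χ c) (χ b))
  loss 6F (a ∷ b ∷ c ∷ d ∷ []) = 𝟙 (irr (χ a) (χ d))
  loss 7F (a ∷ b ∷ c ∷ d ∷ []) = 𝟙 (irr (χ d) (χ a))
  loss 8F (a ∷ b ∷ c ∷ d ∷ []) = 𝟙 (tiny χ ρ ρ≥0 a)

  loss-nonneg : ∀ i v → 0ℚ ≤ loss i v
  loss-nonneg 0F (a ∷ b ∷ c ∷ d ∷ []) = *-nonneg A≥0 (𝟙-nonneg (E a c b ∧ not (U a (κ a c) b)))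
  loss-nonneg 1F (a ∷ b ∷ c ∷ d ∷ []) = *-nonneg A≥0 (𝟙-nonneg (E c a b ∧ not (U c (κ c a) b)))
  loss-nonneg 2F (a ∷ b ∷ c ∷ d ∷ []) = *-nonneg A≥0 (𝟙-nonneg (E a b c ∧ (U a (κ a d) b ∧ U a (κ a d) c)))
  loss-nonneg 3F (a ∷ b ∷ c ∷ d ∷ []) = *-nonneg A≥0 (𝟙-nonneg (E d b c ∧ (U d (κ d a) b ∧ U d (κ d a) c)))
  loss-nonneg 4F (a ∷ b ∷ c ∷ d ∷ []) = 𝟙-nonneg (irr (χ a) (χ b))
  loss-nonneg 5F (a ∷ b ∷ c ∷ d ∷ []) = 𝟙-nonneg (irr (χ c) (χ b))
  loss-nonneg 6F (a ∷ b ∷ c ∷ d ∷ []) = 𝟙-nonneg (irr (χ a) (χ d))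
  loss-nonneg 7F (a ∷ b ∷ c ∷ d ∷ []) = 𝟙-nonneg (irr (χ d) (χ a))
  loss-nonneg 8F (a ∷ b ∷ c ∷ d ∷ []) = 𝟙-nonneg (tiny χ ρ ρ≥0 a)

  private
    const : ∀ {u : Fin n → ℚ} → Prob u → ∀ {c} → 𝔼 u (λ _ → c) ≡ c
    const Pu {c} = 𝔼-const Pu c

  module _ {e : ℚ}
    (escape≤ : escape unif unif unif ≤ e) (spread≤ : spread unif unif unif unif ≤ e)
    (irr≤ : (𝔼 unif λ a → 𝔼 unif λ b → 𝟙 (irr (χ a) (χ b))) ≤ e) (tiny≤ : 𝔼 unif (𝟙 ∘ tiny χ ρ ρ≥0) ≤ e)
    {β : ℚ} (Ae≤β : A * e ≤ β) (e≤β : e ≤ β) where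

    private
      Pᵤ = unif-prob
      scale : ∀ {x} → x ≤ e → A * x ≤ β
      scale x≤e = ≤-trans (*-mono-≤ˡ A A≥0 x≤e) Ae≤β

    expected-loss : ∀ i → 𝔼ᵛ unif 4 (loss i) ≤ β
    expected-loss 0F = ≤-trans (≤-reflexive (trans
      (𝔼-cong unif λ a → trans (𝔼-cong unif λ b → trans (𝔼-cong unif λ c → const Pᵤ) (𝔼-*ˡ unif A _)) (𝔼-*ˡ unif A _)) (𝔼-*ˡ unif A _)))
      (scale (≤-trans (≤-reflexive (𝔼-cong unif λ a → 𝔼-swap unif unif _)) escape≤))
    expected-loss 1F = ≤-trans (≤-reflexive (trans
      (𝔼-cong unif λ a → trans (𝔼-cong unif λ b → trans (𝔼-cong unif λ c → const Pᵤ) (𝔼-*ˡ unif A _)) (𝔼-*ˡ unif A _)) (𝔼-*ˡ unif A _)))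
      (scale (≤-trans (≤-reflexive (trans (𝔼-cong unif λ a → 𝔼-swap unif unif _) (𝔼-swap unif unif _))) escape≤))
    expected-loss 2F = ≤-trans (≤-reflexive (trans
      (𝔼-cong unif λ a → trans (𝔼-cong unif λ b → trans (𝔼-cong unif λ c → 𝔼-*ˡ unif A _) (𝔼-*ˡ unif A _)) (𝔼-*ˡ unif A _)) (𝔼-*ˡ unif A _)))
      (scale (≤-trans (≤-reflexive (𝔼-cong unif λ a → trans (𝔼-cong unif λ b → 𝔼-swap unif unif _) (𝔼-swap unif unif _))) spread≤))
    expected-loss 3F = ≤-trans (≤-reflexive (trans
      (𝔼-cong unif λ a → trans (𝔼-cong unif λ b → trans (𝔼-cong unif λ c → 𝔼-*ˡ unif A _) (𝔼-*ˡ unif A _)) (𝔼-*ˡ unif A _)) (𝔼-*ˡ unif A _)))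
      (scale (≤-trans (≤-reflexive (trans (𝔼-cong unif λ a → trans (𝔼-cong unif λ b → 𝔼-swap unif unif _) (𝔼-swap unif unif _)) (𝔼-swap unif unif _))) spread≤))
    expected-loss 4F = ≤-trans (≤-reflexive (𝔼-cong unif λ a → 𝔼-cong unif λ b → trans (const Pᵤ) (const Pᵤ))) (≤-trans irr≤ e≤β)
    expected-loss 5F = ≤-trans (≤-reflexive (trans (const Pᵤ) (trans (𝔼-cong unif λ b → 𝔼-cong unif λ c → const Pᵤ) (𝔼-swap unif unif _)))) (≤-trans irr≤ e≤β)
    expected-loss 6F = ≤-trans (≤-reflexive (𝔼-cong unif λ a → trans (const Pᵤ) (const Pᵤ))) (≤-trans irr≤ e≤β)
    expected-loss 7F = ≤-trans (≤-reflexive (trans (𝔼-cong unif λ a → trans (const Pᵤ) (const Pᵤ)) (𝔼-swap unif unif _))) (≤-trans irr≤ e≤β)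
    expected-loss 8F = ≤-trans (≤-reflexive (𝔼-cong unif λ a → trans (const Pᵤ) (trans (const Pᵤ) (const Pᵤ)))) (≤-trans tiny≤ e≤β)

  module _ {ζ : ℚ} (Aζ : A * ζ ≡ 1ℚ) (A>0 : 0ℚ < A) {x₁ x₂ x₃ x₄ : Fin n}
           (good : ∀ i → lift χ 4 (loss i) (x₁ ∷ x₂ ∷ x₃ ∷ x₄ ∷ []) < 1ℚ) where

    private
      unscale : ∀ {x} → A * x < 1ℚ → x ≤ ζ
      unscale lt = *-cancel-≤ A A>0 (≤-trans (<⇒≤ lt) (≤-reflexive (sym Aζ)))
      Pₖ = K-prob
      off : ∀ b {t} → t ≡ 𝟙 b → t < 1ℚ → b ≡ false
      off true  refl lt = ⊥-elim (<-irrefl refl lt)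
      off false _ _ = refl

    escape-right : escape (K x₁) (K x₃) (K x₂) ≤ ζ
    escape-right = unscale (subst (_< 1ℚ) (trans
      (𝔼-cong (K x₁) λ a → trans (𝔼-cong (K x₂) λ b → trans (𝔼-cong (K x₃) λ c → const (Pₖ x₄)) (𝔼-*ˡ (K x₃) A _)) (𝔼-*ˡ (K x₂) A _))
      (trans (𝔼-*ˡ (K x₁) A _) (*-right (𝔼-cong (K x₁) λ a → 𝔼-swap (K x₂) (K x₃) _)))) (good 0F))

    escape-left : escape (K x₃) (K x₁) (K x₂) ≤ ζ
    escape-left = unscale (subst (_< 1ℚ) (trans
      (𝔼-cong (K x₁) λ a → trans (𝔼-cong (K x₂) λ b → trans (𝔼-cong (K x₃) λ c → const (Pₖ x₄)) (𝔼-*ˡ (K x₃) A _)) (𝔼-*ˡ (K x₂) A _))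
      (trans (𝔼-*ˡ (K x₁) A _) (*-right (trans (𝔼-cong (K x₁) λ a → 𝔼-swap (K x₂) (K x₃) _) (𝔼-swap (K x₁) (K x₃) _))))) (good 1F))

    spread-right : spread (K x₁) (K x₄) (K x₂) (K x₃) ≤ ζ
    spread-right = unscale (subst (_< 1ℚ) (trans
      (𝔼-cong (K x₁) λ a → trans (𝔼-cong (K x₂) λ b → trans (𝔼-cong (K x₃) λ c → 𝔼-*ˡ (K x₄) A _) (𝔼-*ˡ (K x₃) A _)) (𝔼-*ˡ (K x₂) A _))
      (trans (𝔼-*ˡ (K x₁) A _) (*-right (𝔼-cong (K x₁) λ a → trans (𝔼-cong (K x₂) λ b → 𝔼-swap (K x₃) (K x₄) _) (𝔼-swap (K x₂) (K x₄) _))))) (good 2F))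

    spread-left : spread (K x₄) (K x₁) (K x₂) (K x₃) ≤ ζ
    spread-left = unscale (subst (_< 1ℚ) (trans
      (𝔼-cong (K x₁) λ a → trans (𝔼-cong (K x₂) λ b → trans (𝔼-cong (K x₃) λ c → 𝔼-*ˡ (K x₄) A _) (𝔼-*ˡ (K x₃) A _)) (𝔼-*ˡ (K x₂) A _))
      (trans (𝔼-*ˡ (K x₁) A _) (*-right (trans (𝔼-cong (K x₁) λ a → trans (𝔼-cong (K x₂) λ b → 𝔼-swap (K x₃) (K x₄) _) (𝔼-swap (K x₂) (K x₄) _)) (𝔼-swap (K x₁) (K x₄) _))))) (good 3F))

    regular₁₂ : irr (χ x₁) (χ x₂) ≡ false
    regular₁₂ = off _ (trans (𝔼-on-cell x₁ λ a ea → trans (𝔼-on-cell x₂ λ b eb → trans (trans (𝔼-cong (K x₃) λ c → const (Pₖ x₄)) (const (Pₖ x₃)))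
      (cong₂ (λ i j → 𝟙 (irr i j)) (sym ea) (sym eb))) (const (Pₖ x₂))) (const (Pₖ x₁))) (good 4F)

    regular₃₂ : irr (χ x₃) (χ x₂) ≡ false
    regular₃₂ = off _ (trans (const (Pₖ x₁)) (trans (𝔼-on-cell x₂ λ b eb → trans (𝔼-on-cell x₃ λ c ec → trans (const (Pₖ x₄))
      (cong₂ (λ i j → 𝟙 (irr i j)) (sym ec) (sym eb))) (const (Pₖ x₃))) (const (Pₖ x₂)))) (good 5F)

    regular₁₄ : irr (χ x₁) (χ x₄) ≡ false
    regular₁₄ = off _ (trans (𝔼-on-cell x₁ λ a ea → trans (const (Pₖ x₂)) (trans (const (Pₖ x₃)) (trans (𝔼-on-cell x₄ λ d ed →
      cong₂ (λ i j → 𝟙 (irr i j)) (sym ea) (sym ed)) (const (Pₖ x₄))))) (const (Pₖ x₁))) (good 6F)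

    regular₄₁ : irr (χ x₄) (χ x₁) ≡ false
    regular₄₁ = off _ (trans (𝔼-on-cell x₁ λ a ea → trans (const (Pₖ x₂)) (trans (const (Pₖ x₃)) (trans (𝔼-on-cell x₄ λ d ed →
      cong₂ (λ i j → 𝟙 (irr i j)) (sym ed) (sym ea)) (const (Pₖ x₄))))) (const (Pₖ x₁))) (good 7F)

    large₁ : tiny χ ρ ρ≥0 x₁ ≡ false
    large₁ = off _ (trans (𝔼-on-cell x₁ λ a ea → trans (trans (𝔼-cong (K x₂) λ b → trans (𝔼-cong (K x₃) λ c → const (Pₖ x₄)) (const (Pₖ x₃))) (const (Pₖ x₂)))
      (cong 𝟙 (tiny-cong (sym ea)))) (const (Pₖ x₁))) (good 8F)
      where
      tiny-cong : ∀ {a b} → χ a ≡ χ b → tiny χ ρ ρ≥0 a ≡ tiny χ ρ ρ≥0 b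
      tiny-cong eq = cong (λ z → isYes (z <? ρ * fromℕ n)) (size-cong eq)

-- Homogeneous sequences of cells

module Homogeneous {d μ : ℚ} (d≥0 : 0ℚ ≤ d) (d≤1 : d ≤ 1ℚ) (μ≥0 : 0ℚ ≤ μ) (H : 3Graph) (dense : Dense d μ H)
  (n>0 : 0ℚ < fromℕ (3Graph.n H)) {M N : ℕ} (κ : Fin (3Graph.n H) → Fin (3Graph.n H) → Fin M)
  (U : Fin (3Graph.n H) → Fin M → Fin (3Graph.n H) → Bool)
  (χ : Fin (3Graph.n H) → Fin N) (irr : Fin N → Fin N → Bool) {δ : ℚ} (δ≥0 : 0ℚ ≤ δ)
  (regular : ∀ x y → irr (χ x) (χ y) ≡ false → ∀ p →
     Regular δ (Cells.K χ x) (Cells.K χ y) (λ a c → U a p c) × Regular δ (Cells.K χ x) (Cells.K χ y) (λ a b → κ a b == p))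
  {A ζ ρ : ℚ} (A>0 : 0ℚ < A) (Aζ : A * ζ ≡ 1ℚ) (ρ≥0 : 0ℚ ≤ ρ)
  {h η : ℚ} (h>0 : 0ℚ < h) (h≤1 : h ≤ 1ℚ) (g : ℕ) (gη≡1 : fromℕ g * η ≡ 1ℚ) (η>0 : 0ℚ < η) (η≤h : η ≤ h)
  where

  open 3Graph H renaming (n to order)
  open Link E κ U
  open Levels E κ U
  open Cells χ
  open Uniform n>0
  open Losses E κ U χ irr A ρ (<⇒≤ A>0) n>0 ρ≥0

  private
    V = Fin (3Graph.n H)
    A≥0 = <⇒≤ A>0

  -- The nine `h` are three for the term `3ℚ * η`, one for the tail, one for the errors of
  -- decoupling, and four for edges that escape or lie inside a container, seen from both sides.
  β₀ : ℚ
  β₀ = ¼ + (h + h + h + (h + h + h) + (h + h + h))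

  opaque
    lev : (x y z : V) → ∃ λ l → l ℕ.≤ g × h ≤ tail (fromℕ l * η) (K x) (K y) (K z) × ¬ (h ≤ tail (fromℕ (suc l) * η) (K x) (K y) (K z))
    lev x y z = level {η} {h} g η>0 gη≡1 h≤1 h>0 (K-prob x) (K-prob y) (K-prob z)

  L : V → V → V → ℕ
  L x y z = proj₁ (lev x y z)

  levF : V → V → V → Fin (suc g)
  levF x y z = Fin.fromℕ< (ℕ.s≤s (proj₁ (proj₂ (lev x y z))))

  L-cong : ∀ {x y z x′ y′ z′} → levF x y z ≡ levF x′ y′ z′ → L x y z ≡ L x′ y′ z′
  L-cong {x} {y} {z} {x′} {y′} {z′} eq = trans (sym (Fin.toℕ-fromℕ< _)) (trans (cong Fin.toℕ eq) (Fin.toℕ-fromℕ< _))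

  threshold : V → V → V → ℚ
  threshold x y z = fromℕ (L x y z) * η

  -- The hypotheses of `cover-large` at the level of the triple: a single class has to be large in
  -- the second and in the third cell at once.
  Rich : V → V → V → Set
  Rich x y z = ∃ λ p → threshold x y z ≤ D p (K x) (K z) × threshold x y z ≤ D p (K x) (K y) × inside p (K x) (K y) (K z) ≤ h

  opaque
    rich? : ∀ x y z → Dec (Rich x y z)
    rich? x y z = Fin.any? λ p → (threshold x y z ≤? D p (K x) (K z)) ×-dec
      ((threshold x y z ≤? D p (K x) (K y)) ×-dec (inside p (K x) (K y) (K z) ≤? h))

    poor? : ∀ x y z → Dec (triple E (K x) (K y) (K z) ≤ β₀)
    poor? x y z = triple E (K x) (K y) (K z) ≤? β₀

  Colour : Set
  Colour = Fin (suc g ℕ.* (suc g ℕ.* (2 ℕ.* (2 ℕ.* 2))))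

  code : Fin (suc g) → Fin (suc g) → Bool → Bool → Bool → Colour
  code l l′ r r′ p = Fin.combine l (Fin.combine l′ (Fin.combine (toBit r) (Fin.combine (toBit r′) (toBit p))))

  code-injective : ∀ {l l′ r r′ p m m′ s s′ q} → code l l′ r r′ p ≡ code m m′ s s′ q →
                   l ≡ m × l′ ≡ m′ × r ≡ s × r′ ≡ s′ × p ≡ q
  code-injective {l} {l′} {r} {r′} {p} {m} {m′} {s} {s′} {q} eq =
    let e₁ , f₁ = Fin.combine-injective l (Fin.combine l′ (Fin.combine (toBit r) (Fin.combine (toBit r′) (toBit p)))) m _ eq
        e₂ , f₂ = Fin.combine-injective l′ (Fin.combine (toBit r) (Fin.combine (toBit r′) (toBit p))) m′ _ f₁
        e₃ , f₃ = Fin.combine-injective (toBit r) (Fin.combine (toBit r′) (toBit p)) (toBit s) _ f₂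
        e₄ , e₅ = Fin.combine-injective (toBit r′) (toBit p) (toBit s′) (toBit q) f₃
    in e₁ , e₂ , toBit-injective e₃ , toBit-injective e₄ , toBit-injective e₅

  -- In a triple i < j < k the middle cell holds c, and the outer cells hold a and b in either
  -- order, so levels and richness are recorded for both orders. The last component transfers the
  -- density bound from one triple to all triples of the sequence.
  colour : Vec V 3 → Colour
  colour (i ∷ j ∷ k ∷ []) = code (levF i k j) (levF k i j) (isYes (rich? i k j)) (isYes (rich? k i j)) (isYes (poor? i j k))

  Good : Vec V 4 → Set
  Good v = ∀ i → lift χ 4 (loss i) v < 1ℚ

  inside-sym : ∀ p u v w → inside p u v w ≡ inside p u w v
  inside-sym p u v w = 𝔼-cong u λ a → trans (𝔼-swap v w _) (𝔼-cong w λ c → 𝔼-cong v λ b →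
    cong₂ (λ e f → 𝟙 (e ∧ f)) (sym₂₃ a b c) (Bool.∧-comm (U a p b) (U a p c)))

  yes-true : ∀ {Q : Set} (q : Dec Q) → isYes q ≡ true → Q
  yes-true (yes q) _ = q

  true-yes : ∀ {Q : Set} (q : Dec Q) → Q → isYes q ≡ true
  true-yes (yes _) _ = refl
  true-yes (no ¬q) q = ⊥-elim (¬q q)

  weaken : ∀ {q ε ε′ u v w} → ε ≤ ε′ → Cover δ q ε u v w → Cover δ q ε′ u v w
  weaken le C = record { I = C.I ; I≤ = C.I≤ ; O = C.O ; o = C.o ; regular = C.regular ; squares = C.squares ; uncovered = ≤-trans C.uncovered le }
    where module C = Cover C

  η≤1 : η ≤ 1ℚ
  η≤1 = ≤-trans η≤h h≤1

  side : ∀ x y z → irr (χ x) (χ z) ≡ false → Rich x y z → escape (K x) (K y) (K z) ≤ ζ →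
         Cover δ (¼ + 3ℚ * η + h) (ζ + h) (K x) (K y) (K z)
  side x y z reg (p , Dz , Dy , NI) esc = by-size (≤-total (threshold x y z) ½)
    where
    a = threshold x y z
    a≥0 : 0ℚ ≤ a
    a≥0 = *-nonneg (fromℕ-nonneg _) (<⇒≤ η>0)
    a≤1 : a ≤ 1ℚ
    a≤1 = ≤-trans (*-mono-≤ʳ η (<⇒≤ η>0) (fromℕ-mono (proj₁ (proj₂ (lev x y z))))) (≤-reflexive gη≡1)
    tail≤ : tail (a + η) (K x) (K y) (K z) ≤ h
    tail≤ = ≤-trans (≤-reflexive (cong (λ t → tail t (K x) (K y) (K z)) (sym (trans (*-left (fromℕ-suc (L x y z)))
      (solve 2 (λ l e → (con 1ℚ :+ l) :* e := l :* e :+ e) refl (fromℕ (L x y z)) η)))))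
      (<⇒≤ (≰⇒> (proj₂ (proj₂ (proj₂ (lev x y z))))))
    R = λ p → proj₁ (regular x z reg p)
    by-size : a ≤ ½ ⊎ ½ ≤ a → Cover δ (¼ + 3ℚ * η + h) (ζ + h) (K x) (K y) (K z)
    by-size (inj₁ a≤½) = weaken (≤-trans esc (by-diff h (<⇒≤ h>0) refl))
      (cover-small (K-prob x) (K-prob y) (K-prob z) (<⇒≤ η>0) η≤1 a≥0 R tail≤ a≤½)
    by-size (inj₂ ½≤a) = weaken (+-mono-≤ esc ≤-refl)
      (cover-large (K-prob x) (K-prob y) (K-prob z) (<⇒≤ η>0) η≤1 a≥0 R tail≤ p ½≤a a≤1 Dz Dy NI)

  module _ {τ : ℚ} (τ≥0 : 0ℚ ≤ τ) (ζ≤h : ζ ≤ h) (ζ+Mδ : ζ + fromℕ M * δ ≤ h * τ)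
    (errors : fromℕ (suc M) * (fromℕ (suc M) * (δ + δ)) ≤ h)
    (q′ : ℕ) (count : 1ℚ + fromℕ (suc q′) * fromℕ (suc q′) * τ < fromℕ (suc q′) * h)
    (y : ℕ → V) {col : Colour}
    (mono : ∀ {i j k} → i ℕ.< j → j ℕ.< k → k ℕ.< suc q′ ℕ.+ 3 → colour (y i ∷ y j ∷ y k ∷ []) ≡ col)
    (good : ∀ {i j k l} → i ℕ.< j → j ℕ.< k → k ℕ.< l → l ℕ.< suc q′ ℕ.+ 3 → Good (y i ∷ y j ∷ y k ∷ y l ∷ []))
    where

    private
      -- The targets occupy positions 1 to q, between the fixed cells at positions 0 and q + 1.
      q last : ℕ
      q = suc q′
      last = suc q
      t+1 : Fin q → ℕ
      t+1 t = suc (Fin.toℕ t)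
      0<t+1 : ∀ t → 0 ℕ.< t+1 t
      0<t+1 t = ℕ.s≤s ℕ.z≤n
      t+1<last : ∀ t → t+1 t ℕ.< last
      t+1<last t = ℕ.s≤s (Fin.toℕ<n t)
      last<m : last ℕ.< q ℕ.+ 3
      last<m = ℕ.≤-trans (ℕ.≤-reflexive (ℕ.+-comm 2 q)) (ℕ.+-monoʳ-≤ q (ℕ.n≤1+n 2))
      3<m : 3 ℕ.< q ℕ.+ 3
      3<m = ℕ.m≤n+m 4 q′ ⟨by⟩ ℕ.+-suc q′ 3
        where
        _⟨by⟩_ : ∀ {a b c} → a ℕ.≤ b → b ≡ c → a ℕ.≤ c
        le ⟨by⟩ refl = le

      same : ∀ {i j k i′ j′ k′} → i ℕ.< j → j ℕ.< k → k ℕ.< q ℕ.+ 3 → i′ ℕ.< j′ → j′ ℕ.< k′ → k′ ℕ.< q ℕ.+ 3 →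
        levF (y i) (y k) (y j) ≡ levF (y i′) (y k′) (y j′) × levF (y k) (y i) (y j) ≡ levF (y k′) (y i′) (y j′) ×
        isYes (rich? (y i) (y k) (y j)) ≡ isYes (rich? (y i′) (y k′) (y j′)) × isYes (rich? (y k) (y i) (y j)) ≡ isYes (rich? (y k′) (y i′) (y j′)) ×
        isYes (poor? (y i) (y j) (y k)) ≡ isYes (poor? (y i′) (y j′) (y k′))
      same {i} {j} {k} {i′} {j′} {k′} a b c a′ b′ c′ =
        code-injective {levF (y i) (y k) (y j)} {levF (y k) (y i) (y j)} {isYes (rich? (y i) (y k) (y j))} {isYes (rich? (y k) (y i) (y j))} {isYes (poor? (y i) (y j) (y k))}
          {levF (y i′) (y k′) (y j′)} {levF (y k′) (y i′) (y j′)} {isYes (rich? (y i′) (y k′) (y j′))} {isYes (rich? (y k′) (y i′) (y j′))} {isYes (poor? (y i′) (y j′) (y k′))}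
          (trans (mono a b c) (sym (mono a′ b′ c′)))

      0<1 : 0 ℕ.< 1
      0<1 = ℕ.s≤s ℕ.z≤n
      1<2 : 1 ℕ.< 2
      1<2 = ℕ.s≤s 0<1
      2<3 : 2 ℕ.< 3
      2<3 = ℕ.s≤s 1<2
      2<m : 2 ℕ.< q ℕ.+ 3
      2<m = ℕ.<-trans 2<3 3<m

      base-quadruple : Good (y 0 ∷ y 1 ∷ y 2 ∷ y 3 ∷ [])
      base-quadruple = good 0<1 1<2 2<3 3<m

      targets : ∀ t t′ → t Fin.< t′ → Good (y 0 ∷ y (t+1 t) ∷ y (t+1 t′) ∷ y last ∷ [])
      targets t t′ lt = good (0<t+1 t) (ℕ.s≤s lt) (t+1<last t′) last<m

    -- Here a ranges over cell 0 and b over the last cell. By homogeneity every target has the same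
    -- level, so `common-class` yields a class that is large in two targets t < t′. Letting t′
    -- replace the last cell makes the triple 0, t, t′ rich, and all triples have the same colour.
    rich-right : ¬ Rich (y 0) (y 2) (y 1) → 0 ℕ.< q′ → ⊥
    rich-right ¬rich (ℕ.s≤s _) = common-class (K-prob (y 0)) (K-prob (y last)) (λ p → proj₂ (regular (y 0) (y last) (regular₁₄ Aζ A>0 (targets zero (suc zero) (ℕ.s≤s ℕ.z≤n))) p))
      (λ t → K (y (t+1 t))) (λ t → K-prob (y (t+1 t))) {A = a} {ε = h} {ζ = ζ} {θ = h} {τ = τ} h>0 τ≥0
      (λ t → subst (λ l → h ≤ tail (fromℕ l * η) (K (y 0)) (K (y last)) (K (y (t+1 t))))
        (L-cong (proj₁ (same (0<t+1 t) (t+1<last t) last<m 0<1 1<2 2<m)))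
        (proj₁ (proj₂ (proj₂ (lev (y 0) (y last) (y (t+1 t)))))))
      (λ t t′ lt → spread-right Aζ A>0 (targets t t′ lt))
      ζ+Mδ count
      λ t t′ lt p Dt Dt′ NI → let s = same (0<t+1 t) (ℕ.s≤s lt) (ℕ.<-trans (t+1<last t′) last<m) 0<1 1<2 2<m
                                  l = L-cong (proj₁ s) in
        ¬rich (yes-true (rich? (y 0) (y 2) (y 1)) (trans (sym (proj₁ (proj₂ (proj₂ s)))) (true-yes (rich? (y 0) (y (t+1 t′)) (y (t+1 t)))
          (p , subst (λ l → fromℕ l * η ≤ D p (K (y 0)) (K (y (t+1 t)))) (sym l) Dt
             , subst (λ l → fromℕ l * η ≤ D p (K (y 0)) (K (y (t+1 t′)))) (sym l) Dt′
             , ≤-trans (≤-reflexive (inside-sym p (K (y 0)) (K (y (t+1 t′))) (K (y (t+1 t))))) NI))))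
      where
      a = threshold (y 0) (y 2) (y 1)

    -- The mirror image, with a in the last cell. Now the earlier target replaces cell 0 as the cell
    -- of b, so that the middle cell is again the one of c, as the colouring demands.
    rich-left : ¬ Rich (y 2) (y 0) (y 1) → 0 ℕ.< q′ → ⊥
    rich-left ¬rich (ℕ.s≤s _) = common-class (K-prob (y last)) (K-prob (y 0)) (λ p → proj₂ (regular (y last) (y 0) (regular₄₁ Aζ A>0 (targets zero (suc zero) (ℕ.s≤s ℕ.z≤n))) p))
      (λ t → K (y (t+1 t))) (λ t → K-prob (y (t+1 t))) {A = a} {ε = h} {ζ = ζ} {θ = h} {τ = τ} h>0 τ≥0
      (λ t → subst (λ l → h ≤ tail (fromℕ l * η) (K (y last)) (K (y 0)) (K (y (t+1 t))))
        (L-cong (proj₁ (proj₂ (same (0<t+1 t) (t+1<last t) last<m 0<1 1<2 2<m))))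
        (proj₁ (proj₂ (proj₂ (lev (y last) (y 0) (y (t+1 t)))))))
      (λ t t′ lt → spread-left Aζ A>0 (targets t t′ lt))
      ζ+Mδ count
      λ t t′ lt p Dt Dt′ NI → let s = same (ℕ.s≤s lt) (t+1<last t′) last<m 0<1 1<2 2<m
                                  l = L-cong (proj₁ (proj₂ s)) in
        ¬rich (yes-true (rich? (y 2) (y 0) (y 1)) (trans (sym (proj₁ (proj₂ (proj₂ (proj₂ s))))) (true-yes (rich? (y last) (y (t+1 t)) (y (t+1 t′)))
          (p , subst (λ l → fromℕ l * η ≤ D p (K (y last)) (K (y (t+1 t′)))) (sym l) Dt′
             , subst (λ l → fromℕ l * η ≤ D p (K (y last)) (K (y (t+1 t)))) (sym l) Dt
             , NI))))
      where
      a = threshold (y 2) (y 0) (y 1)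

    private
      3η≤ : 3ℚ * η ≤ h + h + h
      3η≤ = ≤-trans (*-mono-≤ˡ 3ℚ (ℚ.nonNegative⁻¹ 3ℚ) η≤h) (≤-reflexive (solve 1 (λ h → con 3ℚ :* h := h :+ h :+ h) refl h))

    rich-poor : Rich (y 0) (y 2) (y 1) → Rich (y 2) (y 0) (y 1) → triple E (K (y 0)) (K (y 1)) (K (y 2)) ≤ β₀
    rich-poor right left = begin
      triple E (K (y 0)) (K (y 1)) (K (y 2))
        ≡⟨ 𝔼-cong (K (y 0)) (λ a → trans (𝔼-swap (K (y 1)) (K (y 2)) _) (𝔼-cong (K (y 2)) λ c → 𝔼-cong (K (y 1)) λ b → cong 𝟙 (sym₂₃ a b c))) ⟩
      tripleDensity (K (y 0)) (K (y 2)) (K (y 1))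
        ≤⟨ density-bound sym₁₂ (K-prob (y 0)) (K-prob (y 2)) (K-prob (y 1)) δ≥0
             (side (y 0) (y 2) (y 1) (regular₁₂ Aζ A>0 base-quadruple) right (escape-right Aζ A>0 base-quadruple))
             (side (y 2) (y 0) (y 1) (regular₃₂ Aζ A>0 base-quadruple) left (escape-left Aζ A>0 base-quadruple)) ⟩
      ¼ + 3ℚ * η + h + fromℕ (suc M) * (fromℕ (suc M) * (δ + δ)) + (ζ + h + (ζ + h))
        ≤⟨ +-mono-≤ (+-mono-≤ (+-mono-≤ (+-mono-≤ ≤-refl 3η≤) ≤-refl) errors) (+-mono-≤ (+-mono-≤ ζ≤h ≤-refl) (+-mono-≤ ζ≤h ≤-refl)) ⟩
      ¼ + (h + h + h) + h + h + (h + h + (h + h))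
        ≡⟨ solve 1 (λ h → con ¼ :+ (h :+ h :+ h) :+ h :+ h :+ (h :+ h :+ (h :+ h)) := con ¼ :+ (h :+ h :+ h :+ (h :+ h :+ h) :+ (h :+ h :+ h))) refl h ⟩
      β₀ ∎
      where open ≤-Reasoning

    all-poor : triple E (K (y 0)) (K (y 1)) (K (y 2)) ≤ β₀ → ∀ {s z P k₀} → 0ℚ ≤ s → s * (ρ * fromℕ order) ≡ 1ℚ →
      fromℕ q * k₀ ≡ 1ℚ → 0ℚ ≤ k₀ → s * z ≡ 1ℚ → 0ℚ < z → fromℕ order ≤ z * P →
      d ≤ β₀ + (s + s + s) + (k₀ + k₀ + k₀) + 6ℚ * (μ * (P * (P * P)))
    all-poor base {s} s≥0 sρn Qk₀ k₀≥0 sz z>0 N≤ = Weighted.weighted-density d≥0 d≤1 μ≥0 H dense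
      (λ (t : Fin q) → K (y (Fin.toℕ t))) (λ t → K-prob (y (Fin.toℕ t)))
      -- Positions q, q + 1 and q + 2 complete each t < q to a good quadruple with t in front; this
      -- is why the sequence has q + 3 cells.
      (λ t → K-≤ χ ρ ρ≥0 s≥0 sρn (y (Fin.toℕ t)) (large₁ Aζ A>0 (good (Fin.toℕ<n t) (ℕ.n<1+n q) (ℕ.n<1+n (suc q)) 2+q<m)))
      β₀≥0
      (λ {i} {j} {k} ij jk → yes-true (poor? _ _ _) (trans (proj₂ (proj₂ (proj₂ (proj₂ (same ij jk (ℕ.<-≤-trans (Fin.toℕ<n k) (ℕ.m≤m+n q 3)) 0<1 1<2 2<m)))))
        (true-yes (poor? (y 0) (y 1) (y 2)) base)))
      Qk₀ k₀≥0 sz z>0 N≤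
      where
      2+q<m : 2 ℕ.+ q ℕ.< q ℕ.+ 3
      2+q<m = ℕ.≤-reflexive (ℕ.+-comm 3 q)
      hh : 0ℚ ≤ h + h + h
      hh = +-nonneg (+-nonneg (<⇒≤ h>0) (<⇒≤ h>0)) (<⇒≤ h>0)
      β₀≥0 : 0ℚ ≤ β₀
      β₀≥0 = +-nonneg (ℚ.nonNegative⁻¹ ¼) (+-nonneg (+-nonneg hh hh) hh)

    contradiction : ∀ {s z P k₀} → 0 ℕ.< q′ → 0ℚ ≤ s → s * (ρ * fromℕ order) ≡ 1ℚ →
      fromℕ q * k₀ ≡ 1ℚ → 0ℚ ≤ k₀ → s * z ≡ 1ℚ → 0ℚ < z → fromℕ order ≤ z * P →
      d ≤ β₀ + (s + s + s) + (k₀ + k₀ + k₀) + 6ℚ * (μ * (P * (P * P)))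
    contradiction q′>0 = by-richness (rich? (y 0) (y 2) (y 1)) (rich? (y 2) (y 0) (y 1))
      where
      by-richness : Dec (Rich (y 0) (y 2) (y 1)) → Dec (Rich (y 2) (y 0) (y 1)) → _
      by-richness (no ¬r) _       = ⊥-elim (rich-right ¬r q′>0)
      by-richness (yes _) (no ¬r) = ⊥-elim (rich-left ¬r q′>0)
      by-richness (yes r) (yes r′) = all-poor (rich-poor r r′)

-- The choice of parameters

20ℚ : ℚ
20ℚ = ℤ.+ 20 ℚ./ 1

opaque
  unfolding fromℕ

  fromℕ-20 : fromℕ 20 ≡ 20ℚ
  fromℕ-20 = refl

fromℕ-3 : fromℕ 3 ≡ 1ℚ + 1ℚ + 1ℚ
fromℕ-3 = trans (fromℕ-suc 2) (trans (+-right (trans (fromℕ-suc 1) (+-right fromℕ-1))) (sym (+-assoc 1ℚ 1ℚ 1ℚ)))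

fromℕ-2 : fromℕ 2 ≡ 1ℚ + 1ℚ
fromℕ-2 = trans (fromℕ-suc 1) (+-right fromℕ-1)

private
  0<1 : 0ℚ < 1ℚ
  0<1 = ℚ.positive⁻¹ 1ℚ
  ½<1 : ½ < 1ℚ
  ½<1 = subst₂ _<_ (+-identityˡ ½) (solve 0 (con ½ :+ con ½ := con 1ℚ) refl) (+-mono-<ˡ (ℚ.positive⁻¹ ½))
  2<fromℕ3 : 1ℚ + 1ℚ < fromℕ 3
  2<fromℕ3 = subst₂ _<_ (+-identityˡ _) (trans (sym (+-assoc 1ℚ 1ℚ 1ℚ)) (sym fromℕ-3)) (+-mono-<ˡ 0<1)

-- The errors of the whole argument add up to 16 h above 1/4: nine in `β₀`, three each for `s` and
-- `k₀`, and one for `μ`. A distance of 20 h leaves a positive margin.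
record Gap (d : ℚ) : Set where
  field
    h        : ℚ
    h>0      : 0ℚ < h
    h≤1      : h ≤ 1ℚ
    gap      : ¼ + 20ℚ * h ≤ d

choose-gap : ∀ d → ¼ < d → d ≤ 1ℚ → Gap d
choose-gap d d>¼ d≤1 = go (fraction 20 (d - ¼) (subst (_< d - ¼) (+-inverseʳ ¼) (+-mono-<ˡ d>¼)))
  where
  19ℚ : ℚ
  19ℚ = ℤ.+ 19 ℚ./ 1
  go : (∃ λ h → 0ℚ < h × fromℕ 20 * h ≤ d - ¼) → Gap d
  go (h , h>0 , 20h≤) = record { h = h ; h>0 = h>0 ; h≤1 = h≤1
    ; gap = ≤-trans (+-mono-≤ ≤-refl 20h≤′) (≤-reflexive (solve 1 (λ d → con ¼ :+ (d :- con ¼) := d) refl d)) }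
    where
    20h≤′ : 20ℚ * h ≤ d - ¼
    20h≤′ = ≤-trans (≤-reflexive (*-left (sym fromℕ-20))) 20h≤
    h≤1 : h ≤ 1ℚ
    h≤1 = ≤-trans (by-diff (19ℚ * h) (*-nonneg (ℚ.nonNegative⁻¹ 19ℚ) (<⇒≤ h>0)) (solve 1 (λ h → h :+ con 19ℚ :* h := con 20ℚ :* h) refl h))
              (≤-trans 20h≤′ (≤-trans (by-diff ¼ (ℚ.nonNegative⁻¹ ¼) (solve 1 (λ d → d :- con ¼ :+ con ¼ := d) refl d)) d≤1))

-- Here q = q″ + 2 is so large that q h ≥ 3. With τ = 1 / q² the left side of `count` equals 2.
record Lengths (h : ℚ) : Set where
  field
    q″       : ℕ
    k₀       : ℚ
    Qk₀      : fromℕ (suc (suc q″)) * k₀ ≡ 1ℚ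
    k₀>0     : 0ℚ < k₀
    k₀≤h     : k₀ ≤ h
    τ        : ℚ
    τ>0      : 0ℚ < τ
    τ≤1      : τ ≤ 1ℚ
    count    : 1ℚ + fromℕ (suc (suc q″)) * fromℕ (suc (suc q″)) * τ < fromℕ (suc (suc q″)) * h

choose-lengths : ∀ h → 0ℚ < h → h ≤ 1ℚ → Lengths h
choose-lengths h h>0 h≤1 = go₁ (fraction 3 h h>0)
  where
  go₃ : ∀ h₃ → fromℕ 3 * h₃ ≤ h → 0ℚ < h₃ → ∀ q″ → 1ℚ ≤ fromℕ (suc q″) * h₃ →
        (∃ λ k₀ → fromℕ (suc (suc q″)) * k₀ ≡ 1ℚ × 0ℚ < k₀) → Lengths h
  go₃ h₃ 3h₃≤h h₃>0 q″ 1≤qh₃ (k₀ , Qk₀ , k₀>0) = record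
    { q″ = q″ ; k₀ = k₀ ; Qk₀ = Qk₀ ; k₀>0 = k₀>0 ; k₀≤h = k₀≤h ; τ = k₀ * k₀ ; τ>0 = *-pos k₀>0 k₀>0
    ; τ≤1 = ≤-trans (*-mono-≤ (<⇒≤ k₀>0) 0≤1 (≤-trans k₀≤h h≤1) (≤-trans k₀≤h h≤1)) (≤-reflexive (*-identityˡ 1ℚ))
    ; count = ≤-<-trans (≤-reflexive (+-right (trans (solve 2 (λ Q k → Q :* Q :* (k :* k) := (Q :* k) :* (Q :* k)) refl Q k₀) (trans (cong₂ _*_ Qk₀ Qk₀) (*-identityˡ 1ℚ)))))
                (<-≤-trans 2<fromℕ3 3≤Qh) }
    where
    Q = fromℕ (suc (suc q″))
    3≤Qh : fromℕ 3 ≤ Q * h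
    3≤Qh = ≤-trans (≤-reflexive (sym (*-identityʳ (fromℕ 3)))) (≤-trans (*-mono-≤ˡ (fromℕ 3) (fromℕ-nonneg 3)
               (≤-trans 1≤qh₃ (*-mono-≤ʳ h₃ (<⇒≤ h₃>0) (fromℕ-mono (ℕ.n≤1+n (suc q″))))))
               (≤-trans (≤-reflexive (solve 3 (λ t Q x → t :* (Q :* x) := Q :* (t :* x)) refl (fromℕ 3) Q h₃)) (*-mono-≤ˡ Q (fromℕ-nonneg _) 3h₃≤h)))
    k₀≤h : k₀ ≤ h
    k₀≤h = *-cancel-≤ Q (fromℕ-pos (suc q″)) (≤-trans (≤-reflexive Qk₀) (≤-trans (≤-trans (≤-reflexive (sym fromℕ-1)) (fromℕ-mono {1} {3} (ℕ.s≤s ℕ.z≤n))) 3≤Qh))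
  go₂ : ∀ h₃ → fromℕ 3 * h₃ ≤ h → 0ℚ < h₃ → (∃ λ k → 1ℚ ≤ fromℕ (suc k) * h₃) → Lengths h
  go₂ h₃ 3h₃≤h h₃>0 (q″ , 1≤qh₃) = go₃ h₃ 3h₃≤h h₃>0 q″ 1≤qh₃ (reciprocal (suc q″))
  go₁ : (∃ λ h₃ → 0ℚ < h₃ × fromℕ 3 * h₃ ≤ h) → Lengths h
  go₁ (h₃ , h₃>0 , 3h₃≤h) = go₂ h₃ 3h₃≤h h₃>0 (archimedean h₃ h₃>0)

-- `9` is the number of losses and `K` the number of sampled cells. The three `ε` in `e` are the
-- edges lost while the containers are refined and the two error terms of dropping heavy vertices.
record Losses≤ (K kA : ℕ) : Set where
  field
    b e ε    : ℚ
    b-small  : fromℕ (2 ℕ.^ K) * (fromℕ 9 * b) < 1ℚ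
    e>0      : 0ℚ < e
    Ae≤b     : fromℕ (suc kA) * e ≤ b
    ε>0      : 0ℚ < ε
    3ε≤e     : fromℕ 3 * ε ≤ e
    R        : ℕ
    rounds   : 1ℚ ≤ fromℕ R * (ε * (ε * ε))
    ε₀       : ℚ
    ε₀>0     : 0ℚ < ε₀
    4^Rε₀    : fromℕ (4 ℕ.^ R) * ε₀ ≤ ε

choose-losses : ∀ K kA → Losses≤ K kA
choose-losses K kA = go₁ (fraction (2 ℕ.^ K ℕ.* 9) ½ (ℚ.positive⁻¹ ½))
  where
  module _ {b : ℚ} (b-small : fromℕ (2 ℕ.^ K) * (fromℕ 9 * b) < 1ℚ) where
    go₅ : ∀ {e ε} → 0ℚ < e → fromℕ (suc kA) * e ≤ b → 0ℚ < ε → fromℕ 3 * ε ≤ e → ∀ R → 1ℚ ≤ fromℕ R * (ε * (ε * ε)) →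
          (∃ λ ε₀ → 0ℚ < ε₀ × fromℕ (4 ℕ.^ R) * ε₀ ≤ ε) → Losses≤ K kA
    go₅ {e} {ε} e>0 Ae≤b ε>0 3ε≤e R rounds (ε₀ , ε₀>0 , le) = record
      { b = b ; e = e ; ε = ε ; b-small = b-small ; e>0 = e>0 ; Ae≤b = Ae≤b ; ε>0 = ε>0 ; 3ε≤e = 3ε≤e
      ; R = R ; rounds = rounds ; ε₀ = ε₀ ; ε₀>0 = ε₀>0 ; 4^Rε₀ = le }
    go₄ : ∀ {e ε} → 0ℚ < e → fromℕ (suc kA) * e ≤ b → 0ℚ < ε → fromℕ 3 * ε ≤ e → (∃ λ R → 1ℚ ≤ fromℕ (suc R) * (ε * (ε * ε))) → Losses≤ K kA
    go₄ {ε = ε} e>0 Ae≤b ε>0 3ε≤e (R , rounds) = go₅ e>0 Ae≤b ε>0 3ε≤e (suc R) rounds (fraction (4 ℕ.^ suc R) ε ε>0)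
    go₃ : ∀ {e} → 0ℚ < e → fromℕ (suc kA) * e ≤ b → (∃ λ ε → 0ℚ < ε × fromℕ 3 * ε ≤ e) → Losses≤ K kA
    go₃ e>0 Ae≤b (ε , ε>0 , 3ε≤e) = go₄ e>0 Ae≤b ε>0 3ε≤e (archimedean (ε * (ε * ε)) (*-pos ε>0 (*-pos ε>0 ε>0)))
    go₂ : (∃ λ e → 0ℚ < e × fromℕ (suc kA) * e ≤ b) → Losses≤ K kA
    go₂ (e , e>0 , Ae≤b) = go₃ e>0 Ae≤b (fraction 3 e e>0)
  go₁ : (∃ λ b → 0ℚ < b × fromℕ (2 ℕ.^ K ℕ.* 9) * b ≤ ½) → Losses≤ K kA
  go₁ (b , b>0 , b≤) = go₂ (≤-<-trans (≤-trans (≤-reflexive (trans (sym (*-assoc (fromℕ (2 ℕ.^ K)) (fromℕ 9) b))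
      (*-left (sym (fromℕ-* (2 ℕ.^ K) 9))))) b≤) ½<1) (fraction (suc kA) b b>0)

-- The M container relations and the M class relations are regularised together, hence `M + M`. The
-- quantity `ω` is half of what `common-class` tolerates; `M δ` uses one half and `ζ` the other.
record Regularities (h ω e : ℚ) (M : ℕ) : Set where
  field
    δ        : ℚ
    δ>0      : 0ℚ < δ
    Mδ       : fromℕ M * δ ≤ ω
    errors   : fromℕ (suc M) * (fromℕ (suc M) * (δ + δ)) ≤ h
    Rr       : ℕ
    enough   : fromℕ (M ℕ.+ M) ≤ fromℕ Rr * (δ * e * (δ * e))
    ρ        : ℚ
    ρ>0      : 0ℚ < ρ
    Nρ≤e     : fromℕ (cellBound Rr 1) * ρ ≤ e

choose-regularities : ∀ h ω e M → 0ℚ < ω → ω ≤ h → 0ℚ < e → Regularities h ω e M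
choose-regularities h ω e M ω>0 ω≤h e>0 = go₁ (fraction (suc M ℕ.* (suc M ℕ.* 2)) ω ω>0)
  where
  go₃ : ∀ {δ} → 0ℚ < δ → fromℕ (suc M ℕ.* (suc M ℕ.* 2)) * δ ≤ ω → ∀ Rr → fromℕ (M ℕ.+ M) ≤ fromℕ Rr * (δ * e * (δ * e)) →
        (∃ λ ρ → 0ℚ < ρ × fromℕ (cellBound Rr 1) * ρ ≤ e) → Regularities h ω e M
  go₃ {δ} δ>0 Cδ≤ Rr enough (ρ , ρ>0 , Nρ≤e) = record { δ = δ ; δ>0 = δ>0 ; Mδ = Mδ ; errors = errors ; Rr = Rr ; enough = enough ; ρ = ρ ; ρ>0 = ρ>0 ; Nρ≤e = Nρ≤e }
    where
    Mδ : fromℕ M * δ ≤ ω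
    Mδ = ≤-trans (*-mono-≤ʳ δ (<⇒≤ δ>0) (fromℕ-mono (ℕ.≤-trans (ℕ.n≤1+n M) (ℕ.m≤m*n (suc M) (suc M ℕ.* 2))))) Cδ≤
    errors : fromℕ (suc M) * (fromℕ (suc M) * (δ + δ)) ≤ h
    errors = ≤-trans (≤-reflexive (sym (trans (*-left (trans (fromℕ-* (suc M) (suc M ℕ.* 2)) (*-right (trans (fromℕ-* (suc M) 2) (*-right fromℕ-2)))))
                 (solve 2 (λ m d → m :* (m :* (con 1ℚ :+ con 1ℚ)) :* d := m :* (m :* (d :+ d))) refl (fromℕ (suc M)) δ)))) (≤-trans Cδ≤ ω≤h)
  go₂ : ∀ {δ} → 0ℚ < δ → fromℕ (suc M ℕ.* (suc M ℕ.* 2)) * δ ≤ ω → (∃ λ k → 1ℚ ≤ fromℕ (suc k) * (δ * e * (δ * e))) → Regularities h ω e M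
  go₂ {δ} δ>0 Cδ≤ (k , 1≤k) = go₃ δ>0 Cδ≤ ((M ℕ.+ M) ℕ.* suc k)
    (≤-trans (≤-reflexive (sym (*-identityʳ (fromℕ (M ℕ.+ M))))) (≤-trans (*-mono-≤ˡ (fromℕ (M ℕ.+ M)) (fromℕ-nonneg _) 1≤k)
       (≤-reflexive (trans (sym (*-assoc (fromℕ (M ℕ.+ M)) (fromℕ (suc k)) (δ * e * (δ * e)))) (*-left (sym (fromℕ-* (M ℕ.+ M) (suc k))))))))
    (fraction (cellBound ((M ℕ.+ M) ℕ.* suc k) 1) e e>0)
  go₁ : (∃ λ δ → 0ℚ < δ × fromℕ (suc M ℕ.* (suc M ℕ.* 2)) * δ ≤ ω) → Regularities h ω e M
  go₁ (δ , δ>0 , Cδ≤) = go₂ δ>0 Cδ≤ (archimedean (δ * e * (δ * e)) (*-pos (*-pos δ>0 e>0) (*-pos δ>0 e>0)))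

-- Weights of order 1 on cells of size ρ n turn the error μ n³ into μ / ρ³ relative to the cells, so
-- μ is proportional to ρ³. The bound `n₀` makes the weight 1 / (ρ n) of a single vertex at most
-- `h`.
record Sizes (h ρ : ℚ) : Set where
  field
    P        : ℚ
    ρP       : ρ * P ≡ 1ℚ
    μ        : ℚ
    μ>0      : 0ℚ < μ
    6μP³     : 6ℚ * (μ * (P * (P * P))) ≤ h
    n₀       : ℕ
    n₀-large : 1ℚ ≤ fromℕ (suc n₀) * (h * ρ)

choose-sizes : ∀ h ρ → 0ℚ < h → 0ℚ < ρ → Sizes h ρ
choose-sizes h ρ h>0 ρ>0 = go (*-inverse ρ ρ>0) (fraction 6 h h>0) (archimedean (h * ρ) (*-pos h>0 ρ>0))
  where
  go : (∃ λ P → ρ * P ≡ 1ℚ) → (∃ λ h₆ → 0ℚ < h₆ × 6ℚ * h₆ ≤ h) → (∃ λ n₀ → 1ℚ ≤ fromℕ (suc n₀) * (h * ρ)) → Sizes h ρ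
  go (P , ρP) (h₆ , h₆>0 , 6h₆≤h) (n₀ , n₀-large) = record
    { P = P ; ρP = ρP ; μ = h₆ * (ρ * (ρ * ρ)) ; μ>0 = *-pos h₆>0 (*-pos ρ>0 (*-pos ρ>0 ρ>0))
    ; 6μP³ = ≤-trans (≤-reflexive (*-right (trans (solve 3 (λ x ρ P → x :* (ρ :* (ρ :* ρ)) :* (P :* (P :* P)) := x :* ((ρ :* P) :* ((ρ :* P) :* (ρ :* P)))) refl h₆ ρ P)
              (trans (*-right (trans (cong (λ z → z * (z * z)) ρP) (trans (*-identityˡ _) (*-identityˡ 1ℚ)))) (*-identityʳ h₆))))) 6h₆≤h
    ; n₀ = n₀ ; n₀-large = n₀-large }

colours : ℕ → ℕ
colours k₁ = suc (suc k₁) ℕ.* (suc (suc k₁) ℕ.* (2 ℕ.* (2 ℕ.* 2)))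

listLength : ℕ → ℕ → ℕ
listLength k₁ q″ = proj₁ (ramsey (colours k₁) 3 (suc (suc q″) ℕ.+ 3))

-- The dependencies run from `h` through `η`, the number q of targets, `ω` and `ζ` to the sample
-- size, then through `ε`, the number of container rounds and `ε₀` to `δ`, `ρ`, `μ` and `n₀`.
-- Everything depends on d alone; in particular the triangle bound `ε₀` is fixed before any graph is
-- given.
record Parameters (d : ℚ) : Set where
  field
    gap : Gap d
  open Gap gap public hiding (gap)
  field
    k₁       : ℕ
    η        : ℚ
    gη≡1     : fromℕ (suc k₁) * η ≡ 1ℚ
    η>0      : 0ℚ < η
    η≤h      : η ≤ h
    lengths  : Lengths h
  open Lengths lengths public
  field
    ω        : ℚ
    ω>0      : 0ℚ < ω
    2ω≤hτ    : fromℕ 2 * ω ≤ h * τ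
    ω≤h      : ω ≤ h
    kA       : ℕ
    ζ        : ℚ
    Aζ       : fromℕ (suc kA) * ζ ≡ 1ℚ
    ζ≤ω      : ζ ≤ ω
  field
    losses : Losses≤ (listLength k₁ q″) kA
  open Losses≤ losses public
  field
    regularities : Regularities h ω e (2 ℕ.^ R)
  open Regularities regularities public
  field
    sizes : Sizes h ρ
  open Sizes sizes public

parameters : ∀ d → ¼ < d → d ≤ 1ℚ → Parameters d
parameters d d>¼ d≤1 = go₁ (choose-gap d d>¼ d≤1)
  where
  module _ (G : Gap d) where
    open Gap G using (h; h>0; h≤1)

    go₅ : ∀ {k₁ η} → fromℕ (suc k₁) * η ≡ 1ℚ → 0ℚ < η → η ≤ h → (Λ : Lengths h) → let open Lengths Λ in
          ∀ {ω} → 0ℚ < ω → fromℕ 2 * ω ≤ h * τ → ω ≤ h → ∀ {kA ζ} → fromℕ (suc kA) * ζ ≡ 1ℚ → ζ ≤ ω →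
          (L : Losses≤ (listLength k₁ q″) kA) →
          (R : Regularities h ω (Losses≤.e L) (2 ℕ.^ Losses≤.R L)) → Parameters d
    go₅ gη≡1 η>0 η≤h Λ ω>0 2ω≤hτ ω≤h Aζ ζ≤ω L R = record
      { gap = G ; gη≡1 = gη≡1 ; η>0 = η>0 ; η≤h = η≤h ; lengths = Λ ; ω>0 = ω>0 ; 2ω≤hτ = 2ω≤hτ ; ω≤h = ω≤h ; Aζ = Aζ ; ζ≤ω = ζ≤ω
      ; losses = L ; regularities = R ; sizes = choose-sizes h (Regularities.ρ R) h>0 (Regularities.ρ>0 R) }
    go₄ : ∀ {k₁ η} → fromℕ (suc k₁) * η ≡ 1ℚ → 0ℚ < η → η ≤ h → (Λ : Lengths h) → let open Lengths Λ in
          ∀ {ω} → 0ℚ < ω → fromℕ 2 * ω ≤ h * τ → ω ≤ h → ∀ {kA ζ} → fromℕ (suc kA) * ζ ≡ 1ℚ → ζ ≤ ω →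
          Losses≤ (listLength k₁ q″) kA → Parameters d
    go₄ gη≡1 η>0 η≤h Λ {ω} ω>0 2ω≤hτ ω≤h Aζ ζ≤ω L = go₅ gη≡1 η>0 η≤h Λ ω>0 2ω≤hτ ω≤h Aζ ζ≤ω L
      (choose-regularities h ω (Losses≤.e L) (2 ℕ.^ Losses≤.R L) ω>0 ω≤h (Losses≤.e>0 L))
    go₃ : ∀ {k₁ η} → fromℕ (suc k₁) * η ≡ 1ℚ → 0ℚ < η → η ≤ h → (Λ : Lengths h) → let open Lengths Λ in
          ∀ {ω} → 0ℚ < ω → fromℕ 2 * ω ≤ h * τ → (∃ λ kA → ∃ λ ζ → fromℕ (suc kA) * ζ ≡ 1ℚ × 0ℚ < ζ × ζ ≤ ω) → Parameters d
    go₃ {k₁} gη≡1 η>0 η≤h Λ {ω} ω>0 2ω≤hτ (kA , ζ , Aζ , _ , ζ≤ω) = go₄ gη≡1 η>0 η≤h Λ ω>0 2ω≤hτ ω≤h Aζ ζ≤ω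
        (choose-losses (listLength k₁ (Lengths.q″ Λ)) kA)
      where
      ω≤h : ω ≤ h
      ω≤h = ≤-trans (≤-trans (by-diff ω (<⇒≤ ω>0) (sym (trans (*-left fromℕ-2) (solve 1 (λ x → (con 1ℚ :+ con 1ℚ) :* x := x :+ x) refl ω)))) 2ω≤hτ)
              (≤-trans (*-mono-≤ˡ h (<⇒≤ h>0) (Lengths.τ≤1 Λ)) (≤-reflexive (*-identityʳ h)))
    go₂ : (∃ λ k₁ → ∃ λ η → fromℕ (suc k₁) * η ≡ 1ℚ × 0ℚ < η × η ≤ h) → (Λ : Lengths h) →
          (∃ λ ω → 0ℚ < ω × fromℕ 2 * ω ≤ h * Lengths.τ Λ) → Parameters d
    go₂ (k₁ , η , gη≡1 , η>0 , η≤h) Λ (ω , ω>0 , 2ω≤hτ) = go₃ gη≡1 η>0 η≤h Λ ω>0 2ω≤hτ (small-reciprocal ω ω>0)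
    go₁′ : Lengths h → Parameters d
    go₁′ Λ = go₂ (small-reciprocal h h>0) Λ (fraction 2 (h * Lengths.τ Λ) (*-pos h>0 (Lengths.τ>0 Λ)))
  go₁ : Gap d → Parameters d
  go₁ G = go₁′ G (choose-lengths (Gap.h G) (Gap.h>0 G) (Gap.h≤1 G))

-- Dense graphs above 1/4 with few triangles in the links

module Supersaturation {d : ℚ} (d>¼ : ¼ < d) (d≤1 : d ≤ 1ℚ) (parms : Parameters d) where
  open Parameters parms

  private
    M = 2 ℕ.^ R

  module _ (H : 3Graph) (dense : Dense d μ H) (n-large : suc n₀ ℕ.≤ 3Graph.n H)
    (triangles : ∀ a q → ∑ (λ b → ∑ λ c → 𝟙 (3Graph.E H a q b ∧ (3Graph.E H a b c ∧ 3Graph.E H a q c))) ≤ ε₀ * (fromℕ (3Graph.n H) * fromℕ (3Graph.n H))) where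

    open 3Graph H renaming (n to order)

    private
      V = Fin order
      Nᵥ = fromℕ order
      Nᵥ≥0 = fromℕ-nonneg order

      n>0 : 0ℚ < Nᵥ
      n>0 = <-≤-trans (fromℕ-pos n₀) (fromℕ-mono n-large)

      families : ∀ a → Containers.Family (E a) ε>0 (*-nonneg (<⇒≤ ε₀>0) (*-nonneg Nᵥ≥0 Nᵥ≥0)) n>0 (sym₂₃ a) (triangles a) M _
      families a = Containers.containers (E a) ε>0 (*-nonneg (<⇒≤ ε₀>0) (*-nonneg Nᵥ≥0 Nᵥ≥0)) n>0 (sym₂₃ a) (triangles a) R rounds

    κ : V → V → Fin M
    κ a = Containers.Family.κ (families a)

    U : V → Fin M → V → Bool
    U a = Containers.Family.U (families a)

    sparse : ∀ a p → ∑ (λ c → ∑ λ d → 𝟙 (U a p c ∧ (U a p d ∧ E a c d))) ≤ Nᵥ * (ε * Nᵥ)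
    sparse a = Containers.Family.sparse (families a)

    covers : ∀ a → ∑ (λ b → ∑ λ c → 𝟙 (E a b c ∧ not (U a (κ a b) c))) ≤ Nᵥ * (e * Nᵥ)
    covers a = ≤-trans (Containers.Family.covers (families a)) (begin
      fromℕ (4 ℕ.^ R) * (ε₀ * (Nᵥ * Nᵥ)) + (Nᵥ * (ε * Nᵥ) + Nᵥ * (ε * Nᵥ))
        ≡⟨ +-left (sym (*-assoc (fromℕ (4 ℕ.^ R)) ε₀ (Nᵥ * Nᵥ))) ⟩
      fromℕ (4 ℕ.^ R) * ε₀ * (Nᵥ * Nᵥ) + (Nᵥ * (ε * Nᵥ) + Nᵥ * (ε * Nᵥ))
        ≤⟨ +-mono-≤ (*-mono-≤ʳ (Nᵥ * Nᵥ) (square-nonneg Nᵥ) 4^Rε₀) ≤-refl ⟩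
      ε * (Nᵥ * Nᵥ) + (Nᵥ * (ε * Nᵥ) + Nᵥ * (ε * Nᵥ))
        ≡⟨ solve 2 (λ x N → x :* (N :* N) :+ (N :* (x :* N) :+ N :* (x :* N)) := (con 1ℚ :+ con 1ℚ :+ con 1ℚ) :* x :* (N :* N)) refl ε Nᵥ ⟩
      (1ℚ + 1ℚ + 1ℚ) * ε * (Nᵥ * Nᵥ)
        ≤⟨ *-mono-≤ʳ (Nᵥ * Nᵥ) (square-nonneg Nᵥ) (≤-trans (≤-reflexive (*-left (sym fromℕ-3))) 3ε≤e) ⟩
      e * (Nᵥ * Nᵥ)
        ≡⟨ solve 2 (λ x N → x :* (N :* N) := N :* (x :* N)) refl e Nᵥ ⟩
      Nᵥ * (e * Nᵥ) ∎)
      where open ≤-Reasoning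

    relation : Fin M ⊎ Fin M → V → V → Bool
    relation (inj₁ p) a c = U a p c
    relation (inj₂ p) a b = κ a b == p

    f : Fin (M ℕ.+ M) → V → V → Bool
    f r = relation (Fin.splitAt M r)

    open Regularity f δ>0 e>0 n>0 using (RegularPartition; regular-partition)

    ε≤e : ε ≤ e
    ε≤e = ≤-trans (by-diff (ε + ε) (+-nonneg (<⇒≤ ε>0) (<⇒≤ ε>0))
      (trans (solve 1 (λ x → x :+ (x :+ x) := (con 1ℚ :+ con 1ℚ :+ con 1ℚ) :* x) refl ε) (*-left (sym fromℕ-3)))) 3ε≤e

    e≤b : e ≤ b
    e≤b = ≤-trans (≤-trans (≤-reflexive (sym (*-identityˡ e))) (*-mono-≤ʳ e (<⇒≤ e>0)
      (≤-trans (≤-reflexive (sym fromℕ-1)) (fromℕ-mono {1} {suc kA} (ℕ.s≤s ℕ.z≤n))))) Ae≤b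

    module _ (RP : RegularPartition (cellBound Rr 1)) where
      open RegularPartition RP

      regular′ : ∀ x y → irr (χ x) (χ y) ≡ false → ∀ p →
        Regular δ (Cells.K χ x) (Cells.K χ y) (λ a c → U a p c) × Regular δ (Cells.K χ x) (Cells.K χ y) (λ a b → κ a b == p)
      regular′ x y ok p =
        subst (λ z → Regular δ (Cells.K χ x) (Cells.K χ y) (relation z)) (Fin.splitAt-↑ˡ M p M) (regular x y (p Fin.↑ˡ M) ok) ,
        subst (λ z → Regular δ (Cells.K χ x) (Cells.K χ y) (relation z)) (Fin.splitAt-↑ʳ M M p) (regular x y (M Fin.↑ʳ p) ok)

      open Uniform n>0
      open Link E κ U using (escape)
      open Levels E κ U using (spread)

      A = fromℕ (suc kA)

      A>0 : 0ℚ < A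
      A>0 = fromℕ-pos kA

      open Losses E κ U χ irr A ρ (<⇒≤ A>0) n>0 (<⇒≤ ρ>0)

      escape-avg : escape unif unif unif ≤ e
      escape-avg = 𝔼-≤ unif-prob e λ a → 𝔼𝔼-unif-≤ _ (covers a)

      -- Every container is sparse, so the bound holds for whichever class b belongs to.
      spread-avg : spread unif unif unif unif ≤ e
      spread-avg = 𝔼-≤ unif-prob e λ a → 𝔼-≤ unif-prob e λ b → 𝔼𝔼-unif-≤ _ (≤-trans
        (≤-reflexive (∑-cong λ c → ∑-cong λ d → cong 𝟙 (rearrange (E a c d) (U a (κ a b) c) (U a (κ a b) d))))
        (≤-trans (sparse a (κ a b)) (*-mono-≤ˡ Nᵥ Nᵥ≥0 (*-mono-≤ʳ Nᵥ Nᵥ≥0 ε≤e))))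
        where
        rearrange : ∀ x y z → x ∧ (y ∧ z) ≡ y ∧ (z ∧ x)
        rearrange true  y z = cong (y ∧_) (sym (Bool.∧-identityʳ z))
        rearrange false y z = sym (trans (cong (y ∧_) (Bool.∧-zeroʳ z)) (Bool.∧-zeroʳ y))

      irr-avg : (𝔼 unif λ a → 𝔼 unif λ b → 𝟙 (irr (χ a) (χ b))) ≤ e
      irr-avg = 𝔼𝔼-unif-≤ _ (≤-trans few (≤-reflexive (solve 2 (λ x N → x :* (N :* N) := N :* (x :* N)) refl e Nᵥ)))

      tiny-avg : 𝔼 unif (𝟙 ∘ tiny χ ρ (<⇒≤ ρ>0)) ≤ e
      tiny-avg = ≤-trans (few-tiny χ ρ (<⇒≤ ρ>0)) (≤-trans (*-mono-≤ʳ ρ (<⇒≤ ρ>0) (fromℕ-mono N≤)) Nρ≤e)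

      open Homogeneous (<⇒≤ (<-trans (ℚ.positive⁻¹ ¼) d>¼)) d≤1 (<⇒≤ μ>0) H dense n>0 κ U χ irr (<⇒≤ δ>0) regular′
        A>0 Aζ (<⇒≤ ρ>0) h>0 h≤1 (suc k₁) gη≡1 η>0 η≤h

      good-vertices : ∃ λ xs → length xs ≡ listLength k₁ q″ × Increasing 4 Good xs
      good-vertices = avoid χ (listLength k₁ q″) 4 loss loss-nonneg
        (expected-loss escape-avg spread-avg irr-avg tiny-avg Ae≤b e≤b) b-small

      d-small : d ≤ ¼ + (h + h + h + (h + h + h) + (h + h + h)) + (h + h + h) + (h + h + h) + h
      d-small = from-list good-vertices
        where
        v₀ : V
        v₀ = Fin.fromℕ< (ℕ.<-≤-trans (ℕ.s≤s ℕ.z≤n) n-large)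

        z = ρ * Nᵥ
        z>0 : 0ℚ < z
        z>0 = *-pos ρ>0 n>0

        conclude : (∃ λ s → z * s ≡ 1ℚ) → ∀ ys → suc (suc q″) ℕ.+ 3 ℕ.≤ length ys → Increasing 4 Good ys → ∀ col → Monochromatic 3 colour col ys →
                   d ≤ ¼ + (h + h + h + (h + h + h) + (h + h + h)) + (h + h + h) + (h + h + h) + h
        conclude (s , zs) ys long inc col mono = ≤-trans
          (contradiction (<⇒≤ τ>0) (≤-trans ζ≤ω ω≤h) ζ+Mδ errors (suc q″) count (nth v₀ ys) {col}
            (λ ij jk kl → Increasing₃ {P = λ v → colour v ≡ col} {v₀} {ys} mono ij jk (ℕ.<-≤-trans kl long))
            (λ ij jk kl ll → Increasing₄ {P = Good} {v₀} {ys} inc ij jk kl (ℕ.<-≤-trans ll long))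
            (ℕ.s≤s ℕ.z≤n) s≥0 sz Qk₀ (<⇒≤ k₀>0) sz z>0 (≤-reflexive N≡zP))
          (+-mono-≤ (+-mono-≤ (+-mono-≤ ≤-refl (+-mono-≤ (+-mono-≤ s≤h s≤h) s≤h)) (+-mono-≤ (+-mono-≤ k₀≤h k₀≤h) k₀≤h)) 6μP³)
          where
          sz : s * z ≡ 1ℚ
          sz = trans (*-comm s z) zs
          s≥0 : 0ℚ ≤ s
          s≥0 = *-cancel-≤ z z>0 (≤-trans (≤-reflexive (zeroʳ z)) (≤-trans 0≤1 (≤-reflexive (sym zs))))
          s≤h : s ≤ h
          s≤h = *-cancel-≤ z z>0 (≤-trans (≤-reflexive zs) (≤-trans n₀-large (≤-trans (*-mono-≤ʳ (h * ρ) (<⇒≤ (*-pos h>0 ρ>0)) (fromℕ-mono n-large))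
            (≤-reflexive (solve 3 (λ n h r → n :* (h :* r) := r :* n :* h) refl Nᵥ h ρ)))))
          N≡zP : Nᵥ ≡ z * P
          N≡zP = sym (trans (solve 3 (λ r n p → r :* n :* p := n :* (r :* p)) refl ρ Nᵥ P) (trans (*-right ρP) (*-identityʳ Nᵥ)))
          ζ+Mδ : ζ + fromℕ M * δ ≤ h * τ
          ζ+Mδ = ≤-trans (+-mono-≤ ζ≤ω Mδ) (≤-trans (≤-reflexive (trans (solve 1 (λ x → x :+ x := (con 1ℚ :+ con 1ℚ) :* x) refl ω) (*-left (sym fromℕ-2)))) 2ω≤hτ)

        from-ramsey : ∀ xs → Increasing 4 Good xs → _ → d ≤ ¼ + (h + h + h + (h + h + h) + (h + h + h)) + (h + h + h) + (h + h + h) + h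
        from-ramsey xs inc (ys , col , s , long , mono) = conclude (*-inverse z z>0) ys long (Increasing-⊆ 4 s inc) col mono

        from-list : _ → d ≤ ¼ + (h + h + h + (h + h + h) + (h + h + h)) + (h + h + h) + (h + h + h) + h
        from-list (xs , len , inc) = from-ramsey xs inc (proj₂ (ramsey (colours k₁) 3 (suc (suc q″) ℕ.+ 3)) colour xs (ℕ.≤-reflexive (sym len)))

    impossible : ⊥
    impossible = regular-partition Rr enough λ RP → <-irrefl refl (<-≤-trans (ℚ.positive⁻¹ 1ℚ) (absurd (d-small RP)))
      where
      4ℚ : ℚ
      4ℚ = 1ℚ + 1ℚ + (1ℚ + 1ℚ)
      absurd : d ≤ ¼ + (h + h + h + (h + h + h) + (h + h + h)) + (h + h + h) + (h + h + h) + h → 1ℚ ≤ 0ℚ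
      absurd le = ⊥-elim (<-irrefl refl (<-≤-trans (*-pos 4>0 h>0) (by-diff (d - (¼ + 20ℚ * h) + (¼ + (h + h + h + (h + h + h) + (h + h + h)) + (h + h + h) + (h + h + h) + h - d))
        (+-nonneg (diff (Gap.gap gap)) (diff le)) (solve 2 (λ h d → (con 1ℚ :+ con 1ℚ :+ (con 1ℚ :+ con 1ℚ)) :* h :+ (d :- (con ¼ :+ con 20ℚ :* h) :+ (con ¼ :+ (h :+ h :+ h :+ (h :+ h :+ h) :+ (h :+ h :+ h)) :+ (h :+ h :+ h) :+ (h :+ h :+ h) :+ h :- d)) := con 0ℚ) refl h d))))
        where
        4>0 : 0ℚ < 4ℚ
        4>0 = <-≤-trans (ℚ.positive⁻¹ 1ℚ) (by-diff (1ℚ + (1ℚ + 1ℚ)) (+-nonneg 0≤1 (+-nonneg 0≤1 0≤1)) (solve 0 (con 1ℚ :+ (con 1ℚ :+ (con 1ℚ :+ con 1ℚ)) := con 1ℚ :+ con 1ℚ :+ (con 1ℚ :+ con 1ℚ)) refl))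

-- Complete bipartite subgraphs of dense graphs

-- The field `covered` carries the induction through empty left sides: with l = 0, `edge` says
-- nothing, but an edge of the restricted graph at `d j` still certifies that the vertex put aside
-- is adjacent to `d j`. Only arguments below l and m matter.
record Biclique {n} (G : Fin n → Fin n → Bool) (l m : ℕ) : Set where
  field
    b d   : ℕ → Fin n
    b-inj : ∀ {i j} → i ℕ.< l → j ℕ.< l → b i ≡ b j → i ≡ j
    d-inj : ∀ {i j} → i ℕ.< m → j ℕ.< m → d i ≡ d j → i ≡ j
    edge  : ∀ {i j} → i ℕ.< l → j ℕ.< m → G (b i) (d j) ≡ true
    covered : ∀ {j} → j ℕ.< m → ∃ λ x → G x (d j) ≡ true

∧-split : ∀ {x y} → x ∧ y ≡ true → x ≡ true × y ≡ true
∧-split {true} {true} _ = refl , refl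

module CommonNeighbour {n} (G : Fin n → Fin n → Bool) {e : ℚ} (e>0 : 0ℚ < e) (n>0 : 0ℚ < fromℕ n)
  (dense : e * (fromℕ n * fromℕ n) ≤ ∑ λ b → ∑ λ d → 𝟙 (G b d)) where

  N = fromℕ n
  N≥0 = fromℕ-nonneg n

  degree : Fin n → ℚ
  degree d = ∑ λ b → 𝟙 (G b d)

  codegrees : Fin n → ℚ
  codegrees b₁ = ∑ λ b → ∑ λ d → 𝟙 (G b d) * 𝟙 (G b₁ d)

  -- The sum of codegrees is the sum of squared degrees. Instead of Cauchy-Schwarz, each square is
  -- bounded below by its tangent at e N, the guaranteed mean degree.
  codegrees-total : e * e * (N * (N * N)) ≤ ∑ codegrees
  codegrees-total = begin
    e * e * (N * (N * N))
      ≤⟨ by-diff ((e * N + e * N) * (∑ degree - e * (N * N))) (*-nonneg (+-nonneg eN≥0 eN≥0) (diff (≤-trans dense (≤-reflexive (∑-swap _)))))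
           (solve 3 (λ e N S → e :* e :* (N :* (N :* N)) :+ (e :* N :+ e :* N) :* (S :- e :* (N :* N)) := (e :* N :+ e :* N) :* S :- N :* (e :* N :* (e :* N))) refl e N (∑ degree)) ⟩
    (e * N + e * N) * ∑ degree - N * (e * N * (e * N))
      ≡⟨ trans (cong₂ _-_ (∑-*ˡ _ degree) (sym (∑-const n _))) (sym (∑-- _ _)) ⟩
    ∑ (λ d → (e * N + e * N) * degree d - e * N * (e * N))
      ≤⟨ ∑-mono (λ d → by-diff ((degree d - e * N) * (degree d - e * N)) (square-nonneg (degree d - e * N))
           (solve 2 (λ x t → (t :+ t) :* x :- t :* t :+ (x :- t) :* (x :- t) := x :* x) refl (degree d) (e * N))) ⟩
    ∑ (λ d → degree d * degree d)
      ≡⟨ ∑-cong (λ d → trans (∑-*ʳ (degree d) _) (∑-cong λ b → ∑-*ˡ (𝟙 (G b d)) _)) ⟩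
    ∑ (λ d → ∑ λ b → ∑ λ b₁ → 𝟙 (G b d) * 𝟙 (G b₁ d))
      ≡⟨ trans (∑-swap _) (trans (∑-cong λ b → ∑-swap _) (∑-swap _)) ⟩
    ∑ codegrees ∎
    where
    open ≤-Reasoning
    eN≥0 : 0ℚ ≤ e * N
    eN≥0 = *-nonneg (<⇒≤ e>0) N≥0

  half = ½ * (e * e)

  opaque
    popular : ∃ λ b₁ → half * (N * N) < codegrees b₁
    popular = ∑-∃-< (λ _ → half * (N * N)) codegrees (<-≤-trans (subst₂ _<_ (+-identityˡ _) refl (subst (0ℚ + ∑ (λ _ → half * (N * N)) <_) eq (+-mono-<ˡ x>0))) codegrees-total)
      where
      x : ℚ
      x = half * (N * (N * N))
      x>0 : 0ℚ < x
      x>0 = *-pos (*-pos (ℚ.positive⁻¹ ½) (*-pos e>0 e>0)) (*-pos n>0 (*-pos n>0 n>0))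
      eq : x + ∑ (λ (_ : Fin n) → half * (N * N)) ≡ e * e * (N * (N * N))
      eq = trans (+-right (∑-const n _)) (solve 2 (λ e N → con ½ :* (e :* e) :* (N :* (N :* N)) :+ N :* (con ½ :* (e :* e) :* (N :* N)) := e :* e :* (N :* (N :* N))) refl e N)

  b₁ = proj₁ popular

  G′ : Fin n → Fin n → Bool
  G′ b d = (G b d ∧ G b₁ d) ∧ not (b == b₁)

  -- Deleting the row of `b₁` costs at most N edges, no more than half of the surplus once N is
  -- large. It forces later choices to differ from `b₁`.
  still-dense : 1ℚ ≤ N * (½ * half) → ½ * half * (N * N) ≤ ∑ λ b → ∑ λ d → 𝟙 (G′ b d)
  still-dense large = begin
    ½ * half * (N * N)
      ≤⟨ by-diff (N * (N * (½ * half) - 1ℚ)) (*-nonneg N≥0 (diff large))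
           (solve 2 (λ h N → con ½ :* h :* (N :* N) :+ N :* (N :* (con ½ :* h) :- con 1ℚ) := h :* (N :* N) :- N) refl half N) ⟩
    half * (N * N) - N
      ≤⟨ +-mono-≤ (<⇒≤ (proj₂ popular)) ≤-refl ⟩
    codegrees b₁ - N
      ≡⟨ cong (λ z → codegrees b₁ - z) (sym (trans (∑-δ b₁ (λ _ → N * 1ℚ)) (*-identityʳ N))) ⟩
    codegrees b₁ - ∑ (λ b → 𝟙 (b₁ == b) * (N * 1ℚ))
      ≡⟨ sym (∑-- _ _) ⟩
    ∑ (λ b → ∑ (λ d → 𝟙 (G b d) * 𝟙 (G b₁ d)) - 𝟙 (b₁ == b) * (N * 1ℚ))
      ≡⟨ ∑-cong (λ b → trans (cong (λ z → ∑ (λ d → 𝟙 (G b d) * 𝟙 (G b₁ d)) - z) (trans (*-right (sym (∑-const n 1ℚ))) (∑-*ˡ _ _))) (sym (∑-- _ _))) ⟩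
    ∑ (λ b → ∑ λ d → 𝟙 (G b d) * 𝟙 (G b₁ d) - 𝟙 (b₁ == b) * 1ℚ)
      ≤⟨ ∑-mono (λ b → ∑-mono λ d → ≤-trans (≤-reflexive (cong₂ _-_ (sym (𝟙-∧ (G b d) (G b₁ d))) (trans (*-identityʳ _) (cong 𝟙 (==-sym b₁ b)))))
           (point (G b d ∧ G b₁ d) (b == b₁))) ⟩
    ∑ (λ b → ∑ λ d → 𝟙 (G′ b d)) ∎
    where
    open ≤-Reasoning
    point : ∀ x y → 𝟙 x - 𝟙 y ≤ 𝟙 (x ∧ not y)
    point true  true  = ≤-reflexive (+-inverseʳ 1ℚ)
    point true  false = ≤-reflexive (solve 0 (con 1ℚ :- con 0ℚ := con 1ℚ) refl)
    point false y     = by-diff (𝟙 y) (𝟙-nonneg y) (solve 1 (λ y → con 0ℚ :- y :+ y := con 0ℚ) refl (𝟙 y))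

enumerate : (p : Fin n → Bool) → ∃ λ k → fromℕ k ≡ ∑ (𝟙 ∘ p) ×
            ∃ λ (d : Fin k → Fin n) → (∀ {i j} → d i ≡ d j → i ≡ j) × (∀ i → p (d i) ≡ true)
enumerate {zero}  p = 0 , trans fromℕ-0 (sym (∑-zero _)) , (λ ()) , (λ { {()} }) , λ ()
enumerate {suc n} p = cons (p zero) refl (enumerate (p ∘ suc))
  where
  cons : ∀ c → p zero ≡ c → (∃ λ k → fromℕ k ≡ ∑ (𝟙 ∘ p ∘ suc) × ∃ λ (d : Fin k → Fin n) → (∀ {i j} → d i ≡ d j → i ≡ j) × (∀ i → p (suc (d i)) ≡ true)) →
         ∃ λ k → fromℕ k ≡ ∑ (𝟙 ∘ p) × ∃ λ (d : Fin k → Fin (suc n)) → (∀ {i j} → d i ≡ d j → i ≡ j) × (∀ i → p (d i) ≡ true)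
  cons true eq (k , size , d , inj , ok) = suc k , trans (fromℕ-suc k) (trans (cong₂ _+_ (sym (cong 𝟙 eq)) size) (sym (∑-suc _))) , d′ ,
    (λ {i} {j} → inj′ i j) , λ { zero → eq ; (suc i) → ok i }
    where
    d′ : Fin (suc k) → Fin (suc n)
    d′ zero    = zero
    d′ (suc i) = suc (d i)
    inj′ : ∀ i j → d′ i ≡ d′ j → i ≡ j
    inj′ zero    zero    _ = refl
    inj′ (suc i) (suc j) e = cong suc (inj (Fin.suc-injective e))
  cons false eq (k , size , d , inj , ok) = k , trans size (trans (sym (+-identityˡ _)) (trans (+-left (sym (cong 𝟙 eq))) (sym (∑-suc _)))) ,
    suc ∘ d , inj ∘ Fin.suc-injective , ok

fromℕ-cancel-≤ : ∀ {m k} → fromℕ m ≤ fromℕ k → m ℕ.≤ k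
fromℕ-cancel-≤ {m} {k} le = ℕ.≮⇒≥ λ k<m → <-irrefl refl (<-≤-trans
  (≤-<-trans (≤-reflexive (sym (+-identityˡ (fromℕ k)))) (+-mono-<ˡ (ℚ.positive⁻¹ 1ℚ)))
  (≤-trans (≤-reflexive (sym (fromℕ-suc k))) (≤-trans (fromℕ-mono k<m) le)))

truncate : ∀ {c m} (d : Fin c → Fin n) → (∀ {i j} → d i ≡ d j → i ≡ j) → suc m ℕ.≤ c →
           ∃ λ (d′ : ℕ → Fin n) → (∀ {i j} → i ℕ.< suc m → j ℕ.< suc m → d′ i ≡ d′ j → i ≡ j) × (∀ i → ∃ λ x → d′ i ≡ d x)
truncate {n} {c} {m} d inj m<c = (λ i → d (at i)) , (λ i< j< eq → trans (sym (toℕ-at i<)) (trans (cong Fin.toℕ (inj eq)) (toℕ-at j<))) , λ i → at i , refl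
  where
  at : ℕ → Fin c
  at i with i ℕ.<? c
  ... | yes lt = Fin.fromℕ< lt
  -- Positions beyond the given list repeat its first entry; injectivity is claimed only below m +
  -- 1.
  ... | no _   = Fin.fromℕ< (ℕ.<-≤-trans (ℕ.s≤s (ℕ.z≤n {m})) m<c)
  toℕ-at : ∀ {i} → i ℕ.< suc m → Fin.toℕ (at i) ≡ i
  toℕ-at {i} lt with i ℕ.<? c
  ... | yes lt′ = Fin.toℕ-fromℕ< lt′
  ... | no ¬lt = ⊥-elim (¬lt (ℕ.<-≤-trans lt m<c))

HasBiclique : ℕ → ℕ → ℚ → ℕ → Set
HasBiclique l m e n₀ = ∀ {n} → suc n₀ ℕ.≤ n → (G : Fin n → Fin n → Bool) →
  e * (fromℕ n * fromℕ n) ≤ ∑ (λ b → ∑ λ d → 𝟙 (G b d)) → Biclique G l (suc m)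

-- Dependent choice by induction on l: a vertex of large total codegree is put aside and the graph
-- is restricted to its neighbourhood, which keeps a density of at least e² / 4. When no vertex is
-- left to choose, the columns are taken from the nonempty ones.
kővári-sós-turán : ∀ l m e → 0ℚ < e → ∃ (HasBiclique l m e)
kővári-sós-turán zero    m e e>0 = go (archimedean e e>0)
  where
  go : (∃ λ k → 1ℚ ≤ fromℕ (suc k) * e) → ∃ (HasBiclique zero m e)
  go (k , large) = suc m ℕ.* suc k , λ {n} n-large G dense → base n-large G dense
    where
    base : HasBiclique zero m e (suc m ℕ.* suc k)
    base {n} n-large G dense = build (enumerate p)
      where
      open ≤-Reasoning
      N = fromℕ n
      v₀ : Fin n
      v₀ = Fin.fromℕ< (ℕ.<-≤-trans (ℕ.s≤s ℕ.z≤n) n-large)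
      opaque
        hit? : ∀ d → Dec (∃ λ x → G x d ≡ true)
        hit? d = Fin.any? λ x → G x d Bool.≟ true
      p : Fin n → Bool
      p d = isYes (hit? d)
      column : ∀ d → ∑ (λ b → 𝟙 (G b d)) ≤ N * 𝟙 (p d)
      column d with hit? d
      ... | yes _ = ∑-≤-const 1ℚ λ b → 𝟙≤1 (G b d)
      ... | no none = ≤-trans (≤-reflexive (trans (∑-cong λ b → zero-entry b (G b d) refl) (∑-0 n))) (≤-reflexive (sym (zeroʳ N)))
        where
        zero-entry : ∀ b c → G b d ≡ c → 𝟙 (G b d) ≡ 0ℚ
        zero-entry b true  eq = ⊥-elim (none (b , eq))
        zero-entry b false eq = cong 𝟙 eq
      -- At least e N columns are nonempty, because a column has at most N entries; N exceeds (m +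
      -- 1) (k + 1), and (k + 1) e is at least 1.
      many : fromℕ (suc m) ≤ ∑ (𝟙 ∘ p)
      many = *-cancel-≤ N (<-≤-trans (fromℕ-pos (suc m ℕ.* suc k)) (fromℕ-mono n-large)) (begin
        N * fromℕ (suc m)
          ≤⟨ *-mono-≤ˡ N (fromℕ-nonneg n) (begin
               fromℕ (suc m)                             ≡⟨ *-identityʳ _ ⟨
               fromℕ (suc m) * 1ℚ                        ≤⟨ *-mono-≤ˡ _ (fromℕ-nonneg (suc m)) large ⟩
               fromℕ (suc m) * (fromℕ (suc k) * e)       ≡⟨ trans (sym (*-assoc _ _ e)) (*-left (sym (fromℕ-* (suc m) (suc k)))) ⟩
               fromℕ (suc m ℕ.* suc k) * e               ≤⟨ *-mono-≤ʳ e (<⇒≤ e>0) (fromℕ-mono (ℕ.≤-trans (ℕ.n≤1+n _) n-large)) ⟩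
               N * e                                     ∎) ⟩
        N * (N * e)
          ≡⟨ solve 2 (λ N e → N :* (N :* e) := e :* (N :* N)) refl N e ⟩
        e * (N * N)
          ≤⟨ dense ⟩
        ∑ (λ b → ∑ λ d → 𝟙 (G b d))
          ≡⟨ ∑-swap _ ⟩
        ∑ (λ d → ∑ λ b → 𝟙 (G b d))
          ≤⟨ ∑-mono column ⟩
        ∑ (λ d → N * 𝟙 (p d))
          ≡⟨ sym (∑-*ˡ N _) ⟩
        N * ∑ (𝟙 ∘ p) ∎)
      build : (∃ λ k → fromℕ k ≡ ∑ (𝟙 ∘ p) × ∃ λ (d : Fin k → Fin n) → (∀ {i j} → d i ≡ d j → i ≡ j) × (∀ i → p (d i) ≡ true)) → Biclique G zero (suc m)
      build (c , size , d , inj , ok) = finish (truncate d inj (fromℕ-cancel-≤ (≤-trans many (≤-reflexive (sym size)))))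
        where
        yes-true : ∀ {Q : Set} (q : Dec Q) → isYes q ≡ true → Q
        yes-true (yes q) _ = q
        finish : (∃ λ d′ → (∀ {i j} → i ℕ.< suc m → j ℕ.< suc m → d′ i ≡ d′ j → i ≡ j) × (∀ i → ∃ λ x → d′ i ≡ d x)) → Biclique G zero (suc m)
        finish (d′ , inj′ , values) = record
          { b = λ _ → v₀ ; d = d′ ; b-inj = λ () ; edge = λ () ; d-inj = inj′
          ; covered = λ {j} _ → subst (λ v → ∃ λ x → G x v ≡ true) (sym (proj₂ (values j))) (yes-true (hit? (d (proj₁ (values j)))) (ok (proj₁ (values j)))) }
kővári-sós-turán (suc l) m e e>0 = go (archimedean c c>0) (kővári-sós-turán l m c c>0)
  where
  c = ½ * (½ * (e * e))
  c>0 : 0ℚ < c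
  c>0 = *-pos (ℚ.positive⁻¹ ½) (*-pos (ℚ.positive⁻¹ ½) (*-pos e>0 e>0))
  go : (∃ λ k → 1ℚ ≤ fromℕ (suc k) * c) → ∃ (HasBiclique l m c) → ∃ (HasBiclique (suc l) m e)
  go (k , large) (n₀ , find) = k ℕ.+ n₀ , λ {n} n-large G dense → step n-large G dense
    where
    step : HasBiclique (suc l) m e (k ℕ.+ n₀)
    step {n} n-large G dense = extend (find (ℕ.≤-trans (ℕ.s≤s (ℕ.m≤n+m n₀ k)) n-large) G′ (still-dense
        (≤-trans large (*-mono-≤ʳ c (<⇒≤ c>0) (fromℕ-mono (ℕ.≤-trans (ℕ.s≤s (ℕ.m≤m+n k n₀)) n-large))))))
      where
      open CommonNeighbour G e>0 (<-≤-trans (fromℕ-pos (k ℕ.+ n₀)) (fromℕ-mono n-large)) dense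
      extend : Biclique G′ l (suc m) → Biclique G (suc l) (suc m)
      extend B = record { b = b′ ; d = d ; b-inj = b′-inj ; d-inj = d-inj ; edge = edge′ ; covered = covered′ }
        where
        open Biclique B
        b′ : ℕ → Fin n
        b′ zero    = b₁
        b′ (suc i) = b i
        fresh : ∀ {i} → i ℕ.< l → b i ≢ b₁
        fresh {i} i<l eq = absurd (trans (sym (proj₂ (∧-split {G (b i) (d 0) ∧ G b₁ (d 0)} (edge i<l (ℕ.s≤s ℕ.z≤n)))))
                                  (cong not (trans (cong (_== b₁) eq) (==-refl b₁))))
          where
          absurd : true ≢ false
          absurd ()
        b′-inj : ∀ {i j} → i ℕ.< suc l → j ℕ.< suc l → b′ i ≡ b′ j → i ≡ j
        b′-inj {zero}  {zero}  _ _ _ = refl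
        b′-inj {zero}  {suc j} _ (ℕ.s≤s j<) eq = ⊥-elim (fresh j< (sym eq))
        b′-inj {suc i} {zero}  (ℕ.s≤s i<) _ eq = ⊥-elim (fresh i< eq)
        b′-inj {suc i} {suc j} (ℕ.s≤s i<) (ℕ.s≤s j<) eq = cong suc (b-inj i< j< eq)
        edge′ : ∀ {i j} → i ℕ.< suc l → j ℕ.< suc m → G (b′ i) (d j) ≡ true
        edge′ {suc i} {j} (ℕ.s≤s i<) j< = proj₁ (∧-split {G (b i) (d j)} (proj₁ (∧-split {G (b i) (d j) ∧ G b₁ (d j)} (edge i< j<))))
        edge′ {zero} {j} _ j< = let x , e = covered j< in
          proj₂ (∧-split {G x (d j)} (proj₁ (∧-split {G x (d j) ∧ G b₁ (d j)} e)))
        covered′ : ∀ {j} → j ℕ.< suc m → ∃ λ x → G x (d j) ≡ true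
        covered′ {j} j< = let x , e = covered j< in x , proj₁ (∧-split {G x (d j)} (proj₁ (∧-split {G x (d j) ∧ G b₁ (d j)} e)))

-- Wheels from bicliques

true≢false : true ≢ false
true≢false ()

module _ (H : 3Graph) where
  open 3Graph H renaming (n to order)

  edge-≢ : ∀ {a b c} → E a b c ≡ true → a ≢ b
  edge-≢ {a} {b} {c} e refl = true≢false (trans (sym e) (loopless a c))

  edge-≢₂ : ∀ {a b c} → E a b c ≡ true → b ≢ c
  edge-≢₂ {a} {b} {c} e refl = true≢false (trans (sym e) (trans (sym₁₂ a b b) (trans (sym₂₃ b a b) (loopless b a))))

  wheel : ∀ {r} (a : Fin order) (rim : ℕ → Fin order) →
    (∀ {i j} → i ℕ.< suc r → j ℕ.< suc r → rim i ≡ rim j → i ≡ j) →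
    (∀ {i} → suc i ℕ.< suc r → E a (rim i) (rim (suc i)) ≡ true) → E a (rim r) (rim 0) ≡ true →
    ContainsWheel (suc (suc r)) H
  wheel {r} a rim inj step close = φ , φ-inj , edges
    where
    φ : Fin (suc (suc r)) → Fin order
    φ zero    = a
    φ (suc i) = rim (Fin.toℕ i)
    off-rim : ∀ {i} → i ℕ.≤ r → a ≢ rim i
    off-rim {i} i≤r with i ℕ.≟ r
    ... | yes refl = edge-≢ close
    ... | no i≢r   = edge-≢ (step (ℕ.s≤s (ℕ.≤∧≢⇒< i≤r i≢r)))
    bound : (i : Fin (suc r)) → Fin.toℕ i ℕ.≤ r
    bound i = ℕ.≤-pred (Fin.toℕ<n i)
    φ-inj : Injective _≡_ _≡_ φ
    φ-inj {zero}  {zero}  _ = refl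
    φ-inj {zero}  {suc j} e = ⊥-elim (off-rim (bound j) e)
    φ-inj {suc i} {zero}  e = ⊥-elim (off-rim (bound i) (sym e))
    φ-inj {suc i} {suc j} e = cong suc (Fin.toℕ-injective (inj (Fin.toℕ<n i) (Fin.toℕ<n j) e))
    edges : ∀ (z i j : Fin (suc (suc r))) → Fin.toℕ z ≡ 0 → 1 ℕ.≤ Fin.toℕ i → Fin.toℕ j ≡ rimNext (suc (suc r)) (Fin.toℕ i) → E (φ z) (φ i) (φ j) ≡ true
    edges zero (suc i) zero _ _ eq with suc (suc (Fin.toℕ i)) ℕ.<? suc (suc r)
    edges zero (suc i) zero _ _ () | yes _
    edges zero (suc i) zero _ _ () | no _
    edges zero (suc i) (suc j) _ _ eq with suc (suc (Fin.toℕ i)) ℕ.<? suc (suc r)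
    ... | yes lt = subst (λ k → E a (rim (Fin.toℕ i)) (rim k) ≡ true) (sym (ℕ.suc-injective eq)) (step (ℕ.≤-pred lt))
    ... | no ¬lt = subst₂ (λ k m → E a (rim k) (rim m) ≡ true)
                     (sym (ℕ.≤-antisym (bound i) (ℕ.≤-pred (ℕ.≤-pred (ℕ.≮⇒≥ ¬lt)))))
                     (sym (ℕ.suc-injective eq)) close

interleave : {A : Set} → (ℕ → A) → (ℕ → A) → ℕ → A
interleave f g zero    = f 0
interleave f g (suc i) = interleave g (f ∘ suc) i

interleave-even : ∀ {A : Set} (f g : ℕ → A) k → interleave f g (k ℕ.+ k) ≡ f k
interleave-even f g zero    = refl
interleave-even f g (suc k) = trans (cong (interleave g (f ∘ suc)) (ℕ.+-suc k k)) (interleave-even (f ∘ suc) (g ∘ suc) k)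

interleave-odd : ∀ {A : Set} (f g : ℕ → A) k → interleave f g (suc (k ℕ.+ k)) ≡ g k
interleave-odd f g k = interleave-even g (f ∘ suc) k

parity : ∀ i → ∃ λ k → i ≡ k ℕ.+ k ⊎ i ≡ suc (k ℕ.+ k)
parity zero = 0 , inj₁ refl
parity (suc i) with parity i
... | k , inj₁ refl = k , inj₂ refl
... | k , inj₂ refl = suc k , inj₁ (cong suc (sym (ℕ.+-suc k k)))

double-<⁻ : ∀ {k l} → k ℕ.+ k ℕ.< l ℕ.+ l → k ℕ.< l
double-<⁻ {k} {l} lt = ℕ.≰⇒> λ l≤k → ℕ.<-irrefl refl (ℕ.<-≤-trans lt (ℕ.+-mono-≤ l≤k l≤k))

double-≤⁻ : ∀ {k l} → k ℕ.+ k ℕ.≤ l ℕ.+ l → k ℕ.≤ l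
double-≤⁻ {k} {l} le = ℕ.≮⇒≥ λ l<k → ℕ.<-irrefl refl (ℕ.≤-<-trans le (ℕ.+-mono-< l<k l<k))

-- f and g alternate around the rim: f on the even positions below 2 m, g on the
-- odd positions below 2 l.
interleave-injective : ∀ {A : Set} {f g : ℕ → A} {l m r} →
  (∀ {k} → k ℕ.+ k ℕ.< r → k ℕ.< m) → (∀ {k} → suc (k ℕ.+ k) ℕ.< r → k ℕ.< l) →
  (∀ {i j} → i ℕ.< m → j ℕ.< m → f i ≡ f j → i ≡ j) → (∀ {i j} → i ℕ.< l → j ℕ.< l → g i ≡ g j → i ≡ j) →
  (∀ {i j} → i ℕ.< m → j ℕ.< l → f i ≢ g j) →
  ∀ {i j} → i ℕ.< r → j ℕ.< r → interleave f g i ≡ interleave f g j → i ≡ j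
interleave-injective {f = f} {g} even odd f-inj g-inj f≢g {i} {j} i<r j<r eq with parity i | parity j
... | k , inj₁ refl | k′ , inj₁ refl = cong (λ z → z ℕ.+ z) (f-inj (even i<r) (even j<r) (trans (sym (interleave-even f g k)) (trans eq (interleave-even f g k′))))
... | k , inj₂ refl | k′ , inj₂ refl = cong (λ z → suc (z ℕ.+ z)) (g-inj (odd i<r) (odd j<r) (trans (sym (interleave-odd f g k)) (trans eq (interleave-odd f g k′))))
... | k , inj₁ refl | k′ , inj₂ refl = ⊥-elim (f≢g (even i<r) (odd j<r) (trans (sym (interleave-even f g k)) (trans eq (interleave-odd f g k′))))
... | k , inj₂ refl | k′ , inj₁ refl = ⊥-elim (f≢g (even j<r) (odd i<r) (trans (sym (interleave-even f g k′)) (trans (sym eq) (interleave-odd f g k))))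

module _ (H : 3Graph) (a : Fin (3Graph.n H)) where
  open 3Graph H renaming (n to order)

  -- The rim alternates between the two sides of a complete bipartite graph in the link of the hub.
  odd-wheel : ∀ {l} → Biclique (E a) (suc l) (suc l) → ContainsWheel (suc (suc l ℕ.+ suc l)) H
  odd-wheel {l} B = wheel H a rim
    (interleave-injective double-<⁻ (double-<⁻ ∘ ℕ.<-trans (ℕ.n<1+n _)) b-inj d-inj λ i< j< → edge-≢₂ H (edge i< j<)) step
    (subst (λ k → E a (rim k) (b 0) ≡ true) (sym (ℕ.+-suc l l))
      (subst (λ v → E a v (b 0) ≡ true) (sym (interleave-odd b d l)) (trans (sym₂₃ a _ _) (edge (ℕ.s≤s ℕ.z≤n) (ℕ.n<1+n l)))))
    where
    open Biclique B
    rim = interleave b d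
    step : ∀ {i} → suc i ℕ.< suc l ℕ.+ suc l → E a (rim i) (rim (suc i)) ≡ true
    step {i} lt with parity i
    ... | k , inj₁ refl = subst₂ (λ u v → E a u v ≡ true) (sym (interleave-even b d k)) (sym (interleave-odd b d k)) (edge k<l k<l)
      where k<l = double-<⁻ (ℕ.<-trans (ℕ.n<1+n _) lt)
    ... | k , inj₂ refl = subst₂ (λ u v → E a u v ≡ true) (sym (interleave-odd b d k))
        (sym (trans (cong rim (cong suc (sym (ℕ.+-suc k k)))) (interleave-even b d (suc k))))
        (trans (sym₂₃ a _ _) (edge 1+k<l (ℕ.<-trans (ℕ.n<1+n k) 1+k<l)))
      where 1+k<l = double-<⁻ (subst (ℕ._< suc l ℕ.+ suc l) (cong suc (sym (ℕ.+-suc k k))) lt)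

  -- In the link of a, the vertex c is joined to all b and all d. Inserted between the last d and
  -- the first b, it makes the alternating cycle odd, so a wheel with an even number of vertices
  -- appears once the link edges inside the neighbourhood of c are dense.
  even-wheel : ∀ {l} c → Biclique (λ b d → E a c b ∧ (E a b d ∧ E a c d)) (suc l) (suc l) → ContainsWheel (suc (suc (suc l ℕ.+ suc l))) H
  even-wheel {l} c B = wheel H a rim
    (interleave-injective (λ lt → ℕ.s≤s (double-≤⁻ (ℕ.≤-pred lt))) (λ lt → double-<⁻ (ℕ.≤-pred lt)) f-inj d-inj f≢d) step
    (subst₂ (λ u v → E a u v ≡ true) (sym (trans (interleave-even f d (suc l)) f-last)) (sym (f-first (ℕ.s≤s ℕ.z≤n))) (c-b (ℕ.s≤s ℕ.z≤n)))
    where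
    open Biclique B
    L = suc l
    0<L : 0 ℕ.< L
    0<L = ℕ.s≤s ℕ.z≤n
    parts : ∀ {i j} → i ℕ.< L → j ℕ.< L → E a c (b i) ≡ true × E a (b i) (d j) ≡ true × E a c (d j) ≡ true
    parts {i} {j} i< j< = let x , y = ∧-split {E a c (b i)} (edge i< j<) ; z , w = ∧-split {E a (b i) (d j)} y in x , z , w
    c-b : ∀ {i} → i ℕ.< L → E a c (b i) ≡ true
    c-b i< = proj₁ (parts i< 0<L)
    c-d : ∀ {j} → j ℕ.< L → E a c (d j) ≡ true
    c-d j< = proj₂ (proj₂ (parts 0<L j<))
    -- The even rim positions carry the vertices b, followed by c at the last one.
    f : ℕ → Fin order
    f i with i ℕ.<? L
    ... | yes _ = b i
    ... | no _  = c
    f-first : ∀ {i} → i ℕ.< L → f i ≡ b i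
    f-first {i} lt with i ℕ.<? L
    ... | yes _ = refl
    ... | no ¬lt = ⊥-elim (¬lt lt)
    f-last : f L ≡ c
    f-last with L ℕ.<? L
    ... | yes lt = ⊥-elim (ℕ.<-irrefl refl lt)
    ... | no _   = refl
    rim = interleave f d
    position : ∀ {i} → i ℕ.< suc L → i ℕ.< L ⊎ i ≡ L
    position {i} lt with i ℕ.≟ L
    ... | yes e = inj₂ e
    ... | no ne = inj₁ (ℕ.≤∧≢⇒< (ℕ.≤-pred lt) ne)
    f-d : ∀ {i j} → i ℕ.< suc L → j ℕ.< L → E a (f i) (d j) ≡ true
    f-d i< j< with position i<
    ... | inj₁ lt   = subst (λ v → E a v (d _) ≡ true) (sym (f-first lt)) (proj₁ (proj₂ (parts lt j<)))
    ... | inj₂ refl = subst (λ v → E a v (d _) ≡ true) (sym f-last) (c-d j<)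
    f≢d : ∀ {i j} → i ℕ.< suc L → j ℕ.< L → f i ≢ d j
    f≢d i< j< = edge-≢₂ H (f-d i< j<)
    f-inj : ∀ {i j} → i ℕ.< suc L → j ℕ.< suc L → f i ≡ f j → i ≡ j
    f-inj i< j< eq with position i< | position j<
    ... | inj₁ p | inj₁ q = b-inj p q (trans (sym (f-first p)) (trans eq (f-first q)))
    ... | inj₁ p | inj₂ refl = ⊥-elim (edge-≢₂ H (c-b p) (trans (sym f-last) (trans (sym eq) (f-first p))))
    ... | inj₂ refl | inj₁ q = ⊥-elim (edge-≢₂ H (c-b q) (trans (sym f-last) (trans eq (f-first q))))
    ... | inj₂ refl | inj₂ refl = refl
    step : ∀ {i} → suc i ℕ.< suc (L ℕ.+ L) → E a (rim i) (rim (suc i)) ≡ true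
    step {i} lt with parity i
    ... | k , inj₁ refl = subst₂ (λ u v → E a u v ≡ true) (sym (interleave-even f d k)) (sym (interleave-odd f d k))
        (f-d (ℕ.<-trans k<L (ℕ.n<1+n L)) k<L)
      where k<L = double-<⁻ (ℕ.≤-pred lt)
    ... | k , inj₂ refl = subst₂ (λ u v → E a u v ≡ true) (sym (interleave-odd f d k))
        (sym (trans (cong rim (cong suc (sym (ℕ.+-suc k k)))) (interleave-even f d (suc k))))
        (trans (sym₂₃ a _ _) (f-d 1+k<1+L (ℕ.≤-pred 1+k<1+L)))
      where 1+k<1+L = ℕ.s≤s (double-≤⁻ (subst (ℕ._≤ L ℕ.+ L) (cong suc (sym (ℕ.+-suc k k))) (ℕ.≤-pred lt)))

-- Upper bounds for wheel-free graphs

even-triangles : ∀ l ε → 0ℚ < ε → ∃ λ n₀ → ∀ H → suc n₀ ℕ.≤ 3Graph.n H → WheelFree (suc (suc (suc l ℕ.+ suc l))) H →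
  let open 3Graph H in ∀ a q → ∑ (λ b → ∑ λ c → 𝟙 (E a q b ∧ (E a b c ∧ E a q c))) ≤ ε * (fromℕ (3Graph.n H) * fromℕ (3Graph.n H))
even-triangles l ε ε>0 = go (kővári-sós-turán (suc l) l ε ε>0)
  where
  go : ∃ (HasBiclique (suc l) l ε) → _
  go (n₀ , find) = n₀ , λ H large free a q → ℚ.≮⇒≥ λ lt → free (even-wheel H a q (find large _ (<⇒≤ lt)))

sparse-links : ∀ l ε → 0ℚ < ε → ∃ λ n₀ → ∀ H → suc n₀ ℕ.≤ 3Graph.n H → WheelFree (suc (suc l ℕ.+ suc l)) H →
  let open 3Graph H in ∀ a → ∑ (λ b → ∑ λ c → 𝟙 (E a b c)) ≤ ε * (fromℕ (3Graph.n H) * fromℕ (3Graph.n H))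
sparse-links l ε ε>0 = go (kővári-sós-turán (suc l) l ε ε>0)
  where
  go : ∃ (HasBiclique (suc l) l ε) → _
  go (n₀ , find) = n₀ , λ H large free a → ℚ.≮⇒≥ λ lt → free (odd-wheel H a (find large _ (<⇒≤ lt)))

opaque
  unfolding fromℕ

  fromℕ-6 : fromℕ 6 ≡ ℤ.+ 6 ℚ./ 1
  fromℕ-6 = refl

  fromℕ-14 : fromℕ 14 ≡ ℤ.+ 14 ℚ./ 1
  fromℕ-14 = refl

even-upper-bound : ∀ l d → Admissible (suc (suc (suc l ℕ.+ suc l))) d → d ≤ ¼
even-upper-bound l d (_ , d≤1 , admissible) = ℚ.≮⇒≥ λ d>¼ → by-parameters d>¼ (parameters d d>¼ d≤1)
  where
  module _ (d>¼ : ¼ < d) (parms : Parameters d) where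
    open Parameters parms using (μ; μ>0; ε₀; ε₀>0) renaming (n₀ to n₁)

    by-triangles : (∃ λ n₀ → ∀ H → suc n₀ ℕ.≤ 3Graph.n H → WheelFree (suc (suc (suc l ℕ.+ suc l))) H → let open 3Graph H in
                     ∀ a q → ∑ (λ b → ∑ λ c → 𝟙 (E a q b ∧ (E a b c ∧ E a q c))) ≤ ε₀ * (fromℕ (3Graph.n H) * fromℕ (3Graph.n H))) → ⊥
    by-triangles (n₂ , few) = by-graph (admissible μ μ>0 (suc (n₁ ℕ.⊔ n₂)))
      where
      by-graph : (∃ λ H → suc (n₁ ℕ.⊔ n₂) ℕ.≤ 3Graph.n H × WheelFree (suc (suc (suc l ℕ.+ suc l))) H × Dense d μ H) → ⊥
      by-graph (H , large , free , dense) = Supersaturation.impossible d>¼ d≤1 parms H dense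
        (ℕ.≤-trans (ℕ.s≤s (ℕ.m≤m⊔n n₁ n₂)) large) (few H (ℕ.≤-trans (ℕ.s≤s (ℕ.m≤n⊔m n₁ n₂)) large) free)

    by-parameters : ⊥
    by-parameters = by-triangles (even-triangles l ε₀ ε₀>0)

odd-upper-bound : ∀ l d → Admissible (suc (suc l ℕ.+ suc l)) d → d ≤ 0ℚ
odd-upper-bound l d (_ , _ , admissible) = ℚ.≮⇒≥ λ d>0 → by-fraction d>0 (fraction 14 d d>0)
  where
  -- With b as density error and as link bound, d n (n - 1) (n - 2) ≤ 7 b n³: six from the density
  -- condition on ordered triples and one from the links. The factor 2 comes from n (n - 1) (n - 2)
  -- > n³ / 2, which holds from n = 6 on.
  14ℚ : ℚ
  14ℚ = ℤ.+ 14 ℚ./ 1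
  module _ (d>0 : 0ℚ < d) where
    by-fraction : (∃ λ b → 0ℚ < b × fromℕ 14 * b ≤ d) → ⊥
    by-fraction (b , b>0 , 14b≤d) = by-links (sparse-links l b b>0)
      where
      by-links : (∃ λ n₀ → ∀ H → suc n₀ ℕ.≤ 3Graph.n H → WheelFree (suc (suc l ℕ.+ suc l)) H → let open 3Graph H in
                   ∀ a → ∑ (λ b → ∑ λ c → 𝟙 (E a b c)) ≤ b * (fromℕ (3Graph.n H) * fromℕ (3Graph.n H))) → ⊥
      by-links (n₀ , sparse) = by-graph (admissible b b>0 (6 ℕ.+ n₀))
        where
        by-graph : (∃ λ H → 6 ℕ.+ n₀ ℕ.≤ 3Graph.n H × WheelFree (suc (suc l ℕ.+ suc l)) H × Dense d b H) → ⊥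
        by-graph (H , large , free , dense) = <-irrefl refl (<-≤-trans gain>0
          (by-diff ((d - fromℕ 14 * b) * P + 6ℚ * (e - (d * B - b * N³)) + (N * (b * (N * N)) - S))
            (+-nonneg (+-nonneg (*-nonneg (diff 14b≤d) P≥0) (*-nonneg (fromℕ-nonneg 6) (diff edges))) (diff few)) balance))
          where
          open 3Graph H using (E) renaming (n to order)
          N = fromℕ order
          x = fromℕ (order ℕ.∸ 6)
          x≥0 = fromℕ-nonneg (order ℕ.∸ 6)
          e = fromℕ (edgesIn H Subset.⊤)
          B = fromℕ (∣ Subset.⊤ {n = order} ∣ choose 3)
          N³ = fromℕ (order ℕ.^ 3)
          S = ∑ λ a → ∑ λ b → ∑ λ c → 𝟙 (E a b c)
          6≤order : 6 ℕ.≤ order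
          6≤order = ℕ.≤-trans (ℕ.m≤m+n 6 n₀) large
          P = N * (N - 1ℚ) * (N - (1ℚ + 1ℚ))
          6′ : ℚ
          6′ = ℤ.+ 6 ℚ./ 1
          N≡ : N ≡ 6′ + x
          N≡ = trans (cong fromℕ (sym (ℕ.m+[n∸m]≡n 6≤order))) (trans (fromℕ-+ 6 (order ℕ.∸ 6)) (+-left fromℕ-6))
          6≥0 : 0ℚ ≤ 6′
          6≥0 = ℚ.nonNegative⁻¹ 6′
          4>0 : 0ℚ < ℤ.+ 4 ℚ./ 1
          4>0 = ℚ.positive⁻¹ (ℤ.+ 4 ℚ./ 1)
          P≡ : P ≡ (6′ + x) * (6′ + x - 1ℚ) * (6′ + x - (1ℚ + 1ℚ))
          P≡ = cong (λ N → N * (N - 1ℚ) * (N - (1ℚ + 1ℚ))) N≡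
          P≥0 : 0ℚ ≤ P
          P≥0 = ≤-trans (*-nonneg (*-nonneg (fromℕ-nonneg order) (+-nonneg (ℚ.nonNegative⁻¹ (ℤ.+ 5 ℚ./ 1)) x≥0)) (+-nonneg (<⇒≤ 4>0) x≥0))
            (≤-reflexive (sym (trans P≡ (trans (solve 1 (λ x → (con 6′ :+ x) :* (con 6′ :+ x :- con 1ℚ) :* (con 6′ :+ x :- (con 1ℚ :+ con 1ℚ))
              := (con 6′ :+ x) :* (con (ℤ.+ 5 ℚ./ 1) :+ x) :* (con (ℤ.+ 4 ℚ./ 1) :+ x)) refl x) (*-left (*-left (sym N≡)))))))
          edges : d * B - b * N³ ≤ e
          edges = dense-edges {H = H} dense Subset.⊤
          few : S ≤ N * (b * (N * N))
          few = ∑-≤-const (b * (N * N)) (sparse H (ℕ.≤-trans (ℕ.+-monoˡ-≤ n₀ {1} {6} (ℕ.s≤s ℕ.z≤n)) large) free)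
          6e : 6ℚ * e ≡ S
          6e = trans (edges-ordered H Subset.⊤) (∑-cong λ u → ∑-cong λ v → ∑-cong λ w → trans
            (*-left (trans (cong₂ (λ p q → 𝟙 p * q) (lookup-replicate u true) (cong₂ (λ p q → 𝟙 p * 𝟙 q) (lookup-replicate v true) (lookup-replicate w true)))
              (solve 0 (con 1ℚ :* (con 1ℚ :* con 1ℚ) := con 1ℚ) refl))) (*-identityˡ _))
          6B : 6ℚ * B ≡ P
          6B = trans (cong (λ k → 6ℚ * fromℕ (k choose 3)) (∣⊤∣≡n order)) (binomial₃ order)
          N³≡ : N³ ≡ N * (N * N)
          N³≡ = trans (fromℕ-* order _) (*-right (trans (fromℕ-* order _) (*-right (cong fromℕ (ℕ.*-identityʳ order)))))
          -- This is 14 b n (n - 1) (n - 2) - 7 b n³, written with n = 6 + x so that its sign is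
          -- visible.
          gain : ℚ
          gain = (ℤ.+ 7 ℚ./ 1) * (b * N) * (ℤ.+ 4 ℚ./ 1 + (6′ * x + x * x))
          gain>0 : 0ℚ < gain
          gain>0 = *-pos (*-pos (ℚ.positive⁻¹ (ℤ.+ 7 ℚ./ 1)) (*-pos b>0 (<-≤-trans (fromℕ-pos 5) (fromℕ-mono 6≤order))))
            (<-≤-trans 4>0 (by-diff (6′ * x + x * x) (+-nonneg (*-nonneg 6≥0 x≥0) (*-nonneg x≥0 x≥0)) refl))
          balance : gain + ((d - fromℕ 14 * b) * P + 6ℚ * (e - (d * B - b * N³)) + (N * (b * (N * N)) - S)) ≡ 0ℚ
          balance = begin
            gain + ((d - fromℕ 14 * b) * P + 6ℚ * (e - (d * B - b * N³)) + (N * (b * (N * N)) - S))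
              ≡⟨ +-right (+-left (+-right (solve 6 (λ s e d B b n → s :* (e :- (d :* B :- b :* n)) := s :* e :- d :* (s :* B) :+ b :* (s :* n)) refl 6ℚ e d B b N³))) ⟩
            gain + ((d - fromℕ 14 * b) * P + (6ℚ * e - d * (6ℚ * B) + b * (6ℚ * N³)) + (N * (b * (N * N)) - S))
              ≡⟨ +-right (+-left (cong₂ _+_ (cong (λ k → (d - k * b) * P) fromℕ-14)
                   (cong₂ _+_ (cong₂ (λ p q → p - d * q) 6e 6B) (*-right (cong₂ _*_ fromℕ-6 N³≡))))) ⟩
            gain + ((d - 14ℚ * b) * P + (S - d * P + b * (6′ * (N * (N * N)))) + (N * (b * (N * N)) - S))
              ≡⟨ cong (λ N → (ℤ.+ 7 ℚ./ 1) * (b * N) * (ℤ.+ 4 ℚ./ 1 + (6′ * x + x * x)) + ((d - 14ℚ * b) * (N * (N - 1ℚ) * (N - (1ℚ + 1ℚ)))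
                   + (S - d * (N * (N - 1ℚ) * (N - (1ℚ + 1ℚ))) + b * (6′ * (N * (N * N)))) + (N * (b * (N * N)) - S))) N≡ ⟩
            _ ≡⟨ solve 4 (λ x b d S → let N = con 6′ :+ x ; P = N :* (N :- con 1ℚ) :* (N :- (con 1ℚ :+ con 1ℚ)) in
                   con (ℤ.+ 7 ℚ./ 1) :* (b :* N) :* (con (ℤ.+ 4 ℚ./ 1) :+ (con 6′ :* x :+ x :* x)) :+ ((d :- con 14ℚ :* b) :* P
                     :+ (S :- d :* P :+ b :* (con 6′ :* (N :* (N :* N)))) :+ (N :* (b :* (N :* N)) :- S)) := con 0ℚ) refl x b d S ⟩
            0ℚ ∎
            where open ≡-Reasoning

-- Skew conference tournaments

∑-++ : ∀ m {n} (f : Fin (m ℕ.+ n) → ℚ) → ∑ f ≡ ∑ (λ i → f (i Fin.↑ˡ n)) + ∑ (λ i → f (m Fin.↑ʳ i))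
∑-++ zero    f = sym (trans (+-left (∑-zero _)) (+-identityˡ _))
∑-++ (suc m) f = trans (∑-suc f) (trans (+-right (∑-++ m (f ∘ suc))) (trans (sym (+-assoc _ _ _)) (+-left (sym (∑-suc _)))))

-- Powers of two, defined by doubling so that the players of the next stage split into two blocks.
players : ℕ → ℕ
players zero    = 1
players (suc m) = players m ℕ.+ players m

<-players : ∀ m → m ℕ.< players m
<-players zero    = ℕ.s≤s ℕ.z≤n
<-players (suc m) = ℕ.+-mono-≤ {1} (ℕ.≤-<-trans ℕ.z≤n (<-players m)) (<-players m)

-- The doubling K ↦ [[K , K + I] , [K - I , - K]] turns a skew matrix with
-- K² = (1 - n) I into one with K² = (1 - 2 n) I.
beats-blocks : (Fin n → Fin n → Bool) → Fin n ⊎ Fin n → Fin n ⊎ Fin n → Bool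
beats-blocks o (inj₁ x) (inj₁ y) = o x y
beats-blocks o (inj₁ x) (inj₂ y) = (x == y) ∨ o x y
beats-blocks o (inj₂ x) (inj₁ y) = o x y
beats-blocks o (inj₂ x) (inj₂ y) = o y x

beats : ∀ m → Fin (players m) → Fin (players m) → Bool
beats zero    x y = false
beats (suc m) x y = beats-blocks (beats m) (Fin.splitAt (players m) x) (Fin.splitAt (players m) y)

beats-irrefl : ∀ m x → beats m x x ≡ false
beats-irrefl zero    x = refl
beats-irrefl (suc m) x = go (Fin.splitAt (players m) x)
  where
  go : ∀ p → beats-blocks (beats m) p p ≡ false
  go (inj₁ x) = beats-irrefl m x
  go (inj₂ x) = beats-irrefl m x

beats-flip : ∀ m {x y} → x ≢ y → beats m y x ≡ not (beats m x y)
beats-flip zero    {zero} {zero} x≢y = ⊥-elim (x≢y refl)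
beats-flip (suc m) {x} {y} x≢y = go (Fin.splitAt (players m) x) (Fin.splitAt (players m) y)
  λ eq → x≢y (trans (sym (Fin.join-splitAt (players m) (players m) x)) (trans (cong (Fin.join (players m) (players m)) eq) (Fin.join-splitAt (players m) (players m) y)))
  where
  mixed : ∀ x y → beats m y x ≡ not ((x == y) ∨ beats m x y)
  mixed x y with x Fin.≟ y
  ... | yes refl = beats-irrefl m x
  ... | no x≢y   = beats-flip m x≢y
  mixed′ : ∀ x y → (y == x) ∨ beats m y x ≡ not (beats m x y)
  mixed′ x y with y Fin.≟ x
  ... | yes refl = sym (cong not (beats-irrefl m x))
  ... | no y≢x   = beats-flip m (y≢x ∘ sym)
  go : ∀ p q → p ≢ q → beats-blocks (beats m) q p ≡ not (beats-blocks (beats m) p q)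
  go (inj₁ x) (inj₁ y) p≢q = beats-flip m (p≢q ∘ cong inj₁)
  go (inj₁ x) (inj₂ y) p≢q = mixed x y
  go (inj₂ x) (inj₁ y) p≢q = mixed′ x y
  go (inj₂ x) (inj₂ y) p≢q = beats-flip m (p≢q ∘ sym ∘ cong inj₂)

σ : ∀ m → Fin (players m) → Fin (players m) → ℚ
σ m x y = 𝟙 (beats m x y) - 𝟙 (beats m y x)

σ-skew : ∀ m x y → σ m x y ≡ - σ m y x
σ-skew m x y = solve 2 (λ p q → p :- q := :- (q :- p)) refl (𝟙 (beats m x y)) (𝟙 (beats m y x))

module _ (m : ℕ) where
  private
    s = players m
    l r : Fin s → Fin (s ℕ.+ s)
    l = Fin._↑ˡ s
    r = s Fin.↑ʳ_

    split : ∀ p q → beats (suc m) (Fin.join s s p) (Fin.join s s q) ≡ beats-blocks (beats m) p q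
    split p q = cong₂ (beats-blocks (beats m)) (Fin.splitAt-join s s p) (Fin.splitAt-join s s q)

    ∨-δ : ∀ x y → 𝟙 ((x == y) ∨ beats m x y) ≡ 𝟙 (x == y) + 𝟙 (beats m x y)
    ∨-δ x y with x Fin.≟ y
    ... | yes refl = sym (trans (+-right (cong 𝟙 (beats-irrefl m x))) (+-identityʳ 1ℚ))
    ... | no _     = sym (+-identityˡ _)

  σ-ll : ∀ x y → σ (suc m) (l x) (l y) ≡ σ m x y
  σ-ll x y = cong₂ (λ p q → 𝟙 p - 𝟙 q) (split (inj₁ x) (inj₁ y)) (split (inj₁ y) (inj₁ x))

  σ-lr : ∀ x y → σ (suc m) (l x) (r y) ≡ σ m x y + 𝟙 (x == y)
  σ-lr x y = trans (cong₂ (λ p q → 𝟙 p - 𝟙 q) (split (inj₁ x) (inj₂ y)) (split (inj₂ y) (inj₁ x)))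
    (trans (+-left (∨-δ x y)) (solve 3 (λ d p q → d :+ p :- q := p :- q :+ d) refl (𝟙 (x == y)) (𝟙 (beats m x y)) (𝟙 (beats m y x))))

  σ-rl : ∀ x y → σ (suc m) (r x) (l y) ≡ σ m x y - 𝟙 (x == y)
  σ-rl x y = trans (σ-skew (suc m) (r x) (l y)) (trans (cong -_ (trans (σ-lr y x) (cong₂ _+_ (σ-skew m y x) (cong 𝟙 (==-sym y x)))))
    (solve 2 (λ k d → :- (:- k :+ d) := k :- d) refl (σ m x y) (𝟙 (x == y))))

  σ-rr : ∀ x y → σ (suc m) (r x) (r y) ≡ - σ m x y
  σ-rr x y = trans (cong₂ (λ p q → 𝟙 p - 𝟙 q) (split (inj₂ x) (inj₂ y)) (split (inj₂ y) (inj₂ x))) (σ-skew m y x)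

imbalance : ∀ m → (Fin (players m) → ℚ) → Fin (players m) → ℚ
imbalance m f x = ∑ λ y → σ m x y * f y

imbalance-skew : ∀ m f h → ∑ (λ x → imbalance m f x * h x) ≡ - ∑ (λ x → imbalance m h x * f x)
imbalance-skew m f h = begin
  ∑ (λ x → (∑ λ y → σ m x y * f y) * h x)    ≡⟨ ∑-cong (λ x → ∑-*ʳ (h x) _) ⟩
  ∑ (λ x → ∑ λ y → σ m x y * f y * h x)      ≡⟨ ∑-swap _ ⟩
  ∑ (λ y → ∑ λ x → σ m x y * f y * h x)      ≡⟨ ∑-cong (λ y → ∑-cong λ x → trans (*-left (*-left (σ-skew m x y)))
    (solve 3 (λ k f h → :- k :* f :* h := :- con 1ℚ :* (k :* h :* f)) refl (σ m y x) (f y) (h x))) ⟩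
  ∑ (λ y → ∑ λ x → - 1ℚ * (σ m y x * h x * f y))  ≡⟨ ∑-cong (λ y → trans (sym (∑-*ˡ (- 1ℚ) _)) (*-right (sym (∑-*ʳ (f y) _)))) ⟩
  ∑ (λ y → - 1ℚ * (imbalance m h y * f y))   ≡⟨ ∑-*ˡ (- 1ℚ) _ ⟨
  - 1ℚ * ∑ (λ y → imbalance m h y * f y)     ≡⟨ solve 1 (λ z → :- con 1ℚ :* z := :- z) refl _ ⟩
  - ∑ (λ y → imbalance m h y * f y)          ∎
  where open ≡-Reasoning

∑² : (Fin n → ℚ) → ℚ
∑² f = ∑ λ x → f x * f x

-- The norm form of K² = (1 - n) I for a skew matrix; it makes the signs balanced on every vertex
-- set. In the doubling step the mixed terms vanish by skewness: those of u with v cancel each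
-- other, and those of u or v with itself are 0.
imbalance-norm : ∀ m f → ∑² (imbalance m f) + ∑² f ≡ fromℕ (players m) * ∑² f
imbalance-norm zero f = begin
  ∑² (imbalance 0 f) + ∑² f  ≡⟨ +-left (trans (∑-cong λ x → trans (*-left (vanish x)) (zeroˡ _)) (∑-0 1)) ⟩
  0ℚ + ∑² f                  ≡⟨ solve 1 (λ z → con 0ℚ :+ z := con 1ℚ :* z) refl (∑² f) ⟩
  1ℚ * ∑² f                  ≡⟨ *-left fromℕ-1 ⟨
  fromℕ 1 * ∑² f             ∎
  where
  open ≡-Reasoning
  vanish : ∀ x → imbalance 0 f x ≡ 0ℚ
  vanish x = trans (∑-cong λ y → trans (*-left (+-inverseʳ 0ℚ)) (zeroˡ (f y))) (∑-0 1)
imbalance-norm (suc m) f = begin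
  ∑² (imbalance (suc m) f) + ∑² f
    ≡⟨ cong₂ _+_ (trans (∑-++ s _) (cong₂ _+_ (∑-cong λ x → cong (λ z → z * z) (upper-half x)) (∑-cong λ x → cong (λ z → z * z) (lower-half x)))) (∑-++ s _) ⟩
  ∑ (λ x → (p x + (q x + v x)) * (p x + (q x + v x))) + ∑ (λ x → (p x - u x - q x) * (p x - u x - q x)) + (∑² u + ∑² v)
    ≡⟨ +-left (trans (sym (∑-+ _ _)) (trans (∑-cong λ x → expand (p x) (q x) (u x) (v x)) sums)) ⟩
  two * ∑² p + two * ∑² q + ∑² u + ∑² v + two * (pv + qu + qv - pu) + (∑² u + ∑² v)
    ≡⟨ +-left (+-right (*-right (trans (cong₂ _-_ (cong₂ _+_ (+-left (imbalance-skew m u v)) (self v)) (self u))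
         (solve 1 (λ z → :- z :+ z :+ con 0ℚ :- con 0ℚ := con 0ℚ) refl qu)))) ⟩
  two * ∑² p + two * ∑² q + ∑² u + ∑² v + two * 0ℚ + (∑² u + ∑² v)
    ≡⟨ solve 4 (λ p q u v → let two = con 1ℚ :+ con 1ℚ in two :* p :+ two :* q :+ u :+ v :+ two :* con 0ℚ :+ (u :+ v) := two :* (p :+ u) :+ two :* (q :+ v)) refl (∑² p) (∑² q) (∑² u) (∑² v) ⟩
  two * (∑² p + ∑² u) + two * (∑² q + ∑² v)
    ≡⟨ cong₂ (λ y z → two * y + two * z) (imbalance-norm m u) (imbalance-norm m v) ⟩
  two * (fromℕ s * ∑² u) + two * (fromℕ s * ∑² v)
    ≡⟨ solve 3 (λ s u v → let two = con 1ℚ :+ con 1ℚ in two :* (s :* u) :+ two :* (s :* v) := (s :+ s) :* (u :+ v)) refl (fromℕ s) (∑² u) (∑² v) ⟩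
  (fromℕ s + fromℕ s) * (∑² u + ∑² v)
    ≡⟨ cong₂ _*_ (sym (fromℕ-+ s s)) (sym (∑-++ s _)) ⟩
  fromℕ (s ℕ.+ s) * ∑² f ∎
  where
  open ≡-Reasoning
  s = players m
  two = 1ℚ + 1ℚ
  u v p q : Fin s → ℚ
  u x = f (x Fin.↑ˡ s)
  v x = f (s Fin.↑ʳ x)
  p = imbalance m u
  q = imbalance m v
  pv = ∑ λ x → p x * v x
  qu = ∑ λ x → q x * u x
  qv = ∑ λ x → q x * v x
  pu = ∑ λ x → p x * u x
  upper-half : ∀ x → imbalance (suc m) f (x Fin.↑ˡ s) ≡ p x + (q x + v x)
  upper-half x = trans (∑-++ s _) (cong₂ _+_ (∑-cong λ y → *-left (σ-ll m x y))
    (trans (∑-cong λ y → trans (*-left (σ-lr m x y)) (distribʳ (v y) _ _)) (trans (∑-+ _ _) (+-right (∑-δ x v)))))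
  lower-half : ∀ x → imbalance (suc m) f (s Fin.↑ʳ x) ≡ p x - u x - q x
  lower-half x = trans (∑-++ s _) (cong₂ _+_
    (trans (∑-cong λ y → trans (*-left (σ-rl m x y)) (solve 3 (λ a b c → (a :- b) :* c := a :* c :- b :* c) refl (σ m x y) (𝟙 (x == y)) (u y)))
      (trans (∑-- _ _) (cong (λ z → p x - z) (∑-δ x u))))
    (trans (∑-cong λ y → trans (*-left (σ-rr m x y)) (solve 2 (λ k z → :- k :* z := :- con 1ℚ :* (k :* z)) refl (σ m x y) (v y)))
      (trans (sym (∑-*ˡ (- 1ℚ) _)) (solve 1 (λ z → :- con 1ℚ :* z := :- z) refl (q x)))))
  expand : ∀ p q u v → (p + (q + v)) * (p + (q + v)) + (p - u - q) * (p - u - q)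
    ≡ two * (p * p) + two * (q * q) + u * u + v * v + two * (p * v + q * u + q * v - p * u)
  expand = solve 4 (λ p q u v → let two = con 1ℚ :+ con 1ℚ in (p :+ (q :+ v)) :* (p :+ (q :+ v)) :+ (p :- u :- q) :* (p :- u :- q)
    := two :* (p :* p) :+ two :* (q :* q) :+ u :* u :+ v :* v :+ two :* (p :* v :+ q :* u :+ q :* v :- p :* u)) refl
  sums : ∑ (λ x → two * (p x * p x) + two * (q x * q x) + u x * u x + v x * v x + two * (p x * v x + q x * u x + q x * v x - p x * u x))
    ≡ two * ∑² p + two * ∑² q + ∑² u + ∑² v + two * (pv + qu + qv - pu)
  sums = trans (∑-+ _ _) (cong₂ _+_
    (trans (∑-+ _ _) (+-left (trans (∑-+ _ _) (+-left (trans (∑-+ _ _) (cong₂ _+_ (sym (∑-*ˡ two _)) (sym (∑-*ˡ two _))))))))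
    (trans (sym (∑-*ˡ two _)) (*-right (trans (∑-- _ _) (+-left (trans (∑-+ _ _) (+-left (∑-+ _ _))))))))
  self : ∀ h → ∑ (λ x → imbalance m h x * h x) ≡ 0ℚ
  self h = begin
    z                    ≡⟨ solve 1 (λ z → z := con ½ :* (z :+ z)) refl z ⟩
    ½ * (z + z)          ≡⟨ *-right (+-right (imbalance-skew m h h)) ⟩
    ½ * (z - z)          ≡⟨ solve 1 (λ z → con ½ :* (z :- z) := con 0ℚ) refl z ⟩
    0ℚ                   ∎
    where z = ∑ λ x → imbalance m h x * h x

-- Cyclic triangles of the tournament

∑∑∑-rotate : (S : Fin n → Fin n → Fin n → ℚ) → ∑∑∑ (λ a b c → S b c a) ≡ ∑∑∑ S
∑∑∑-rotate S = trans (∑-swap _) (∑-cong λ b → ∑-swap _)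

module _ (m : ℕ) where
  private
    V = Fin (players m)

    cyclic : V → V → V → Bool
    cyclic a b c = beats m a b ∧ (beats m b c ∧ beats m c a)

    cyclic-rotate : ∀ a b c → cyclic a b c ≡ cyclic b c a
    cyclic-rotate a b c = trans (Bool.∧-comm (beats m a b) _) (Bool.∧-assoc (beats m b c) _ _)

  cyclic-triangles : 3Graph
  cyclic-triangles = record
    { n = players m
    ; E = λ a b c → cyclic a b c ∨ cyclic c b a
    ; sym₁₂ = λ a b c → trans (Bool.∨-comm (cyclic a b c) _) (cong₂ _∨_ (cyclic-rotate c b a) (trans (cyclic-rotate a b c) (cyclic-rotate b c a)))
    ; sym₂₃ = λ a b c → trans (Bool.∨-comm (cyclic a b c) _) (cong₂ _∨_ (trans (cyclic-rotate c b a) (cyclic-rotate b a c)) (cyclic-rotate a b c))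
    ; loopless = λ a c → cong₂ _∨_ (cong (_∧ (beats m a c ∧ beats m c a)) (beats-irrefl m a))
        (trans (cong (λ z → beats m c a ∧ (z ∧ beats m a c)) (beats-irrefl m a)) (Bool.∧-zeroʳ (beats m c a)))
    }

  private
    open module H = 3Graph cyclic-triangles using (E)
    N = fromℕ (players m)

  -- In a cyclic triangle each vertex beats exactly one of the other two.
  edge-alternates : ∀ {a b c} → E a b c ≡ true → beats m a c ≡ not (beats m a b)
  edge-alternates {a} {b} {c} e = by-distinct (beats-flip m (edge-≢ cyclic-triangles e)) (beats-flip m a≢c) e
    where
    a≢c : a ≢ c
    a≢c = edge-≢ cyclic-triangles (trans (sym (H.sym₂₃ a b c)) e)
    by-distinct : beats m b a ≡ not (beats m a b) → beats m c a ≡ not (beats m a c) → E a b c ≡ true → beats m a c ≡ not (beats m a b)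
    by-distinct eqb eqc e rewrite eqb | eqc with beats m a b | beats m a c | beats m b c | beats m c b
    ... | true  | false | _ | _ = refl
    ... | false | true  | _ | _ = refl
    ... | true  | true  | true  | true  with () ← e
    ... | true  | true  | true  | false with () ← e
    ... | true  | true  | false | true  with () ← e
    ... | true  | true  | false | false with () ← e
    ... | false | false | true  | true  with () ← e
    ... | false | false | true  | false with () ← e
    ... | false | false | false | true  with () ← e
    ... | false | false | false | false with () ← e

  -- Around the rim the orientation towards the hub alternates, so the rim is even.
  even-wheel-free : ∀ k → WheelFree (suc k ℕ.+ suc k) cyclic-triangles
  even-wheel-free k (φ , _ , edges) = not-fixed last-colour
    where
    t = suc k ℕ.+ suc k
    hub : Fin t
    hub = zero
    colour : ∀ {i} → i ℕ.< t → Bool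
    colour lt = beats m (φ hub) (φ (Fin.fromℕ< lt))
    next : ∀ {i j} (i< : suc i ℕ.< t) (j< : j ℕ.< t) → j ≡ rimNext t (suc i) → colour j< ≡ not (colour i<)
    next i< j< eq = edge-alternates (edges hub (Fin.fromℕ< i<) (Fin.fromℕ< j<) refl (subst (1 ℕ.≤_) (sym (Fin.toℕ-fromℕ< i<)) (ℕ.s≤s ℕ.z≤n))
      (trans (Fin.toℕ-fromℕ< j<) (trans eq (cong (rimNext t) (sym (Fin.toℕ-fromℕ< i<))))))
    rimNext-< : ∀ {i j} → j ≡ suc i → j ℕ.< t → j ≡ rimNext t i
    rimNext-< {i} refl lt with suc i ℕ.<? t
    ... | yes _ = refl
    ... | no ¬lt = ⊥-elim (¬lt lt)
    rimNext-last : ∀ {i} → suc i ≡ t → 1 ≡ rimNext t i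
    rimNext-last {i} eq with suc i ℕ.<? t
    ... | yes lt = ⊥-elim (ℕ.<-irrefl eq lt)
    ... | no _ = refl
    1<t : 1 ℕ.< t
    1<t = ℕ.s≤s (subst (1 ℕ.≤_) (sym (ℕ.+-suc k k)) (ℕ.s≤s ℕ.z≤n))
    even-colours : ∀ j (lt : suc (j ℕ.+ j) ℕ.< t) → colour lt ≡ colour 1<t
    even-colours zero    lt = refl
    even-colours (suc j) lt = trans (next 2+ lt (rimNext-< refl lt)) (trans (cong not (next 1+ 2+ (rimNext-< (cong suc (ℕ.+-suc j j)) 2+)))
      (trans (Bool.not-involutive _) (even-colours j 1+)))
      where
      2+ : suc (j ℕ.+ suc j) ℕ.< t
      2+ = ℕ.<-trans (ℕ.n<1+n _) lt
      1+ : suc (j ℕ.+ j) ℕ.< t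
      1+ = ℕ.<-trans (ℕ.s≤s (ℕ.≤-reflexive (sym (ℕ.+-suc j j)))) 2+
    last< : suc (k ℕ.+ k) ℕ.< t
    last< = ℕ.s≤s (ℕ.≤-reflexive (sym (ℕ.+-suc k k)))
    last-colour : colour 1<t ≡ not (colour 1<t)
    last-colour = trans (next last< 1<t (rimNext-last (cong suc (sym (ℕ.+-suc k k))))) (cong not (even-colours k last<))
    not-fixed : ∀ {b} → b ≡ not b → ⊥
    not-fixed {true}  ()
    not-fixed {false} ()

  private
    pairs : V → V → V → ℚ
    pairs a b c = σ m a b * σ m b c + (σ m b c * σ m c a + σ m c a * σ m a b)

    coincidences : V → V → V → ℚ
    coincidences a b c = δ[ a , b ] + (δ[ b , c ] + δ[ c , a ])

    4ℚ : ℚ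
    4ℚ = ℤ.+ 4 ℚ./ 1

  -- For distinct vertices `1ℚ + pairs a b c` is 4 if the three signs agree and 0 otherwise. If two
  -- vertices coincide, one sign is 0 and the other two are opposite, so the left side is at most 1
  -- and the coincidence pays for it.
  edge-weight : ∀ a b c → 1ℚ + pairs a b c ≤ 4ℚ * 𝟙 (E a b c) + coincidences a b c
  edge-weight a b c = by-coincidence (a Fin.≟ b) (b Fin.≟ c) (c Fin.≟ a)
    where
    e≥0 : 0ℚ ≤ 4ℚ * 𝟙 (E a b c)
    e≥0 = *-nonneg (ℚ.nonNegative⁻¹ 4ℚ) (𝟙-nonneg (E a b c))
    δ≥0 : ∀ (x y : V) → 0ℚ ≤ δ[ x , y ]
    δ≥0 x y = 𝟙-nonneg (x == y)
    degenerate : ∀ {x y z e p q r} → x ≡ 0ℚ → y ≡ - z → 0ℚ ≤ e → p ≡ 1ℚ → 0ℚ ≤ q → 0ℚ ≤ r → 1ℚ + (x * y + (y * z + z * x)) ≤ e + (p + (q + r))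
    degenerate {z = z} {e} {q = q} {r} refl refl e≥0 refl q≥0 r≥0 = by-diff (z * z + e + (q + r)) (+-nonneg (+-nonneg (square-nonneg z) e≥0) (+-nonneg q≥0 r≥0))
      (solve 4 (λ z e q r → con 1ℚ :+ (con 0ℚ :* :- z :+ (:- z :* z :+ z :* con 0ℚ)) :+ (z :* z :+ e :+ (q :+ r)) := e :+ (con 1ℚ :+ (q :+ r))) refl z e q r)
    turn : ∀ x y z → x + (y + z) ≡ z + (x + y)
    turn = solve 3 (λ x y z → x :+ (y :+ z) := z :+ (x :+ y)) refl
    equal : ∀ {x y : V} → x ≡ y → σ m x y ≡ 0ℚ
    equal refl = +-inverseʳ _
    ==-equal : ∀ {x y : V} → x ≡ y → δ[ x , y ] ≡ 1ℚ
    ==-equal {x} refl = cong 𝟙 (==-refl x)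
    opposite : ∀ {x y z : V} → x ≡ y → σ m y z ≡ - σ m z x
    opposite {x} {z = z} refl = σ-skew m x z
    distinct-weight : ∀ p q r → 1ℚ + ((𝟙 p - 𝟙 (not p)) * (𝟙 q - 𝟙 (not q)) + ((𝟙 q - 𝟙 (not q)) * (𝟙 r - 𝟙 (not r)) + (𝟙 r - 𝟙 (not r)) * (𝟙 p - 𝟙 (not p))))
      ≡ 4ℚ * 𝟙 ((p ∧ (q ∧ r)) ∨ (not q ∧ (not p ∧ not r)))
    distinct-weight true  true  true  = solve 0 (let t = con 1ℚ :- con 0ℚ in con 1ℚ :+ (t :* t :+ (t :* t :+ t :* t)) := con 4ℚ :* con 1ℚ) refl
    distinct-weight true  true  false = solve 0 (let t = con 1ℚ :- con 0ℚ ; f = con 0ℚ :- con 1ℚ in con 1ℚ :+ (t :* t :+ (t :* f :+ f :* t)) := con 4ℚ :* con 0ℚ) refl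
    distinct-weight true  false true  = solve 0 (let t = con 1ℚ :- con 0ℚ ; f = con 0ℚ :- con 1ℚ in con 1ℚ :+ (t :* f :+ (f :* t :+ t :* t)) := con 4ℚ :* con 0ℚ) refl
    distinct-weight true  false false = solve 0 (let t = con 1ℚ :- con 0ℚ ; f = con 0ℚ :- con 1ℚ in con 1ℚ :+ (t :* f :+ (f :* f :+ f :* t)) := con 4ℚ :* con 0ℚ) refl
    distinct-weight false true  true  = solve 0 (let t = con 1ℚ :- con 0ℚ ; f = con 0ℚ :- con 1ℚ in con 1ℚ :+ (f :* t :+ (t :* t :+ t :* f)) := con 4ℚ :* con 0ℚ) refl
    distinct-weight false true  false = solve 0 (let t = con 1ℚ :- con 0ℚ ; f = con 0ℚ :- con 1ℚ in con 1ℚ :+ (f :* t :+ (t :* f :+ f :* f)) := con 4ℚ :* con 0ℚ) refl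
    distinct-weight false false true  = solve 0 (let t = con 1ℚ :- con 0ℚ ; f = con 0ℚ :- con 1ℚ in con 1ℚ :+ (f :* f :+ (f :* t :+ t :* f)) := con 4ℚ :* con 0ℚ) refl
    distinct-weight false false false = solve 0 (let f = con 0ℚ :- con 1ℚ in con 1ℚ :+ (f :* f :+ (f :* f :+ f :* f)) := con 4ℚ :* con 1ℚ) refl
    by-coincidence : Dec (a ≡ b) → Dec (b ≡ c) → Dec (c ≡ a) → 1ℚ + pairs a b c ≤ 4ℚ * 𝟙 (E a b c) + coincidences a b c
    by-coincidence (yes ab) _ _ = degenerate (equal ab) (opposite ab) e≥0 (==-equal ab) (δ≥0 b c) (δ≥0 c a)
    by-coincidence _ (yes bc) _ = ≤-trans (≤-reflexive (+-right (sym (turn _ _ _))))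
      (≤-trans (degenerate (equal bc) (opposite bc) e≥0 (==-equal bc) (δ≥0 c a) (δ≥0 a b)) (≤-reflexive (+-right (turn _ _ _))))
    by-coincidence _ _ (yes ca) = ≤-trans (≤-reflexive (+-right (turn _ _ _)))
      (≤-trans (degenerate (equal ca) (opposite ca) e≥0 (==-equal ca) (δ≥0 a b) (δ≥0 b c)) (≤-reflexive (+-right (sym (turn _ _ _)))))
    by-coincidence (no ab) (no bc) (no ca) = by-diff (coincidences a b c) (+-nonneg (δ≥0 a b) (+-nonneg (δ≥0 b c) (δ≥0 c a)))
      (+-left (by-flips (beats-flip m ab) (beats-flip m bc) (beats-flip m ca)))
      where
      by-flips : beats m b a ≡ not (beats m a b) → beats m c b ≡ not (beats m b c) → beats m a c ≡ not (beats m c a) → 1ℚ + pairs a b c ≡ 4ℚ * 𝟙 (E a b c)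
      by-flips eq₁ eq₂ eq₃ rewrite eq₁ | eq₂ | eq₃ = distinct-weight (beats m a b) (beats m b c) (beats m c a)

  module _ (f : V → Bool) where
    private
      x : V → ℚ
      x = 𝟙 ∘ f
      u = ∑ x
      g = imbalance m x
      w : V → V → V → ℚ
      w a b c = x a * (x b * x c)
      x≥0 : ∀ a → 0ℚ ≤ x a
      x≥0 a = 𝟙-nonneg (f a)

    weight-rotate : ∀ (S : V → V → V → ℚ) → ∑∑∑ (λ a b c → w a b c * S b c a) ≡ ∑∑∑ (λ a b c → w a b c * S a b c)
    weight-rotate S = trans (∑-cong λ a → ∑-cong λ b → ∑-cong λ c → *-left (solve 3 (λ a b c → a :* (b :* c) := b :* (c :* a)) refl (x a) (x b) (x c)))
      (∑∑∑-rotate (λ a b c → w a b c * S a b c))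

    cherries : V → V → V → ℚ
    cherries a b c = σ m a b * σ m b c

    -- Reversing the first sign makes both factors point out of the middle vertex, so the sums over
    -- the ends combine to a square, with a negative sign.
    cherry-sum : ∑∑∑ (λ a b c → w a b c * cherries a b c) ≡ - ∑ (λ b → x b * (g b * g b))
    cherry-sum = begin
      ∑∑∑ (λ a b c → w a b c * cherries a b c)
        ≡⟨ ∑-swap _ ⟩
      ∑ (λ b → ∑ λ a → ∑ λ c → w a b c * cherries a b c)
        ≡⟨ ∑-cong (λ b → ∑-cong λ a → trans (∑-cong λ c → trans (cong (λ z → w a b c * (z * σ m b c)) (σ-skew m a b))
             (solve 5 (λ a b c p q → a :* (b :* c) :* (:- p :* q) := (:- con 1ℚ :* b :* (p :* a)) :* (q :* c)) refl (x a) (x b) (x c) (σ m b a) (σ m b c)))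
             (sym (∑-*ˡ _ _))) ⟩
      ∑ (λ b → ∑ λ a → (- 1ℚ * x b * (σ m b a * x a)) * g b)
        ≡⟨ ∑-cong (λ b → trans (sym (∑-*ʳ (g b) _)) (trans (*-left (sym (∑-*ˡ _ _)))
             (solve 2 (λ x g → :- con 1ℚ :* x :* g :* g := :- con 1ℚ :* (x :* (g :* g))) refl (x b) (g b)))) ⟩
      ∑ (λ b → - 1ℚ * (x b * (g b * g b)))
        ≡⟨ trans (sym (∑-*ˡ (- 1ℚ) _)) (solve 1 (λ z → :- con 1ℚ :* z := :- z) refl _) ⟩
      - ∑ (λ b → x b * (g b * g b)) ∎
      where open ≡-Reasoning

    u≤N : u ≤ N
    u≤N = ≤-trans (∑-≤-const 1ℚ (λ a → 𝟙≤1 (f a))) (≤-reflexive (*-identityʳ N))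

    u≥0 : 0ℚ ≤ u
    u≥0 = ∑-nonneg x≥0

    cherry-bound : ∑ (λ b → x b * (g b * g b)) ≤ N * N
    cherry-bound = begin
      ∑ (λ b → x b * (g b * g b))  ≤⟨ ∑-mono (λ b → *-mono-≤ʳ (g b * g b) (square-nonneg (g b)) (𝟙≤1 (f b))) ⟩
      ∑ (λ b → 1ℚ * (g b * g b))   ≡⟨ ∑-cong (λ b → *-identityˡ _) ⟩
      ∑² g                         ≤⟨ by-diff (∑² x) (∑-nonneg λ a → square-nonneg (x a)) (imbalance-norm m x) ⟩
      N * ∑² x                     ≡⟨ *-right (∑-cong λ a → 𝟙-idem (f a)) ⟩
      N * u                        ≤⟨ *-mono-≤ˡ N (fromℕ-nonneg (players m)) u≤N ⟩
      N * N                        ∎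
      where open ≤-Reasoning

    coincidence-sum : ∑∑∑ (λ a b c → w a b c * δ[ a , b ]) ≡ u * u
    coincidence-sum = begin
      ∑∑∑ (λ a b c → w a b c * δ[ a , b ])
        ≡⟨ ∑-cong (λ a → ∑-cong λ b → trans (∑-cong λ c → solve 4 (λ a b c d → a :* (b :* c) :* d := d :* (a :* b) :* c) refl (x a) (x b) (x c) δ[ a , b ]) (sym (∑-*ˡ _ _))) ⟩
      ∑ (λ a → ∑ λ b → δ[ a , b ] * (x a * x b) * u)
        ≡⟨ ∑-cong (λ a → trans (sym (∑-*ʳ u _)) (*-left (trans (∑-δ a (λ b → x a * x b)) (𝟙-idem (f a))))) ⟩
      ∑ (λ a → x a * u)  ≡⟨ ∑-*ʳ u x ⟨
      u * u ∎
      where open ≡-Reasoning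

    total-weight : ∑∑∑ (λ a b c → w a b c * 1ℚ) ≡ u * (u * u)
    total-weight = trans (∑-cong λ a → trans (∑-cong λ b → trans (∑-cong λ c → trans (*-identityʳ _) (sym (*-assoc _ _ _))) (sym (∑-*ˡ (x a * x b) x)))
      (trans (∑-cong λ b → *-assoc _ _ _) (trans (sym (∑-*ˡ (x a) _)) (*-right (sym (∑-*ʳ u x)))))) (sym (∑-*ʳ (u * u) x))

    ∑∑∑-+ : ∀ (S R : V → V → V → ℚ) → ∑∑∑ (λ a b c → w a b c * (S a b c + R a b c)) ≡ ∑∑∑ (λ a b c → w a b c * S a b c) + ∑∑∑ (λ a b c → w a b c * R a b c)
    ∑∑∑-+ S R = trans (∑-cong λ a → trans (∑-cong λ b → trans (∑-cong λ c → distribˡ _ _ _) (∑-+ _ _)) (∑-+ _ _)) (∑-+ _ _)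

    three-rotations : ∀ S → ∑∑∑ (λ a b c → w a b c * (S a b c + (S b c a + S c a b))) ≡
      (1ℚ + 1ℚ + 1ℚ) * ∑∑∑ (λ a b c → w a b c * S a b c)
    three-rotations S = trans (∑∑∑-+ S _) (trans (+-right (trans (∑∑∑-+ (λ a b c → S b c a) (λ a b c → S c a b))
      (cong₂ _+_ (weight-rotate S) (trans (weight-rotate (λ a b c → S b c a)) (weight-rotate S)))))
      (solve 1 (λ s → s :+ (s :+ s) := (con 1ℚ :+ con 1ℚ :+ con 1ℚ) :* s) refl _))

    -- The three quadratic terms of an edge indicator cost at most 3 N² in total, and the three
    -- kinds of coincidence at most 3 u², which is at most 3 N².
    ordered-edges : u * (u * u) ≤ 4ℚ * ∑∑∑ (λ a b c → w a b c * 𝟙 (E a b c)) + ℤ.+ 6 ℚ./ 1 * (N * N)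
    ordered-edges = by-diff (surplus + three * (N * N - Q) + three * (N * N - u * u)) (+-nonneg (+-nonneg (diff summed) (*-nonneg 3≥0 (diff cherry-bound)))
        (*-nonneg 3≥0 (diff (*-mono-≤ u≥0 (fromℕ-nonneg (players m)) u≤N u≤N))))
      (solve 4 (λ e q u N → let three = con 1ℚ :+ con 1ℚ :+ con 1ℚ in
        u :* (u :* u) :+ (con 4ℚ :* e :+ three :* (u :* u) :- (u :* (u :* u) :+ three :* (:- q)) :+ three :* (N :* N :- q) :+ three :* (N :* N :- u :* u))
          := con 4ℚ :* e :+ con (ℤ.+ 6 ℚ./ 1) :* (N :* N)) refl X Q u N)
      where
      three = 1ℚ + 1ℚ + 1ℚ
      3≥0 : 0ℚ ≤ three
      3≥0 = +-nonneg (+-nonneg 0≤1 0≤1) 0≤1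
      Q = ∑ λ b → x b * (g b * g b)
      X = ∑∑∑ λ a b c → w a b c * 𝟙 (E a b c)
      surplus = 4ℚ * X + three * (u * u) - (u * (u * u) + three * (- Q))
      pull : ∑∑∑ (λ a b c → w a b c * (4ℚ * 𝟙 (E a b c))) ≡ 4ℚ * X
      pull = sym (trans (∑-*ˡ 4ℚ _) (∑-cong λ a → trans (∑-*ˡ 4ℚ _) (∑-cong λ b → trans (∑-*ˡ 4ℚ _)
        (∑-cong λ c → solve 3 (λ k w e → k :* (w :* e) := w :* (k :* e)) refl 4ℚ (w a b c) (𝟙 (E a b c))))))
      summed : u * (u * u) + three * (- Q) ≤ 4ℚ * X + three * (u * u)
      summed = begin
        u * (u * u) + three * (- Q)
          ≡⟨ cong₂ _+_ (sym total-weight) (trans (*-right (sym cherry-sum)) (sym (three-rotations cherries))) ⟩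
        ∑∑∑ (λ a b c → w a b c * 1ℚ) + ∑∑∑ (λ a b c → w a b c * pairs a b c)
          ≡⟨ ∑∑∑-+ (λ _ _ _ → 1ℚ) pairs ⟨
        ∑∑∑ (λ a b c → w a b c * (1ℚ + pairs a b c))
          ≤⟨ ∑-mono (λ a → ∑-mono λ b → ∑-mono λ c → *-mono-≤ˡ (w a b c) (*-nonneg (x≥0 a) (*-nonneg (x≥0 b) (x≥0 c))) (edge-weight a b c)) ⟩
        ∑∑∑ (λ a b c → w a b c * (4ℚ * 𝟙 (E a b c) + coincidences a b c))
          ≡⟨ ∑∑∑-+ (λ a b c → 4ℚ * 𝟙 (E a b c)) coincidences ⟩
        ∑∑∑ (λ a b c → w a b c * (4ℚ * 𝟙 (E a b c))) + ∑∑∑ (λ a b c → w a b c * coincidences a b c)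
          ≡⟨ cong₂ _+_ pull (trans (three-rotations (λ a b c → δ[ a , b ])) (*-right coincidence-sum)) ⟩
        4ℚ * X + three * (u * u) ∎
        where open ≤-Reasoning

fromℕ-≤-square : ∀ k → fromℕ k ≤ fromℕ k * fromℕ k
fromℕ-≤-square zero    = ≤-trans (≤-reflexive fromℕ-0) (square-nonneg _)
fromℕ-≤-square (suc k) = ≤-trans (fromℕ-mono (ℕ.m≤m*n (suc k) (suc k))) (≤-reflexive (fromℕ-* (suc k) (suc k)))

-- The quadratic error 6 N² is absorbed by the term with μ N³ as soon as N μ ≥ 1. The factor 24
-- clears the denominator 4 of the density and the 6 orders of a triple.
cyclic-triangles-dense : ∀ {μ} m → 0ℚ < μ → 1ℚ ≤ fromℕ (players m) * μ → Dense ¼ μ (cyclic-triangles m)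
cyclic-triangles-dense {μ} m μ>0 Nμ≥1 = edges-dense {H = cyclic-triangles m} λ U → *-cancel-≤ 24ℚ (ℚ.positive⁻¹ 24ℚ) (bound U)
  where
  open 3Graph (cyclic-triangles m) using (E)
  4ℚ 6′ 24ℚ 18ℚ : ℚ
  4ℚ  = ℤ.+ 4 ℚ./ 1
  6′  = ℤ.+ 6 ℚ./ 1
  24ℚ = ℤ.+ 24 ℚ./ 1
  18ℚ = ℤ.+ 18 ℚ./ 1
  N = fromℕ (players m)
  N≥0 = fromℕ-nonneg (players m)
  N³ = fromℕ (players m ℕ.^ 3)
  N³≡ : N³ ≡ N * (N * N)
  N³≡ = trans (fromℕ-* (players m) _) (*-right (trans (fromℕ-* (players m) _) (*-right (cong fromℕ (ℕ.*-identityʳ (players m))))))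
  bound : ∀ U → 24ℚ * (¼ * fromℕ (∣ U ∣ choose 3) - μ * N³) ≤ 24ℚ * fromℕ (edgesIn (cyclic-triangles m) U)
  bound U = by-diff ((4ℚ * X + 6′ * (N * N) - u * (u * u)) + (u * u - u + (u * u - u) + u * u) + (6′ * (N * N)) * (N * μ - 1ℚ) + 18ℚ * (μ * (N * (N * N))))
    (+-nonneg (+-nonneg (+-nonneg (diff edges) (+-nonneg (+-nonneg (diff u≤u²) (diff u≤u²)) (square-nonneg u)))
      (*-nonneg (*-nonneg (ℚ.nonNegative⁻¹ 6′) (square-nonneg N)) (diff Nμ≥1))) (*-nonneg (ℚ.nonNegative⁻¹ 18ℚ) (*-nonneg (<⇒≤ μ>0) (*-nonneg N≥0 (square-nonneg N))))) (begin
    24ℚ * (¼ * B - μ * N³) + D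
      ≡⟨ +-left (trans (cong (λ z → 24ℚ * (¼ * B - μ * z)) N³≡)
           (solve 3 (λ B μ M → con 24ℚ :* (con ¼ :* B :- μ :* M) := con 6′ :* B :- con 24ℚ :* (μ :* M)) refl B μ (N * (N * N)))) ⟩
    6′ * B - 24ℚ * (μ * (N * (N * N))) + D
      ≡⟨ +-left (+-left (trans (*-left (sym fromℕ-6)) (trans (binomial₃ ∣ U ∣) (cong (λ z → z * (z - 1ℚ) * (z - (1ℚ + 1ℚ))) (card U))))) ⟩
    u * (u - 1ℚ) * (u - (1ℚ + 1ℚ)) - 24ℚ * (μ * (N * (N * N))) + D
      ≡⟨ solve 4 (λ X u N μ → u :* (u :- con 1ℚ) :* (u :- (con 1ℚ :+ con 1ℚ)) :- con 24ℚ :* (μ :* (N :* (N :* N)))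
           :+ ((con 4ℚ :* X :+ con 6′ :* (N :* N) :- u :* (u :* u)) :+ (u :* u :- u :+ (u :* u :- u) :+ u :* u) :+ (con 6′ :* (N :* N)) :* (N :* μ :- con 1ℚ) :+ con 18ℚ :* (μ :* (N :* (N :* N))))
           := con 4ℚ :* X) refl X u N μ ⟩
    4ℚ * X       ≡⟨ *-right (sym (edges-ordered (cyclic-triangles m) U)) ⟩
    4ℚ * (6ℚ * e)  ≡⟨ *-right (*-left fromℕ-6) ⟩
    4ℚ * (6′ * e)  ≡⟨ solve 1 (λ e → con 4ℚ :* (con 6′ :* e) := con 24ℚ :* e) refl e ⟩
    24ℚ * e ∎)
    where
    open ≡-Reasoning
    B = fromℕ (∣ U ∣ choose 3)
    e = fromℕ (edgesIn (cyclic-triangles m) U)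
    u = ∑ λ a → 𝟙 (lookup U a)
    X = ∑∑∑ λ a b c → 𝟙 (lookup U a) * (𝟙 (lookup U b) * 𝟙 (lookup U c)) * 𝟙 (E a b c)
    D = (4ℚ * X + 6′ * (N * N) - u * (u * u)) + (u * u - u + (u * u - u) + u * u) + (6′ * (N * N)) * (N * μ - 1ℚ) + 18ℚ * (μ * (N * (N * N)))
    edges : u * (u * u) ≤ 4ℚ * X + 6′ * (N * N)
    edges = ordered-edges m (lookup U)
    u≤u² : u ≤ u * u
    u≤u² = subst (λ z → z ≤ z * z) (card U) (fromℕ-≤-square ∣ U ∣)

-- Lower bounds and the two densities

even-lower-bound : ∀ k → Admissible (suc k ℕ.+ suc k) ¼
even-lower-bound k = ℚ.nonNegative⁻¹ ¼ , 1≥¼ , λ μ μ>0 n₀ → go μ μ>0 n₀ (archimedean μ μ>0)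
  where
  1≥¼ : ¼ ≤ 1ℚ
  1≥¼ = by-diff (ℤ.+ 3 ℚ./ 4) (ℚ.nonNegative⁻¹ (ℤ.+ 3 ℚ./ 4)) (solve 0 (con ¼ :+ con (ℤ.+ 3 ℚ./ 4) := con 1ℚ) refl)
  go : ∀ μ → 0ℚ < μ → ∀ n₀ → (∃ λ k → 1ℚ ≤ fromℕ (suc k) * μ) → ∃ λ H → n₀ ℕ.≤ 3Graph.n H × WheelFree (suc k ℕ.+ suc k) H × Dense ¼ μ H
  go μ μ>0 n₀ (r , large) = cyclic-triangles s , ℕ.≤-trans (ℕ.m≤m⊔n n₀ (suc r)) s≤players , even-wheel-free s k ,
    cyclic-triangles-dense s μ>0 (≤-trans large (*-mono-≤ʳ μ (<⇒≤ μ>0) (fromℕ-mono (ℕ.≤-trans (ℕ.m≤n⊔m n₀ (suc r)) s≤players))))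
    where
    s = n₀ ℕ.⊔ suc r
    s≤players = ℕ.<⇒≤ (<-players s)

edgeless : ℕ → 3Graph
edgeless k = record { n = k ; E = λ _ _ _ → false ; sym₁₂ = λ _ _ _ → refl ; sym₂₃ = λ _ _ _ → refl ; loopless = λ _ _ → refl }

odd-lower-bound : ∀ t → Admissible (suc (suc t)) 0ℚ
odd-lower-bound t = ≤-refl , 0≤1 , λ μ μ>0 n₀ → edgeless n₀ , ℕ.≤-refl , no-wheel n₀ ,
  edges-dense {H = edgeless n₀} λ U → by-diff (μ * fromℕ (n₀ ℕ.^ 3) + fromℕ (edgesIn (edgeless n₀) U))
    (+-nonneg (*-nonneg (<⇒≤ μ>0) (fromℕ-nonneg (n₀ ℕ.^ 3))) (fromℕ-nonneg _))
    (solve 3 (λ b c e → con 0ℚ :* b :- c :+ (c :+ e) := e) refl (fromℕ (∣ U ∣ choose 3)) (μ * fromℕ (n₀ ℕ.^ 3)) (fromℕ (edgesIn (edgeless n₀) U)))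
  where
  rimNext-< : rimNext (suc (suc t)) 1 ℕ.< suc (suc t)
  rimNext-< with 2 ℕ.<? suc (suc t)
  ... | yes lt = lt
  ... | no _   = ℕ.s≤s (ℕ.s≤s ℕ.z≤n)
  no-wheel : ∀ k → WheelFree (suc (suc t)) (edgeless k)
  no-wheel k (φ , _ , edges) with () ← edges zero (suc zero) (Fin.fromℕ< rimNext-<) refl (ℕ.s≤s ℕ.z≤n) (Fin.toℕ-fromℕ< rimNext-<)

even-density : ∀ k → IsUniformTuranDensity (suc (suc k) ℕ.+ suc (suc k)) ¼
even-density k = subst (λ t → ∀ d → Admissible t d → d ≤ ¼) (cong suc (sym (ℕ.+-suc (suc k) (suc k)))) (even-upper-bound k) ,
  λ e e<¼ → ¼ , even-lower-bound (suc k) , e<¼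

odd-density : ∀ k → IsUniformTuranDensity (suc (suc k ℕ.+ suc k)) 0ℚ
odd-density k = odd-upper-bound k , λ e e<0 → 0ℚ , odd-lower-bound (k ℕ.+ suc k) , e<0

2∣double : ∀ k → 2 ∣ k ℕ.+ k
2∣double k = divides k (trans (cong (k ℕ.+_) (sym (ℕ.+-identityʳ k))) (ℕ.*-comm 2 k))

odd-∤ : ∀ k → ¬ (2 ∣ suc (k ℕ.+ k))
odd-∤ k 2∣t = 2∤1 (∣m+n∣m⇒∣n {2} {k ℕ.+ k} {1} (subst (2 ∣_) (ℕ.+-comm 1 (k ℕ.+ k)) 2∣t) (2∣double k))
  where
  2∤1 : ¬ (2 ∣ 1)
  2∤1 2∣1 = case ∣1⇒≡1 2∣1 of λ ()

open import Data.Integer using (+_)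
open import Data.Nat using (_≥_)
open import Data.Rational using (_/_)

theorem1p7 : ∀ (t : ℕ) → t ≥ 3 →
    (2 ∣ t → IsUniformTuranDensity t ((+ 1) / 4)) ×
    (¬ (2 ∣ t) → IsUniformTuranDensity t ((+ 0) / 1))
theorem1p7 t t≥3 = by-parity t≥3 (parity t)
  where
  by-parity : ∀ {t} → t ≥ 3 → (∃ λ k → t ≡ k ℕ.+ k ⊎ t ≡ suc (k ℕ.+ k)) →
    (2 ∣ t → IsUniformTuranDensity t ¼) × (¬ (2 ∣ t) → IsUniformTuranDensity t 0ℚ)
  by-parity _ (suc (suc k) , inj₁ refl) = (λ _ → even-density k) , λ ∤ → ⊥-elim (∤ (2∣double (suc (suc k))))
  by-parity _ (suc k , inj₂ refl) = (λ 2∣t → ⊥-elim (odd-∤ (suc k) 2∣t)) , λ _ → odd-density k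
  by-parity (ℕ.s≤s ()) (zero , inj₂ refl)
  by-parity (ℕ.s≤s (ℕ.s≤s ())) (suc zero , inj₁ refl)
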